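{- Let $C_{7,j}(q)=\sum_{n\ge0}a_{7,j}(n)q^n$. Then $$C_{7,1}(q) = q \frac{E(q^{28})E^3(q^{14})E(q^4)}{E(q^2)} \{ \sigma(q^4) + q^2 \psi(q^2) \psi(q^{14}) \},$$ and $$C_{7,0}(q) = \omega(q^2) \left\{ \psi^2(q^4) \varphi^2(q^{14}) + q^6 \psi^2(q^{28}) \varphi^2(q^2) + q^2 \frac{E(q^{28})E^3(q^{14})E(q^4)}{E(q^2)} \right\} + q^2 \psi(q^4) \psi^2(q^{14}) \varphi^3(q^{14}) + 2q^4 \psi^3(q^2) \psi^3(q^{14}) + 4q^{12} \psi^2(q^{14}) \psi^3(q^{28}) \varphi(q^2).$$
   Context: For $|q|<1$, $E(q)=\prod_{n\ge1}(1-q^n)$, $\varphi(q)=\sum_{n=-\infty}^{\infty}q^{n^2}$, $\psi(q)=\sum_{n=-\infty}^{\infty}q^{2n^2-n}=\sum_{n\ge0}q^{n(n+1)/2}$. Define $\omega(q)=\psi(q^4)\varphi(q^{14})+q^3\psi(q^{28})\varphi(q^2)$ and $\sigma(q)=\varphi(q)\varphi(q^7)+4q^2\psi(q^2)\psi(q^{14})$. A partition is a $7$-core if it has no hook of length $7$. The BG-rank of a partition $(\lambda_1\ge\dots\ge\lambda_r)$ is $\sum_{j=1}^r(-1)^{j+1}\mathrm{par}(\lambda_j)$, where $\mathrm{par}(\lambda)=1$ if $\lambda$ is odd and $0$ if even. $a_{7,j}(n)$ is the number of 7-core partitions of $n$ with BG-rank $j$. -}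

module Defs where

open import Data.Bool using (Bool; true; false; if_then_else_; _∧_; not)
open import Data.Nat as ℕ using (ℕ; zero; suc; _≤ᵇ_; _<ᵇ_; _≡ᵇ_; NonZero)
open import Data.Nat.DivMod using (_/_; _%_)
open import Data.Integer as ℤ using (ℤ; +_; -_)
open import Data.List using (List; []; _∷_; map; upTo; filter; concatMap; length; zipWith; foldr)
open import Relation.Nullary.Decidable using (does)
open import Data.Bool.Properties using (T?)
open import Data.Bool using (T)
open import Data.Product using (_×_; _,_; proj₁; proj₂)

listsOfLength : ℕ → List ℕ → List (List ℕ)
listsOfLength zero    xs = [] ∷ []
listsOfLength (suc L) xs = concatMap (λ x → map (x ∷_) (listsOfLength L xs)) xs

listsUpTo : ℕ → List ℕ → List (List ℕ)
listsUpTo L xs = concatMap (λ l → listsOfLength l xs) (upTo (suc L))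

allB : {A : Set} → (A → Bool) → List A → Bool
allB p []       = true
allB p (x ∷ xs) = p x ∧ allB p xs

sumℕ : List ℕ → ℕ
sumℕ = foldr ℕ._+_ 0

nonIncreasing : List ℕ → Bool
nonIncreasing []           = true
nonIncreasing (x ∷ [])     = true
nonIncreasing (x ∷ y ∷ ys) = (y ≤ᵇ x) ∧ nonIncreasing (y ∷ ys)

isPartitionOf : ℕ → List ℕ → Bool
isPartitionOf n λs = nonIncreasing λs ∧ allB (1 ≤ᵇ_) λs ∧ (sumℕ λs ≡ᵇ n)

-- every partition of n has ≤ n parts, each in 1..n
partitions : ℕ → List (List ℕ)
partitions n = filter (λ λs → T? (isPartitionOf n λs))
                      (listsUpTo n (map suc (upTo n)))

lookupℕ : List ℕ → ℕ → ℕ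
lookupℕ []       _       = 0
lookupℕ (x ∷ xs) zero    = x
lookupℕ (x ∷ xs) (suc i) = lookupℕ xs i

-- conjugate part λ'_j (0-indexed column j): number of parts > j
conj : List ℕ → ℕ → ℕ
conj λs j = length (filter (λ x → T? (suc j ≤ᵇ x)) λs)

-- hook length of cell (i , j) (0-indexed, j < λ_i):
--   (λ_i - j - 1) + (λ'_j - i - 1) + 1
hook : List ℕ → ℕ → ℕ → ℕ
hook λs i j = suc ((lookupℕ λs i ℕ.∸ suc j) ℕ.+ (conj λs j ℕ.∸ suc i))

cells : List ℕ → List (ℕ × ℕ)
cells λs = concatMap (λ i → map (λ j → (i , j)) (upTo (lookupℕ λs i))) (upTo (length λs))

isCore : ℕ → List ℕ → Bool
isCore t λs = allB (λ c → not (hook λs (proj₁ c) (proj₂ c) ≡ᵇ t)) (cells λs)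

par : ℕ → ℤ
par x = if x % 2 ≡ᵇ 1 then + 1 else + 0

bgRankFrom : Bool → List ℕ → ℤ
bgRankFrom s []       = + 0
bgRankFrom s (x ∷ xs) = (if s then par x else - par x) ℤ.+ bgRankFrom (not s) xs

bgRank : List ℕ → ℤ
bgRank = bgRankFrom true

a7 : ℤ → ℕ → ℕ
a7 j n = length (filter (λ λs → T? (isCore 7 λs ∧ does (bgRank λs ℤ.≟ j))) (partitions n))

Series : Set
Series = ℕ → ℤ

sumℤ : List ℤ → ℤ
sumℤ = foldr ℤ._+_ (+ 0)

infixl 6 _⊕_
infixl 7 _⊗_

_⊕_ : Series → Series → Series
(f ⊕ g) n = f n ℤ.+ g n

_⊗_ : Series → Series → Series
(f ⊗ g) n = sumℤ (map (λ k → f k ℤ.* g (n ℕ.∸ k)) (upTo (suc n)))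

scale : ℤ → Series → Series
scale c f n = c ℤ.* f n

oneS : Series
oneS zero    = + 1
oneS (suc _) = + 0

qpow : ℕ → Series → Series
qpow m f n = if m ≤ᵇ n then f (n ℕ.∸ m) else + 0

at : (d : ℕ) → .{{NonZero d}} → Series → Series
at d f n = if n % d ≡ᵇ 0 then f (n / d) else + 0

powS : Series → ℕ → Series
powS f zero    = oneS
powS f (suc k) = f ⊗ powS f k

-- multiplicative inverse of a series with constant term 1:
-- invRev f n = [b_n , b_{n-1} , … , b_0]  where  b_0 = 1,
-- b_{m} = - Σ_{k=1}^{m} f_k b_{m-k}.
invRev : Series → ℕ → List ℤ
invRev f zero    = + 1 ∷ []
invRev f (suc n) =
  let prev = invRev f n in
  (- sumℤ (zipWith ℤ._*_ (map (λ i → f (suc i)) (upTo (suc n))) prev)) ∷ prev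

headℤ : List ℤ → ℤ
headℤ []      = + 0
headℤ (x ∷ _) = x

invS : Series → Series
invS f n = headℤ (invRev f n)

Eprod : ℕ → Series
Eprod zero    = oneS
Eprod (suc N) = Eprod N ⊗ (oneS ⊕ scale (- + 1) (qpow (suc N) oneS))

-- E(q) = ∏_{n≥1}(1-q^n); its q^n coefficient equals that of ∏_{k=1}^{n}(1-q^k)
E : Series
E n = Eprod n n

-- φ(q) = Σ_{m∈ℤ} q^{m²}: coefficient of q^n = #{m ∈ ℤ : m² = n}
--   (m and -m, counted once when m = 0; |m| ≤ n)
φ : Series
φ n = sumℤ (map (λ k → if (k ℕ.* k) ≡ᵇ n then (if k ≡ᵇ 0 then + 1 else + 2) else + 0)
                (upTo (suc n)))

-- ψ(q) = Σ_{k≥0} q^{k(k+1)/2}: coefficient of q^n = #{k ≥ 0 : k(k+1) = 2n}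
ψ : Series
ψ n = sumℤ (map (λ k → if (k ℕ.* suc k) ≡ᵇ (2 ℕ.* n) then + 1 else + 0)
                (upTo (suc n)))

ω : Series
ω = at 4 ψ ⊗ at 14 φ ⊕ qpow 3 (at 28 ψ ⊗ at 2 φ)

σ : Series
σ = φ ⊗ at 7 φ ⊕ scale (+ 4) (qpow 2 (at 2 ψ ⊗ at 14 ψ))

C7 : ℤ → Series
C7 j n = + a7 j n

Q : Series
Q = at 28 E ⊗ powS (at 14 E) 3 ⊗ at 4 E ⊗ invS (at 2 E)

RHS1 : Series
RHS1 = qpow 1 (Q ⊗ (at 4 σ ⊕ qpow 2 (at 2 ψ ⊗ at 14 ψ)))

RHS0 : Series
RHS0 =
  at 2 ω ⊗ ( powS (at 4 ψ) 2 ⊗ powS (at 14 φ) 2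
           ⊕ qpow 6 (powS (at 28 ψ) 2 ⊗ powS (at 2 φ) 2)
           ⊕ qpow 2 Q )
  ⊕ qpow 2 (at 4 ψ ⊗ powS (at 14 ψ) 2 ⊗ powS (at 14 φ) 3)
  ⊕ scale (+ 2) (qpow 4 (powS (at 2 ψ) 3 ⊗ powS (at 14 ψ) 3))
  ⊕ scale (+ 4) (qpow 12 (powS (at 14 ψ) 2 ⊗ powS (at 28 ψ) 3 ⊗ at 2 φ))

module Submission where

-- Put q = t². A vector of ℤ⁷ is a 7-core λ with a charge M, and weighting it by t^(2|λ| + M²) and by x to the number of odd entries of
-- its abacus makes the lattice sum factor over the runners. With C_j(t) = Σ a_{7,j}(n) t²ⁿ, F = φ(t⁴), G = φ(t²⁸), T = 2tψ(t⁸),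
-- H = 2t⁷ψ(t⁵⁶) and the even and odd parts aᵢ, bᵢ of the remaining theta series this reads
--   (G + xH) (Π (aᵢ + bᵢx))² = F (C₂ + C₁x² + C₀x⁴ + C₋₁x⁶) + T (C₋₁x + C₀x³ + C₁x⁵ + C₂x⁷).
-- A signed version of the same sum and the Jacobi triple product turn C₋₁ and C₂ into infinite products. The binary quadratic identity
-- ψ(q)ψ(q⁷) = ω(q²) + qψ(q²)ψ(q¹⁴) yields the algebraic relations among F, G, T, H, p = 2t⁴ψ(t⁴)ψ(t²⁸) and o = 2t²ω(t⁴), and with
-- them the coefficients of Π (aᵢ + bᵢx) are determined up to a common factor: they are proportional to cubic polynomials λ₀, …, λ₃ in
-- these series. The factor is 8t², because the sum S of the coefficients satisfies A = t⁶S(t⁴) for the first of them, while λ₀ is the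
-- sum of the λᵢ at t⁴. The two formulas are then polynomial identities.

-- Over cores alone the lattice sum carries the constraint that the coordinates add up to zero, and
-- it does not factor. Admitting every charge removes the constraint; the price is that even and odd
-- M, which contribute F and T, read the BG-rank from the number of odd entries in two different
-- ways, so that each C_j occurs twice. This redundancy drives the algebra: C₀ stands in the
-- coefficients of x³ and of x⁴, and eliminating it leaves a relation among F, T, G, H and p alone,
-- which complements those coming from the quadratic identity. Series are cancelled and never
-- divided. Each cancelled factor is shown to be `Regular` through a lowest coefficient, and the
-- same argument selects the right factor where a polynomial relation splits. The long polynomials
-- in the algebraic lemmas are cofactors: they exhibit a target as a combination of known relations,
-- and `solve` checks the combination. The variable x is never formal; it runs through the positive
-- integers, which is enough to separate the coefficients.

open import Defs
open import Level using (0ℓ)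
open import Data.Bool as Bool using (Bool; true; false; if_then_else_; _∧_; _∨_; not; T)
open import Data.Nat as ℕ using (ℕ; zero; suc; NonZero; z≤n; s≤s)
import Data.Nat.Properties as ℕₚ
open import Data.Integer as ℤ using (ℤ; +_; -[1+_]; -_)
import Data.Integer.Properties as ℤₚ
open import Data.List as List using (List; []; _∷_; _++_; map; upTo; applyUpTo; filter; concatMap; length)
open import Data.Vec as Vec using (Vec; []; _∷_)
open import Data.Product using (_×_; _,_; proj₁; proj₂; ∃)
open import Data.Sum as Sum using (_⊎_; inj₁; inj₂)
open import Data.Empty using (⊥; ⊥-elim)
open import Data.Unit using (⊤; tt)
open import Function using (_∘_; id; case_of_)
open import Relation.Nullary using (Dec; yes; no; contradiction)
open import Relation.Binary.PropositionalEquality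
  using (_≡_; _≢_; refl; sym; trans; cong; cong₂; subst; subst₂; module ≡-Reasoning)
open import Algebra.Bundles using (CommutativeRing)
open import Data.Fin as Fin using (Fin)
open import Algebra.Structures using (IsCommutativeRing)
open import Data.Nat.DivMod using (_/_; _%_)
import Data.Nat.DivMod as DM
import Data.Nat.Divisibility as Div
open import Data.Nat.Solver using (module +-*-Solver)
open import Data.List.Properties using (map-applyUpTo; map-upTo; ∷-injectiveˡ; ∷-injectiveʳ)
open import Data.List.Membership.Propositional using (_∈_)
open import Data.List.Membership.Propositional.Properties
  using (∈-map⁺; ∈-map⁻; ∈-++⁺ˡ; ∈-++⁺ʳ; ∈-++⁻; ∈-concat⁺′; ∈-concat⁻′; ∈-cartesianProduct⁺; ∈-cartesianProduct⁻; ∈-applyUpTo⁺; ∈-applyUpTo⁻; ∈-upTo⁺; ∈-upTo⁻; ∈-filter⁺; ∈-filter⁻)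
open import Data.List.Membership.Propositional.Properties.WithK using (unique∧set⇒bag)
open import Data.List.Relation.Binary.BagAndSetEquality using (∼bag⇒↭)
open import Data.List.Relation.Binary.Permutation.Propositional using (_↭_; prep; swap) renaming (refl to ↭-refl; trans to ↭-trans)
open import Data.List.Relation.Unary.Any using (here; there)
open import Data.List.Relation.Unary.All as All using (All; []; _∷_)
import Data.List.Relation.Unary.All.Properties as All
open import Data.List.Relation.Unary.AllPairs as AllPairs using ([]; _∷_)
import Data.List.Relation.Unary.AllPairs.Properties as AllPairs
open import Data.List.Relation.Unary.Unique.Propositional using (Unique)
import Data.List.Relation.Unary.Unique.Propositional.Properties as Unique
open import Relation.Nullary.Decidable using (does; isYes; _×-dec_; toWitness)
open import Function.Bundles using (mk⇔)
open import Data.Bool.Properties using (T?)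
open import Relation.Binary.Definitions using (tri<; tri≈; tri>)
open import Data.Vec.Relation.Binary.Pointwise.Inductive as Pointwise using (Pointwise; []; _∷_)

-- Reflective normalisation of polynomial identities in a commutative ring with integer constants.
infixl 6 _:+_ _:-_
infixl 7 _:*_
infixr 8 _:^_

data Expr (n : ℕ) : Set where
  var  : Fin n → Expr n
  con  : ℤ → Expr n
  _:+_ : Expr n → Expr n → Expr n
  _:*_ : Expr n → Expr n → Expr n
  _:-_ : Expr n → Expr n → Expr n
  :neg : Expr n → Expr n
  _:^_ : Expr n → ℕ → Expr n

infixr 8 _·_
_·_ : ∀ {n} → ℕ → Expr n → Expr n
k · e = con (+ k) :* e

Mono : ℕ → Set
Mono n = Vec ℕ n

Poly : ℕ → Set
Poly n = List (ℤ × Mono n)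

data Cmp {n} (m m′ : Mono n) : Set where
  before after : Cmp m m′
  same : m ≡ m′ → Cmp m m′

-- Only `same` carries a proof, so the soundness of normalisation never depends on the order; the
-- order merely brings like monomials together.
cmp : ∀ {n} (m m′ : Mono n) → Cmp m m′
cmp []      []        = same refl
cmp (i ∷ m) (j ∷ m′) with i ℕ.≟ j | cmp m m′
... | yes i≡j | same m≡m′ = same (cong₂ _∷_ i≡j m≡m′)
... | yes _   | before      = before
... | yes _   | after      = after
... | no _    | _       = if i ℕ.<ᵇ j then before else after

mutual
  add : ∀ {n} → Poly n → Poly n → Poly n
  add []            q = q
  add ((c , m) ∷ p) q = addTerm c m p q

  addTerm : ∀ {n} → ℤ → Mono n → Poly n → Poly n → Poly n
  addTerm c m p [] = (c , m) ∷ p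
  addTerm c m p ((d , m′) ∷ q) with cmp m m′
  ... | before   = (c , m) ∷ add p ((d , m′) ∷ q)
  ... | after   = (d , m′) ∷ addTerm c m p q
  ... | same _ = (c ℤ.+ d , m) ∷ add p q

scaleBy : ∀ {n} → ℤ → Mono n → Poly n → Poly n
scaleBy c m []             = []
scaleBy c m ((d , m′) ∷ q) = (c ℤ.* d , Vec.zipWith ℕ._+_ m m′) ∷ scaleBy c m q

mul : ∀ {n} → Poly n → Poly n → Poly n
mul []            q = []
mul ((c , m) ∷ p) q = add (scaleBy c m q) (mul p q)

unit : ∀ n → Mono n
unit n = Vec.replicate n 0

power : ∀ {n} → Poly n → ℕ → Poly n
power p zero    = (+ 1 , unit _) ∷ []
power p (suc k) = mul p (power p k)

indicator : ∀ {n} → Fin n → Mono n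
indicator Fin.zero    = 1 ∷ unit _
indicator (Fin.suc i) = 0 ∷ indicator i

norm : ∀ {n} → Expr n → Poly n
norm (var i)  = (+ 1 , indicator i) ∷ []
norm (con c)  = (c , unit _) ∷ []
norm (a :+ b) = add (norm a) (norm b)
norm (a :* b) = mul (norm a) (norm b)
norm (a :- b) = add (norm a) (scaleBy -[1+ 0 ] (unit _) (norm b))
norm (:neg a) = scaleBy -[1+ 0 ] (unit _) (norm a)
norm (a :^ k) = power (norm a) k

-- Terms that cancel stay in the list with coefficient zero, hence a test on the coefficients
-- instead of a comparison with the empty list.
allZero : ∀ {n} → Poly n → Bool
allZero []                  = true
allZero ((+ 0 , _) ∷ p)     = allZero p
allZero ((+ suc _ , _) ∷ p) = false
allZero ((-[1+ _ ] , _) ∷ p) = false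

Vars : ℕ → Set
Vars n = Vec (Expr n) n

module Polynomial
  (R : CommutativeRing 0ℓ 0ℓ)
  (ι : ℤ → CommutativeRing.Carrier R)
  (ι-+ : ∀ a b → CommutativeRing._≈_ R (ι (a ℤ.+ b)) (CommutativeRing._+_ R (ι a) (ι b)))
  (ι-* : ∀ a b → CommutativeRing._≈_ R (ι (a ℤ.* b)) (CommutativeRing._*_ R (ι a) (ι b)))
  (ι-0 : CommutativeRing._≈_ R (ι (+ 0)) (CommutativeRing.0# R))
  (ι-1 : CommutativeRing._≈_ R (ι (+ 1)) (CommutativeRing.1# R))
  where

  open CommutativeRing R hiding (zero) renaming (-_ to infix 8 ⊖_; refl to ≈-refl; sym to ≈-sym; trans to ≈-trans)
  open import Relation.Binary.Reasoning.Setoid setoid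
  open import Algebra.Properties.Ring ring using (-‿distribˡ-*)
  import Algebra.Properties.CommutativeSemigroup +-commutativeSemigroup as CS+
  import Algebra.Properties.CommutativeSemigroup *-commutativeSemigroup as CS*

  infixr 8 _↑_
  _↑_ : Carrier → ℕ → Carrier
  a ↑ zero  = 1#
  a ↑ suc k = a * (a ↑ k)

  ↑-+ : ∀ a j k → a ↑ (j ℕ.+ k) ≈ a ↑ j * a ↑ k
  ↑-+ a zero    k = ≈-sym (*-identityˡ _)
  ↑-+ a (suc j) k = ≈-trans (*-congˡ (↑-+ a j k)) (≈-sym (*-assoc _ _ _))

  ⟦_⟧ : ∀ {n} → Expr n → Vec Carrier n → Carrier
  ⟦ var i ⟧ ρ = Vec.lookup ρ i
  ⟦ con c ⟧ ρ = ι c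
  ⟦ a :+ b ⟧ ρ = ⟦ a ⟧ ρ + ⟦ b ⟧ ρ
  ⟦ a :* b ⟧ ρ = ⟦ a ⟧ ρ * ⟦ b ⟧ ρ
  ⟦ a :- b ⟧ ρ = ⟦ a ⟧ ρ + ⊖ ⟦ b ⟧ ρ
  ⟦ :neg a ⟧ ρ = ⊖ ⟦ a ⟧ ρ
  ⟦ a :^ k ⟧ ρ = ⟦ a ⟧ ρ ↑ k

  ⟦_⟧ᵐ : ∀ {n} → Mono n → Vec Carrier n → Carrier
  ⟦ [] ⟧ᵐ    []      = 1#
  ⟦ k ∷ m ⟧ᵐ (a ∷ ρ) = a ↑ k * ⟦ m ⟧ᵐ ρ

  ⟦_⟧ᵖ : ∀ {n} → Poly n → Vec Carrier n → Carrier
  ⟦ [] ⟧ᵖ          ρ = 0#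
  ⟦ (c , m) ∷ p ⟧ᵖ ρ = ι c * ⟦ m ⟧ᵐ ρ + ⟦ p ⟧ᵖ ρ

  mutual
    add-sound : ∀ {n} (p q : Poly n) ρ → ⟦ add p q ⟧ᵖ ρ ≈ ⟦ p ⟧ᵖ ρ + ⟦ q ⟧ᵖ ρ
    add-sound []            q ρ = ≈-sym (+-identityˡ _)
    add-sound ((c , m) ∷ p) q ρ = addTerm-sound c m p q ρ

    addTerm-sound : ∀ {n} c (m : Mono n) p q ρ →
      ⟦ addTerm c m p q ⟧ᵖ ρ ≈ (ι c * ⟦ m ⟧ᵐ ρ + ⟦ p ⟧ᵖ ρ) + ⟦ q ⟧ᵖ ρ
    addTerm-sound c m p [] ρ = ≈-sym (+-identityʳ _)
    addTerm-sound c m p ((d , m′) ∷ q) ρ with cmp m m′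
    ... | before = ≈-trans (+-congˡ (add-sound p ((d , m′) ∷ q) ρ)) (≈-sym (+-assoc _ _ _))
    ... | after = ≈-trans (+-congˡ (addTerm-sound c m p q ρ)) (CS+.x∙yz≈y∙xz _ _ _)
    ... | same refl = begin
      ι (c ℤ.+ d) * ⟦ m ⟧ᵐ ρ + ⟦ add p q ⟧ᵖ ρ
        ≈⟨ +-cong (≈-trans (*-congʳ (ι-+ c d)) (distribʳ _ _ _)) (add-sound p q ρ) ⟩
      (ι c * ⟦ m ⟧ᵐ ρ + ι d * ⟦ m ⟧ᵐ ρ) + (⟦ p ⟧ᵖ ρ + ⟦ q ⟧ᵖ ρ)
        ≈⟨ CS+.interchange _ _ _ _ ⟩
      (ι c * ⟦ m ⟧ᵐ ρ + ⟦ p ⟧ᵖ ρ) + (ι d * ⟦ m ⟧ᵐ ρ + ⟦ q ⟧ᵖ ρ) ∎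

  mono-sound : ∀ {n} (m m′ : Mono n) ρ →
    ⟦ Vec.zipWith ℕ._+_ m m′ ⟧ᵐ ρ ≈ ⟦ m ⟧ᵐ ρ * ⟦ m′ ⟧ᵐ ρ
  mono-sound []      []       []      = ≈-sym (*-identityˡ _)
  mono-sound (j ∷ m) (k ∷ m′) (a ∷ ρ) =
    ≈-trans (*-cong (↑-+ a j k) (mono-sound m m′ ρ)) (CS*.interchange _ _ _ _)

  scaleBy-sound : ∀ {n} c (m : Mono n) q ρ → ⟦ scaleBy c m q ⟧ᵖ ρ ≈ (ι c * ⟦ m ⟧ᵐ ρ) * ⟦ q ⟧ᵖ ρ
  scaleBy-sound c m []             ρ = ≈-sym (zeroʳ _)
  scaleBy-sound c m ((d , m′) ∷ q) ρ = begin
    ι (c ℤ.* d) * ⟦ Vec.zipWith ℕ._+_ m m′ ⟧ᵐ ρ + ⟦ scaleBy c m q ⟧ᵖ ρ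
      ≈⟨ +-cong (*-cong (ι-* c d) (mono-sound m m′ ρ)) (scaleBy-sound c m q ρ) ⟩
    (ι c * ι d) * (⟦ m ⟧ᵐ ρ * ⟦ m′ ⟧ᵐ ρ) + (ι c * ⟦ m ⟧ᵐ ρ) * ⟦ q ⟧ᵖ ρ
      ≈⟨ +-congʳ (CS*.interchange _ _ _ _) ⟩
    (ι c * ⟦ m ⟧ᵐ ρ) * (ι d * ⟦ m′ ⟧ᵐ ρ) + (ι c * ⟦ m ⟧ᵐ ρ) * ⟦ q ⟧ᵖ ρ
      ≈⟨ ≈-sym (distribˡ _ _ _) ⟩
    (ι c * ⟦ m ⟧ᵐ ρ) * (ι d * ⟦ m′ ⟧ᵐ ρ + ⟦ q ⟧ᵖ ρ) ∎

  mul-sound : ∀ {n} (p q : Poly n) ρ → ⟦ mul p q ⟧ᵖ ρ ≈ ⟦ p ⟧ᵖ ρ * ⟦ q ⟧ᵖ ρ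
  mul-sound []            q ρ = ≈-sym (zeroˡ _)
  mul-sound ((c , m) ∷ p) q ρ = ≈-trans (add-sound (scaleBy c m q) (mul p q) ρ)
    (≈-trans (+-cong (scaleBy-sound c m q ρ) (mul-sound p q ρ)) (≈-sym (distribʳ _ _ _)))

  unit-sound : ∀ {n} (ρ : Vec Carrier n) → ⟦ unit n ⟧ᵐ ρ ≈ 1#
  unit-sound []      = ≈-refl
  unit-sound (a ∷ ρ) = ≈-trans (*-identityˡ _) (unit-sound ρ)

  indicator-sound : ∀ {n} (i : Fin n) ρ → ⟦ indicator i ⟧ᵐ ρ ≈ Vec.lookup ρ i
  indicator-sound Fin.zero    (a ∷ ρ) =
    ≈-trans (*-cong (*-identityʳ a) (unit-sound ρ)) (*-identityʳ a)
  indicator-sound (Fin.suc i) (a ∷ ρ) = ≈-trans (*-identityˡ _) (indicator-sound i ρ)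

  ι-neg : ∀ a → ι -[1+ 0 ] * a ≈ ⊖ a
  ι-neg a = begin
    ι -[1+ 0 ] * a                  ≈⟨ ≈-sym (+-identityʳ _) ⟩
    ι -[1+ 0 ] * a + 0#             ≈⟨ +-congˡ (≈-sym (-‿inverseʳ a)) ⟩
    ι -[1+ 0 ] * a + (a + ⊖ a)      ≈⟨ ≈-sym (+-assoc _ _ _) ⟩
    (ι -[1+ 0 ] * a + a) + ⊖ a
      ≈⟨ +-congʳ (≈-trans (+-congˡ (≈-trans (≈-sym (*-identityˡ a)) (*-congʳ (≈-sym ι-1)))) (≈-sym (distribʳ _ _ _))) ⟩
    (ι -[1+ 0 ] + ι (+ 1)) * a + ⊖ a
      ≈⟨ +-congʳ (≈-trans (*-congʳ (≈-trans (≈-sym (ι-+ -[1+ 0 ] (+ 1))) ι-0)) (zeroˡ a)) ⟩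
    0# + ⊖ a                        ≈⟨ +-identityˡ _ ⟩
    ⊖ a                             ∎

  norm-sound : ∀ {n} (e : Expr n) ρ → ⟦ norm e ⟧ᵖ ρ ≈ ⟦ e ⟧ ρ
  norm-sound (var i) ρ = ≈-trans (+-identityʳ _)
    (≈-trans (*-cong ι-1 (indicator-sound i ρ)) (*-identityˡ _))
  norm-sound (con c) ρ = ≈-trans (+-identityʳ _) (≈-trans (*-congˡ (unit-sound ρ)) (*-identityʳ _))
  norm-sound (a :+ b) ρ =
    ≈-trans (add-sound (norm a) (norm b) ρ) (+-cong (norm-sound a ρ) (norm-sound b ρ))
  norm-sound (a :* b) ρ =
    ≈-trans (mul-sound (norm a) (norm b) ρ) (*-cong (norm-sound a ρ) (norm-sound b ρ))
  norm-sound (a :- b) ρ = ≈-trans (add-sound (norm a) _ ρ) (+-cong (norm-sound a ρ)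
    (≈-trans (scaleBy-sound -[1+ 0 ] (unit _) (norm b) ρ)
      (≈-trans (*-cong (≈-trans (*-congˡ (unit-sound ρ)) (*-identityʳ _)) (norm-sound b ρ)) (ι-neg _))))
  norm-sound (:neg a) ρ = ≈-trans (scaleBy-sound -[1+ 0 ] (unit _) (norm a) ρ)
    (≈-trans (*-cong (≈-trans (*-congˡ (unit-sound ρ)) (*-identityʳ _)) (norm-sound a ρ)) (ι-neg _))
  norm-sound (a :^ k) ρ = go k
    where
    go : ∀ k → ⟦ power (norm a) k ⟧ᵖ ρ ≈ ⟦ a ⟧ ρ ↑ k
    go zero    = ≈-trans (+-identityʳ _) (≈-trans (*-cong ι-1 (unit-sound ρ)) (*-identityˡ _))
    go (suc k) = ≈-trans (mul-sound (norm a) (power (norm a) k) ρ) (*-cong (norm-sound a ρ) (go k))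

  allZero-sound : ∀ {n} (p : Poly n) ρ → allZero p ≡ true → ⟦ p ⟧ᵖ ρ ≈ 0#
  allZero-sound []              ρ _  = ≈-refl
  allZero-sound ((+ 0 , m) ∷ p) ρ ok =
    ≈-trans (+-cong (≈-trans (*-congʳ ι-0) (zeroˡ _)) (allZero-sound p ρ ok)) (+-identityˡ _)

  -- Only the difference of the two sides is normalised, and only integer coefficients and exponents
  -- are computed; elements of the ring remain untouched. The goal is a function of the variables,
  -- so that each use can name them by a pattern.
  solve : ∀ {n} (ρ : Vec Carrier n) (goal : Vars n → Expr n × Expr n) →
    let (l , r) = goal (Vec.tabulate var) in
    allZero (norm (l :- r)) ≡ true → ⟦ l ⟧ ρ ≈ ⟦ r ⟧ ρ
  solve ρ goal ok = let (l , r) = goal (Vec.tabulate var) in begin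
    ⟦ l ⟧ ρ                            ≈⟨ ≈-sym (+-identityʳ _) ⟩
    ⟦ l ⟧ ρ + 0#                       ≈⟨ +-congˡ (≈-sym (-‿inverseˡ _)) ⟩
    ⟦ l ⟧ ρ + (⊖ ⟦ r ⟧ ρ + ⟦ r ⟧ ρ)    ≈⟨ ≈-sym (+-assoc _ _ _) ⟩
    (⟦ l ⟧ ρ + ⊖ ⟦ r ⟧ ρ) + ⟦ r ⟧ ρ
      ≈⟨ +-congʳ (≈-trans (≈-sym (norm-sound (l :- r) ρ)) (allZero-sound (norm (l :- r)) ρ ok)) ⟩
    0# + ⟦ r ⟧ ρ                       ≈⟨ +-identityˡ _ ⟩
    ⟦ r ⟧ ρ                            ∎

module ℤR = Polynomial ℤₚ.+-*-commutativeRing id (λ _ _ → refl) (λ _ _ → refl) refl refl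

≡⇒-≡0 : ∀ {i j} → i ≡ j → i ℤ.- j ≡ + 0
≡⇒-≡0 {i} refl = ℤₚ.+-inverseʳ i

-≡0⇒≡ : ∀ {i j} → i ℤ.- j ≡ + 0 → i ≡ j
-≡0⇒≡ {i} {j} = ℤₚ.i-j≡0⇒i≡j i j

infixr 8 _⊙ᶻ_
-- Certificates over ℤ: `solve` rewrites i - j as a sum of terms c(l - r), and each term vanishes by
-- a known equation l = r.
_⊙ᶻ_ : ∀ c {i j} → i ≡ j → c ℤ.* (i ℤ.- j) ≡ + 0
c ⊙ᶻ p = trans (cong (c ℤ.*_) (≡⇒-≡0 p)) (ℤₚ.*-zeroʳ c)

infixl 6 _⊞ᶻ_
_⊞ᶻ_ : ∀ {i j} → i ≡ + 0 → j ≡ + 0 → i ℤ.+ j ≡ + 0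
p ⊞ᶻ q = cong₂ ℤ._+_ p q

-- Formal power series over ℤ as a commutative ring

infix 4 _≈_
-- A record and not a bare family of equations, so that f and g can be recovered from the type by
-- unification.
record _≈_ (f g : Series) : Set where
  constructor coeffs
  field at-degree : ∀ n → f n ≡ g n
open _≈_ public

≈-refl : {f : Series} → f ≈ f
≈-refl = coeffs λ _ → refl

≈-sym : {f g : Series} → f ≈ g → g ≈ f
≈-sym p = coeffs λ n → sym (at-degree p n)

≈-trans : {f g h : Series} → f ≈ g → g ≈ h → f ≈ h
≈-trans p q = coeffs λ n → trans (at-degree p n) (at-degree q n)

tail : Series → Series
tail f n = f (suc n)

zeroS : Series
zeroS _ = + 0

conv : Series → Series → Series
conv f g n = sumℤ (applyUpTo (λ k → f k ℤ.* g (n ℕ.∸ k)) (suc n))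

⊗≡conv : ∀ f g n → (f ⊗ g) n ≡ conv f g n
⊗≡conv f g n = cong sumℤ (map-upTo (λ k → f k ℤ.* g (n ℕ.∸ k)) (suc n))

⊗-head : ∀ f g → (f ⊗ g) 0 ≡ f 0 ℤ.* g 0
⊗-head f g = ℤₚ.+-identityʳ _

-- Removing the constant term of the left factor makes the product structurally recursive in the
-- degree. The laws of the product are inductions along this recursion, and commutativity compares
-- it with its mirror image `⊗-suc′`.
⊗-suc : ∀ f g n → (f ⊗ g) (suc n) ≡ f 0 ℤ.* g (suc n) ℤ.+ (tail f ⊗ g) n
⊗-suc f g n = trans (⊗≡conv f g (suc n)) (cong (λ s → f 0 ℤ.* g (suc n) ℤ.+ s) (sym (⊗≡conv (tail f) g n)))

⊗-cong : ∀ {f f′ g g′} → f ≈ f′ → g ≈ g′ → f ⊗ g ≈ f′ ⊗ g′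
⊗-cong {f} {f′} {g} {g′} (coeffs p) (coeffs q) = coeffs λ n → go n p
  where
  go : ∀ {f f′} n → (∀ k → f k ≡ f′ k) → (f ⊗ g) n ≡ (f′ ⊗ g′) n
  go {f} {f′} zero p = trans (⊗-head f g) (trans (cong₂ ℤ._*_ (p 0) (q 0)) (sym (⊗-head f′ g′)))
  go {f} {f′} (suc n) p = trans (⊗-suc f g n)
    (trans (cong₂ ℤ._+_ (cong₂ ℤ._*_ (p 0) (q (suc n))) (go n (p ∘ suc))) (sym (⊗-suc f′ g′ n)))

⊗-suc′ : ∀ f g n → (f ⊗ g) (suc n) ≡ (f ⊗ tail g) n ℤ.+ f (suc n) ℤ.* g 0
⊗-suc′ f g zero = begin
  (f ⊗ g) 1                                ≡⟨ ⊗-suc f g 0 ⟩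
  f 0 ℤ.* g 1 ℤ.+ (tail f ⊗ g) 0           ≡⟨ cong₂ ℤ._+_ (sym (⊗-head f (tail g))) (⊗-head (tail f) g) ⟩
  (f ⊗ tail g) 0 ℤ.+ f 1 ℤ.* g 0           ∎
  where open ≡-Reasoning
⊗-suc′ f g (suc n) = begin
  (f ⊗ g) (suc (suc n))
    ≡⟨ ⊗-suc f g (suc n) ⟩
  f 0 ℤ.* g (suc (suc n)) ℤ.+ (tail f ⊗ g) (suc n)
    ≡⟨ cong (λ s → f 0 ℤ.* g (suc (suc n)) ℤ.+ s) (⊗-suc′ (tail f) g n) ⟩
  f 0 ℤ.* g (suc (suc n)) ℤ.+ ((tail f ⊗ tail g) n ℤ.+ f (suc (suc n)) ℤ.* g 0)
    ≡⟨ sym (ℤₚ.+-assoc (f 0 ℤ.* g (suc (suc n))) _ _) ⟩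
  (f 0 ℤ.* g (suc (suc n)) ℤ.+ (tail f ⊗ tail g) n) ℤ.+ f (suc (suc n)) ℤ.* g 0
    ≡⟨ cong (λ s → s ℤ.+ f (suc (suc n)) ℤ.* g 0) (sym (⊗-suc f (tail g) n)) ⟩
  (f ⊗ tail g) (suc n) ℤ.+ f (suc (suc n)) ℤ.* g 0 ∎
  where open ≡-Reasoning

⊗-comm : ∀ f g → f ⊗ g ≈ g ⊗ f
⊗-comm f g = coeffs (go f g)
  where
  go : ∀ f g n → (f ⊗ g) n ≡ (g ⊗ f) n
  go f g zero    = trans (⊗-head f g) (trans (ℤₚ.*-comm (f 0) (g 0)) (sym (⊗-head g f)))
  go f g (suc n) = trans (⊗-suc f g n) (trans (ℤₚ.+-comm (f 0 ℤ.* g (suc n)) _)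
    (trans (cong₂ ℤ._+_ (go (tail f) g n) (ℤₚ.*-comm (f 0) (g (suc n)))) (sym (⊗-suc′ g f n))))

⊗-distribʳ : ∀ h f g → (f ⊕ g) ⊗ h ≈ f ⊗ h ⊕ g ⊗ h
⊗-distribʳ h f g = coeffs (go f g)
  where
  go : ∀ f g n → ((f ⊕ g) ⊗ h) n ≡ (f ⊗ h ⊕ g ⊗ h) n
  go f g zero = trans (⊗-head (f ⊕ g) h) (trans (ℤₚ.*-distribʳ-+ (h 0) (f 0) (g 0))
    (sym (cong₂ ℤ._+_ (⊗-head f h) (⊗-head g h))))
  go f g (suc n) = begin
    ((f ⊕ g) ⊗ h) (suc n)
      ≡⟨ ⊗-suc (f ⊕ g) h n ⟩
    (f 0 ℤ.+ g 0) ℤ.* h (suc n) ℤ.+ ((tail f ⊕ tail g) ⊗ h) n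
      ≡⟨ cong (λ s → (f 0 ℤ.+ g 0) ℤ.* h (suc n) ℤ.+ s) (go (tail f) (tail g) n) ⟩
    (f 0 ℤ.+ g 0) ℤ.* h (suc n) ℤ.+ ((tail f ⊗ h) n ℤ.+ (tail g ⊗ h) n)
      ≡⟨ ℤR.solve (f 0 ∷ g 0 ∷ h (suc n) ∷ (tail f ⊗ h) n ∷ (tail g ⊗ h) n ∷ [])
           (λ { (a ∷ b ∷ c ∷ d ∷ e ∷ []) → (a :+ b) :* c :+ (d :+ e) , (a :* c :+ d) :+ (b :* c :+ e) }) refl ⟩
    (f 0 ℤ.* h (suc n) ℤ.+ (tail f ⊗ h) n) ℤ.+ (g 0 ℤ.* h (suc n) ℤ.+ (tail g ⊗ h) n)
      ≡⟨ sym (cong₂ ℤ._+_ (⊗-suc f h n) (⊗-suc g h n)) ⟩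
    (f ⊗ h ⊕ g ⊗ h) (suc n) ∎
    where open ≡-Reasoning

scale-⊗ : ∀ c f g → scale c f ⊗ g ≈ scale c (f ⊗ g)
scale-⊗ c f g = coeffs (go f)
  where
  go : ∀ f n → (scale c f ⊗ g) n ≡ c ℤ.* (f ⊗ g) n
  go f zero = trans (⊗-head (scale c f) g) (trans (ℤₚ.*-assoc c (f 0) (g 0)) (cong (c ℤ.*_) (sym (⊗-head f g))))
  go f (suc n) = trans (⊗-suc (scale c f) g n) (trans
    (cong₂ ℤ._+_ (ℤₚ.*-assoc c (f 0) (g (suc n))) (go (tail f) n))
    (trans (sym (ℤₚ.*-distribˡ-+ c (f 0 ℤ.* g (suc n)) _)) (cong (c ℤ.*_) (sym (⊗-suc f g n)))))

⊗-assoc : ∀ f g h → (f ⊗ g) ⊗ h ≈ f ⊗ (g ⊗ h)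
⊗-assoc f g h = coeffs (go f)
  where
  tail-⊗ : ∀ f → tail (f ⊗ g) ≈ scale (f 0) (tail g) ⊕ tail f ⊗ g
  tail-⊗ f = coeffs (⊗-suc f g)
  go : ∀ f n → ((f ⊗ g) ⊗ h) n ≡ (f ⊗ (g ⊗ h)) n
  go f zero = begin
    ((f ⊗ g) ⊗ h) 0            ≡⟨ ⊗-head (f ⊗ g) h ⟩
    (f ⊗ g) 0 ℤ.* h 0          ≡⟨ cong (ℤ._* h 0) (⊗-head f g) ⟩
    f 0 ℤ.* g 0 ℤ.* h 0        ≡⟨ ℤₚ.*-assoc (f 0) (g 0) (h 0) ⟩
    f 0 ℤ.* (g 0 ℤ.* h 0)      ≡⟨ cong (f 0 ℤ.*_) (sym (⊗-head g h)) ⟩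
    f 0 ℤ.* (g ⊗ h) 0          ≡⟨ sym (⊗-head f (g ⊗ h)) ⟩
    (f ⊗ (g ⊗ h)) 0            ∎
    where open ≡-Reasoning
  go f (suc n) = begin
    ((f ⊗ g) ⊗ h) (suc n)
      ≡⟨ ⊗-suc (f ⊗ g) h n ⟩
    (f ⊗ g) 0 ℤ.* h (suc n) ℤ.+ (tail (f ⊗ g) ⊗ h) n
      ≡⟨ cong₂ (λ a b → a ℤ.* h (suc n) ℤ.+ b) (⊗-head f g) (at-degree (≈-trans
           (⊗-cong (tail-⊗ f) (≈-refl {h})) (⊗-distribʳ h (scale (f 0) (tail g)) (tail f ⊗ g))) n) ⟩
    f 0 ℤ.* g 0 ℤ.* h (suc n) ℤ.+ ((scale (f 0) (tail g) ⊗ h) n ℤ.+ ((tail f ⊗ g) ⊗ h) n)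
      ≡⟨ cong₂ (λ a b → f 0 ℤ.* g 0 ℤ.* h (suc n) ℤ.+ (a ℤ.+ b)) (at-degree (scale-⊗ (f 0) (tail g) h) n) (go (tail f) n) ⟩
    f 0 ℤ.* g 0 ℤ.* h (suc n) ℤ.+ (f 0 ℤ.* (tail g ⊗ h) n ℤ.+ (tail f ⊗ (g ⊗ h)) n)
      ≡⟨ ℤR.solve (f 0 ∷ g 0 ∷ h (suc n) ∷ (tail g ⊗ h) n ∷ (tail f ⊗ (g ⊗ h)) n ∷ [])
           (λ { (a ∷ b ∷ c ∷ d ∷ e ∷ []) → a :* b :* c :+ (a :* d :+ e) , a :* (b :* c :+ d) :+ e }) refl ⟩
    f 0 ℤ.* (g 0 ℤ.* h (suc n) ℤ.+ (tail g ⊗ h) n) ℤ.+ (tail f ⊗ (g ⊗ h)) n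
      ≡⟨ cong (λ s → f 0 ℤ.* s ℤ.+ (tail f ⊗ (g ⊗ h)) n) (sym (⊗-suc g h n)) ⟩
    f 0 ℤ.* (g ⊗ h) (suc n) ℤ.+ (tail f ⊗ (g ⊗ h)) n
      ≡⟨ sym (⊗-suc f (g ⊗ h) n) ⟩
    (f ⊗ (g ⊗ h)) (suc n) ∎
    where open ≡-Reasoning

zero-⊗ : ∀ g → zeroS ⊗ g ≈ zeroS
zero-⊗ g = coeffs go
  where
  go : ∀ n → (zeroS ⊗ g) n ≡ + 0
  go zero    = ⊗-head zeroS g
  go (suc n) = trans (⊗-suc zeroS g n) (trans (ℤₚ.+-identityˡ _) (go n))

scale-one : ∀ c g → scale c oneS ⊗ g ≈ scale c g
scale-one c g = coeffs λ { zero → trans (⊗-head (scale c oneS) g) (cong (ℤ._* g 0) (ℤₚ.*-identityʳ c)) ; (suc n) → go n }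
  where
  tail-zero : tail (scale c oneS) ≈ zeroS
  tail-zero = coeffs λ _ → ℤₚ.*-zeroʳ c
  go : ∀ n → (scale c oneS ⊗ g) (suc n) ≡ c ℤ.* g (suc n)
  go n = trans (⊗-suc (scale c oneS) g n) (trans
    (cong₂ ℤ._+_ (cong (ℤ._* g (suc n)) (ℤₚ.*-identityʳ c))
      (at-degree (≈-trans (⊗-cong tail-zero (≈-refl {g})) (zero-⊗ g)) n))
    (ℤₚ.+-identityʳ _))

⊗-identityˡ : ∀ g → oneS ⊗ g ≈ g
⊗-identityˡ g = ≈-trans (⊗-cong (coeffs λ n → sym (ℤₚ.*-identityˡ (oneS n))) (≈-refl {g}))
  (≈-trans (scale-one (+ 1) g) (coeffs λ n → ℤₚ.*-identityˡ (g n)))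

-- The operations are opaque so that unification treats them as constructors
-- instead of expanding convolutions coefficientwise.
opaque
  infixl 6 _+_
  infixl 7 _*_

  _+_ _*_ : Series → Series → Series
  _+_ = _⊕_
  _*_ = _⊗_

  neg : Series → Series
  neg f n = - f n

  𝟘 𝟙 : Series
  𝟘 _ = + 0
  𝟙 = oneS

  const : ℤ → Series
  const c = scale c oneS

  +≈⊕ : ∀ f g → f + g ≈ f ⊕ g
  +≈⊕ f g = ≈-refl

  *≈⊗ : ∀ f g → f * g ≈ f ⊗ g
  *≈⊗ f g = ≈-refl

  𝟙≈oneS : 𝟙 ≈ oneS
  𝟙≈oneS = ≈-refl

  scale≈const : ∀ c f → scale c f ≈ const c * f
  scale≈const c f = ≈-sym (scale-one c f)

  coeff-+ : ∀ f g n → (f + g) n ≡ f n ℤ.+ g n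
  coeff-+ f g n = refl

  coeff-neg : ∀ f n → neg f n ≡ - f n
  coeff-neg f n = refl

  coeff-𝟘 : ∀ n → 𝟘 n ≡ + 0
  coeff-𝟘 n = refl

  coeff-*-zero : ∀ f g → (f * g) 0 ≡ f 0 ℤ.* g 0
  coeff-*-zero = ⊗-head

  coeff-*-suc : ∀ f g n → (f * g) (suc n) ≡ f 0 ℤ.* g (suc n) ℤ.+ (tail f * g) n
  coeff-*-suc = ⊗-suc

  coeff-const-* : ∀ c f n → (const c * f) n ≡ c ℤ.* f n
  coeff-const-* c f n = at-degree (scale-one c f) n

  const-zero : ∀ c → const c 0 ≡ c
  const-zero c = ℤₚ.*-identityʳ c

  const-suc : ∀ c n → const c (suc n) ≡ + 0
  const-suc c n = ℤₚ.*-zeroʳ c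

  isCommutativeRing : IsCommutativeRing _≈_ _+_ _*_ neg 𝟘 𝟙
  isCommutativeRing = record
    { isRing = record
      { +-isAbelianGroup = record
        { isGroup = record
          { isMonoid = record
            { isSemigroup = record
              { isMagma = record
                { isEquivalence = record { refl = ≈-refl ; sym = ≈-sym ; trans = ≈-trans }
                ; ∙-cong = λ p q → coeffs λ n → cong₂ ℤ._+_ (at-degree p n) (at-degree q n) }
              ; assoc = λ f g h → coeffs λ n → ℤₚ.+-assoc (f n) (g n) (h n) }
            ; identity = (λ f → coeffs λ n → ℤₚ.+-identityˡ (f n)) , (λ f → coeffs λ n → ℤₚ.+-identityʳ (f n)) }
          ; inverse = (λ f → coeffs λ n → ℤₚ.+-inverseˡ (f n)) , (λ f → coeffs λ n → ℤₚ.+-inverseʳ (f n))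
          ; ⁻¹-cong = λ p → coeffs λ n → cong -_ (at-degree p n) }
        ; comm = λ f g → coeffs λ n → ℤₚ.+-comm (f n) (g n) }
      ; *-cong = ⊗-cong
      ; *-assoc = ⊗-assoc
      ; *-identity = ⊗-identityˡ , λ f → ≈-trans (⊗-comm f oneS) (⊗-identityˡ f)
      ; distrib = (λ f g h → ≈-trans (⊗-comm f (g ⊕ h)) (≈-trans (⊗-distribʳ f g h)
                    (coeffs λ n → cong₂ ℤ._+_ (at-degree (⊗-comm g f) n) (at-degree (⊗-comm h f) n)))) , ⊗-distribʳ }
    ; *-comm = ⊗-comm }

  const-+ : ∀ a b → const (a ℤ.+ b) ≈ const a + const b
  const-+ a b = coeffs λ n → ℤₚ.*-distribʳ-+ (oneS n) a b

  const-* : ∀ a b → const (a ℤ.* b) ≈ const a * const b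
  const-* a b = ≈-sym (≈-trans (scale-one a (const b)) (coeffs λ n → sym (ℤₚ.*-assoc a b (oneS n))))

  const-0 : const (+ 0) ≈ 𝟘
  const-0 = coeffs λ n → refl

  const-1 : const (+ 1) ≈ 𝟙
  const-1 = coeffs λ n → ℤₚ.*-identityˡ (oneS n)

seriesRing : CommutativeRing 0ℓ 0ℓ
seriesRing = record { isCommutativeRing = isCommutativeRing }

module SR = Polynomial seriesRing const const-+ const-* const-0 const-1
open SR public using (_↑_)

open CommutativeRing seriesRing public using
  ( +-cong; +-congˡ; +-congʳ; *-cong; *-congˡ; *-congʳ; +-assoc; +-comm; *-assoc; *-comm
  ; +-identityˡ; +-identityʳ; *-identityˡ; *-identityʳ; zeroˡ; zeroʳ; distribˡ; distribʳ; -‿inverseʳ; -‿cong)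
module ≈-Reasoning where
  open import Relation.Binary.Reasoning.Setoid (CommutativeRing.setoid seriesRing) public

infixl 6 _-_
_-_ : Series → Series → Series
f - g = f + neg g

coeff-- : ∀ f g n → (f - g) n ≡ f n ℤ.- g n
coeff-- f g n = trans (coeff-+ f (neg g) n) (cong (λ z → f n ℤ.+ z) (coeff-neg g n))

-≈𝟘⇒≈ : ∀ {f g} → f - g ≈ 𝟘 → f ≈ g
-≈𝟘⇒≈ {f} {g} p = coeffs λ n → ℤₚ.i-j≡0⇒i≡j (f n) (g n)
  (trans (sym (coeff-- f g n)) (trans (at-degree p n) (coeff-𝟘 n)))

≈⇒-≈𝟘 : ∀ {f g} → f ≈ g → f - g ≈ 𝟘
≈⇒-≈𝟘 {f} {g} p = ≈-trans (+-congʳ p) (-‿inverseʳ g)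

-- Powers of the variable and the dilations q ↦ q^d

opaque
  unfolding _+_

  X^ : ℕ → Series
  X^ m = qpow m oneS

  qpow-suc : ∀ m f n → qpow (suc m) f (suc n) ≡ qpow m f n
  qpow-suc zero    f n = refl
  qpow-suc (suc m) f n = refl

  X⊗ : Series → Series
  X⊗ f zero    = + 0
  X⊗ f (suc n) = f n

  X⊗-* : ∀ f g → X⊗ f * g ≈ X⊗ (f * g)
  X⊗-* f g = coeffs λ { zero → ⊗-head (X⊗ f) g ; (suc n) → trans (⊗-suc (X⊗ f) g n) (ℤₚ.+-identityˡ _) }

  X⊗-cong : {f g : Series} → f ≈ g → X⊗ f ≈ X⊗ g
  X⊗-cong p = coeffs λ { zero → refl ; (suc n) → at-degree p n }

  qpow-step : ∀ m f → qpow (suc m) f ≈ X⊗ (qpow m f)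
  qpow-step m f = coeffs λ { zero → refl ; (suc n) → qpow-suc m f n }

  X^-suc : ∀ m → X^ (suc m) ≈ X⊗ (X^ m)
  X^-suc m = qpow-step m oneS

  X^-zero : X^ 0 ≈ 𝟙
  X^-zero = coeffs λ _ → refl

qpow≈ : ∀ m f → qpow m f ≈ X^ m * f
qpow≈ zero f = ≈-sym (≈-trans (*-congʳ X^-zero) (*-identityˡ f))
qpow≈ (suc m) f = begin
  qpow (suc m) f            ≈⟨ qpow-step m f ⟩
  X⊗ (qpow m f)             ≈⟨ X⊗-cong (qpow≈ m f) ⟩
  X⊗ (X^ m * f)             ≈⟨ X⊗-* (X^ m) f ⟨
  X⊗ (X^ m) * f             ≈⟨ *-congʳ (X^-suc m) ⟨
  X^ (suc m) * f            ∎
  where open ≈-Reasoning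

X^-+ : ∀ m n → X^ (m ℕ.+ n) ≈ X^ m * X^ n
X^-+ zero n = ≈-sym (≈-trans (*-congʳ X^-zero) (*-identityˡ _))
X^-+ (suc m) n = begin
  X^ (suc (m ℕ.+ n))   ≈⟨ X^-suc (m ℕ.+ n) ⟩
  X⊗ (X^ (m ℕ.+ n))    ≈⟨ X⊗-cong (X^-+ m n) ⟩
  X⊗ (X^ m * X^ n)     ≈⟨ X⊗-* (X^ m) (X^ n) ⟨
  X⊗ (X^ m) * X^ n     ≈⟨ *-congʳ (X^-suc m) ⟨
  X^ (suc m) * X^ n    ∎
  where open ≈-Reasoning

qpow-≥ : ∀ m f n → qpow m f (m ℕ.+ n) ≡ f n
qpow-≥ zero f n = refl
qpow-≥ (suc m) f n = trans (qpow-suc m f (m ℕ.+ n)) (qpow-≥ m f n)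

qpow-< : ∀ m f n → n ℕ.< m → qpow m f n ≡ + 0
qpow-< (suc m) f zero    _         = refl
qpow-< (suc m) f (suc n) (s≤s n<m) = trans (qpow-suc m f n) (qpow-< m f n n<m)

coeff-X^*-≥ : ∀ m f n → (X^ m * f) (m ℕ.+ n) ≡ f n
coeff-X^*-≥ m f n = trans (sym (at-degree (qpow≈ m f) (m ℕ.+ n))) (qpow-≥ m f n)

coeff-X^*-< : ∀ m f n → n ℕ.< m → (X^ m * f) n ≡ + 0
coeff-X^*-< m f n n<m = trans (sym (at-degree (qpow≈ m f) n)) (qpow-< m f n n<m)

opaque
  dil : (d : ℕ) .{{_ : NonZero d}} → Series → Series
  dil d f = at d f

  at≈dil : ∀ d .{{_ : NonZero d}} f → at d f ≈ dil d f
  at≈dil d f = ≈-refl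

  dil-cong : ∀ d .{{_ : NonZero d}} {f g : Series} → f ≈ g → dil d f ≈ dil d g
  dil-cong d p = coeffs λ n → cong (λ z → if n % d ℕ.≡ᵇ 0 then z else + 0) (at-degree p (n / d))

  dil-≥ : ∀ d .{{_ : NonZero d}} f n → dil d f (d ℕ.+ n) ≡ dil d (tail f) n
  dil-≥ d f n = cong₂ (λ r k → if r ℕ.≡ᵇ 0 then f k else + 0)
    (trans (cong (_% d) (ℕₚ.+-comm d n)) (DM.[m+n]%n≡m%n n d))
    (trans (DM.m/n≡1+[m∸n]/n (ℕₚ.m≤m+n d n)) (cong (λ z → suc (z / d)) (ℕₚ.m+n∸m≡n d n)))

  dil-< : ∀ d .{{_ : NonZero d}} f n → n ℕ.< d → dil d f n ≡ const (f 0) n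
  dil-< d f n n<d rewrite DM.m<n⇒m%n≡m n<d | DM.m<n⇒m/n≡0 n<d with n
  ... | zero  = sym (const-zero (f 0))
  ... | suc k = sym (const-suc (f 0) k)

-- The recursion on `tail` that characterises a dilation. With the uniqueness below,
-- multiplicativity and composition follow without any division with remainder.
dil-step : ∀ d .{{_ : NonZero d}} f → dil d f ≈ const (f 0) + X^ d * dil d (tail f)
dil-step d f = coeffs λ n → trans (go n) (sym (coeff-+ (const (f 0)) (X^ d * dil d (tail f)) n))
  where
  go : ∀ n → dil d f n ≡ const (f 0) n ℤ.+ (X^ d * dil d (tail f)) n
  go n with n ℕ.<? d
  ... | yes n<d = trans (dil-< d f n n<d) (trans (sym (ℤₚ.+-identityʳ _))
                    (cong (λ z → const (f 0) n ℤ.+ z) (sym (coeff-X^*-< d (dil d (tail f)) n n<d))))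
  ... | no n≮d = subst (λ m → dil d f m ≡ const (f 0) m ℤ.+ (X^ d * dil d (tail f)) m)
                   (ℕₚ.m+[n∸m]≡n (ℕₚ.≮⇒≥ n≮d)) (above (n ℕ.∸ d))
    where
    vanish : ∀ e .{{_ : NonZero e}} k → const (f 0) (e ℕ.+ k) ≡ + 0
    vanish (suc e) k = const-suc (f 0) (e ℕ.+ k)
    above : ∀ k → dil d f (d ℕ.+ k) ≡ const (f 0) (d ℕ.+ k) ℤ.+ (X^ d * dil d (tail f)) (d ℕ.+ k)
    above k = trans (dil-≥ d f k) (sym (trans (cong₂ ℤ._+_ (vanish d k) (coeff-X^*-≥ d (dil d (tail f)) k))
      (ℤₚ.+-identityˡ _)))

tail-* : ∀ f g → tail (f * g) ≈ const (f 0) * tail g + tail f * g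
tail-* f g = coeffs λ n → trans (coeff-*-suc f g n) (sym (trans (coeff-+ (const (f 0) * tail g) (tail f * g) n)
  (cong (ℤ._+ (tail f * g) n) (coeff-const-* (f 0) (tail g) n))))

-- A family of series obeying Φ f = r f + X^d Φ (tail f) with d ≥ 1 is determined by r.
unique-recursion : ∀ d .{{_ : NonZero d}} (r Φ Ψ : Series → Series) →
  (∀ f → Φ f ≈ r f + X^ d * Φ (tail f)) → (∀ f → Ψ f ≈ r f + X^ d * Ψ (tail f)) → ∀ f → Φ f ≈ Ψ f
unique-recursion (suc d) r Φ Ψ φ-step ψ-step f = coeffs λ n → go n n ℕₚ.≤-refl f
  where
  go : ∀ b n → n ℕ.≤ b → ∀ f → Φ f n ≡ Ψ f n
  go b n n≤b f = trans (at-degree (φ-step f) n) (trans (coeff-+ (r f) (X^ (suc d) * Φ (tail f)) n)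
    (trans (cong (λ z → r f n ℤ.+ z) (inner b n n≤b))
    (sym (trans (at-degree (ψ-step f) n) (coeff-+ (r f) (X^ (suc d) * Ψ (tail f)) n)))))
    where
    above : ∀ b k → suc d ℕ.+ k ℕ.≤ b → (X^ (suc d) * Φ (tail f)) (suc d ℕ.+ k) ≡ (X^ (suc d) * Ψ (tail f)) (suc d ℕ.+ k)
    above (suc b) k (s≤s le) = trans (coeff-X^*-≥ (suc d) (Φ (tail f)) k)
      (trans (go b k (ℕₚ.≤-trans (ℕₚ.m≤n+m k d) le) (tail f)) (sym (coeff-X^*-≥ (suc d) (Ψ (tail f)) k)))
    inner : ∀ b n → n ℕ.≤ b → (X^ (suc d) * Φ (tail f)) n ≡ (X^ (suc d) * Ψ (tail f)) n
    inner b n n≤b with n ℕ.<? suc d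
    ... | yes n<d = trans (coeff-X^*-< (suc d) (Φ (tail f)) n n<d) (sym (coeff-X^*-< (suc d) (Ψ (tail f)) n n<d))
    ... | no n≮d = subst (λ m → (X^ (suc d) * Φ (tail f)) m ≡ (X^ (suc d) * Ψ (tail f)) m) eq
                     (above b (n ℕ.∸ suc d) (subst (ℕ._≤ b) (sym eq) n≤b))
      where eq = ℕₚ.m+[n∸m]≡n (ℕₚ.≮⇒≥ n≮d)

opaque
  unfolding dil _+_

  dil-+ : ∀ d .{{_ : NonZero d}} f g → dil d (f + g) ≈ dil d f + dil d g
  dil-+ d f g = coeffs λ n → go (n % d ℕ.≡ᵇ 0) (f (n / d)) (g (n / d))
    where
    go : ∀ b x y → (if b then x ℤ.+ y else + 0) ≡ (if b then x else + 0) ℤ.+ (if b then y else + 0)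
    go true  x y = refl
    go false x y = refl

  dil-neg : ∀ d .{{_ : NonZero d}} f → dil d (neg f) ≈ neg (dil d f)
  dil-neg d f = coeffs λ n → go (n % d ℕ.≡ᵇ 0) (f (n / d))
    where
    go : ∀ b x → (if b then - x else + 0) ≡ - (if b then x else + 0)
    go true  x = refl
    go false x = refl

dil-const-* : ∀ d .{{_ : NonZero d}} c f → dil d (const c * f) ≈ const c * dil d f
dil-const-* d c = unique-recursion d (λ f → const (c ℤ.* f 0)) (λ f → dil d (const c * f)) (λ f → const c * dil d f)
  (λ f → ≈-trans (dil-step d (const c * f)) (+-cong (const-cong (coeff-const-* c f 0))
     (*-congˡ (dil-cong d (coeffs λ n → trans (coeff-const-* c f (suc n)) (sym (coeff-const-* c (tail f) n)))))))
  (λ f → ≈-trans (*-congˡ (dil-step d f)) (≈-trans (distribˡ _ _ _)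
     (+-cong (≈-sym (const-* c (f 0))) (SR.solve (const c ∷ X^ d ∷ dil d (tail f) ∷ [])
        (λ { (a ∷ b ∷ e ∷ []) → a :* (b :* e) , b :* (a :* e) }) refl))))
  where
  const-cong : ∀ {a b} → a ≡ b → const a ≈ const b
  const-cong refl = ≈-refl

-- For fixed g both sides satisfy Φ f = f(0) g(q^d) + q^d Φ(tail f), and this recursion has one
-- solution.
dil-* : ∀ d .{{_ : NonZero d}} f g → dil d (f * g) ≈ dil d f * dil d g
dil-* d f g = unique-recursion d (λ f → const (f 0) * dil d g) (λ f → dil d (f * g)) (λ f → dil d f * dil d g)
  step₁ step₂ f
  where
  open ≈-Reasoning
  step₁ : ∀ f → dil d (f * g) ≈ const (f 0) * dil d g + X^ d * dil d (tail f * g)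
  step₁ f = begin
    dil d (f * g)
      ≈⟨ dil-step d (f * g) ⟩
    const ((f * g) 0) + X^ d * dil d (tail (f * g))
      ≈⟨ +-cong head (*-congˡ (≈-trans (dil-cong d (tail-* f g)) (≈-trans (dil-+ d _ _) (+-congʳ (dil-const-* d (f 0) (tail g)))))) ⟩
    const (f 0) * const (g 0) + X^ d * (const (f 0) * dil d (tail g) + dil d (tail f * g))
      ≈⟨ SR.solve (const (f 0) ∷ const (g 0) ∷ X^ d ∷ dil d (tail g) ∷ dil d (tail f * g) ∷ [])
           (λ { (a ∷ b ∷ x ∷ u ∷ v ∷ []) → a :* b :+ x :* (a :* u :+ v) , a :* (b :+ x :* u) :+ x :* v }) refl ⟩
    const (f 0) * (const (g 0) + X^ d * dil d (tail g)) + X^ d * dil d (tail f * g)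
      ≈⟨ +-congʳ (*-congˡ (dil-step d g)) ⟨
    const (f 0) * dil d g + X^ d * dil d (tail f * g) ∎
    where
    head : const ((f * g) 0) ≈ const (f 0) * const (g 0)
    head rewrite coeff-*-zero f g = const-* (f 0) (g 0)
  step₂ : ∀ f → dil d f * dil d g ≈ const (f 0) * dil d g + X^ d * (dil d (tail f) * dil d g)
  step₂ f = ≈-trans (*-congʳ (dil-step d f)) (≈-trans (distribʳ _ _ _) (+-congˡ (*-assoc _ _ _)))

dil-X^ : ∀ d .{{_ : NonZero d}} m → dil d (X^ m) ≈ X^ (m ℕ.* d)
dil-const : ∀ d .{{_ : NonZero d}} c → dil d (const c) ≈ const c
dil-const d c = begin
  dil d (const c)                                       ≈⟨ dil-step d (const c) ⟩
  const (const c 0) + X^ d * dil d (tail (const c))     ≈⟨ +-cong (subst (λ z → const (const c 0) ≈ const z) (const-zero c) ≈-refl)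
                                                            (*-congˡ (dil-cong d (coeffs λ n → trans (const-suc c n) (sym (coeff-𝟘 n))))) ⟩
  const c + X^ d * dil d 𝟘                              ≈⟨ +-congˡ (≈-trans (*-congˡ dil-𝟘) (zeroʳ _)) ⟩
  const c + 𝟘                                           ≈⟨ +-identityʳ _ ⟩
  const c                                               ∎
  where
  open ≈-Reasoning
  dil-𝟘 : dil d 𝟘 ≈ 𝟘
  dil-𝟘 = ≈-trans (dil-cong d (≈-sym (zeroˡ 𝟘))) (≈-trans (dil-cong d (*-congʳ (≈-sym const-0)))
    (≈-trans (dil-const-* d (+ 0) 𝟘) (≈-trans (*-congʳ const-0) (zeroˡ _))))

dil-X^ d zero = ≈-trans (dil-cong d (≈-trans X^-zero (≈-sym const-1))) (≈-trans (dil-const d (+ 1)) (≈-trans const-1 (≈-sym X^-zero)))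
dil-X^ d (suc m) = begin
  dil d (X^ (suc m))               ≈⟨ dil-cong d (X^-+ 1 m) ⟩
  dil d (X^ 1 * X^ m)              ≈⟨ dil-* d (X^ 1) (X^ m) ⟩
  dil d (X^ 1) * dil d (X^ m)      ≈⟨ *-cong one (dil-X^ d m) ⟩
  X^ d * X^ (m ℕ.* d)              ≈⟨ X^-+ d (m ℕ.* d) ⟨
  X^ (d ℕ.+ m ℕ.* d)               ∎
  where
  open ≈-Reasoning
  X¹ : ∀ n → X^ 1 (suc n) ≡ const (+ 1) n
  X¹ n = trans (at-degree (≈-sym (≈-trans (*-comm (X^ 1) 𝟙) (*-identityˡ _))) (suc n))
    (trans (coeff-X^*-≥ 1 𝟙 n) (sym (at-degree const-1 n)))
  X¹-zero : X^ 1 0 ≡ + 0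
  X¹-zero = trans (at-degree (≈-sym (≈-trans (*-comm (X^ 1) 𝟙) (*-identityˡ _))) 0) (coeff-X^*-< 1 𝟙 0 (s≤s z≤n))
  one : dil d (X^ 1) ≈ X^ d
  one = begin
    dil d (X^ 1)                                    ≈⟨ dil-step d (X^ 1) ⟩
    const (X^ 1 0) + X^ d * dil d (tail (X^ 1))     ≈⟨ +-cong (subst (λ z → const z ≈ 𝟘) (sym X¹-zero) const-0)
                                                          (*-congˡ (dil-cong d (coeffs X¹))) ⟩
    𝟘 + X^ d * dil d (const (+ 1))                  ≈⟨ +-identityˡ _ ⟩
    X^ d * dil d (const (+ 1))                      ≈⟨ *-congˡ (≈-trans (dil-const d (+ 1)) const-1) ⟩
    X^ d * 𝟙                                        ≈⟨ *-identityʳ _ ⟩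
    X^ d                                            ∎

dil-𝟙 : ∀ d .{{_ : NonZero d}} → dil d 𝟙 ≈ 𝟙
dil-𝟙 d = ≈-trans (dil-cong d (≈-sym const-1)) (≈-trans (dil-const d (+ 1)) const-1)

dil-dil : ∀ c d .{{_ : NonZero c}} .{{_ : NonZero d}} .{{_ : NonZero (d ℕ.* c)}} f → dil c (dil d f) ≈ dil (d ℕ.* c) f
dil-dil c d f = unique-recursion (d ℕ.* c) (λ f → const (f 0)) (λ f → dil c (dil d f)) (dil (d ℕ.* c))
  (λ f → begin
    dil c (dil d f)                                          ≈⟨ dil-cong c (dil-step d f) ⟩
    dil c (const (f 0) + X^ d * dil d (tail f))              ≈⟨ dil-+ c _ _ ⟩
    dil c (const (f 0)) + dil c (X^ d * dil d (tail f))      ≈⟨ +-cong (dil-const c (f 0)) (≈-trans (dil-* c _ _) (*-congʳ (dil-X^ c d))) ⟩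
    const (f 0) + X^ (d ℕ.* c) * dil c (dil d (tail f))      ∎)
  (dil-step (d ℕ.* c)) f
  where open ≈-Reasoning

dil-zero : ∀ d .{{_ : NonZero d}} f → dil d f 0 ≡ f 0
dil-zero (suc d) f = trans (dil-< (suc d) f 0 (s≤s z≤n)) (const-zero (f 0))

dil-multiple : ∀ d .{{_ : NonZero d}} f k → dil d f (k ℕ.* d) ≡ f k
dil-multiple d f zero    = dil-zero d f
dil-multiple d f (suc k) = trans (dil-≥ d f (k ℕ.* d)) (dil-multiple d (tail f) k)

dil-nonmultiple : ∀ d .{{_ : NonZero d}} f k r → r ℕ.< d → r ≢ 0 → dil d f (k ℕ.* d ℕ.+ r) ≡ + 0
dil-nonmultiple d f zero r r<d r≢0 with r
... | zero  = contradiction refl r≢0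
... | suc r = trans (dil-< d f (suc r) r<d) (const-suc (f 0) r)
dil-nonmultiple d f (suc k) r r<d r≢0 = trans (cong (dil d f) (ℕₚ.+-assoc d (k ℕ.* d) r))
  (trans (dil-≥ d f (k ℕ.* d ℕ.+ r)) (dil-nonmultiple d (tail f) k r r<d r≢0))

dil-injective : ∀ d .{{_ : NonZero d}} {f g} → dil d f ≈ dil d g → f ≈ g
dil-injective d {f} {g} p = coeffs λ n → trans (sym (dil-multiple d f n)) (trans (at-degree p (n ℕ.* d)) (dil-multiple d g n))

dissect₂ : ∀ a b c d → dil 2 a + X^ 1 * dil 2 b ≈ dil 2 c + X^ 1 * dil 2 d → a ≈ c × b ≈ d
dissect₂ a b c d p = coeffs (λ n → trans (sym (even a b n)) (trans (at-degree p (n ℕ.* 2)) (even c d n)))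
                   , coeffs (λ n → trans (sym (odd a b n)) (trans (at-degree p (suc (n ℕ.* 2))) (odd c d n)))
  where
  odd : ∀ a b n → (dil 2 a + X^ 1 * dil 2 b) (suc (n ℕ.* 2)) ≡ b n
  odd a b n = trans (coeff-+ _ _ (suc (n ℕ.* 2))) (trans (cong₂ ℤ._+_
    (trans (cong (dil 2 a) (ℕₚ.+-comm 1 (n ℕ.* 2))) (dil-nonmultiple 2 a n 1 (s≤s (s≤s z≤n)) λ ()))
    (trans (coeff-X^*-≥ 1 (dil 2 b) (n ℕ.* 2)) (dil-multiple 2 b n))) (ℤₚ.+-identityˡ _))
  below : ∀ b n → (X^ 1 * dil 2 b) (n ℕ.* 2) ≡ + 0
  below b zero    = coeff-X^*-< 1 (dil 2 b) 0 (s≤s z≤n)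
  below b (suc n) = trans (coeff-X^*-≥ 1 (dil 2 b) (suc (n ℕ.* 2)))
    (trans (cong (dil 2 b) (ℕₚ.+-comm 1 (n ℕ.* 2))) (dil-nonmultiple 2 b n 1 (s≤s (s≤s z≤n)) λ ()))
  even : ∀ a b n → (dil 2 a + X^ 1 * dil 2 b) (n ℕ.* 2) ≡ a n
  even a b n = trans (coeff-+ _ _ (n ℕ.* 2)) (trans (cong₂ ℤ._+_ (dil-multiple 2 a n) (below b n)) (ℤₚ.+-identityʳ _))

-- Lowest terms and cancellation

opaque
  unfolding _+_

  coeff-*-suc′ : ∀ f g n → (f * g) (suc n) ≡ (f * tail g) n ℤ.+ f (suc n) ℤ.* g 0
  coeff-*-suc′ = ⊗-suc′

coeff-*-lowest : ∀ m n f g → (∀ k → k ℕ.< m → f k ≡ + 0) → (∀ k → k ℕ.< n → g k ≡ + 0) →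
  (f * g) (m ℕ.+ n) ≡ f m ℤ.* g n
coeff-*-lowest (suc m) n f g p q = trans (coeff-*-suc f g (m ℕ.+ n))
  (trans (cong₂ ℤ._+_ (cong (ℤ._* g (suc (m ℕ.+ n))) (p 0 (s≤s z≤n)))
    (coeff-*-lowest m n (tail f) g (λ k k<m → p (suc k) (s≤s k<m)) q)) (ℤₚ.+-identityˡ _))
coeff-*-lowest zero zero f g p q = coeff-*-zero f g
coeff-*-lowest zero (suc n) f g p q = trans (coeff-*-suc′ f g n)
  (trans (cong₂ ℤ._+_ (coeff-*-lowest zero n f (tail g) (λ _ ()) (λ k k<n → q (suc k) (s≤s k<n)))
    (trans (cong (f (suc n) ℤ.*_) (q 0 (s≤s z≤n))) (ℤₚ.*-zeroʳ (f (suc n))))) (ℤₚ.+-identityʳ _))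

-- This replaces being nonzero: it is closed under products and is exactly what cancelling requires,
-- with no search for a lowest nonzero coefficient.
Regular : Series → Set
Regular f = ∀ g → f * g ≈ 𝟘 → g ≈ 𝟘

below-suc : ∀ {P : ℕ → Set} {n} → (∀ k → k ℕ.< n → P k) → P n → ∀ k → k ℕ.< suc n → P k
below-suc {P} {n} below at-n k (s≤s k≤n) with ℕₚ.m≤n⇒m<n∨m≡n k≤n
... | inj₁ k<n  = below k k<n
... | inj₂ refl = at-n

strong-induction : (P : ℕ → Set) → (∀ n → (∀ k → k ℕ.< n → P k) → P n) → ∀ n → P n
strong-induction P step n = step n (go n)
  where
  go : ∀ n k → k ℕ.< n → P k
  go (suc n) = below-suc (go n) (step n (go n))

-- If g vanishes below degree n, the coefficient of fg at m + n is the single product of f at m and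
-- g at n; since ℤ has no zero divisors, g vanishes at n too.
regular-lead : ∀ m f → (∀ k → k ℕ.< m → f k ≡ + 0) → f m ≢ + 0 → Regular f
regular-lead m f p f≢0 g fg≈0 = coeffs λ n → trans (strong-induction (λ n → g n ≡ + 0) step n) (sym (coeff-𝟘 n))
  where
  step : ∀ n → (∀ k → k ℕ.< n → g k ≡ + 0) → g n ≡ + 0
  step n q with ℤₚ.i*j≡0⇒i≡0∨j≡0 (f m) (trans (sym (coeff-*-lowest m n f g p q))
                  (trans (at-degree fg≈0 (m ℕ.+ n)) (coeff-𝟘 _)))
  ... | inj₁ f≡0 = contradiction f≡0 f≢0
  ... | inj₂ g≡0 = g≡0

regular-unit : ∀ f → f 0 ≢ + 0 → Regular f
regular-unit f = regular-lead 0 f λ _ ()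

regular-* : ∀ {f g} → Regular f → Regular g → Regular (f * g)
regular-* {f} {g} rf rg h p = rg h (rf (g * h) (≈-trans (≈-sym (*-assoc f g h)) p))

regular-cong : ∀ {f g} → f ≈ g → Regular f → Regular g
regular-cong p rf h q = rf h (≈-trans (*-congʳ p) q)

regular-X^ : ∀ m → Regular (X^ m)
regular-X^ m g p = coeffs λ n → trans (sym (coeff-X^*-≥ m g n)) (trans (at-degree p (m ℕ.+ n))
  (trans (coeff-𝟘 _) (sym (coeff-𝟘 n))))

regular-const : ∀ c → c ≢ + 0 → Regular (const c)
regular-const c c≢0 = regular-unit (const c) (λ e → c≢0 (trans (sym (const-zero c)) e))

cancel : ∀ {f g h} → Regular f → f * g ≈ f * h → g ≈ h
cancel {f} {g} {h} rf p = -≈𝟘⇒≈ (rf (g - h) (≈-trans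
  (SR.solve (f ∷ g ∷ h ∷ []) (λ { (f ∷ g ∷ h ∷ []) → f :* (g :- h) , f :* g :- f :* h }) refl)
  (≈⇒-≈𝟘 p)))

infixr 8 _⊙_
-- One summand of a certificate. A target is rewritten by `solve` as a sum of cofactors times
-- differences l - r of known relations; the cofactors, written `_` in the terms joined by `_⊞_`,
-- are inferred from that sum.
_⊙_ : ∀ c {l r} → l ≈ r → c * (l - r) ≈ 𝟘
c ⊙ p = ≈-trans (*-congˡ (≈⇒-≈𝟘 p)) (zeroʳ c)

infixr 8 _⊙₀_
_⊙₀_ : ∀ c {l} → l ≈ 𝟘 → c * l ≈ 𝟘
c ⊙₀ q = ≈-trans (*-congˡ q) (zeroʳ c)

infixl 6 _⊞_
_⊞_ : ∀ {f g} → f ≈ 𝟘 → g ≈ 𝟘 → f + g ≈ 𝟘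
p ⊞ q = ≈-trans (+-cong p q) (+-identityˡ 𝟘)

-- Elimination in the polynomial relations

-- With S = A + A′x + B′x² + Bx³, the hypotheses kᵢ compare the coefficients of xⁱ in
-- (G + xH) S² = F (K + Mx² + Zx⁴ + Lx⁶) + T (Lx + Zx³ + Mx⁵ + Kx⁷).
module CoreRelations
  (F T G H p A A′ B′ B K L M Z : Series)
  (r1 : p * p ≈ F * T * (G * H))
  (k0 : K * F ≈ G * (A * A))
  (k1 : L * T ≈ H * (A * A) + const (+ 2) * G * (A * A′))
  (k2 : M * F ≈ G * (A′ * A′ + const (+ 2) * (A * B′)) + const (+ 2) * H * (A * A′))
  (k3 : Z * T ≈ const (+ 2) * G * (A * B + A′ * B′) + H * (A′ * A′ + const (+ 2) * (A * B′)))
  (k4 : Z * F ≈ G * (B′ * B′ + const (+ 2) * (A′ * B)) + const (+ 2) * H * (A * B + A′ * B′))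
  (k6 : L * F ≈ G * (B * B) + const (+ 2) * H * (B * B′))
  (k7 : K * T ≈ H * (B * B))
  (e8 : L * (G * H) ≈ K * (F * T))
  (regular-F : Regular F) (regular-T : Regular T) (regular-G : Regular G) (regular-H : Regular H)
  (regular-A : Regular A) (regular-B : Regular B) (regular-Ap+BFH : Regular (A * p + B * (F * H)))
  where

  -- The squares of the two sides agree: (Ap)² = A²FTGH by `r1`, and A²TG = KFT = B²FH by `k0` and
  -- `k7`. The factor Ap + BFH is cancelled, which settles the sign.
  A-B : A * p ≈ B * (F * H)
  A-B = -≈𝟘⇒≈ (regular-Ap+BFH _ (≈-trans (SR.solve (F ∷ T ∷ G ∷ H ∷ p ∷ A ∷ B ∷ K ∷ []) (λ { (F ∷ T ∷ G ∷ H ∷ p ∷ A ∷ B ∷ K ∷ []) →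
      (A :* p :+ B :* (F :* H)) :* (A :* p :- B :* (F :* H)) ,
      (A :* A) :* ((p :* p) :- (F :* T :* (G :* H))) :+ (con (+ 0) :- F :* T :* H) :* ((K :* F) :- (G :* (A :* A))) :+ (F :* F :* H) :* ((K :* T) :- (H :* (B :* B))) }) refl) (_ ⊙ r1 ⊞ _ ⊙ k0 ⊞ _ ⊙ k7)))

  B-A : A * (T * G) ≈ B * p
  B-A = cancel (regular-* regular-F regular-H) (-≈𝟘⇒≈ (≈-trans (SR.solve (F ∷ T ∷ G ∷ H ∷ p ∷ A ∷ B ∷ []) (λ { (F ∷ T ∷ G ∷ H ∷ p ∷ A ∷ B ∷ []) →
      F :* H :* (A :* (T :* G)) :- F :* H :* (B :* p) ,
      p :* ((A :* p) :- (B :* (F :* H))) :+ (con (+ 0) :- A) :* ((p :* p) :- (F :* T :* (G :* H))) }) refl) (_ ⊙ A-B ⊞ _ ⊙ r1)))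

  -- `e8` and `k0` express LGH through A, after which `k1` is linear in A′ once a factor A is
  -- cancelled. `B′-B` is the mirror image, with `k6` and `k7`.
  A′-A : const (+ 2) * (G * H) * A′ ≈ A * (T * T - H * H)
  A′-A = cancel (regular-* regular-G regular-A) (-≈𝟘⇒≈ (≈-trans (SR.solve (F ∷ T ∷ G ∷ H ∷ A ∷ A′ ∷ K ∷ L ∷ []) (λ { (F ∷ T ∷ G ∷ H ∷ A ∷ A′ ∷ K ∷ L ∷ []) →
      G :* A :* (2 · (G :* H) :* A′) :- G :* A :* (A :* (T :* T :- H :* H)) ,
      (con (+ 0) :- G :* H) :* ((L :* T) :- (H :* (A :* A) :+ 2 · G :* (A :* A′))) :+ T :* ((L :* (G :* H)) :- (K :* (F :* T))) :+ (T :* T) :* ((K :* F) :- (G :* (A :* A))) }) refl) (_ ⊙ k1 ⊞ _ ⊙ e8 ⊞ _ ⊙ k0)))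

  B′-B : const (+ 2) * (G * H) * B′ ≈ B * (F * F - G * G)
  B′-B = cancel (regular-* regular-H regular-B) (-≈𝟘⇒≈ (≈-trans (SR.solve (F ∷ T ∷ G ∷ H ∷ B′ ∷ B ∷ K ∷ L ∷ []) (λ { (F ∷ T ∷ G ∷ H ∷ B′ ∷ B ∷ K ∷ L ∷ []) →
      H :* B :* (2 · (G :* H) :* B′) :- H :* B :* (B :* (F :* F :- G :* G)) ,
      (con (+ 0) :- G :* H) :* ((L :* F) :- (G :* (B :* B) :+ 2 · H :* (B :* B′))) :+ F :* ((L :* (G :* H)) :- (K :* (F :* T))) :+ (F :* F) :* ((K :* T) :- (H :* (B :* B))) }) refl) (_ ⊙ k6 ⊞ _ ⊙ e8 ⊞ _ ⊙ k7)))

  -- `k3` and `k4` both determine Z. Equating the two values and replacing A′, B′ and the ratio of A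
  -- to B leaves AB times a polynomial in F, T, G, H and p.
  central : const (+ 2) * p * (F * G - T * H) * (const (+ 4) * (G * H * (G * H)) + (T * T - H * H) * (F * F - G * G)) + F * H * (F * H) * ((T * T - H * H) * (T * T - H * H)) - T * G * (T * G) * ((F * F - G * G) * (F * F - G * G)) + const (+ 4) * p * (G * H) * (F * H * (F * F - G * G) - T * G * (T * T - H * H)) ≈ 𝟘
  central = regular-* regular-A regular-B _ (≈-trans (SR.solve (F ∷ T ∷ G ∷ H ∷ p ∷ A ∷ A′ ∷ B′ ∷ B ∷ Z ∷ []) (λ { (F ∷ T ∷ G ∷ H ∷ p ∷ A ∷ A′ ∷ B′ ∷ B ∷ Z ∷ []) →
      A :* B :* (2 · p :* (F :* G :- T :* H) :* (4 · (G :* H :* (G :* H)) :+ (T :* T :- H :* H) :* (F :* F :- G :* G)) :+ F :* H :* (F :* H) :* ((T :* T :- H :* H) :* (T :* T :- H :* H)) :- T :* G :* (T :* G) :* ((F :* F :- G :* G) :* (F :* F :- G :* G)) :+ 4 · p :* (G :* H) :* (F :* H :* (F :* F :- G :* G) :- T :* G :* (T :* T :- H :* H))) ,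
      (con (+ 0) :- 4 · F :* G :^ 2 :* H :^ 2 :* p) :* ((Z :* T) :- (2 · G :* (A :* B :+ A′ :* B′) :+ H :* (A′ :* A′ :+ 2 · (A :* B′)))) :+ (4 · T :* G :^ 2 :* H :^ 2 :* p) :* ((Z :* F) :- (G :* (B′ :* B′ :+ 2 · (A′ :* B)) :+ 2 · H :* (A :* B :+ A′ :* B′))) :+ (H :* p :* (F :* (A :* (H :^ 2 :- T :^ 2) :- 2 · G :* (2 · G :* B′ :+ H :* A′)) :+ 4 · T :* G :* (H :* B′ :+ G :* B))) :* ((2 · (G :* H) :* A′) :- (A :* (T :* T :- H :* H))) :+ (p :* (T :* (G :* (F :* (F :* B :- 2 · T :* A) :+ G :* (2 · H :* B′ :- G :* B)) :+ 2 · H :* A :* (T :^ 2 :- H :^ 2)) :- 2 · F :* G :* H :^ 2 :* A)) :* ((2 · (G :* H) :* B′) :- (B :* (F :* F :- G :* G))) :+ (F :* H :* A :* (T :^ 2 :* (2 · H :^ 2 :- T :^ 2) :- H :^ 4)) :* ((A :* p) :- (B :* (F :* H))) :+ (T :* G :* B :* (F :^ 2 :* (2 · G :^ 2 :- F :^ 2) :- G :^ 4)) :* ((A :* (T :* G)) :- (B :* p)) }) refl) (_ ⊙ k3 ⊞ _ ⊙ k4 ⊞ _ ⊙ A′-A ⊞ _ ⊙ B′-B ⊞ _ ⊙ A-B ⊞ _ ⊙ B-A))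

module CurveRelations
  (x y p o X Y U V : Series)
  (hxy : p * p ≈ x * y)
  (hXY : X * Y ≈ p * p * (p * p))
  (hUV : U * V ≈ p * p * (p * p))
  (hS : X + Y ≈ const (+ 2) * o * (x + y - p))
  (ho : o * o ≈ p * (const (+ 2) * (x + y) - const (+ 3) * p))
  (hM : const (+ 2) * p * (x - y) * (const (+ 5) * (U * V) + V * (V - X - Y)) + V * V * (y * y) - const (+ 2) * (y * y) * (X * V) + X * X * (y * y) - V * V * (x * x) + const (+ 2) * (x * x) * (Y * V) - Y * Y * (x * x) + const (+ 4) * p * (V * (x * X) - U * V * x - V * (y * Y) + U * V * y) ≈ 𝟘)
  (regular-f₂ : Regular (const (+ 8) * (x + y) * o * (x + y - p) * (x - y) - const (+ 2) * (x + y - const (+ 2) * p) * (const (+ 2) * (x - y) * V - (X - Y) * (x + y + const (+ 2) * p) + const (+ 2) * (x - y) * o * (x + y + p)) - const (+ 4) * (X - Y) * ((x + y) * (x + y) - const (+ 2) * p * (x + y) - const (+ 2) * (p * p))))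
  (regular-e : Regular (x - y)) (regular-V : Regular V) (regular-σ+2p : Regular (x + y + const (+ 2) * p))
  (regular-x+p : Regular (x + p)) (regular-y+p : Regular (y + p))
  where

  -- X and Y are the roots of a quadratic whose sum and product are known; the certificates below
  -- lower powers of X with it.
  X² : X * X ≈ X * (const (+ 2) * o * (x + y - p)) - p * p * (p * p)
  X² = -≈𝟘⇒≈ (≈-trans (SR.solve (x ∷ y ∷ p ∷ o ∷ X ∷ Y ∷ []) (λ { (x ∷ y ∷ p ∷ o ∷ X ∷ Y ∷ []) →
        X :* X :- (X :* (2 · o :* (x :+ y :- p)) :- p :* p :* (p :* p)) ,
        X :* ((X :+ Y) :- (2 · o :* (x :+ y :- p))) :+ (con (+ 0) :- con (+ 1)) :* ((X :* Y) :- (p :* p :* (p :* p))) }) refl) (_ ⊙ hS ⊞ _ ⊙ hXY))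

  -- Modulo the other relations, 8(x - y) times the left side of `hM` factors into two polynomials
  -- that are linear in V and X - Y; the other one is cancelled by `regular-f₂`.
  Ω : const (+ 2) * (x - y) * V + (x + y + const (+ 2) * p) * (X - Y) - const (+ 2) * (x - y) * o * (x + y + p) ≈ 𝟘
  Ω = regular-f₂ _ (≈-trans (SR.solve (x ∷ y ∷ p ∷ o ∷ X ∷ Y ∷ U ∷ V ∷ []) (λ { (x ∷ y ∷ p ∷ o ∷ X ∷ Y ∷ U ∷ V ∷ []) →
        (8 · (x :+ y) :* o :* (x :+ y :- p) :* (x :- y) :- 2 · (x :+ y :- 2 · p) :* (2 · (x :- y) :* V :- (X :- Y) :* (x :+ y :+ 2 · p) :+ 2 · (x :- y) :* o :* (x :+ y :+ p)) :- 4 · (X :- Y) :* ((x :+ y) :* (x :+ y) :- 2 · p :* (x :+ y) :- 2 · (p :* p))) :* (2 · (x :- y) :* V :+ (x :+ y :+ 2 · p) :* (X :- Y) :- 2 · (x :- y) :* o :* (x :+ y :+ p)) ,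
        (2 · x :* (x :* (x :* (2 · o :* (x :+ p :- 8 · y) :+ 3 · Y :- X :- 4 · V) :+ y :* (10 · o :* (3 · p :- 2 · y) :+ 13 · X :+ 12 · V :- 7 · Y) :+ 2 · p :* (10 · p :* o :+ Y :- 3 · X)) :+ 2 · p :* (4 · p :* (3 · o :* (y :- p) :+ Y :- 3 · X :- V) :+ y :* (7 · y :* o :+ 2 · Y :- 6 · X)) :+ y :^ 2 :* (9 · X :- 3 · Y :- 4 · V)) :+ 2 · y :* (y :* (y :* (2 · o :* (y :+ p) :+ 3 · X :- Y :- 4 · V) :+ 2 · p :* (2 · p :* o :+ Y :- 3 · X)) :+ 8 · p :^ 2 :* (Y :+ V :- p :* o :- 3 · X))) :* ((X :+ Y) :- (2 · o :* (x :+ y :- p))) :+ (16 · x :* (2 · y :* (p :- x :- y) :+ p :* (x :+ 4 · p)) :+ 16 · y :* p :* (y :+ 4 · p)) :* ((X :* X) :- (X :* (2 · o :* (x :+ y :- p)) :- p :* p :* (p :* p))) :+ (48 · p :* (x :* (2 · y :- x) :- y :^ 2)) :* ((U :* V) :- (p :* p :* (p :* p))) :+ (32 · x :* (2 · y :* (x :* (x :* (3 · p :- x :- 2 · y) :+ y :* (4 · p :- y) :+ p :^ 2) :+ p :* (y :* (y :+ p) :- 3 · p :^ 2)) :+ p :^ 2 :* (2 · x :* (x :- 3 · p) :+ 3 · p :^ 2)) :+ 32 · y :* p :^ 3 :* (p :- 2 · y)) :* ((o :* o) :- (p :* (2 · (x :+ y) :- 3 · p))) :+ (32 · p :* (x :*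 (2 · x :* (x :* (2 · x :+ 6 · y :- 9 · p) :+ 2 · y :* (3 · y :- 10 · p) :+ 11 · p :^ 2) :+ 2 · y :* (y :* (2 · y :- 13 · p) :+ 14 · p :^ 2) :+ o :* (X :+ V) :- 11 · p :^ 3) :+ y :* (p :* (2 · y :* (3 · p :- 2 · y) :- 5 · p :^ 2) :- o :* (X :+ V))) :+ 32 · o :* (y :^ 2 :* (X :+ V) :- x :^ 2 :* (X :+ V)) :+ 32 · X :* V :* (x :- y)) :* ((p :* p) :- (x :* y)) :+ (8 · x :- 8 · y) :* (2 · p :* (x :- y) :* (5 · (U :* V) :+ V :* (V :- X :- Y)) :+ V :* V :* (y :* y) :- 2 · (y :* y) :* (X :* V) :+ X :* X :* (y :* y) :- V :* V :* (x :* x) :+ 2 · (x :* x) :* (Y :* V) :- Y :* Y :* (x :* x) :+ 4 · p :* (V :* (x :* X) :- U :* V :* x :- V :* (y :* Y) :+ U :* V :* y)) }) refl) (_ ⊙ hS ⊞ _ ⊙ X² ⊞ _ ⊙ hUV ⊞ _ ⊙ ho ⊞ _ ⊙ hxy ⊞ _ ⊙₀ hM))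

  -- `Ω` times its conjugate under the exchange of X and Y contains X - Y only squared, that is
  -- through X + Y and XY; V factors out of what remains because UV = p⁴. With the theta series
  -- inserted this evaluates ψ(q)⁴ - 7q³ψ(q⁷)⁴ at q = t⁴, up to the factor 4t².
  V-U : V - const (+ 7) * U ≈ const (+ 2) * o * (x + y + p)
  V-U = -≈𝟘⇒≈ (regular-* (regular-* (regular-* (regular-const (+ 4) λ ()) regular-e) regular-e) regular-V _ (≈-trans (SR.solve (x ∷ y ∷ p ∷ o ∷ X ∷ Y ∷ U ∷ V ∷ []) (λ { (x ∷ y ∷ p ∷ o ∷ X ∷ Y ∷ U ∷ V ∷ []) →
        4 · (x :- y) :* (x :- y) :* V :* (V :- 7 · U :- 2 · o :* (x :+ y :+ p)) ,
        (x :* (x :* (2 · o :* (x :+ 3 · y :+ 3 · p) :+ Y :- 3 · X) :+ 2 · y :* (3 · o :* (y :+ 2 · p) :+ Y :- 3 · X) :+ 4 · p :* (Y :- 3 · X)) :+ y :* (y :* (2 · o :* (y :+ 3 · p) :+ Y :- 3 · X) :+ 4 · p :* (Y :- 3 · X)) :+ 4 · p :^ 2 :* (Y :- 2 · p :* o :- 3 · X)) :* ((X :+ Y) :- (2 · o :* (x :+ y :- p))) :+ (4 · x :* (x :+ 2 · y :+ 4 · p) :+ 4 · y :* (y :+ 4 · p) :+ 16 · p :^ 2) :* ((X :* X) :- (X :* (2 · o :* (x :+ y :- p)) :- p :* p :* (p :* p))) :+ (28 · x :* (2 · y :- x) :- 28 · y :^ 2) :* ((U :* V) :- (p :* p :*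 (p :* p))) :+ (16 · x :* (y :* (x :* (x :+ 2 · y :+ 2 · p) :+ y :* (y :+ 2 · p) :- p :^ 2) :- p :^ 2 :* (x :+ p)) :+ 16 · p :^ 2 :* (p :^ 2 :- y :* (y :+ p))) :* ((o :* o) :- (p :* (2 · (x :+ y) :- 3 · p))) :+ (16 · p :* (x :* (4 · p :^ 2 :- x :* (2 · x :+ 6 · y :+ p) :- 2 · y :* (3 · y :+ p)) :+ y :* (4 · p :^ 2 :- y :* (2 · y :+ p)) :- 4 · p :^ 3)) :* ((p :* p) :- (x :* y)) :+ (2 · (x :- y) :* V :- 2 · (x :- y) :* o :* (x :+ y :+ p) :- (x :+ y :+ 2 · p) :* (X :- Y)) :* (2 · (x :- y) :* V :+ (x :+ y :+ 2 · p) :* (X :- Y) :- 2 · (x :- y) :* o :* (x :+ y :+ p)) }) refl) (_ ⊙ hS ⊞ _ ⊙ X² ⊞ _ ⊙ hUV ⊞ _ ⊙ ho ⊞ _ ⊙ hxy ⊞ _ ⊙₀ Ω)))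

  U² : const (+ 7) * (U * U) ≈ p * p * (p * p) - const (+ 2) * o * (x + y + p) * U
  U² = -≈𝟘⇒≈ (≈-trans (SR.solve (x ∷ y ∷ p ∷ o ∷ U ∷ V ∷ []) (λ { (x ∷ y ∷ p ∷ o ∷ U ∷ V ∷ []) →
        7 · (U :* U) :- (p :* p :* (p :* p) :- 2 · o :* (x :+ y :+ p) :* U) ,
        1 · ((U :* V) :- (p :* p :* (p :* p))) :+ (con (+ 0) :- U) :* ((V :- 7 · U) :- (2 · o :* (x :+ y :+ p))) }) refl) (_ ⊙ hUV ⊞ _ ⊙ V-U))

  D-e : (x + y + const (+ 2) * p) * (X - Y) ≈ (y - x) * (const (+ 7) * U + V)
  D-e = -≈𝟘⇒≈ (≈-trans (SR.solve (x ∷ y ∷ p ∷ o ∷ X ∷ Y ∷ U ∷ V ∷ []) (λ { (x ∷ y ∷ p ∷ o ∷ X ∷ Y ∷ U ∷ V ∷ []) →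
        (x :+ y :+ 2 · p) :* (X :- Y) :- (y :- x) :* (7 · U :+ V) ,
        1 · (2 · (x :- y) :* V :+ (x :+ y :+ 2 · p) :* (X :- Y) :- 2 · (x :- y) :* o :* (x :+ y :+ p)) :+ (y :- x) :* ((V :- 7 · U) :- (2 · o :* (x :+ y :+ p))) }) refl) (_ ⊙₀ Ω ⊞ _ ⊙ V-U))

  -- `hS` and `D-e` give X + Y and X - Y, the latter with denominator x + y + 2p. As xy = p² implies
  -- (x + p)(y + p) = p(x + y + 2p), X itself needs only the denominator x + p.
  xX : (x + p) * X ≈ const (+ 7) * (p - x) * U + const (+ 2) * p * o * y
  xX = -≈𝟘⇒≈ (regular-* (regular-const (+ 2) λ ()) regular-σ+2p _ (≈-trans (SR.solve (x ∷ y ∷ p ∷ o ∷ X ∷ Y ∷ U ∷ V ∷ []) (λ { (x ∷ y ∷ p ∷ o ∷ X ∷ Y ∷ U ∷ V ∷ []) →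
        2 · (x :+ y :+ 2 · p) :* ((x :+ p) :* X :- (7 · (p :- x) :* U :+ 2 · p :* o :* y)) ,
        (x :+ p) :* (((x :+ y :+ 2 · p) :* (X :- Y)) :- ((y :- x) :* (7 · U :+ V))) :+ ((x :+ p) :* (x :+ y :+ 2 · p)) :* ((X :+ Y) :- (2 · o :* (x :+ y :- p))) :+ (x :* (y :- x :- p) :+ y :* p) :* ((V :- 7 · U) :- (2 · o :* (x :+ y :+ p))) :+ (con (+ 0) :- 4 · o :* (x :+ y :+ p) :- 28 · U) :* ((p :* p) :- (x :* y)) }) refl) (_ ⊙ D-e ⊞ _ ⊙ hS ⊞ _ ⊙ V-U ⊞ _ ⊙ hxy)))

  yY : (y + p) * Y ≈ const (+ 7) * (p - y) * U + const (+ 2) * p * o * x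
  yY = -≈𝟘⇒≈ (regular-* (regular-const (+ 2) λ ()) regular-σ+2p _ (≈-trans (SR.solve (x ∷ y ∷ p ∷ o ∷ X ∷ Y ∷ U ∷ V ∷ []) (λ { (x ∷ y ∷ p ∷ o ∷ X ∷ Y ∷ U ∷ V ∷ []) →
        2 · (x :+ y :+ 2 · p) :* ((y :+ p) :* Y :- (7 · (p :- y) :* U :+ 2 · p :* o :* x)) ,
        (con (+ 0) :- y :- p) :* (((x :+ y :+ 2 · p) :* (X :- Y)) :- ((y :- x) :* (7 · U :+ V))) :+ ((y :+ p) :* (x :+ y :+ 2 · p)) :* ((X :+ Y) :- (2 · o :* (x :+ y :- p))) :+ (y :* (x :- y :- p) :+ x :* p) :* ((V :- 7 · U) :- (2 · o :* (x :+ y :+ p))) :+ (con (+ 0) :- 4 · o :* (x :+ y :+ p) :- 28 · U) :* ((p :* p) :- (x :* y)) }) refl) (_ ⊙ D-e ⊞ _ ⊙ hS ⊞ _ ⊙ V-U ⊞ _ ⊙ hxy)))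

  -- From here to `Z₀`: the identities behind `λ₁-λ₀`, `λ₂-λ₃`, `λ₀-λ₃`, `J-form`, `λ₀λ₃`,
  -- `M-bracket` and `Z-bracket`, multiplied by monomials in F, T, G, H so that they can be written
  -- in x, y, X, Y, U, V, p, o. The factors x + p and y + p are supplied so that `xX` and `yY` can
  -- remove X and Y, while `V-U` removes V.
  E₁ : x * (const (+ 7) * U + V + X - Y + const (+ 4) * y * o) - const (+ 2) * p * (V - X) ≈ 𝟘
  E₁ = (regular-* regular-x+p regular-y+p) _ (≈-trans (SR.solve (x ∷ y ∷ p ∷ o ∷ X ∷ Y ∷ U ∷ V ∷ []) (λ { (x ∷ y ∷ p ∷ o ∷ X ∷ Y ∷ U ∷ V ∷ []) →
        (x :+ p) :* (y :+ p) :* (x :* (7 · U :+ V :+ X :- Y :+ 4 · y :* o) :- 2 · p :* (V :- X)) ,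
        (p :* (x :* (x :- y :- p) :- 2 · p :* (y :+ p)) :+ x :^ 2 :* y) :* ((V :- 7 · U) :- (2 · o :* (x :+ y :+ p))) :+ (p :* (x :+ 2 · y :+ 2 · p) :+ x :* y) :* (((x :+ p) :* X) :- (7 · (p :- x) :* U :+ 2 · p :* o :* y)) :+ (con (+ 0) :- x :* (x :+ p)) :* (((y :+ p) :* Y) :- (7 · (p :- y) :* U :+ 2 · p :* o :* x)) :+ (con (+ 0) :- 2 · o :* (x :* (x :+ 3 · y :+ 3 · p) :+ 2 · p :* (y :+ p)) :- 14 · x :* U) :* ((p :* p) :- (x :* y)) }) refl) (_ ⊙ V-U ⊞ _ ⊙ xX ⊞ _ ⊙ yY ⊞ _ ⊙ hxy))

  E₂ : y * (const (+ 7) * U + V + Y - X + const (+ 4) * x * o) - const (+ 2) * p * (V - Y) ≈ 𝟘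
  E₂ = (regular-* regular-x+p regular-y+p) _ (≈-trans (SR.solve (x ∷ y ∷ p ∷ o ∷ X ∷ Y ∷ U ∷ V ∷ []) (λ { (x ∷ y ∷ p ∷ o ∷ X ∷ Y ∷ U ∷ V ∷ []) →
        (x :+ p) :* (y :+ p) :* (y :* (7 · U :+ V :+ Y :- X :+ 4 · x :* o) :- 2 · p :* (V :- Y)) ,
        (p :* (y :* (y :- x :- p) :- 2 · p :* (x :+ p)) :+ x :* y :^ 2) :* ((V :- 7 · U) :- (2 · o :* (x :+ y :+ p))) :+ (con (+ 0) :- y :* (y :+ p)) :* (((x :+ p) :* X) :- (7 · (p :- x) :* U :+ 2 · p :* o :* y)) :+ (p :* (2 · x :+ y :+ 2 · p) :+ x :* y) :* (((y :+ p) :* Y) :- (7 · (p :- y) :* U :+ 2 · p :* o :* x)) :+ (con (+ 0) :- 2 · o :* (y :* (3 · x :+ y :+ 3 · p) :+ 2 · p :* (x :+ p)) :- 14 · y :* U) :* ((p :* p) :- (x :* y)) }) refl) (_ ⊙ V-U ⊞ _ ⊙ xX ⊞ _ ⊙ yY ⊞ _ ⊙ hxy))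

  E₃ : x * (p * x * Y - y * y * X + V * (y * y - p * x - const (+ 2) * p * y + const (+ 2) * (p * p))) ≈ 𝟘
  E₃ = (regular-* regular-x+p regular-y+p) _ (≈-trans (SR.solve (x ∷ y ∷ p ∷ o ∷ X ∷ Y ∷ U ∷ V ∷ []) (λ { (x ∷ y ∷ p ∷ o ∷ X ∷ Y ∷ U ∷ V ∷ []) →
        (x :+ p) :* (y :+ p) :* (x :* (p :* x :* Y :- y :* y :* X :+ V :* (y :* y :- p :* x :- 2 · p :* y :+ 2 · (p :* p)))) ,
        (x :* (p :* (x :* (p :* (p :- x) :- y :* (x :+ y :+ p)) :+ y :^ 2 :* (y :- p) :+ 2 · p :^ 3) :+ x :* y :^ 3)) :* ((V :- 7 · U) :- (2 · o :* (x :+ y :+ p))) :+ (con (+ 0) :- x :* y :^ 2 :* (y :+ p)) :* (((x :+ p) :* X) :- (7 · (p :- x) :* U :+ 2 · p :* o :* y)) :+ (x :^ 2 :* p :* (x :+ p)) :* (((y :+ p) :* Y) :- (7 · (p :- y) :* U :+ 2 · p :* o :* x)) :+ (2 · x :* (p :* (o :* (x :* (x :+ 2 · y :+ 3 · p) :+ y :* (2 · p :- y) :+ 2 · p :^ 2) :+ 7 · U :* (x :+ p)) :- y :^ 2 :* (o :* (x :+ y) :+ 7 · U))) :* ((p :* p) :- (x :* y)) }) refl) (_ ⊙ V-U ⊞ _ ⊙ xX ⊞ _ ⊙ yY ⊞ _ ⊙ hxy))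

  J : x * x * y * Y + x * (y * y) * X - V * (const (+ 2) * o * U + p * p * (x + y) - const (+ 2) * (p * p * p)) ≈ 𝟘
  J = (regular-* regular-x+p regular-y+p) _ (≈-trans (SR.solve (x ∷ y ∷ p ∷ o ∷ X ∷ Y ∷ U ∷ V ∷ []) (λ { (x ∷ y ∷ p ∷ o ∷ X ∷ Y ∷ U ∷ V ∷ []) →
        (x :+ p) :* (y :+ p) :* (x :* x :* y :* Y :+ x :* (y :* y) :* X :- V :* (2 · o :* U :+ p :* p :* (x :+ y) :- 2 · (p :* p :* p))) ,
        (p :* (p :* (p :* (p :* (x :+ y :+ 2 · p) :- x :^ 2 :- y :^ 2) :- x :* y :* (x :+ y) :- 2 · o :* U) :- 2 · o :* U :* (x :+ y)) :- 2 · x :* y :* o :* U) :* ((V :- 7 · U) :- (2 · o :* (x :+ y :+ p))) :+ (x :* y :^ 2 :* (y :+ p)) :* (((x :+ p) :* X) :- (7 · (p :- x) :* U :+ 2 · p :* o :* y)) :+ (x :^ 2 :* y :* (x :+ p)) :* (((y :+ p) :* Y) :- (7 · (p :- y) :* U :+ 2 · p :* o :* x)) :+ (4 · U :* (x :* (y :* (x :+ y :+ p) :- p :^ 2) :- p :^ 2 :* (y :+ p))) :* ((o :* o) :- (p :* (2 · (x :+ y) :- 3 · p))) :+ (p :* (p :* (2 · p :* (2 · o :* (x :+ y :+ p) :+ 13 · U) :+ x :* (4 · y :* o :+ 11 · U) :+ 11 · y :* U) :- x :* (x :* (2 · x :* o :+ 15 · U) :+ 2 · y :* U) :- y :^ 2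 :* (2 · y :* o :+ 15 · U)) :+ 7 · U :* (x :* y :* (x :+ y) :- 2 · o :* U)) :* ((p :* p) :- (x :* y)) :+ (con (+ 0) :- 2 · o :* (x :* (2 · y :+ p) :+ y :* p)) :* ((7 · (U :* U)) :- (p :* p :* (p :* p) :- 2 · o :* (x :+ y :+ p) :* U)) }) refl) (_ ⊙ V-U ⊞ _ ⊙ xX ⊞ _ ⊙ yY ⊞ _ ⊙ ho ⊞ _ ⊙ hxy ⊞ _ ⊙ U²))

  -- `U²` provides only 7U², hence the additional factor 7 in what is cancelled.
  J′ : U * V * (U - X - Y + V) + const (+ 2) * p * (x * x * y * Y + x * (y * y) * X - x * y * (x + y) * V) + const (+ 4) * (p * p) * (x * y) * V - const (+ 8) * (U * V) * (p * o + U) ≈ 𝟘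
  J′ = (regular-* (regular-* regular-x+p regular-y+p) (regular-const (+ 7) λ ())) _ (≈-trans (SR.solve (x ∷ y ∷ p ∷ o ∷ X ∷ Y ∷ U ∷ V ∷ []) (λ { (x ∷ y ∷ p ∷ o ∷ X ∷ Y ∷ U ∷ V ∷ []) →
        (x :+ p) :* (y :+ p) :* con (+ 7) :* (U :* V :* (U :- X :- Y :+ V) :+ 2 · p :* (x :* x :* y :* Y :+ x :* (y :* y) :* X :- x :* y :* (x :+ y) :* V) :+ 4 · (p :* p) :* (x :* y) :* V :- 8 · (U :* V) :* (p :* o :+ U)) ,
        (7 · p :* (U :* (x :* (2 · o :* (x :- y :- 2 · p) :+ V :- X :- Y) :+ y :* (2 · o :* (y :- 2 · p) :+ V :- X :- Y) :+ p :* (V :- 6 · p :* o :- X :- Y)) :+ 2 · x :* y :* (p :* (p :* (x :+ y :+ 2 · p) :- x :^ 2 :- y :^ 2) :- x :* y :* (x :+ y))) :+ 7 · x :* y :* U :* (2 · o :* (x :+ y) :+ V :- X :- Y)) :* ((V :- 7 · U) :- (2 · o :* (x :+ y :+ p))) :+ (14 · x :* y :^ 2 :* p :* (y :+ p) :- 7 · U :* (2 · o :* (y :* (x :+ y :+ 2 · p) :+ p :* (x :+ p)) :+ 7 · U :* (y :+ p))) :* (((x :+ p) :* X) :- (7 · (p :- x) :* U :+ 2 · p :* o :* y)) :+ (14 · x :^ 2 :* y :* p :* (x :+ p) :- 7 · U :* (2 · o :* (x :* (x :+ y :+ 2 · p) :+ p :* (y :+ p)) :+ 7 · U :* (x :+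 p))) :* (((y :+ p) :* Y) :- (7 · (p :- y) :* U :+ 2 · p :* o :* x)) :+ (84 · U :* (x :* (y :* (x :* (x :+ 2 · y :+ 2 · p) :+ y :* (y :+ 2 · p) :- p :^ 2) :- p :^ 2 :* (x :+ 2 · p)) :- p :^ 2 :* (y :* (y :+ 2 · p) :+ p :^ 2))) :* ((o :* o) :- (p :* (2 · (x :+ y) :- 3 · p))) :+ (14 · p :* (2 · x :* (y :* (o :* (x :* (x :+ 2 · y :+ 2 · p) :+ y :* (y :+ 2 · p)) :+ U :* (p :- 11 · x :- 11 · y)) :+ 3 · U :* (4 · p :^ 2 :- x :* (2 · x :+ p))) :+ U :* (6 · y :* (4 · p :^ 2 :- y :* (2 · y :+ p)) :+ 18 · p :^ 3 :- 35 · o :* U)) :- 98 · U :^ 2 :* (5 · o :* (x :+ y) :+ 7 · U)) :* ((p :* p) :- (x :* y)) :+ (con (+ 0) :- 28 · x :* y :* o :* (x :+ y :+ 2 · p)) :* ((7 · (U :* U)) :- (p :* p :* (p :* p) :- 2 · o :* (x :+ y :+ p) :* U)) }) refl) (_ ⊙ V-U ⊞ _ ⊙ xX ⊞ _ ⊙ yY ⊞ _ ⊙ ho ⊞ _ ⊙ hxy ⊞ _ ⊙ U²))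

  Z₁ : x * (y * y * (V * Y + const (+ 2) * (x * x * (y * y)) - const (+ 3) * (X * U)) + const (+ 4) * p * (x * x * x * (y * y) - x * (Y * U)) - const (+ 4) * p * (x * x * (y * y)) * (const (+ 2) * (x + y) - p)) ≈ 𝟘
  Z₁ = (regular-* regular-x+p regular-y+p) _ (≈-trans (SR.solve (x ∷ y ∷ p ∷ o ∷ X ∷ Y ∷ U ∷ V ∷ []) (λ { (x ∷ y ∷ p ∷ o ∷ X ∷ Y ∷ U ∷ V ∷ []) →
        (x :+ p) :* (y :+ p) :* (x :* (y :* y :* (V :* Y :+ 2 · (x :* x :* (y :* y)) :- 3 · (X :* U)) :+ 4 · p :* (x :* x :* x :* (y :* y) :- x :* (Y :* U)) :- 4 · p :* (x :* x :* (y :* y)) :* (2 · (x :+ y) :- p))) ,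
        (x :* y :^ 2 :* Y :* (p :* (x :+ y :+ p) :+ x :* y)) :* ((V :- 7 · U) :- (2 · o :* (x :+ y :+ p))) :+ (con (+ 0) :- 3 · x :* y :^ 2 :* U :* (y :+ p)) :* (((x :+ p) :* X) :- (7 · (p :- x) :* U :+ 2 · p :* o :* y)) :+ (x :* (y :^ 2 :* (2 · o :* (x :* (x :+ y :+ 2 · p) :+ p :* (y :+ p)) :+ 7 · U :* (x :+ p)) :- 4 · x :* p :* U :* (x :+ p))) :* (((y :+ p) :* Y) :- (7 · (p :- y) :* U :+ 2 · p :* o :* x)) :+ (4 · x :^ 2 :* y :^ 2 :* p :* (x :* (x :+ y :+ 2 · p) :+ p :* (y :+ p))) :* ((o :* o) :- (p :* (2 · (x :+ y) :- 3 · p))) :+ (2 · x :* (x :* (y :* (y :* (p :* (x :* (2 · x :+ 3 · y :- 4 · p) :- y :* (y :+ 2 · p) :- p :^ 2) :+ 11 · o :* U :- x :* y :^ 2) :+ 14 · U :^ 2 :- 2 · x :^ 2 :* p :^ 2) :- 2 · U :* (x :* (2 · o :* (x :+ p) :+ 7 · U) :+ 7 · p :* U)) :+ y :^ 2 :* (7 · U :* (o :* (y :+ p) :+ 2 · U) :- 5 · y :* p :^ 3))) :* ((p :* p) :- (x :* y)) :+ (2 · x :* y :* (x :* (2 · x :* (y :- x) :+ 5 · y :* p) :- 5 · y :^ 2 :* p)) :* ((7 · (U :* U)) :- (p :* p :* (p :* p) :- 2 · o :* (x :+ y :+ p) :* U)) }) refl) (_ ⊙ V-U ⊞ _ ⊙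 xX ⊞ _ ⊙ yY ⊞ _ ⊙ ho ⊞ _ ⊙ hxy ⊞ _ ⊙ U²))

  Z₀ : const (+ 4) * p * (x * x * x) * y * (const (+ 4) * p * ((x + y - p) * (x + y - p)) + const (+ 4) * o * U + (p * o + U) * o) - (p * o + U) * (const (+ 2) * p * (x * x * x) * (const (+ 3) * U + V + X - Y) + x * x * (y * y) * V - const (+ 2) * (x * x * (y * y)) * X + X * X * U) ≈ 𝟘
  Z₀ = (regular-* (regular-* (regular-* regular-x+p regular-x+p) regular-y+p) (regular-const (+ 7) λ ())) _ (≈-trans (SR.solve (x ∷ y ∷ p ∷ o ∷ X ∷ Y ∷ U ∷ V ∷ []) (λ { (x ∷ y ∷ p ∷ o ∷ X ∷ Y ∷ U ∷ V ∷ []) →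
        (x :+ p) :* (x :+ p) :* (y :+ p) :* con (+ 7) :* (4 · p :* (x :* x :* x) :* y :* (4 · p :* ((x :+ y :- p) :* (x :+ y :- p)) :+ 4 · o :* U :+ (p :* o :+ U) :* o) :- (p :* o :+ U) :* (2 · p :* (x :* x :* x) :* (3 · U :+ V :+ X :- Y) :+ x :* x :* (y :* y) :* V :- 2 · (x :* x :* (y :* y)) :* X :+ X :* X :* U)) ,
        (con (+ 0) :- 7 · x :^ 2 :* (p :* (x :* (p :* (y :* (o :* (x :* (2 · x :+ y :+ 4 · p) :+ 2 · y :* (y :+ p) :+ 2 · p :^ 2) :+ 2 · U :* (2 · x :+ y :+ p)) :+ 2 · p :* (x :* (o :* (x :+ 2 · p) :+ 2 · U) :+ p :* (p :* o :+ U)) :+ 2 · x :^ 2 :* U) :+ y :* (x :* (y :* (y :* o :+ U) :+ 2 · x :* U) :+ 2 · y :^ 2 :* U)) :+ y :^ 2 :* p :* (p :* (o :* (y :+ p) :+ U) :+ y :* U)) :+ x :^ 2 :* y :^ 3 :* U)) :* ((V :- 7 · U) :- (2 · o :* (x :+ y :+ p))) :+ (7 · p :* (U :* (y :* (x :* (2 · x :* (x :* (y :- x :- p) :+ y :* (y :+ p)) :+ o :* (7 · U :- X)) :- o :* (p :* (2 · o :* (y :+ p) :+ X :+ 9 · U) :+ 2 · y :* U) :- U :* (X :+ 7 · U)) :+ p :* (x :* (o :* (7 · U :- X) :- 2 · x :^ 2 :* (x :+ p)) :- U :* (7 · p :* o :+ X :+ 7 · U) :- p :* o :* X) :+ x :*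 U :* (7 · U :- X)) :+ 2 · x :^ 2 :* o :* (p :* (x :* (y :* (y :- x :- p) :- p :* (x :+ p)) :+ y :^ 2 :* (y :+ p)) :+ x :* y :^ 3)) :+ 7 · x :* y :* U :* (U :* (7 · U :- X) :+ 2 · x :^ 2 :* y :^ 2)) :* (((x :+ p) :* X) :- (7 · (p :- x) :* U :+ 2 · p :* o :* y)) :+ (14 · x :^ 3 :* p :* (p :* (x :* (o :* (x :+ 2 · p) :+ 2 · U) :+ p :* (p :* o :+ U)) :+ x :^ 2 :* U)) :* (((y :+ p) :* Y) :- (7 · (p :- y) :* U :+ 2 · p :* o :* x)) :+ (14 · p :* (x :* (x :* (y :* (y :* (p :^ 2 :* (y :^ 2 :- p :^ 2) :- 7 · U :^ 2) :- 5 · p :* U :^ 2) :- x :* (p :* (y :* (x :* (x :* (2 · x :+ y :+ 6 · p) :+ y :* (4 · y :+ 5 · p) :+ 8 · p :^ 2) :+ p :* (y :* (3 · y :+ 5 · p) :+ 4 · p :^ 2)) :+ 2 · p :^ 2 :* (x :* (x :+ 2 · p) :+ p :^ 2) :+ 2 · U :^ 2) :+ x :* (y :^ 3 :* (x :+ y) :+ 2 · U :^ 2))) :+ y :* U :^ 2 :* (3 · y :* (3 · y :+ 7 · p) :+ 14 · p :^ 2)) :- 2 · y :* p :* U :* (y :* (p :* (o :* (y :+ p) :+ 8 · U) :+ y :* U) :+ 7 · p :^ 2 :* U)) :+ 14 · x :* y :* U :^ 2 :* (x :* (x :* (7 · x :- 2 · y) :- 7 · y :^ 2) :+ 2 ·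 y :^ 3)) :* ((o :* o) :- (p :* (2 · (x :+ y) :- 3 · p))) :+ (7 · x :* (x :* (p :* (p :* (x :* (y :* (2 · x :* (14 · p :^ 2 :- 2 · x :* (4 · x :+ 7 · y :+ 5 · p) :- y :* (4 · y :+ 17 · p)) :+ 2 · y :* (y :* (2 · y :- 11 · p) :- 3 · p :^ 2) :+ 32 · p :^ 3 :- 47 · o :* U) :+ 2 · p :* (2 · x :* (4 · p :^ 2 :- x :* (2 · x :+ p)) :+ 6 · p :^ 3 :- 11 · o :* U) :- 4 · U :* (5 · x :* o :+ 2 · U)) :+ y :* (2 · y :* (p :^ 2 :* (3 · p :- 2 · y) :+ 7 · o :* U) :+ U :* (5 · p :* o :+ 93 · U)) :- 7 · p :* U :^ 2) :+ U :* (x :* (2 · x :* (o :* (2 · x :- 37 · y) :- 4 · U) :- y :* (3 · y :* o :+ 83 · U)) :- 4 · y :^ 2 :* (2 · y :* o :+ 5 · U))) :+ U :* (y :* (x :* (7 · y :* (2 · y :* o :+ 9 · U) :- 2 · x :* (o :* (18 · x :+ 11 · y) :+ 63 · U)) :- 8 · y :^ 3 :* o) :- 35 · o :* U :^ 2)) :+ U :* (y :* (y :* (2 · y :* (2 · y :* (o :* (p :- 2 · y) :- 7 · U) :+ p :* (p :* o :+ 31 · U)) :- 3 · p :^ 2 :* (5 · p :* o :+ 19 · U)) :+ 7 · U :* (9 · o :* U :- 19 · p :^ 3)) :+ 98 · U :^ 2 :* (p :* o :+ U))) :+ 7 · U :* (y :* (p :* (4 · y :* (p :* (y :* (o :* (p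 :- 2 · y) :- 13 · U) :+ p :* (3 · p :* o :+ 10 · U)) :- 2 · y :^ 2 :* U) :+ 7 · U :* (12 · p :^ 3 :- 11 · o :* U)) :- 7 · U :^ 2 :* (4 · y :* o :+ 7 · U)) :- 49 · p :* U :^ 2 :* (p :* o :+ U))) :* ((p :* p) :- (x :* y)) :+ (7 · x :* (y :* (x :* (y :* (2 · x :* (3 · x :* (y :- 3 · x :- 2 · p) :- 5 · y :* p) :+ 2 · y :^ 2 :* (3 · p :- 2 · y) :+ 9 · o :* U) :+ U :* (o :* (5 · p :- 7 · x) :+ 7 · U)) :+ U :* (7 · p :* U :- y :* (o :* (2 · y :+ 7 · p) :+ 7 · U))) :+ x :* p :* U :* (2 · x :* o :- 7 · U))) :* ((7 · (U :* U)) :- (p :* p :* (p :* p) :- 2 · o :* (x :+ y :+ p) :* U)) }) refl) (_ ⊙ V-U ⊞ _ ⊙ xX ⊞ _ ⊙ yY ⊞ _ ⊙ ho ⊞ _ ⊙ hxy ⊞ _ ⊙ U²))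

module Solution
  (F T G H p o A A′ B′ B K L M Z : Series)
  (r1 : p * p ≈ F * T * (G * H))
  (hS : (F * H * (F * H)) + (T * G * (T * G)) ≈ const (+ 2) * o * ((F * G) + (T * H) - p))
  (ho : o * o ≈ p * (const (+ 2) * ((F * G) + (T * H)) - const (+ 3) * p))
  (k0 : K * F ≈ G * (A * A))
  (k1 : L * T ≈ H * (A * A) + const (+ 2) * G * (A * A′))
  (k2 : M * F ≈ G * (A′ * A′ + const (+ 2) * (A * B′)) + const (+ 2) * H * (A * A′))
  (k3 : Z * T ≈ const (+ 2) * G * (A * B + A′ * B′) + H * (A′ * A′ + const (+ 2) * (A * B′)))
  (k4 : Z * F ≈ G * (B′ * B′ + const (+ 2) * (A′ * B)) + const (+ 2) * H * (A * B + A′ * B′))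
  (k6 : L * F ≈ G * (B * B) + const (+ 2) * H * (B * B′))
  (k7 : K * T ≈ H * (B * B))
  (e8 : L * (G * H) ≈ K * (F * T))
  (regular-F : Regular F)
  (regular-T : Regular T)
  (regular-G : Regular G)
  (regular-H : Regular H)
  (regular-p : Regular p)
  (regular-A : Regular A)
  (regular-B : Regular B)
  (regular-Ap+BFH : Regular (A * p + B * (F * H)))
  (regular-f₂ : Regular (const (+ 8) * ((F * G) + (T * H)) * o * ((F * G) + (T * H) - p) * ((F * G) - (T * H)) - const (+ 2) * ((F * G) + (T * H) - const (+ 2) * p) * (const (+ 2) * ((F * G) - (T * H)) * (F * T * (F * T)) - ((F * H * (F * H)) - (T * G * (T * G))) * ((F * G) + (T * H) + const (+ 2) * p) + const (+ 2) * ((F * G) - (T * H)) * o * ((F * G) + (T * H) + p)) - const (+ 4) * ((F * H * (F * H)) - (T * G * (T * G))) * (((F * G) + (T * H)) * ((F * G) + (T * H)) - const (+ 2) * p * ((F * G) + (T * H)) - const (+ 2) * (p * p))))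
  (regular-e : Regular (F * G - T * H)) (regular-σ+2p : Regular (F * G + T * H + const (+ 2) * p))
  (regular-x+p : Regular (F * G + p)) (regular-y+p : Regular (T * H + p))
  where

  open CoreRelations F T G H p A A′ B′ B K L M Z r1 k0 k1 k2 k3 k4 k6 k7 e8
    regular-F regular-T regular-G regular-H regular-A regular-B regular-Ap+BFH public

  xy : p * p ≈ F * G * (T * H)
  xy = -≈𝟘⇒≈ (≈-trans (SR.solve (F ∷ T ∷ G ∷ H ∷ p ∷ []) (λ { (F ∷ T ∷ G ∷ H ∷ p ∷ []) →
        p :* p :- F :* G :* (T :* H) ,
        1 · ((p :* p) :- (F :* T :* (G :* H))) }) refl) (_ ⊙ (r1)))

  XY : (F * H * (F * H)) * (T * G * (T * G)) ≈ p * p * (p * p)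
  XY = -≈𝟘⇒≈ (≈-trans (SR.solve (F ∷ T ∷ G ∷ H ∷ p ∷ []) (λ { (F ∷ T ∷ G ∷ H ∷ p ∷ []) →
        (F :* H :* (F :* H)) :* (T :* G :* (T :* G)) :- p :* p :* (p :* p) ,
        (con (+ 0) :- p :^ 2 :- F :* T :* G :* H) :* ((p :* p) :- (F :* T :* (G :* H))) }) refl) (_ ⊙ (r1)))

  UV : (G * H * (G * H)) * (F * T * (F * T)) ≈ p * p * (p * p)
  UV = -≈𝟘⇒≈ (≈-trans (SR.solve (F ∷ T ∷ G ∷ H ∷ p ∷ []) (λ { (F ∷ T ∷ G ∷ H ∷ p ∷ []) →
        (G :* H :* (G :* H)) :* (F :* T :* (F :* T)) :- p :* p :* (p :* p) ,
        (con (+ 0) :- p :^ 2 :- F :* T :* G :* H) :* ((p :* p) :- (F :* T :* (G :* H))) }) refl) (_ ⊙ (r1)))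

  -- The factor F²T² turns every monomial of `central` into one in x, y, X, Y, U, V and p; F²H⁶, for
  -- instance, becomes X²y².
  VM : const (+ 2) * p * ((F * G) - (T * H)) * (const (+ 5) * ((G * H * (G * H)) * (F * T * (F * T))) + (F * T * (F * T)) * ((F * T * (F * T)) - (F * H * (F * H)) - (T * G * (T * G)))) + (F * T * (F * T)) * (F * T * (F * T)) * ((T * H) * (T * H)) - const (+ 2) * ((T * H) * (T * H)) * ((F * H * (F * H)) * (F * T * (F * T))) + (F * H * (F * H)) * (F * H * (F * H)) * ((T * H) * (T * H)) - (F * T * (F * T)) * (F * T * (F * T)) * ((F * G) * (F * G)) + const (+ 2) * ((F * G) * (F * G)) * ((T * G * (T * G)) * (F * T * (F * T))) - (T * G * (T * G)) * (T * G * (T * G)) * ((F * G) * (F * G)) + const (+ 4) * p * ((F * T * (F * T)) * ((F * G) * (F * H * (F * H))) - (G * H * (G * H)) * (F * T * (F * T)) * (F * G) - (F * T * (F * T)) * ((T * H) * (T * G * (T * G))) + (G * H * (G * H)) * (F * T * (F * T)) * (T * H)) ≈ 𝟘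
  VM = ≈-trans (SR.solve (F ∷ T ∷ G ∷ H ∷ p ∷ []) (λ { (F ∷ T ∷ G ∷ H ∷ p ∷ []) →
        2 · p :* ((F :* G) :- (T :* H)) :* (5 · ((G :* H :* (G :* H)) :* (F :* T :* (F :* T))) :+ (F :* T :* (F :* T)) :* ((F :* T :* (F :* T)) :- (F :* H :* (F :* H)) :- (T :* G :* (T :* G)))) :+ (F :* T :* (F :* T)) :* (F :* T :* (F :* T)) :* ((T :* H) :* (T :* H)) :- 2 · ((T :* H) :* (T :* H)) :* ((F :* H :* (F :* H)) :* (F :* T :* (F :* T))) :+ (F :* H :* (F :* H)) :* (F :* H :* (F :* H)) :* ((T :* H) :* (T :* H)) :- (F :* T :* (F :* T)) :* (F :* T :* (F :* T)) :* ((F :* G) :* (F :* G)) :+ 2 · ((F :* G) :* (F :* G)) :* ((T :* G :* (T :* G)) :* (F :* T :* (F :* T))) :- (T :* G :* (T :* G)) :* (T :* G :* (T :* G)) :* ((F :* G) :* (F :* G)) :+ 4 · p :* ((F :* T :* (F :* T)) :* ((F :* G) :* (F :* H :* (F :* H))) :- (G :* H :* (G :* H)) :* (F :* T :* (F :* T)) :* (F :* G) :- (F :* T :* (F :* T)) :* ((T :* H) :* (T :* G :* (T :* G))) :+ (G :* H :* (G :* H)) :* (F :* T :* (F :* T)) :* (T :* H)) ,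
        (F :^ 2 :* T :^ 2) :* (2 · p :* (F :* G :- T :* H) :* (4 · (G :* H :* (G :* H)) :+ (T :* T :- H :* H) :* (F :* F :- G :* G)) :+ F :* H :* (F :* H) :* ((T :* T :- H :* H) :* (T :* T :- H :* H)) :- T :* G :* (T :* G) :* ((F :* F :- G :* G) :* (F :* F :- G :* G)) :+ 4 · p :* (G :* H) :* (F :* H :* (F :* F :- G :* G) :- T :* G :* (T :* T :- H :* H))) }) refl) (_ ⊙₀ (central))

  open CurveRelations (F * G) (T * H) p o (F * H * (F * H)) (T * G * (T * G)) (G * H * (G * H)) (F * T * (F * T))
    xy XY UV hS ho VM regular-f₂ regular-e (regular-* (regular-* regular-F regular-T) (regular-* regular-F regular-T))
    regular-σ+2p regular-x+p regular-y+p

  -- The four cubics are related by a dilation: their sum is λ₀ again before t is replaced by t⁴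
  -- (`D≈Λ`, `dil-Λ`). This recurrence is what fixes the common factor later.
  λ₀ : Series
  λ₀ = G * G * G - F * F * G + const (+ 2) * p * F

  λ₁ : Series
  λ₁ = const (+ 3) * (G * G * H) + F * F * H + const (+ 2) * T * o

  λ₂ : Series
  λ₂ = const (+ 3) * (G * (H * H)) + T * T * G + const (+ 2) * F * o

  λ₃ : Series
  λ₃ = H * H * H - T * T * H + const (+ 2) * p * T

  λ₁-λ₀ : const (+ 2) * (G * H) * λ₁ ≈ λ₀ * (T * T - H * H)
  λ₁-λ₀ = -≈𝟘⇒≈ (regular-F _ (≈-trans (SR.solve (F ∷ T ∷ G ∷ H ∷ p ∷ o ∷ []) (λ { (F ∷ T ∷ G ∷ H ∷ p ∷ o ∷ []) →
        F :* (2 · (G :* H) :* (3 · (G :* G :* H) :+ F :* F :* H :+ 2 · T :* o) :- ((G :* G :* G :- F :* F :* G :+ 2 · p :* F) :* (T :* T :- H :* H))) ,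
        1 · ((F :* G) :* (7 · (G :* H :* (G :* H)) :+ (F :* T :* (F :* T)) :+ (F :* H :* (F :* H)) :- (T :* G :* (T :* G)) :+ 4 · (T :* H) :* o) :- 2 · p :* ((F :* T :* (F :* T)) :- (F :* H :* (F :* H)))) }) refl) (_ ⊙₀ (E₁))))

  λ₂-λ₃ : const (+ 2) * (G * H) * λ₂ ≈ λ₃ * (F * F - G * G)
  λ₂-λ₃ = -≈𝟘⇒≈ (regular-T _ (≈-trans (SR.solve (F ∷ T ∷ G ∷ H ∷ p ∷ o ∷ []) (λ { (F ∷ T ∷ G ∷ H ∷ p ∷ o ∷ []) →
        T :* (2 · (G :* H) :* (3 · (G :* (H :* H)) :+ T :* T :* G :+ 2 · F :* o) :- ((H :* H :* H :- T :* T :* H :+ 2 · p :* T) :* (F :* F :- G :* G))) ,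
        1 · ((T :* H) :* (7 · (G :* H :* (G :* H)) :+ (F :* T :* (F :* T)) :+ (T :* G :* (T :* G)) :- (F :* H :* (F :* H)) :+ 4 · (F :* G) :* o) :- 2 · p :* ((F :* T :* (F :* T)) :- (T :* G :* (T :* G)))) }) refl) (_ ⊙₀ (E₂))))

  λ₀-λ₃ : λ₀ * p ≈ λ₃ * (F * H)
  λ₀-λ₃ = -≈𝟘⇒≈ ((regular-* (regular-* (regular-* regular-F regular-T) (regular-* regular-F regular-T)) regular-G) _ (≈-trans (SR.solve (F ∷ T ∷ G ∷ H ∷ p ∷ []) (λ { (F ∷ T ∷ G ∷ H ∷ p ∷ []) →
        (F :* T :* (F :* T) :* G) :* ((G :* G :* G :- F :* F :* G :+ 2 · p :* F) :* p :- ((H :* H :* H :- T :* T :* H :+ 2 · p :* T) :* (F :* H))) ,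
        1 · ((F :* G) :* (p :* (F :* G) :* (T :* G :* (T :* G)) :- (T :* H) :* (T :* H) :* (F :* H :* (F :* H)) :+ (F :* T :* (F :* T)) :* ((T :* H) :* (T :* H) :- p :* (F :* G) :- 2 · p :* (T :* H) :+ 2 · (p :* p)))) }) refl) (_ ⊙₀ (E₃))))

  -- Required for C₀, whose formula contains TG³ and FH³ multiplied by GH.
  J-form : T * H * (G * G * (G * G)) + F * G * (H * H * (H * H)) ≈ const (+ 2) * o * (G * H * (G * H)) + p * p * ((F * G) + (T * H)) - const (+ 2) * (p * p * p)
  J-form = -≈𝟘⇒≈ ((regular-* (regular-* regular-F regular-T) (regular-* regular-F regular-T)) _ (≈-trans (SR.solve (F ∷ T ∷ G ∷ H ∷ p ∷ o ∷ []) (λ { (F ∷ T ∷ G ∷ H ∷ p ∷ o ∷ []) →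
        (F :* T :* (F :* T)) :* (T :* H :* (G :* G :* (G :* G)) :+ F :* G :* (H :* H :* (H :* H)) :- (2 · o :* (G :* H :* (G :* H)) :+ p :* p :* ((F :* G) :+ (T :* H)) :- 2 · (p :* p :* p))) ,
        1 · ((F :* G) :* (F :* G) :* (T :* H) :* (T :* G :* (T :* G)) :+ (F :* G) :* ((T :* H) :* (T :* H)) :* (F :* H :* (F :* H)) :- (F :* T :* (F :* T)) :* (2 · o :* (G :* H :* (G :* H)) :+ p :* p :* ((F :* G) :+ (T :* H)) :- 2 · (p :* p :* p))) }) refl) (_ ⊙₀ (J))))

  λ₀λ₃ : λ₀ * λ₃ ≈ const (+ 8) * (G * H) * (p * o + (G * H * (G * H)))
  λ₀λ₃ = -≈𝟘⇒≈ ((regular-* (regular-* (regular-* regular-F regular-T) (regular-* regular-F regular-T)) (regular-* regular-G regular-H)) _ (≈-trans (SR.solve (F ∷ T ∷ G ∷ H ∷ p ∷ o ∷ []) (λ { (F ∷ T ∷ G ∷ H ∷ p ∷ o ∷ []) →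
        (F :* T :* (F :* T) :* (G :* H)) :* ((G :* G :* G :- F :* F :* G :+ 2 · p :* F) :* (H :* H :* H :- T :* T :* H :+ 2 · p :* T) :- (8 · (G :* H) :* (p :* o :+ (G :* H :* (G :* H))))) ,
        1 · ((G :* H :* (G :* H)) :* (F :* T :* (F :* T)) :* ((G :* H :* (G :* H)) :- (F :* H :* (F :* H)) :- (T :* G :* (T :* G)) :+ (F :* T :* (F :* T))) :+ 2 · p :* ((F :* G) :* (F :* G) :* (T :* H) :* (T :* G :* (T :* G)) :+ (F :* G) :* ((T :* H) :* (T :* H)) :* (F :* H :* (F :* H)) :- (F :* G) :* (T :* H) :* ((F :* G) :+ (T :* H)) :* (F :* T :* (F :* T))) :+ 4 · (p :* p) :* ((F :* G) :* (T :* H)) :* (F :* T :* (F :* T)) :- 8 · ((G :* H :* (G :* H)) :* (F :* T :* (F :* T))) :* (p :* o :+ (G :* H :* (G :* H)))) }) refl) (_ ⊙₀ (J′))))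

  -- The relations that are quadratic in A, A′, B′, B all reduce to the product AB, so the value of
  -- `λ₀ * λ₃` suffices for L, M and Z.
  K-AB : K * p ≈ G * H * (A * B)
  K-AB = -≈𝟘⇒≈ (regular-F _ (≈-trans (SR.solve (F ∷ G ∷ H ∷ p ∷ A ∷ B ∷ K ∷ []) (λ { (F ∷ G ∷ H ∷ p ∷ A ∷ B ∷ K ∷ []) →
        F :* (K :* p :- G :* H :* (A :* B)) ,
        p :* ((K :* F) :- (G :* (A :* A))) :+ (G :* A) :* ((A :* p) :- (B :* (F :* H))) }) refl) (_ ⊙ (k0) ⊞ _ ⊙ (A-B))))

  L-AB : L * p ≈ F * T * (A * B)
  L-AB = -≈𝟘⇒≈ (regular-* regular-G regular-H _ (≈-trans (SR.solve (F ∷ T ∷ G ∷ H ∷ p ∷ A ∷ B ∷ K ∷ L ∷ []) (λ { (F ∷ T ∷ G ∷ H ∷ p ∷ A ∷ B ∷ K ∷ L ∷ []) →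
        G :* H :* (L :* p :- F :* T :* (A :* B)) ,
        p :* ((L :* (G :* H)) :- (K :* (F :* T))) :+ (F :* T) :* ((K :* p) :- (G :* H :* (A :* B))) }) refl) (_ ⊙ (e8) ⊞ _ ⊙ (K-AB))))

  regular-x² : Regular (F * G * (F * G))
  regular-x² = regular-* (regular-* regular-F regular-G) (regular-* regular-F regular-G)

  regular-y² : Regular (T * H * (T * H))
  regular-y² = regular-* (regular-* regular-T regular-H) (regular-* regular-T regular-H)

  -- Because the core relations are quadratic in A, A′, B′, B, the series L, M and Z come out
  -- multiplied by c².
  module Scaled (c : Series) (cA : c * A ≈ λ₀) (cB : c * B ≈ λ₃) where

    AB-form : c * c * (A * B) ≈ const (+ 8) * (G * H) * (p * o + (G * H * (G * H)))
    AB-form = -≈𝟘⇒≈ (≈-trans (SR.solve (F ∷ T ∷ G ∷ H ∷ p ∷ o ∷ A ∷ B ∷ c ∷ []) (λ { (F ∷ T ∷ G ∷ H ∷ p ∷ o ∷ A ∷ B ∷ c ∷ []) →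
        c :* c :* (A :* B) :- 8 · (G :* H) :* (p :* o :+ (G :* H :* (G :* H))) ,
        (c :* B) :* ((c :* A) :- (G :* G :* G :- F :* F :* G :+ 2 · p :* F)) :+ (F :* (2 · p :- F :* G) :+ G :^ 3) :* ((c :* B) :- (H :* H :* H :- T :* T :* H :+ 2 · p :* T)) :+ 1 · (((G :* G :* G :- F :* F :* G :+ 2 · p :* F) :* (H :* H :* H :- T :* T :* H :+ 2 · p :* T)) :- (8 · (G :* H) :* (p :* o :+ (G :* H :* (G :* H))))) }) refl) (_ ⊙ (cA) ⊞ _ ⊙ (cB) ⊞ _ ⊙ (λ₀λ₃)))

    L-form : c * c * L ≈ const (+ 8) * p * (p * o + (G * H * (G * H)))
    L-form = -≈𝟘⇒≈ (regular-p _ (≈-trans (SR.solve (F ∷ T ∷ G ∷ H ∷ p ∷ o ∷ A ∷ B ∷ L ∷ c ∷ []) (λ { (F ∷ T ∷ G ∷ H ∷ p ∷ o ∷ A ∷ B ∷ L ∷ c ∷ []) →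
        p :* (c :* c :* L :- 8 · p :* (p :* o :+ (G :* H :* (G :* H)))) ,
        (c :* c) :* ((L :* p) :- (F :* T :* (A :* B))) :+ (F :* T) :* ((c :* c :* (A :* B)) :- (8 · (G :* H) :* (p :* o :+ (G :* H :* (G :* H))))) :+ (con (+ 0) :- 8 · p :* o :- 8 · G :^ 2 :* H :^ 2) :* ((p :* p) :- (F :* T :* (G :* H))) }) refl) (_ ⊙ (L-AB) ⊞ _ ⊙ (AB-form) ⊞ _ ⊙ (r1))))

    M-AB : const (+ 4) * (G * H * (G * H)) * p * (M * F) ≈ G * H * (A * B) * (F * ((T * T - H * H) * (T * T - H * H)) + const (+ 4) * (G * p) * (F * F - G * G) + const (+ 4) * (F * (H * H)) * (T * T - H * H))
    M-AB = -≈𝟘⇒≈ (≈-trans (SR.solve (F ∷ T ∷ G ∷ H ∷ p ∷ A ∷ A′ ∷ B′ ∷ B ∷ M ∷ []) (λ { (F ∷ T ∷ G ∷ H ∷ p ∷ A ∷ A′ ∷ B′ ∷ B ∷ M ∷ []) →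
        4 · (G :* H :* (G :* H)) :* p :* (M :* F) :- G :* H :* (A :* B) :* (F :* ((T :* T :- H :* H) :* (T :* T :- H :* H)) :+ 4 · (G :* p) :* (F :* F :- G :* G) :+ 4 · (F :* (H :* H)) :* (T :* T :- H :* H)) ,
        (4 · G :^ 2 :* H :^ 2 :* p) :* ((M :* F) :- (G :* (A′ :* A′ :+ 2 · (A :* B′)) :+ 2 · H :* (A :* A′))) :+ (G :* p :* (H :* (2 · G :* A′ :+ 3 · H :* A) :+ T :^ 2 :* A)) :* ((2 · (G :* H) :* A′) :- (A :* (T :* T :- H :* H))) :+ (4 · G :^ 2 :* H :* p :* A) :* ((2 · (G :* H) :* B′) :- (B :* (F :* F :- G :* G))) :+ (G :* A :* (T :^ 2 :* (T :^ 2 :+ 2 · H :^ 2) :- 3 · H :^ 4)) :* ((A :* p) :- (B :* (F :* H))) }) refl) (_ ⊙ (k2) ⊞ _ ⊙ (A′-A) ⊞ _ ⊙ (B′-B) ⊞ _ ⊙ (A-B)))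

    M-bracket : (F * ((T * T - H * H) * (T * T - H * H)) + const (+ 4) * (G * p) * (F * F - G * G) + const (+ 4) * (F * (H * H)) * (T * T - H * H)) ≈ const (+ 4) * p * F * (const (+ 2) * ((F * G) + (T * H)) - p)
    M-bracket = -≈𝟘⇒≈ (regular-* (regular-* regular-x² regular-y²) regular-G _ (≈-trans (SR.solve (F ∷ T ∷ G ∷ H ∷ p ∷ []) (λ { (F ∷ T ∷ G ∷ H ∷ p ∷ []) →
        (F :* G) :* (F :* G) :* ((T :* H) :* (T :* H)) :* G :* ((F :* ((T :* T :- H :* H) :* (T :* T :- H :* H)) :+ 4 · (G :* p) :* (F :* F :- G :* G) :+ 4 · (F :* (H :* H)) :* (T :* T :- H :* H)) :- 4 · p :* F :* (2 · ((F :* G) :+ (T :* H)) :- p)) ,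
        1 · ((F :* G) :* ((T :* H) :* (T :* H) :* ((F :* T :* (F :* T)) :* (T :* G :* (T :* G)) :+ 2 · ((F :* G) :* (F :* G) :* ((T :* H) :* (T :* H))) :- 3 · ((F :* H :* (F :* H)) :* (G :* H :* (G :* H)))) :+ 4 · p :* ((F :* G) :* (F :* G) :* (F :* G) :* ((T :* H) :* (T :* H)) :- (F :* G) :* ((T :* G :* (T :* G)) :* (G :* H :* (G :* H)))) :- 4 · p :* ((F :* G) :* (F :* G) :* ((T :* H) :* (T :* H))) :* (2 · ((F :* G) :+ (T :* H)) :- p))) }) refl) (_ ⊙₀ (Z₁))))

    M-form : c * c * M ≈ const (+ 8) * (p * o + (G * H * (G * H))) * (const (+ 2) * ((F * G) + (T * H)) - p)
    M-form = -≈𝟘⇒≈ (regular-* (regular-* (regular-* (regular-const (+ 4) λ ()) (regular-* (regular-* regular-G regular-H) (regular-* regular-G regular-H))) regular-p) regular-F _ (≈-trans (SR.solve (F ∷ T ∷ G ∷ H ∷ p ∷ o ∷ A ∷ B ∷ M ∷ c ∷ []) (λ { (F ∷ T ∷ G ∷ H ∷ p ∷ o ∷ A ∷ B ∷ M ∷ c ∷ []) →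
        4 · (G :* H :* (G :* H)) :* p :* F :* (c :* c :* M :- 8 · (p :* o :+ (G :* H :* (G :* H))) :* (2 · ((F :* G) :+ (T :* H)) :- p)) ,
        (c :* c) :* ((4 · (G :* H :* (G :* H)) :* p :* (M :* F)) :- (G :* H :* (A :* B) :* (F :* ((T :* T :- H :* H) :* (T :* T :- H :* H)) :+ 4 · (G :* p) :* (F :* F :- G :* G) :+ 4 · (F :* (H :* H)) :* (T :* T :- H :* H)))) :+ (G :* H :* (F :* (T :^ 2 :* (T :^ 2 :+ 2 · H :^ 2) :+ 4 · F :* G :* p :- 3 · H :^ 4) :- 4 · G :^ 3 :* p)) :* ((c :* c :* (A :* B)) :- (8 · (G :* H) :* (p :* o :+ (G :* H :* (G :* H))))) :+ (8 · G :^ 2 :* H :^ 2 :* (p :* o :+ G :^ 2 :* H :^ 2)) :* (((F :* ((T :* T :- H :* H) :* (T :* T :- H :* H)) :+ 4 · (G :* p) :* (F :* F :- G :* G) :+ 4 · (F :* (H :* H)) :* (T :* T :- H :* H))) :- (4 · p :* F :* (2 · ((F :* G) :+ (T :* H)) :- p))) }) refl) (_ ⊙ (M-AB) ⊞ _ ⊙ (AB-form) ⊞ _ ⊙ (M-bracket))))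

    Z-AB : const (+ 4) * (G * H * (G * H)) * p * (Z * T) ≈ A * B * (const (+ 2) * (G * p) * (const (+ 4) * (G * H * (G * H)) + (T * T - H * H) * (F * F - G * G)) + F * (H * H) * ((T * T - H * H) * (T * T - H * H)) + const (+ 4) * (G * (H * H)) * p * (F * F - G * G))
    Z-AB = -≈𝟘⇒≈ (≈-trans (SR.solve (F ∷ T ∷ G ∷ H ∷ p ∷ A ∷ A′ ∷ B′ ∷ B ∷ Z ∷ []) (λ { (F ∷ T ∷ G ∷ H ∷ p ∷ A ∷ A′ ∷ B′ ∷ B ∷ Z ∷ []) →
        4 · (G :* H :* (G :* H)) :* p :* (Z :* T) :- A :* B :* (2 · (G :* p) :* (4 · (G :* H :* (G :* H)) :+ (T :* T :- H :* H) :* (F :* F :- G :* G)) :+ F :* (H :* H) :* ((T :* T :- H :* H) :* (T :* T :- H :* H)) :+ 4 · (G :* (H :* H)) :* p :* (F :* F :- G :* G)) ,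
        (4 · G :^ 2 :* H :^ 2 :* p) :* ((Z :* T) :- (2 · G :* (A :* B :+ A′ :* B′) :+ H :* (A′ :* A′ :+ 2 · (A :* B′)))) :+ (H :* p :* (2 · G :* (2 · G :* B′ :+ H :* A′) :+ A :* (T :^ 2 :- H :^ 2))) :* ((2 · (G :* H) :* A′) :- (A :* (T :* T :- H :* H))) :+ (2 · G :* p :* A :* (T :^ 2 :+ H :^ 2)) :* ((2 · (G :* H) :* B′) :- (B :* (F :* F :- G :* G))) :+ (H :* A :* (T :* T :- H :* H) :* (T :* T :- H :* H)) :* ((A :* p) :- (B :* (F :* H))) }) refl) (_ ⊙ (k3) ⊞ _ ⊙ (A′-A) ⊞ _ ⊙ (B′-B) ⊞ _ ⊙ (A-B)))

    -- Stated with the factor GH(po + (GH)²), one eighth of c²AB, since the bracket of `Z-AB` occurs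
    -- only multiplied by AB.
    Z-bracket : G * H * (p * o + (G * H * (G * H))) * (const (+ 2) * (G * p) * (const (+ 4) * (G * H * (G * H)) + (T * T - H * H) * (F * F - G * G)) + F * (H * H) * ((T * T - H * H) * (T * T - H * H)) + const (+ 4) * (G * (H * H)) * p * (F * F - G * G)) ≈ const (+ 4) * (G * H * (G * H)) * p * T * (const (+ 4) * p * ((((F * G) + (T * H)) - p) * (((F * G) + (T * H)) - p)) + const (+ 4) * o * (G * H * (G * H)) + (p * o + (G * H * (G * H))) * o)
    Z-bracket = -≈𝟘⇒≈ (regular-* (regular-* regular-x² (regular-* regular-F regular-G)) regular-H _ (≈-trans (SR.solve (F ∷ T ∷ G ∷ H ∷ p ∷ o ∷ []) (λ { (F ∷ T ∷ G ∷ H ∷ p ∷ o ∷ []) →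
        (F :* G :* (F :* G) :* (F :* G)) :* H :* (G :* H :* (p :* o :+ (G :* H :* (G :* H))) :* (2 · (G :* p) :* (4 · (G :* H :* (G :* H)) :+ (T :* T :- H :* H) :* (F :* F :- G :* G)) :+ F :* (H :* H) :* ((T :* T :- H :* H) :* (T :* T :- H :* H)) :+ 4 · (G :* (H :* H)) :* p :* (F :* F :- G :* G)) :- 4 · (G :* H :* (G :* H)) :* p :* T :* (4 · p :* ((((F :* G) :+ (T :* H)) :- p) :* (((F :* G) :+ (T :* H)) :- p)) :+ 4 · o :* (G :* H :* (G :* H)) :+ (p :* o :+ (G :* H :* (G :* H))) :* o)) ,
        (con (+ 0) :- G :^ 2 :* H :^ 2) :* (4 · p :* ((F :* G) :* (F :* G) :* (F :* G)) :* (T :* H) :* (4 · p :* (((F :* G) :+ (T :* H) :- p) :* ((F :* G) :+ (T :* H) :- p)) :+ 4 · o :* (G :* H :* (G :* H)) :+ (p :* o :+ (G :* H :* (G :* H))) :* o) :- (p :* o :+ (G :* H :* (G :* H))) :* (2 · p :* ((F :* G) :* (F :* G) :* (F :* G)) :* (3 · (G :* H :* (G :* H)) :+ (F :* T :* (F :* T)) :+ (F :* H :* (F :* H)) :- (T :* G :* (T :* G))) :+ (F :* G) :* (F :* G) :* ((T :* H) :* (T :* H)) :* (F :* T :* (F :* T)) :- 2 · ((F :* G) :* (F :* G) :* ((T :* H) :* (T :* H))) :* (F :* H :* (F :* H)) :+ (F :* H :* (F :* H)) :* (F :* H :* (F :* H)) :* (G :* H :* (G :* H)))) }) refl) (_ ⊙₀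 (Z₀))))

    Z-form : c * c * Z ≈ const (+ 8) * (const (+ 4) * p * ((((F * G) + (T * H)) - p) * (((F * G) + (T * H)) - p)) + const (+ 4) * o * (G * H * (G * H)) + (p * o + (G * H * (G * H))) * o)
    Z-form = -≈𝟘⇒≈ (regular-* (regular-* (regular-* (regular-const (+ 4) λ ()) (regular-* (regular-* regular-G regular-H) (regular-* regular-G regular-H))) regular-p) regular-T _ (≈-trans (SR.solve (F ∷ T ∷ G ∷ H ∷ p ∷ o ∷ A ∷ B ∷ Z ∷ c ∷ []) (λ { (F ∷ T ∷ G ∷ H ∷ p ∷ o ∷ A ∷ B ∷ Z ∷ c ∷ []) →
        4 · (G :* H :* (G :* H)) :* p :* T :* (c :* c :* Z :- 8 · (4 · p :* ((((F :* G) :+ (T :* H)) :- p) :* (((F :* G) :+ (T :* H)) :- p)) :+ 4 · o :* (G :* H :* (G :* H)) :+ (p :* o :+ (G :* H :* (G :* H))) :* o)) ,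
        (c :* c) :* ((4 · (G :* H :* (G :* H)) :* p :* (Z :* T)) :- (A :* B :* (2 · (G :* p) :* (4 · (G :* H :* (G :* H)) :+ (T :* T :- H :* H) :* (F :* F :- G :* G)) :+ F :* (H :* H) :* ((T :* T :- H :* H) :* (T :* T :- H :* H)) :+ 4 · (G :* (H :* H)) :* p :* (F :* F :- G :* G)))) :+ (F :* (H :^ 2 :* (T :^ 2 :* (T :^ 2 :- 2 · H :^ 2) :+ 2 · F :* G :* p :+ H :^ 4) :+ 2 · F :* T :^ 2 :* G :* p) :+ 2 · G :^ 3 :* p :* (3 · H :^ 2 :- T :^ 2)) :* ((c :* c :* (A :* B)) :- (8 · (G :* H) :* (p :* o :+ (G :* H :* (G :* H))))) :+ (con (+ 8)) :* ((G :* H :* (p :* o :+ (G :* H :* (G :* H))) :* (2 · (G :* p) :* (4 · (G :* H :* (G :* H)) :+ (T :* T :- H :* H) :* (F :* F :- G :* G)) :+ F :* (H :* H) :* ((T :* T :- H :* H) :* (T :* T :- H :* H)) :+ 4 · (G :* (H :* H)) :* p :* (F :* F :- G :* G))) :- (4 · (G :* H :* (G :* H)) :* p :* T :* (4 · p :* ((((F :* G) :+ (T :* H)) :- p) :* (((F :* G) :+ (T :* H)) :- p)) :+ 4 · o :* (G :* H :* (G :* H)) :+ (p :* o :+ (G :* H :* (G :* H))) :* o))) }) refl) (_ ⊙ (Z-AB) ⊞ _ ⊙ (AB-form) ⊞ _ ⊙ (Z-bracket))))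

-- Generating functions of graded families with finite fibres.

-- The order of the lists is immaterial: a sum over a fibre depends only on its set of members
-- (`sumOver-set`), so families are compared through bijections.
record Fibres {A : Set} (P : A → Set) (w : A → ℕ) : Set where
  field
    fibre    : ℕ → List A
    unique   : ∀ n → Unique (fibre n)
    sound    : ∀ {n a} → a ∈ fibre n → P a × w a ≡ n
    complete : ∀ {a} → P a → a ∈ fibre (w a)
open Fibres public

sumOver : {A : Set} → (A → ℤ) → List A → ℤ
sumOver s xs = sumℤ (map s xs)

opaque
  gen : {A : Set} {P : A → Set} {w : A → ℕ} → Fibres P w → (A → ℤ) → Series
  gen Φ s n = sumOver s (fibre Φ n)

  coeff-gen : {A : Set} {P : A → Set} {w : A → ℕ} (Φ : Fibres P w) (s : A → ℤ) → ∀ n → gen Φ s n ≡ sumOver s (fibre Φ n)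
  coeff-gen Φ s n = refl

sumOver-↭ : {A : Set} (s : A → ℤ) {xs ys : List A} → xs ↭ ys → sumOver s xs ≡ sumOver s ys
sumOver-↭ s ↭-refl         = refl
sumOver-↭ s (prep x p)     = cong (λ z → s x ℤ.+ z) (sumOver-↭ s p)
sumOver-↭ s {x ∷ y ∷ xs} (swap x y p) = trans (cong (λ z → s x ℤ.+ (s y ℤ.+ z)) (sumOver-↭ s p))
  (ℤR.solve (s x ∷ s y ∷ _ ∷ []) (λ { (a ∷ b ∷ c ∷ []) → a :+ (b :+ c) , b :+ (a :+ c) }) refl)
sumOver-↭ s (↭-trans p q)  = trans (sumOver-↭ s p) (sumOver-↭ s q)

sumOver-cong : {A : Set} {s s′ : A → ℤ} (xs : List A) → (∀ {a} → a ∈ xs → s a ≡ s′ a) → sumOver s xs ≡ sumOver s′ xs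
sumOver-cong []       p = refl
sumOver-cong (x ∷ xs) p = cong₂ ℤ._+_ (p (here refl)) (sumOver-cong xs (p ∘ there))

sumOver-map : {A B : Set} (s : B → ℤ) (f : A → B) (xs : List A) → sumOver s (map f xs) ≡ sumOver (s ∘ f) xs
sumOver-map s f []       = refl
sumOver-map s f (x ∷ xs) = cong (λ z → s (f x) ℤ.+ z) (sumOver-map s f xs)

sumOver-++ : {A : Set} (s : A → ℤ) (xs ys : List A) → sumOver s (xs ++ ys) ≡ sumOver s xs ℤ.+ sumOver s ys
sumOver-++ s []       ys = sym (ℤₚ.+-identityˡ _)
sumOver-++ s (x ∷ xs) ys = trans (cong (λ z → s x ℤ.+ z) (sumOver-++ s xs ys)) (sym (ℤₚ.+-assoc (s x) _ _))

sumOver-+ : {A : Set} (s s′ : A → ℤ) (xs : List A) → sumOver (λ a → s a ℤ.+ s′ a) xs ≡ sumOver s xs ℤ.+ sumOver s′ xs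
sumOver-+ s s′ []       = refl
sumOver-+ s s′ (x ∷ xs) = trans (cong (λ z → s x ℤ.+ s′ x ℤ.+ z) (sumOver-+ s s′ xs))
  (ℤR.solve (s x ∷ s′ x ∷ sumOver s xs ∷ sumOver s′ xs ∷ [])
    (λ { (a ∷ b ∷ c ∷ d ∷ []) → a :+ b :+ (c :+ d) , a :+ c :+ (b :+ d) }) refl)

sumOver-scale : {A : Set} (c : ℤ) (s : A → ℤ) (xs : List A) → sumOver (λ a → c ℤ.* s a) xs ≡ c ℤ.* sumOver s xs
sumOver-scale c s []       = sym (ℤₚ.*-zeroʳ c)
sumOver-scale c s (x ∷ xs) = trans (cong (λ z → c ℤ.* s x ℤ.+ z) (sumOver-scale c s xs)) (sym (ℤₚ.*-distribˡ-+ c (s x) _))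

unique-map : {A B : Set} (f : A → B) {xs : List A} → (∀ {a a′} → a ∈ xs → a′ ∈ xs → f a ≡ f a′ → a ≡ a′) →
  Unique xs → Unique (map f xs)
unique-map f {[]}     inj []          = []
unique-map f {x ∷ xs} inj (x∉xs ∷ us) = All.map⁺ (All.tabulate λ {y} y∈xs fx≡fy →
    All.lookup x∉xs y∈xs (inj (here refl) (there y∈xs) fx≡fy))
  ∷ unique-map f (λ p q → inj (there p) (there q)) us

sumOver-set : {A : Set} (s : A → ℤ) {xs ys : List A} → Unique xs → Unique ys →
  (∀ {a} → a ∈ xs → a ∈ ys) → (∀ {a} → a ∈ ys → a ∈ xs) → sumOver s xs ≡ sumOver s ys
sumOver-set s u v p q = sumOver-↭ s (∼bag⇒↭ (unique∧set⇒bag u v (mk⇔ p q)))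

module _ {A B : Set} {P : A → Set} {Q : B → Set} {w : A → ℕ} {v : B → ℕ}
  (Φ : Fibres P w) (Ψ : Fibres Q v) (s : A → ℤ) (s′ : B → ℤ) where

  -- The bijection may depend on the degree.
  gen-bijection : (f : ℕ → A → B) →
    (∀ n a → P a → w a ≡ n → Q (f n a) × v (f n a) ≡ n × s a ≡ s′ (f n a)) →
    (∀ n a a′ → P a → w a ≡ n → P a′ → w a′ ≡ n → f n a ≡ f n a′ → a ≡ a′) →
    (∀ n b → Q b → v b ≡ n → ∃ λ a → P a × w a ≡ n × f n a ≡ b) →
    gen Φ s ≈ gen Ψ s′
  gen-bijection f into inj onto = coeffs λ n → begin
    gen Φ s n                             ≡⟨ coeff-gen Φ s n ⟩
    sumOver s (fibre Φ n)                 ≡⟨ sumOver-cong (fibre Φ n) (λ a∈ → let (p , e) = sound Φ a∈ in proj₂ (proj₂ (into n _ p e))) ⟩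
    sumOver (s′ ∘ f n) (fibre Φ n)        ≡⟨ sym (sumOver-map s′ (f n) (fibre Φ n)) ⟩
    sumOver s′ (map (f n) (fibre Φ n))    ≡⟨ sumOver-set s′
        (unique-map (f n) (λ a∈ a′∈ → let (p , e) = sound Φ a∈ ; (p′ , e′) = sound Φ a′∈ in inj n _ _ p e p′ e′) (unique Φ n))
        (unique Ψ n) (fwd n) (bwd n) ⟩
    sumOver s′ (fibre Ψ n)                ≡⟨ sym (coeff-gen Ψ s′ n) ⟩
    gen Ψ s′ n                            ∎
    where
    open ≡-Reasoning
    fwd : ∀ n {b} → b ∈ map (f n) (fibre Φ n) → b ∈ fibre Ψ n
    fwd n b∈ with ∈-map⁻ (f n) b∈
    ... | a , a∈ , refl = let (p , e) = sound Φ a∈ ; (q , e′ , _) = into n a p e in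
      subst (λ m → f n a ∈ fibre Ψ m) e′ (complete Ψ q)
    bwd : ∀ n {b} → b ∈ fibre Ψ n → b ∈ map (f n) (fibre Φ n)
    bwd n {b} b∈ with sound Ψ b∈
    ... | q , e with onto n b q e
    ... | a , p , e′ , refl = ∈-map⁺ (f n) (subst (λ m → a ∈ fibre Φ m) e′ (complete Φ p))

gen-cong : {A : Set} {P : A → Set} {w : A → ℕ} (Φ : Fibres P w) {s s′ : A → ℤ} → (∀ a → P a → s a ≡ s′ a) → gen Φ s ≈ gen Φ s′
gen-cong Φ {s} {s′} p = coeffs λ n → trans (coeff-gen Φ s n)
  (trans (sumOver-cong (fibre Φ n) (λ a∈ → p _ (proj₁ (sound Φ a∈)))) (sym (coeff-gen Φ s′ n)))

gen-+ : {A : Set} {P : A → Set} {w : A → ℕ} (Φ : Fibres P w) (s s′ : A → ℤ) → gen Φ (λ a → s a ℤ.+ s′ a) ≈ gen Φ s + gen Φ s′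
gen-+ Φ s s′ = coeffs λ n → trans (coeff-gen Φ _ n) (trans (sumOver-+ s s′ (fibre Φ n))
  (sym (trans (coeff-+ _ _ n) (cong₂ ℤ._+_ (coeff-gen Φ s n) (coeff-gen Φ s′ n)))))

gen-scale : {A : Set} {P : A → Set} {w : A → ℕ} (Φ : Fibres P w) (c : ℤ) (s : A → ℤ) → gen Φ (λ a → c ℤ.* s a) ≈ const c * gen Φ s
gen-scale Φ c s = coeffs λ n → trans (coeff-gen Φ _ n) (trans (sumOver-scale c s (fibre Φ n))
  (sym (trans (coeff-const-* c _ n) (cong (c ℤ.*_) (coeff-gen Φ s n)))))

Always : {A : Set} → A → Set
Always _ = ⊤

gen-iso : {A B : Set} {w : A → ℕ} {v : B → ℕ} (Φ : Fibres Always w) (Ψ : Fibres Always v) {s : A → ℤ} {s′ : B → ℤ}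
  (f : A → B) (g : B → A) → (∀ a → g (f a) ≡ a) → (∀ b → f (g b) ≡ b) →
  (∀ a → v (f a) ≡ w a) → (∀ a → s a ≡ s′ (f a)) → gen Φ s ≈ gen Ψ s′
gen-iso {v = v} Φ Ψ {s} {s′} f g gf fg wt weight = gen-bijection Φ Ψ s s′ (λ _ → f)
  (λ n a _ e → tt , trans (wt a) e , weight a)
  (λ n a a′ _ _ _ _ e → trans (sym (gf a)) (trans (cong g e) (gf a′)))
  (λ n b _ e → g b , tt , trans (sym (wt (g b))) (trans (cong v (fg b)) e) , fg b)

infixr 6 _⊎ᶠ_
infixr 7 _×ᶠ_

_×ᶠ_ : {A B : Set} {P : A → Set} {Q : B → Set} {w : A → ℕ} {v : B → ℕ} → Fibres P w → Fibres Q v →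
  Fibres (λ (ab : A × B) → P (proj₁ ab) × Q (proj₂ ab)) (λ ab → w (proj₁ ab) ℕ.+ v (proj₂ ab))
_×ᶠ_ {A} {B} {P} {Q} {w} {v} Φ Ψ = record { fibre = fib ; unique = uniq ; sound = snd ; complete = comp }
  where
  piece : ℕ → ℕ → List (A × B)
  piece n k = List.cartesianProduct (fibre Φ k) (fibre Ψ (n ℕ.∸ k))
  fib : ℕ → List (A × B)
  fib n = List.concat (applyUpTo (piece n) (suc n))
  piece⁻ : ∀ n k {ab} → ab ∈ piece n k → (P (proj₁ ab) × Q (proj₂ ab)) × w (proj₁ ab) ≡ k × v (proj₂ ab) ≡ n ℕ.∸ k
  piece⁻ n k ab∈ with ∈-cartesianProduct⁻ (fibre Φ k) (fibre Ψ (n ℕ.∸ k)) ab∈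
  ... | a∈ , b∈ = (proj₁ (sound Φ a∈) , proj₁ (sound Ψ b∈)) , proj₂ (sound Φ a∈) , proj₂ (sound Ψ b∈)
  uniq : ∀ n → Unique (fib n)
  uniq n = Unique.concat⁺ (All.applyUpTo⁺₁ (piece n) (suc n) (λ {k} _ → Unique.cartesianProduct⁺ (unique Φ k) (unique Ψ (n ℕ.∸ k))))
    (AllPairs.applyUpTo⁺₁ (piece n) (suc n) λ {i} {j} i<j _ (p , q) →
      ℕₚ.<⇒≢ i<j (trans (sym (proj₁ (proj₂ (piece⁻ n i p)))) (proj₁ (proj₂ (piece⁻ n j q)))))
  snd : ∀ {n ab} → ab ∈ fib n → (P (proj₁ ab) × Q (proj₂ ab)) × w (proj₁ ab) ℕ.+ v (proj₂ ab) ≡ n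
  snd {n} ab∈ with ∈-concat⁻′ (applyUpTo (piece n) (suc n)) ab∈
  ... | xs , ab∈xs , xs∈ with ∈-applyUpTo⁻ (piece n) xs∈
  ... | k , s≤s k≤n , refl with piece⁻ n k ab∈xs
  ... | pq , e , e′ = pq , trans (cong₂ ℕ._+_ e e′) (ℕₚ.m+[n∸m]≡n k≤n)
  comp : ∀ {ab} → P (proj₁ ab) × Q (proj₂ ab) → ab ∈ fib (w (proj₁ ab) ℕ.+ v (proj₂ ab))
  comp {a , b} (p , q) = ∈-concat⁺′ (∈-cartesianProduct⁺ (complete Φ p)
      (subst (λ m → b ∈ fibre Ψ m) (sym (ℕₚ.m+n∸m≡n (w a) (v b))) (complete Ψ q)))
    (∈-applyUpTo⁺ (piece (w a ℕ.+ v b)) (s≤s (ℕₚ.m≤m+n (w a) (v b))))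

sumOver-cartesian : {A B : Set} (s : A → ℤ) (t : B → ℤ) (xs : List A) (ys : List B) →
  sumOver (λ ab → s (proj₁ ab) ℤ.* t (proj₂ ab)) (List.cartesianProduct xs ys) ≡ sumOver s xs ℤ.* sumOver t ys
sumOver-cartesian s t []       ys = refl
sumOver-cartesian {A} {B} s t (x ∷ xs) ys = trans (sumOver-++ st (map (x ,_) ys) _)
  (trans (cong₂ ℤ._+_ (trans (sumOver-map st (x ,_) ys) (sumOver-scale (s x) t ys)) (sumOver-cartesian s t xs ys))
    (sym (ℤₚ.*-distribʳ-+ (sumOver t ys) (s x) (sumOver s xs))))
  where
  st : A × B → ℤ
  st ab = s (proj₁ ab) ℤ.* t (proj₂ ab)

sumOver-concat : {A : Set} (s : A → ℤ) (f : ℕ → List A) (m : ℕ) →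
  sumOver s (List.concat (applyUpTo f m)) ≡ sumℤ (applyUpTo (λ k → sumOver s (f k)) m)
sumOver-concat s f zero    = refl
sumOver-concat s f (suc m) = trans (sumOver-++ s (f 0) _) (cong (λ z → sumOver s (f 0) ℤ.+ z) (sumOver-concat s (f ∘ suc) m))

sumℤ-applyUpTo-cong : ∀ {f g : ℕ → ℤ} m → (∀ k → f k ≡ g k) → sumℤ (applyUpTo f m) ≡ sumℤ (applyUpTo g m)
sumℤ-applyUpTo-cong zero    p = refl
sumℤ-applyUpTo-cong (suc m) p = cong₂ ℤ._+_ (p 0) (sumℤ-applyUpTo-cong m (p ∘ suc))

gen-× : {A B : Set} {P : A → Set} {Q : B → Set} {w : A → ℕ} {v : B → ℕ} (Φ : Fibres P w) (Ψ : Fibres Q v)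
  (s : A → ℤ) (t : B → ℤ) → gen (Φ ×ᶠ Ψ) (λ ab → s (proj₁ ab) ℤ.* t (proj₂ ab)) ≈ gen Φ s * gen Ψ t
gen-× Φ Ψ s t = coeffs λ n → trans (coeff-gen (Φ ×ᶠ Ψ) _ n) (trans (sumOver-concat (λ ab → s (proj₁ ab) ℤ.* t (proj₂ ab)) (λ k → List.cartesianProduct (fibre Φ k) (fibre Ψ (n ℕ.∸ k))) (suc n))
  (trans (sumℤ-applyUpTo-cong (suc n) (λ k → trans (sumOver-cartesian s t (fibre Φ k) (fibre Ψ (n ℕ.∸ k)))
      (sym (cong₂ ℤ._*_ (coeff-gen Φ s k) (coeff-gen Ψ t (n ℕ.∸ k))))))
    (sym (trans (at-degree (*≈⊗ (gen Φ s) (gen Ψ t)) n) (⊗≡conv (gen Φ s) (gen Ψ t) n)))))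

_⊎ᶠ_ : {A B : Set} {P : A → Set} {Q : B → Set} {w : A → ℕ} {v : B → ℕ} → Fibres P w → Fibres Q v →
  Fibres Sum.[ P , Q ] Sum.[ w , v ]
_⊎ᶠ_ {A} {B} {P} {Q} {w} {v} Φ Ψ = record { fibre = fib ; unique = uniq ; sound = snd ; complete = comp }
  where
  fib : ℕ → List (A ⊎ B)
  fib n = map inj₁ (fibre Φ n) ++ map inj₂ (fibre Ψ n)
  uniq : ∀ n → Unique (fib n)
  uniq n = Unique.++⁺ (unique-map inj₁ (λ { _ _ refl → refl }) (unique Φ n)) (unique-map inj₂ (λ { _ _ refl → refl }) (unique Ψ n))
    λ (p , q) → case ∈-map⁻ inj₁ p , ∈-map⁻ inj₂ q of λ { ((_ , _ , refl) , (_ , _ , ())) }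
  snd : ∀ {n x} → x ∈ fib n → Sum.[ P , Q ] x × Sum.[ w , v ] x ≡ n
  snd {n} x∈ with ∈-++⁻ (map inj₁ (fibre Φ n)) x∈
  ... | inj₁ p with ∈-map⁻ inj₁ p
  ...   | a , a∈ , refl = sound Φ a∈
  snd {n} x∈ | inj₂ p with ∈-map⁻ inj₂ p
  ...   | b , b∈ , refl = sound Ψ b∈
  comp : ∀ {x} → Sum.[ P , Q ] x → x ∈ fib (Sum.[ w , v ] x)
  comp {inj₁ a} p = ∈-++⁺ˡ (∈-map⁺ inj₁ (complete Φ p))
  comp {inj₂ b} q = ∈-++⁺ʳ (map inj₁ (fibre Φ (v b))) (∈-map⁺ inj₂ (complete Ψ q))

gen-⊎ : {A B : Set} {P : A → Set} {Q : B → Set} {w : A → ℕ} {v : B → ℕ} (Φ : Fibres P w) (Ψ : Fibres Q v)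
  (s : A → ℤ) (t : B → ℤ) → gen (Φ ⊎ᶠ Ψ) Sum.[ s , t ] ≈ gen Φ s + gen Ψ t
gen-⊎ Φ Ψ s t = coeffs λ n → trans (coeff-gen (Φ ⊎ᶠ Ψ) _ n) (trans (sumOver-++ Sum.[ s , t ] (map inj₁ (fibre Φ n)) (map inj₂ (fibre Ψ n)))
  (trans (cong₂ ℤ._+_ (trans (sumOver-map _ inj₁ (fibre Φ n)) (sym (coeff-gen Φ s n)))
                      (trans (sumOver-map _ inj₂ (fibre Ψ n)) (sym (coeff-gen Ψ t n))))
    (sym (coeff-+ _ _ n))))

shift : {A : Set} {P : A → Set} {w : A → ℕ} (m : ℕ) → Fibres P w → Fibres P (λ a → m ℕ.+ w a)
shift {A} {P} {w} m Φ = record { fibre = fib ; unique = uniq ; sound = snd ; complete = comp }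
  where
  fib : ℕ → List A
  fib n = if m ℕ.≤ᵇ n then fibre Φ (n ℕ.∸ m) else []
  uniq : ∀ n → Unique (fib n)
  uniq n with m ℕ.≤ᵇ n
  ... | true  = unique Φ _
  ... | false = []
  snd : ∀ {n a} → a ∈ fib n → P a × m ℕ.+ w a ≡ n
  snd {n} a∈ with m ℕ.≤ᵇ n in eq
  ... | true = let (p , e) = sound Φ a∈ in p , trans (cong (m ℕ.+_) e) (ℕₚ.m+[n∸m]≡n (ℕₚ.≤ᵇ⇒≤ m n (subst T (sym eq) tt)))
  comp : ∀ {a} → P a → a ∈ fib (m ℕ.+ w a)
  comp {a} p with m ℕ.≤ᵇ (m ℕ.+ w a) in eq
  ... | true  = subst (λ k → a ∈ fibre Φ k) (sym (ℕₚ.m+n∸m≡n m (w a))) (complete Φ p)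
  ... | false = ⊥-elim (subst T eq (ℕₚ.≤⇒≤ᵇ (ℕₚ.m≤m+n m (w a))))

gen-shift : {A : Set} {P : A → Set} {w : A → ℕ} (m : ℕ) (Φ : Fibres P w) (s : A → ℤ) → gen (shift m Φ) s ≈ X^ m * gen Φ s
gen-shift m Φ s = ≈-trans (coeffs λ n → trans (coeff-gen (shift m Φ) s n) (go n)) (qpow≈ m (gen Φ s))
  where
  go : ∀ n → sumOver s (fibre (shift m Φ) n) ≡ qpow m (gen Φ s) n
  go n with m ℕ.≤ᵇ n
  ... | true  = sym (coeff-gen Φ s (n ℕ.∸ m))
  ... | false = refl

dilate : {A : Set} {P : A → Set} {w : A → ℕ} (d : ℕ) .{{_ : NonZero d}} → Fibres P w → Fibres P (λ a → w a ℕ.* d)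
dilate {A} {P} {w} d Φ = record { fibre = fib ; unique = uniq ; sound = snd ; complete = comp }
  where
  fib : ℕ → List A
  fib n = if n % d ℕ.≡ᵇ 0 then fibre Φ (n / d) else []
  uniq : ∀ n → Unique (fib n)
  uniq n with n % d ℕ.≡ᵇ 0
  ... | true  = unique Φ _
  ... | false = []
  snd : ∀ {n a} → a ∈ fib n → P a × w a ℕ.* d ≡ n
  snd {n} a∈ with n % d ℕ.≡ᵇ 0 in eq
  ... | true = let (p , e) = sound Φ a∈ in p , trans (cong (ℕ._* d) e) (sym (trans (DM.m≡m%n+[m/n]*n n d)
                 (cong (ℕ._+ n / d ℕ.* d) (ℕₚ.≡ᵇ⇒≡ (n % d) 0 (subst T (sym eq) tt)))))
  comp : ∀ {a} → P a → a ∈ fib (w a ℕ.* d)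
  comp {a} p = go (DM.m*n%n≡0 (w a) d) (DM.m*n/n≡m (w a) d)
    where
    go : ∀ {r q} → r ≡ 0 → q ≡ w a → a ∈ (if r ℕ.≡ᵇ 0 then fibre Φ q else [])
    go refl refl = complete Φ p

gen-dilate : {A : Set} {P : A → Set} {w : A → ℕ} (d : ℕ) .{{_ : NonZero d}} (Φ : Fibres P w) (s : A → ℤ) → gen (dilate d Φ) s ≈ dil d (gen Φ s)
gen-dilate d Φ s = ≈-trans (coeffs λ n → trans (coeff-gen (dilate d Φ) s n) (go n)) (at≈dil d (gen Φ s))
  where
  go : ∀ n → sumOver s (fibre (dilate d Φ) n) ≡ at d (gen Φ s) n
  go n with n % d ℕ.≡ᵇ 0
  ... | true  = sym (coeff-gen Φ s (n / d))
  ... | false = refl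

restrict : {A : Set} {P Q : A → Set} {w : A → ℕ} → (∀ a → Dec (Q a)) → Fibres P w → Fibres (λ a → P a × Q a) w
restrict Q? Φ = record
  { fibre = λ n → filter Q? (fibre Φ n)
  ; unique = λ n → Unique.filter⁺ Q? (unique Φ n)
  ; sound = λ a∈ → let (a∈′ , q) = ∈-filter⁻ Q? a∈ ; (p , e) = sound Φ a∈′ in (p , q) , e
  ; complete = λ (p , q) → ∈-filter⁺ Q? (complete Φ p) q }

-- A weight that dominates the size of its argument confines the elements of weight n to a finite
-- box, from which they are filtered.
bounded : {A : Set} (box : ℕ → List A) (w : A → ℕ) → (∀ n → Unique (box n)) → (∀ a → a ∈ box (w a)) → Fibres Always w
bounded box w u c = record
  { fibre = λ n → filter (λ a → w a ℕ.≟ n) (box n)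
  ; unique = λ n → Unique.filter⁺ (λ a → w a ℕ.≟ n) (u n)
  ; sound = λ {n} a∈ → tt , proj₂ (∈-filter⁻ (λ a → w a ℕ.≟ n) {xs = box n} a∈)
  ; complete = λ {a} _ → ∈-filter⁺ (λ b → w b ℕ.≟ w a) (c a) refl }

ℕ-fibres : (w : ℕ → ℕ) → (∀ k → k ℕ.≤ w k) → Fibres Always w
ℕ-fibres w le = bounded (λ n → upTo (suc n)) w (λ n → Unique.upTo⁺ (suc n)) (λ k → ∈-upTo⁺ (s≤s (le k)))

interval : ℕ → List ℤ
interval n = map +_ (upTo (suc n)) ++ map -[1+_] (upTo n)

ℤ-fibres : (w : ℤ → ℕ) → (∀ z → ℤ.∣ z ∣ ℕ.≤ w z) → Fibres Always w
ℤ-fibres w le = bounded interval w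
  (λ n → Unique.++⁺ (unique-map +_ (λ { _ _ refl → refl }) (Unique.upTo⁺ (suc n))) (unique-map -[1+_] (λ { _ _ refl → refl }) (Unique.upTo⁺ n))
    λ (p , q) → case ∈-map⁻ +_ p , ∈-map⁻ -[1+_] q of λ { ((_ , _ , refl) , (_ , _ , ())) })
  λ { (+ k) → ∈-++⁺ˡ (∈-map⁺ +_ (∈-upTo⁺ (s≤s (le (+ k)))))
    ; -[1+ k ] → ∈-++⁺ʳ (map +_ (upTo (suc (w -[1+ k ])))) (∈-map⁺ -[1+_] (∈-upTo⁺ (le -[1+ k ]))) }

-- Partitions as 0-1 words: a bead at position x is a part equal to the number of gaps below x.

falses trues : (ℕ → Bool) → ℕ → ℕ
falses b zero    = 0
falses b (suc L) = if b L then falses b L else suc (falses b L)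
trues b zero    = 0
trues b (suc L) = if b L then suc (trues b L) else trues b L

infixr 5 _∷⁺_
-- A bead without gaps below it would be a part zero; such parts are dropped.
_∷⁺_ : ℕ → List ℕ → List ℕ
zero  ∷⁺ xs = xs
suc k ∷⁺ xs = suc k ∷ xs

parts : (ℕ → Bool) → ℕ → List ℕ
parts b zero    = []
parts b (suc L) = if b L then falses b L ∷⁺ parts b L else parts b L

falses+trues : ∀ b L → falses b L ℕ.+ trues b L ≡ L
falses+trues b zero = refl
falses+trues b (suc L) with b L
... | true  = trans (ℕₚ.+-suc (falses b L) (trues b L)) (cong suc (falses+trues b L))
... | false = cong suc (falses+trues b L)

T∧ : ∀ {a b} → T a → T b → T (a ∧ b)
T∧ {true} _ q = q

∧T : ∀ {a b} → T (a ∧ b) → T a × T b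
∧T {true} q = tt , q

data Descending : ℕ → List ℕ → Set where
  []  : ∀ {m} → Descending m []
  _∷_ : ∀ {m y ys} → 1 ℕ.≤ y × y ℕ.≤ m → Descending y ys → Descending m (y ∷ ys)

descending-mono : ∀ {m n λs} → m ℕ.≤ n → Descending m λs → Descending n λs
descending-mono m≤n []                = []
descending-mono m≤n ((p , q) ∷ d) = (p , ℕₚ.≤-trans q m≤n) ∷ d

parts-descending : ∀ b L → Descending (falses b L) (parts b L)
parts-descending b zero = []
parts-descending b (suc L) with b L
... | false = descending-mono (ℕₚ.n≤1+n _) (parts-descending b L)
... | true with falses b L | parts-descending b L
...   | zero  | d = d
...   | suc k | d = (s≤s z≤n , ℕₚ.≤-refl) ∷ d

descending⇒nonIncreasing : ∀ {m λs} → Descending m λs → T (nonIncreasing λs)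
descending⇒nonIncreasing [] = tt
descending⇒nonIncreasing (_ ∷ []) = tt
descending⇒nonIncreasing (_ ∷ d@((_ , q) ∷ _)) = T∧ (ℕₚ.≤⇒≤ᵇ q) (descending⇒nonIncreasing d)

descending⇒positive : ∀ {m λs} → Descending m λs → T (allB (1 ℕ.≤ᵇ_) λs)
descending⇒positive [] = tt
descending⇒positive ((p , _) ∷ d) = T∧ (ℕₚ.≤⇒≤ᵇ p) (descending⇒positive d)

head₀ : List ℕ → ℕ
head₀ []      = 0
head₀ (y ∷ _) = y

⇒descending : ∀ λs → T (nonIncreasing λs) → T (allB (1 ℕ.≤ᵇ_) λs) → Descending (head₀ λs) λs
⇒descending [] _ _ = []
⇒descending (y ∷ []) _ q = (ℕₚ.≤ᵇ⇒≤ 1 y (proj₁ (∧T {1 ℕ.≤ᵇ y} q)) , ℕₚ.≤-refl) ∷ []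
⇒descending (y ∷ z ∷ zs) p q =
  (ℕₚ.≤ᵇ⇒≤ 1 y (proj₁ (∧T {1 ℕ.≤ᵇ y} q)) , ℕₚ.≤-refl) ∷
  descending-mono (ℕₚ.≤ᵇ⇒≤ z y (proj₁ (∧T {z ℕ.≤ᵇ y} p)))
    (⇒descending (z ∷ zs) (proj₂ (∧T {z ℕ.≤ᵇ y} p)) (proj₂ (∧T {1 ℕ.≤ᵇ y} q)))

no-falses : ∀ b L → falses b L ≡ 0 → parts b L ≡ []
no-falses b L e with parts b L | parts-descending b L
... | []     | _ = refl
... | y ∷ ys | (p , q) ∷ _ = contradiction (ℕₚ.≤-trans p (subst (y ℕ.≤_) e q)) λ ()

-- The sign (-1)^n.
pm : ℕ → ℤ
pm zero    = + 1
pm (suc n) = - pm n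

pm-+ : ∀ m n → pm (m ℕ.+ n) ≡ pm m ℤ.* pm n
pm-+ zero    n = sym (ℤₚ.*-identityˡ (pm n))
pm-+ (suc m) n = trans (cong -_ (pm-+ m n)) (ℤₚ.neg-distribˡ-* (pm m) (pm n))

pm² : ∀ n → pm n ℤ.* pm n ≡ + 1
pm² zero    = refl
pm² (suc n) = trans (ℤR.solve (pm n ∷ []) (λ { (a ∷ []) → :neg a :* :neg a , a :* a }) refl) (pm² n)

par-pm : ∀ n → + 2 ℤ.* par n ≡ + 1 ℤ.- pm n
par-pm zero          = refl
par-pm (suc zero)    = refl
par-pm (suc (suc n)) = trans (cong (+ 2 ℤ.*_) (cong (λ r → if r ℕ.≡ᵇ 1 then + 1 else + 0)
    (trans (cong (_% 2) (ℕₚ.+-comm 2 n)) (DM.[m+n]%n≡m%n n 2))))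
  (trans (par-pm n) (cong (λ z → + 1 ℤ.- z) (sym (ℤₚ.neg-involutive (pm n)))))

bgRankFrom-false : ∀ λs → bgRankFrom false λs ≡ - bgRankFrom true λs
bgRankFrom-false []       = refl
bgRankFrom-false (x ∷ xs) = trans (cong (λ z → - par x ℤ.+ z)
    (trans (sym (ℤₚ.neg-involutive (bgRankFrom true xs))) (cong -_ (sym (bgRankFrom-false xs)))))
  (sym (ℤₚ.neg-distrib-+ (par x) (bgRankFrom false xs)))

bgRank-∷⁺ : ∀ b L → bgRank (falses b L ∷⁺ parts b L) ≡ par (falses b L) ℤ.- bgRank (parts b L)
bgRank-∷⁺ b L with falses b L in eq
... | suc k = cong (λ z → par (suc k) ℤ.+ z) (bgRankFrom-false (parts b L))
... | zero rewrite no-falses b L eq = refl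

sumℕ-∷⁺ : ∀ k xs → sumℕ (k ∷⁺ xs) ≡ k ℕ.+ sumℕ xs
sumℕ-∷⁺ zero    xs = refl
sumℕ-∷⁺ (suc k) xs = refl

beadSum : (ℕ → ℤ) → (ℕ → Bool) → ℕ → ℤ
beadSum g b zero    = + 0
beadSum g b (suc L) = (if b L then g L else + 0) ℤ.+ beadSum g b L

trues-beadSum : ∀ b L → + trues b L ≡ beadSum (λ _ → + 1) b L
trues-beadSum b zero = refl
trues-beadSum b (suc L) with b L
... | true  = cong (λ z → + 1 ℤ.+ z) (trues-beadSum b L)
... | false = trans (trues-beadSum b L) (sym (ℤₚ.+-identityˡ _))

-- The part of a bead at position x is x minus the number of beads below it. For t beads these
-- numbers add up to t(t - 1)/2.
size-formula : ∀ b L → + 2 ℤ.* + sumℕ (parts b L) ℤ.+ + trues b L ℤ.* + trues b L ≡ + 2 ℤ.* beadSum +_ b L ℤ.+ + trues b L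
size-formula b zero = refl
size-formula b (suc L) with b L
... | false = trans (size-formula b L) (cong (λ z → + 2 ℤ.* z ℤ.+ + trues b L) (sym (ℤₚ.+-identityˡ (beadSum +_ b L))))
... | true = trans (cong (λ z → + 2 ℤ.* + z ℤ.+ + suc t ℤ.* + suc t) (sumℕ-∷⁺ f (parts b L))) (-≡0⇒≡ (trans
      (ℤR.solve (+ f ∷ + t ∷ + L ∷ + sumℕ (parts b L) ∷ beadSum +_ b L ∷ [])
        (λ { (f ∷ t ∷ l ∷ s ∷ q ∷ []) →
          2 · (f :+ s) :+ (con (+ 1) :+ t) :* (con (+ 1) :+ t) :- (2 · (l :+ q) :+ (con (+ 1) :+ t)) ,
          1 · (2 · s :+ t :* t :- (2 · q :+ t)) :+ 2 · (f :+ t :- l) }) refl)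
      ((+ 1) ⊙ᶻ size-formula b L ⊞ᶻ (+ 2) ⊙ᶻ cong +_ (falses+trues b L))))
  where
  f = falses b L
  t = trues b L

-- Adding a bead with f gaps below it changes the rank r into `par f - r`, which explains the sign
-- `pm (trues b L)`. The position is f plus the number of beads below, so parities of parts turn
-- into parities of positions.
bgRank-formula : ∀ b L → + 4 ℤ.* bgRank (parts b L) ≡ pm (trues b L) ℤ.* (+ 2 ℤ.* beadSum pm b L ℤ.- + 1) ℤ.+ + 1
bgRank-formula b zero = refl
bgRank-formula b (suc L) with b L
... | false = trans (bgRank-formula b L) (cong (λ z → pm (trues b L) ℤ.* (+ 2 ℤ.* z ℤ.- + 1) ℤ.+ + 1) (sym (ℤₚ.+-identityˡ (beadSum pm b L))))
... | true = -≡0⇒≡ (trans (cong (λ z → + 4 ℤ.* z ℤ.- rhs) (bgRank-∷⁺ b L)) (trans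
      (ℤR.solve (par (falses b L) ∷ bgRank (parts b L) ∷ pm (trues b L) ∷ pm L ∷ pm (falses b L) ∷ beadSum pm b L ∷ [])
        (λ { (r ∷ g ∷ t ∷ l ∷ f ∷ d ∷ []) →
          4 · (r :- g) :- (:neg t :* (2 · (l :+ d) :- con (+ 1)) :+ con (+ 1)) ,
          2 · (2 · r :- (con (+ 1) :- f)) :+ con (- + 1) :* (4 · g :- (t :* (2 · d :- con (+ 1)) :+ con (+ 1)))
            :+ 2 · t :* (l :- f :* t) :+ 2 · f :* (t :* t :- con (+ 1)) }) refl)
      ((+ 2) ⊙ᶻ par-pm (falses b L) ⊞ᶻ (- + 1) ⊙ᶻ bgRank-formula b L
        ⊞ᶻ (+ 2 ℤ.* pm (trues b L)) ⊙ᶻ trans (cong pm (sym (falses+trues b L))) (pm-+ (falses b L) (trues b L))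
        ⊞ᶻ (+ 2 ℤ.* pm (falses b L)) ⊙ᶻ pm² (trues b L))))
  where
  rhs = - pm (trues b L) ℤ.* (+ 2 ℤ.* (pm L ℤ.+ beadSum pm b L) ℤ.- + 1) ℤ.+ + 1

-- Hook lengths of parts b L are the distances from a bead down to a gap.

T⇒≡ : ∀ {b} → T b → b ≡ true
T⇒≡ {true} _ = refl

≡⇒T : ∀ {b} → b ≡ true → T b
≡⇒T refl = tt

conj-above : ∀ x xs j → j ℕ.< x → conj (x ∷ xs) j ≡ suc (conj xs j)
conj-above x xs j j<x with suc j ℕ.≤ᵇ x | ℕₚ.≤⇒≤ᵇ j<x
... | true | _ = refl

conj-bounded : ∀ {m λs} j → Descending m λs → m ℕ.≤ j → conj λs j ≡ 0
conj-bounded j [] _ = refl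
conj-bounded {m} {y ∷ ys} j ((p , y≤m) ∷ d) m≤j with suc j ℕ.≤ᵇ y in eq
... | true  = contradiction (ℕₚ.≤ᵇ⇒≤ (suc j) y (≡⇒T eq)) (ℕₚ.≤⇒≯ (ℕₚ.≤-trans y≤m m≤j))
... | false = conj-bounded j d (ℕₚ.≤-trans y≤m m≤j)

lookup-bounded : ∀ {m λs} i → Descending m λs → lookupℕ λs i ℕ.≤ m
lookup-bounded i       []             = z≤n
lookup-bounded zero    ((_ , q) ∷ d)  = q
lookup-bounded (suc i) ((_ , q) ∷ d)  = ℕₚ.≤-trans (lookup-bounded i d) q

rowHook : List ℕ → ℕ → ℕ → ℕ
rowHook xs x j = (x ℕ.∸ j) ℕ.+ conj xs j

hook-zero : ∀ x xs j → j ℕ.< x → hook (x ∷ xs) 0 j ≡ rowHook xs x j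
hook-zero x xs j j<x = trans (cong (λ c → suc ((x ℕ.∸ suc j) ℕ.+ (c ℕ.∸ 1))) (conj-above x xs j j<x))
  (cong (ℕ._+ conj xs j) (sym (ℕₚ.+-∸-assoc 1 j<x)))

hook-suc : ∀ x xs i j → j ℕ.< x → hook (x ∷ xs) (suc i) j ≡ hook xs i j
hook-suc x xs i j j<x = cong (λ c → suc ((lookupℕ xs i ℕ.∸ suc j) ℕ.+ (c ℕ.∸ suc (suc i)))) (conj-above x xs j j<x)

NoHook : ℕ → List ℕ → Set
NoHook t λs = ∀ i j → j ℕ.< lookupℕ λs i → hook λs i j ≢ t

allB⁻ : {A : Set} (p : A → Bool) (xs : List A) → T (allB p xs) → ∀ {x} → x ∈ xs → T (p x)
allB⁻ p (x ∷ xs) ok (here refl) = proj₁ (∧T {p x} ok)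
allB⁻ p (x ∷ xs) ok (there x∈)  = allB⁻ p xs (proj₂ (∧T {p x} ok)) x∈

allB⁺ : {A : Set} (p : A → Bool) (xs : List A) → (∀ {x} → x ∈ xs → T (p x)) → T (allB p xs)
allB⁺ p []       ok = tt
allB⁺ p (x ∷ xs) ok = T∧ (ok (here refl)) (allB⁺ p xs (ok ∘ there))

row : List ℕ → ℕ → List (ℕ × ℕ)
row λs i = map (i ,_) (upTo (lookupℕ λs i))

cells⁺ : ∀ λs i j → i ℕ.< length λs → j ℕ.< lookupℕ λs i → (i , j) ∈ cells λs
cells⁺ λs i j i< j< = ∈-concat⁺′ (∈-map⁺ (i ,_) (∈-upTo⁺ j<)) (∈-map⁺ (row λs) (∈-upTo⁺ i<))

cells⁻ : ∀ λs {c} → c ∈ cells λs → proj₂ c ℕ.< lookupℕ λs (proj₁ c)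
cells⁻ λs c∈ with ∈-concat⁻′ (map (row λs) (upTo (length λs))) c∈
... | xs , c∈xs , xs∈ with ∈-map⁻ (row λs) xs∈
... | i , _ , refl with ∈-map⁻ (i ,_) c∈xs
... | j , j∈ , refl = ∈-upTo⁻ j∈

lookup-nonzero : ∀ λs i {j} → j ℕ.< lookupℕ λs i → i ℕ.< length λs
lookup-nonzero (x ∷ xs) zero    _ = s≤s z≤n
lookup-nonzero (x ∷ xs) (suc i) p = s≤s (lookup-nonzero xs i p)

isCore⇒NoHook : ∀ t λs → T (isCore t λs) → NoHook t λs
isCore⇒NoHook t λs ok i j j< e = go (allB⁻ _ (cells λs) ok (cells⁺ λs i j (lookup-nonzero λs i j<) j<)) (ℕₚ.≡⇒≡ᵇ (hook λs i j) t e)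
  where
  go : ∀ {b} → T (not b) → T b → ⊥
  go {true} () _
  go {false} _ ()

NoHook⇒isCore : ∀ t λs → NoHook t λs → T (isCore t λs)
NoHook⇒isCore t λs nh = allB⁺ _ (cells λs) λ {c} c∈ → go (λ ok → nh (proj₁ c) (proj₂ c) (cells⁻ λs c∈) (ℕₚ.≡ᵇ⇒≡ _ t ok))
  where
  go : ∀ {b} → (T b → ⊥) → T (not b)
  go {true}  f = f tt
  go {false} f = tt

RowAvoids : ℕ → List ℕ → ℕ → Set
RowAvoids t xs x = ∀ j → j ℕ.< x → rowHook xs x j ≢ t

NoHook-∷⁺⁻ : ∀ t x xs → Descending x xs → NoHook t (x ∷⁺ xs) → RowAvoids t xs x × NoHook t xs
NoHook-∷⁺⁻ t zero    xs d nh = (λ _ ()) , nh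
NoHook-∷⁺⁻ t (suc x) xs d nh =
  (λ j j< e → nh 0 j j< (trans (hook-zero (suc x) xs j j<) e)) ,
  (λ i j j< e → nh (suc i) j j< (trans (hook-suc (suc x) xs i j (ℕₚ.<-≤-trans j< (lookup-bounded i d))) e))

NoHook-∷⁺⁺ : ∀ t x xs → Descending x xs → RowAvoids t xs x → NoHook t xs → NoHook t (x ∷⁺ xs)
NoHook-∷⁺⁺ t zero    xs d ra nh = nh
NoHook-∷⁺⁺ t (suc x) xs d ra nh zero    j j< e = ra j j< (trans (sym (hook-zero (suc x) xs j j<)) e)
NoHook-∷⁺⁺ t (suc x) xs d ra nh (suc i) j j< e =
  nh i j j< (trans (sym (hook-suc (suc x) xs i j (ℕₚ.<-≤-trans j< (lookup-bounded i d)))) e)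

conj-∷⁺ : ∀ x xs j → j ℕ.< x → conj (x ∷⁺ xs) j ≡ suc (conj xs j)
conj-∷⁺ (suc x) xs j j<x = conj-above (suc x) xs j j<x

-- Column j belongs to the gap with j gaps below it. Of the positions from this gap up to L,
-- `falses b L ∸ j` are gaps; the beads among them are the parts exceeding j, which `conj` counts.
gap-of-column : ∀ b L j → j ℕ.< falses b L → ∃ λ g → g ℕ.< L × b g ≡ false × g ℕ.+ rowHook (parts b L) (falses b L) j ≡ L
gap-of-column b (suc L) j j< with b L in eq
... | true with gap-of-column b L j j<
...   | g , g< , bg , e = g , ℕₚ.m<n⇒m<1+n g< , bg ,
        trans (cong (g ℕ.+_) (trans (cong ((falses b L ℕ.∸ j) ℕ.+_) (conj-∷⁺ (falses b L) (parts b L) j j<)) (ℕₚ.+-suc _ _)))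
          (trans (ℕₚ.+-suc g _) (cong suc e))
gap-of-column b (suc L) j (s≤s j≤) | false with ℕₚ.m≤n⇒m<n∨m≡n j≤
... | inj₂ refl = L , ℕₚ.≤-refl , eq ,
        trans (cong (L ℕ.+_) (trans (cong ((suc j ℕ.∸ j) ℕ.+_) (conj-bounded j (parts-descending b L) ℕₚ.≤-refl))
          (trans (ℕₚ.+-identityʳ _) (trans (ℕₚ.+-∸-assoc 1 (ℕₚ.≤-refl {j})) (cong suc (ℕₚ.n∸n≡0 j)))))) (ℕₚ.+-comm L 1)
... | inj₁ j< with gap-of-column b L j j<
...   | g , g< , bg , e = g , ℕₚ.m<n⇒m<1+n g< , bg ,
        trans (cong (λ z → g ℕ.+ (z ℕ.+ conj (parts b L) j)) (ℕₚ.+-∸-assoc 1 j≤)) (trans (ℕₚ.+-suc g _) (cong suc e))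

column-of-gap : ∀ b L g → g ℕ.< L → b g ≡ false → ∃ λ j → j ℕ.< falses b L × g ℕ.+ rowHook (parts b L) (falses b L) j ≡ L
column-of-gap b (suc L) g (s≤s g≤) bg with b L in eq
... | true with ℕₚ.m≤n⇒m<n∨m≡n g≤
...   | inj₂ refl = case trans (sym eq) bg of λ ()
...   | inj₁ g< with column-of-gap b L g g< bg
...     | j , j< , e = j , j< ,
        trans (cong (g ℕ.+_) (trans (cong ((falses b L ℕ.∸ j) ℕ.+_) (conj-∷⁺ (falses b L) (parts b L) j j<)) (ℕₚ.+-suc _ _)))
          (trans (ℕₚ.+-suc g _) (cong suc e))
column-of-gap b (suc L) g (s≤s g≤) bg | false with ℕₚ.m≤n⇒m<n∨m≡n g≤
... | inj₂ refl = falses b L , ℕₚ.≤-refl ,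
        trans (cong (L ℕ.+_) (trans (cong ((suc (falses b L) ℕ.∸ falses b L) ℕ.+_) (conj-bounded (falses b L) (parts-descending b L) ℕₚ.≤-refl))
          (trans (ℕₚ.+-identityʳ _) (trans (ℕₚ.+-∸-assoc 1 (ℕₚ.≤-refl {falses b L})) (cong suc (ℕₚ.n∸n≡0 (falses b L))))))) (ℕₚ.+-comm L 1)
... | inj₁ g< with column-of-gap b L g g< bg
...   | j , j< , e = j , ℕₚ.m<n⇒m<1+n j< ,
        trans (cong (λ z → g ℕ.+ (z ℕ.+ conj (parts b L) j)) (ℕₚ.+-∸-assoc 1 (ℕₚ.<⇒≤ j<))) (trans (ℕₚ.+-suc g _) (cong suc e))

-- No bead stands t places above a gap: the abacus criterion for t-cores, on the positions below L.
Closed : ℕ → (ℕ → Bool) → ℕ → Set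
Closed t b L = ∀ x → x ℕ.+ t ℕ.< L → b (x ℕ.+ t) ≡ true → b x ≡ true

core⇒closed : ∀ t .{{_ : NonZero t}} b L → NoHook t (parts b L) → Closed t b L
core⇒closed (suc t) b (suc L) nh x (s≤s x+t≤L) bx with b L in eq
... | false with ℕₚ.m≤n⇒m<n∨m≡n x+t≤L
...   | inj₁ x+t<L = core⇒closed (suc t) b L nh x x+t<L bx
...   | inj₂ refl  = case trans (sym eq) bx of λ ()
core⇒closed (suc t) b (suc L) nh x (s≤s x+t≤L) bx | true
  with NoHook-∷⁺⁻ (suc t) (falses b L) (parts b L) (parts-descending b L) nh | ℕₚ.m≤n⇒m<n∨m≡n x+t≤L
... | ra , nh′ | inj₁ x+t<L = core⇒closed (suc t) b L nh′ x x+t<L bx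
... | ra , nh′ | inj₂ refl with b x in bx′
...   | true = refl
...   | false with column-of-gap b L x (ℕₚ.m<m+n x (s≤s z≤n)) bx′
...     | j , j< , e = contradiction (ℕₚ.+-cancelˡ-≡ x _ _ e) (ra j j<)

closed⇒core : ∀ t b L → Closed t b L → NoHook t (parts b L)
closed⇒core t b zero cl i j ()
closed⇒core t b (suc L) cl with b L in eq
... | false = closed⇒core t b L (λ x x< → cl x (ℕₚ.m<n⇒m<1+n x<))
... | true  = NoHook-∷⁺⁺ t (falses b L) (parts b L) (parts-descending b L) avoids
                (closed⇒core t b L (λ x x< → cl x (ℕₚ.m<n⇒m<1+n x<)))
  where
  avoids : RowAvoids t (parts b L) (falses b L)
  avoids j j< e with gap-of-column b L j j<
  ... | g , g< , bg , e′ = case trans (sym bg) (cl g (subst (ℕ._< suc L) (sym g+t) ℕₚ.≤-refl) (trans (cong b g+t) eq)) of λ ()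
    where
    g+t : g ℕ.+ t ≡ L
    g+t = trans (cong (g ℕ.+_) (sym e)) e′

∷⁺-injective : ∀ k xs ys → k ∷⁺ xs ≡ k ∷⁺ ys → xs ≡ ys
∷⁺-injective zero    xs ys e    = e
∷⁺-injective (suc k) xs .xs refl = refl

∷⁺-too-big : ∀ k xs ys → Descending k ys → suc k ∷⁺ xs ≢ ys
∷⁺-too-big k xs .(suc k ∷ xs) ((_ , q) ∷ _) refl = ℕₚ.<-irrefl refl q

-- The number of beads has to agree, since prefixing a word with a bead and shifting it gives the
-- same partition. At the top a bead cannot face a gap: its part would exceed the number of gaps
-- available to the other word.
parts-injective : ∀ b b′ L → parts b L ≡ parts b′ L → trues b L ≡ trues b′ L → ∀ x → x ℕ.< L → b x ≡ b′ x
parts-injective b b′ (suc L) e t x (s≤s x≤L) with b L in eq | b′ L in eq′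
... | false | false with ℕₚ.m≤n⇒m<n∨m≡n x≤L
...   | inj₁ x<L  = parts-injective b b′ L e t x x<L
...   | inj₂ refl = trans eq (sym eq′)
parts-injective b b′ (suc L) e t x (s≤s x≤L) | true | true with ℕₚ.m≤n⇒m<n∨m≡n x≤L
...   | inj₂ refl = trans eq (sym eq′)
...   | inj₁ x<L  = parts-injective b b′ L (∷⁺-injective (falses b L) _ _ (trans e (cong (_∷⁺ parts b′ L) (sym f)))) (ℕₚ.suc-injective t) x x<L
  where
  f : falses b L ≡ falses b′ L
  f = ℕₚ.+-cancelʳ-≡ (trues b L) _ _ (trans (falses+trues b L) (trans (sym (falses+trues b′ L)) (cong (falses b′ L ℕ.+_) (sym (ℕₚ.suc-injective t)))))
parts-injective b b′ (suc L) e t x (s≤s x≤L) | true | false =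
  contradiction (trans (cong (_∷⁺ parts b L) f) e) (∷⁺-too-big (falses b′ L) (parts b L) (parts b′ L) (parts-descending b′ L))
  where
  f : suc (falses b′ L) ≡ falses b L
  f = ℕₚ.+-cancelʳ-≡ (trues b L) _ _ (trans (sym (ℕₚ.+-suc (falses b′ L) (trues b L))) (trans (cong (falses b′ L ℕ.+_) t)
        (trans (falses+trues b′ L) (sym (falses+trues b L)))))
parts-injective b b′ (suc L) e t x (s≤s x≤L) | false | true =
  contradiction (trans (cong (_∷⁺ parts b′ L) f) (sym e)) (∷⁺-too-big (falses b L) (parts b′ L) (parts b L) (parts-descending b L))
  where
  f : suc (falses b L) ≡ falses b′ L
  f = ℕₚ.+-cancelʳ-≡ (trues b′ L) _ _ (trans (sym (ℕₚ.+-suc (falses b L) (trues b′ L))) (trans (cong (falses b L ℕ.+_) (sym t))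
        (trans (falses+trues b L) (sym (falses+trues b′ L)))))

-- The word of a partition with N parts allowed.
beads : List ℕ → ℕ → ℕ → Bool
beads []       N       x = x ℕ.<ᵇ N
beads (y ∷ ys) zero    x = false
beads (y ∷ ys) (suc N) x = (x ℕ.≡ᵇ y ℕ.+ N) ∨ beads ys N x

<ᵇ-true : ∀ {x N} → x ℕ.< N → (x ℕ.<ᵇ N) ≡ true
<ᵇ-true x<N = T⇒≡ (ℕₚ.<⇒<ᵇ x<N)

<ᵇ-false : ∀ {x N} → N ℕ.≤ x → (x ℕ.<ᵇ N) ≡ false
<ᵇ-false {x} {N} N≤x with x ℕ.<ᵇ N in eq
... | false = refl
... | true  = contradiction (ℕₚ.<ᵇ⇒< x N (≡⇒T eq)) (ℕₚ.≤⇒≯ N≤x)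

≡ᵇ-false : ∀ {x y} → x ≢ y → (x ℕ.≡ᵇ y) ≡ false
≡ᵇ-false {x} {y} x≢y with x ℕ.≡ᵇ y in eq
... | false = refl
... | true  = contradiction (ℕₚ.≡ᵇ⇒≡ x y (≡⇒T eq)) x≢y

≡ᵇ-true : ∀ x → (x ℕ.≡ᵇ x) ≡ true
≡ᵇ-true x = T⇒≡ (ℕₚ.≡⇒≡ᵇ x x refl)

word-cong : ∀ b b′ L → (∀ x → x ℕ.< L → b x ≡ b′ x) → trues b L ≡ trues b′ L × falses b L ≡ falses b′ L × parts b L ≡ parts b′ L
word-cong b b′ zero    e = refl , refl , refl
word-cong b b′ (suc L) e with b L | b′ L | e L ℕₚ.≤-refl | word-cong b b′ L (λ x x<L → e x (ℕₚ.m<n⇒m<1+n x<L))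
... | true  | _ | refl | t , f , p = cong suc t , f , cong₂ _∷⁺_ f p
... | false | _ | refl | t , f , p = t , cong suc f , p

word-extend : ∀ b L₀ k → (∀ x → L₀ ℕ.≤ x → b x ≡ false) → trues b (k ℕ.+ L₀) ≡ trues b L₀ × parts b (k ℕ.+ L₀) ≡ parts b L₀
word-extend b L₀ zero    e = refl , refl
word-extend b L₀ (suc k) e rewrite e (k ℕ.+ L₀) (ℕₚ.m≤n+m L₀ k) = word-extend b L₀ k e

beads-above : ∀ {m λs} → Descending m λs → ∀ N x → m ℕ.+ N ℕ.≤ x → beads λs N x ≡ false
beads-above {m} [] N x le = <ᵇ-false (ℕₚ.≤-trans (ℕₚ.m≤n+m N m) le)
beads-above (_ ∷ d) zero x le = refl
beads-above {m} {y ∷ ys} ((_ , y≤m) ∷ d) (suc N) x le =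
  cong₂ _∨_ (≡ᵇ-false (λ e → ℕₚ.<⇒≢ lt (sym e))) (beads-above d N x (ℕₚ.<⇒≤ lt))
  where
  lt : y ℕ.+ N ℕ.< x
  lt = ℕₚ.≤-trans (ℕₚ.≤-reflexive (sym (ℕₚ.+-suc y N))) (ℕₚ.≤-trans (ℕₚ.+-monoˡ-≤ (suc N) y≤m) le)

vacuum : ∀ N L → L ℕ.≤ N → trues (ℕ._<ᵇ N) L ≡ L × falses (ℕ._<ᵇ N) L ≡ 0
vacuum N zero    le = refl , refl
vacuum N (suc L) le rewrite <ᵇ-true le = let (t , f) = vacuum N L (ℕₚ.<⇒≤ le) in cong suc t , f

-- The bead of the largest part is the topmost one; below it the word is that of the remaining parts
-- with one bead fewer.
beads-parts : ∀ {m λs} → Descending m λs → ∀ N → length λs ℕ.≤ N → ∀ L → m ℕ.+ N ℕ.≤ L →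
  trues (beads λs N) L ≡ N × parts (beads λs N) L ≡ λs
beads-parts {m} [] N _ L le = trans (cong (trues _) (sym eL)) (trans (proj₁ ext) (proj₁ (vacuum N N ℕₚ.≤-refl)))
                            , trans (cong (parts _) (sym eL)) (trans (proj₂ ext) (no-falses _ N (proj₂ (vacuum N N ℕₚ.≤-refl))))
  where
  eL : L ℕ.∸ N ℕ.+ N ≡ L
  eL = ℕₚ.m∸n+n≡m (ℕₚ.≤-trans (ℕₚ.m≤n+m N m) le)
  ext = word-extend (ℕ._<ᵇ N) N (L ℕ.∸ N) (λ x N≤x → <ᵇ-false N≤x)
beads-parts {m} {suc y ∷ ys} ((_ , y≤m) ∷ d) (suc N) (s≤s len) L le =
  trans (cong (trues b) (sym eL)) (trans (proj₁ ext) top-trues) , trans (cong (parts b) (sym eL)) (trans (proj₂ ext) top-parts)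
  where
  b = beads (suc y ∷ ys) (suc N)
  p = suc y ℕ.+ N
  le′ : suc p ℕ.≤ L
  le′ = ℕₚ.≤-trans (ℕₚ.≤-reflexive (sym (ℕₚ.+-suc (suc y) N))) (ℕₚ.≤-trans (ℕₚ.+-monoˡ-≤ (suc N) y≤m) le)
  eL : L ℕ.∸ suc p ℕ.+ suc p ≡ L
  eL = ℕₚ.m∸n+n≡m le′
  above : ∀ x → suc p ℕ.≤ x → b x ≡ false
  above x p<x = beads-above ((s≤s z≤n , ℕₚ.≤-refl) ∷ d) (suc N) x (ℕₚ.≤-trans (ℕₚ.≤-reflexive (ℕₚ.+-suc (suc y) N)) p<x)
  ext = word-extend b (suc p) (L ℕ.∸ suc p) above
  same-below : ∀ x → x ℕ.< p → b x ≡ beads ys N x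
  same-below x x<p = cong (_∨ beads ys N x) (≡ᵇ-false (ℕₚ.<⇒≢ x<p))
  wc = word-cong b (beads ys N) p same-below
  ih = beads-parts d N len p ℕₚ.≤-refl
  bead : b p ≡ true
  bead = cong (_∨ beads ys N p) (≡ᵇ-true p)
  trues-p : trues b p ≡ N
  trues-p = trans (proj₁ wc) (proj₁ ih)
  falses-p : falses b p ≡ suc y
  falses-p = ℕₚ.+-cancelʳ-≡ N _ _ (trans (cong (falses b p ℕ.+_) (sym trues-p)) (falses+trues b p))
  step-trues : ∀ c → c ≡ true → (if c then suc (trues b p) else trues b p) ≡ suc (trues b p)
  step-trues _ refl = refl
  step-parts : ∀ c → c ≡ true → (if c then falses b p ∷⁺ parts b p else parts b p) ≡ falses b p ∷⁺ parts b p
  step-parts _ refl = refl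
  top-trues : trues b (suc p) ≡ suc N
  top-trues = trans (step-trues (b p) bead) (cong suc trues-p)
  top-parts : parts b (suc p) ≡ suc y ∷ ys
  top-parts = trans (step-parts (b p) bead) (cong₂ _∷⁺_ falses-p (trans (proj₂ (proj₂ wc)) (proj₂ ih)))

-- 7-cores with a charge as vectors in ℤ⁷ (one coordinate per residue class of positions).

runners : (ℕ → ℕ) → ℕ → Bool
runners m x = (x / 7) ℕ.<ᵇ m (x % 7)

runners-at : ∀ m i k → i ℕ.< 7 → runners m (i ℕ.+ k ℕ.* 7) ≡ (k ℕ.<ᵇ m i)
runners-at m i k i<7 = cong₂ (λ q r → q ℕ.<ᵇ m r)
  (trans (DM.+-distrib-/-∣ʳ i (Div.divides-refl k)) (cong₂ ℕ._+_ (DM.m<n⇒m/n≡0 i<7) (DM.m*n/n≡m k 7)))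
  (trans (DM.[m+kn]%n≡m%n i k 7) (DM.m<n⇒m%n≡m i<7))

column : (ℕ → ℤ) → ℕ → ℕ → ℤ
column g i zero    = + 0
column g i (suc c) = g (i ℕ.+ c ℕ.* 7) ℤ.+ column g i c

run : (ℕ → ℤ) → ℕ → ℕ → ℕ → ℤ
run g i c zero    = + 0
run g i c (suc H) = (if H ℕ.<ᵇ c then g (i ℕ.+ H ℕ.* 7) else + 0) ℤ.+ run g i c H

run-≤ : ∀ g i c H → H ℕ.≤ c → run g i c H ≡ column g i H
run-≤ g i c zero    _  = refl
run-≤ g i c (suc H) le rewrite <ᵇ-true le = cong (λ z → g (i ℕ.+ H ℕ.* 7) ℤ.+ z) (run-≤ g i c H (ℕₚ.<⇒≤ le))

run-≥ : ∀ g i c H → c ℕ.≤ H → run g i c H ≡ column g i c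
run-≥ g i zero zero _ = refl
run-≥ g i c (suc H) c≤ with ℕₚ.m≤n⇒m<n∨m≡n c≤
... | inj₂ refl = run-≤ g i (suc H) (suc H) ℕₚ.≤-refl
... | inj₁ (s≤s c≤H) rewrite <ᵇ-false c≤H = trans (ℤₚ.+-identityˡ (run g i c H)) (run-≥ g i c H c≤H)

Σ₇ : (ℕ → ℤ) → ℤ
Σ₇ f = f 0 ℤ.+ f 1 ℤ.+ f 2 ℤ.+ f 3 ℤ.+ f 4 ℤ.+ f 5 ℤ.+ f 6

Σ₇-cong : ∀ {f g} → (∀ i → i ℕ.< 7 → f i ≡ g i) → Σ₇ f ≡ Σ₇ g
Σ₇-cong p = cong₂ ℤ._+_ (cong₂ ℤ._+_ (cong₂ ℤ._+_ (cong₂ ℤ._+_ (cong₂ ℤ._+_ (cong₂ ℤ._+_ (p 0 (lt 0)) (p 1 (lt 1))) (p 2 (lt 2))) (p 3 (lt 3))) (p 4 (lt 4))) (p 5 (lt 5))) (p 6 (lt 6))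
  where
  lt : ∀ i {ok : T (i ℕ.<ᵇ 7)} → i ℕ.< 7
  lt i {ok} = ℕₚ.<ᵇ⇒< i 7 ok

beadSum-step : ∀ g b L c → b L ≡ c → beadSum g b (suc L) ≡ (if c then g L else + 0) ℤ.+ beadSum g b L
beadSum-step g b L _ refl = refl

beadSum-runners : ∀ g m H → beadSum g (runners m) (H ℕ.* 7) ≡ Σ₇ (λ i → run g i (m i) H)
beadSum-runners g m zero = refl
beadSum-runners g m (suc H) = trans (step 6 (step 5 (step 4 (step 3 (step 2 (step 1 (step 0 (beadSum-runners g m H))))))))
  (ℤR.solve (u 0 ∷ u 1 ∷ u 2 ∷ u 3 ∷ u 4 ∷ u 5 ∷ u 6 ∷ r 0 ∷ r 1 ∷ r 2 ∷ r 3 ∷ r 4 ∷ r 5 ∷ r 6 ∷ [])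
    (λ { (a ∷ b ∷ c ∷ d ∷ e ∷ f ∷ g ∷ a′ ∷ b′ ∷ c′ ∷ d′ ∷ e′ ∷ f′ ∷ g′ ∷ []) →
       g :+ (f :+ (e :+ (d :+ (c :+ (b :+ (a :+ (a′ :+ b′ :+ c′ :+ d′ :+ e′ :+ f′ :+ g′))))))) ,
       (a :+ a′) :+ (b :+ b′) :+ (c :+ c′) :+ (d :+ d′) :+ (e :+ e′) :+ (f :+ f′) :+ (g :+ g′) }) refl)
  where
  u r : ℕ → ℤ
  u i = if H ℕ.<ᵇ m i then g (i ℕ.+ H ℕ.* 7) else + 0
  r i = run g i (m i) H
  step : ∀ i {ok : T (i ℕ.<ᵇ 7)} {s} → beadSum g (runners m) (i ℕ.+ H ℕ.* 7) ≡ s → beadSum g (runners m) (suc i ℕ.+ H ℕ.* 7) ≡ u i ℤ.+ s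
  step i {ok} e = trans (beadSum-step g (runners m) (i ℕ.+ H ℕ.* 7) _ (runners-at m i H (ℕₚ.<ᵇ⇒< i 7 ok))) (cong (λ z → u i ℤ.+ z) e)

beadSum-columns : ∀ g m H → (∀ i → i ℕ.< 7 → m i ℕ.≤ H) → beadSum g (runners m) (H ℕ.* 7) ≡ Σ₇ (λ i → column g i (m i))
beadSum-columns g m H le = trans (beadSum-runners g m H) (Σ₇-cong λ i i<7 → run-≥ g i (m i) H (le i i<7))

column-one : ∀ i c → column (λ _ → + 1) i c ≡ + c
column-one i zero    = refl
column-one i (suc c) = cong (λ z → + 1 ℤ.+ z) (column-one i c)

column-id : ∀ i c → + 2 ℤ.* column +_ i c ≡ + c ℤ.* (+ 2 ℤ.* + i ℤ.+ + 7 ℤ.* (+ c ℤ.- + 1))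
column-id i zero    = refl
column-id i (suc c) = trans (cong (λ z → + 2 ℤ.* (+ i ℤ.+ z ℤ.+ column +_ i c)) (ℤₚ.pos-* c 7)) (-≡0⇒≡ (trans
  (ℤR.solve (+ i ∷ + c ∷ column +_ i c ∷ []) (λ { (i ∷ c ∷ s ∷ []) →
     2 · (i :+ c :* con (+ 7) :+ s) :- (con (+ 1) :+ c) :* (2 · i :+ 7 · ((con (+ 1) :+ c) :- con (+ 1))) ,
     1 · (2 · s :- c :* (2 · i :+ 7 · (c :- con (+ 1)))) }) refl)
  ((+ 1) ⊙ᶻ column-id i c)))

pm-*7 : ∀ c → pm (c ℕ.* 7) ≡ pm c
pm-*7 zero    = refl
pm-*7 (suc c) = trans (ℤR.solve (pm (c ℕ.* 7) ∷ []) (λ { (a ∷ []) → :neg (:neg (:neg (:neg (:neg (:neg (:neg a)))))) , :neg a }) refl) (cong -_ (pm-*7 c))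

column-pm : ∀ i c → + 2 ℤ.* column pm i c ≡ pm i ℤ.* (+ 1 ℤ.- pm c)
column-pm i zero    = sym (ℤₚ.*-zeroʳ (pm i))
column-pm i (suc c) = trans (cong (λ z → + 2 ℤ.* (z ℤ.+ column pm i c)) (trans (pm-+ i (c ℕ.* 7)) (cong (pm i ℤ.*_) (pm-*7 c)))) (-≡0⇒≡ (trans
  (ℤR.solve (pm i ∷ pm c ∷ column pm i c ∷ []) (λ { (i ∷ c ∷ s ∷ []) →
     2 · (i :* c :+ s) :- i :* (con (+ 1) :- :neg c) ,
     1 · (2 · s :- i :* (con (+ 1) :- c)) }) refl)
  ((+ 1) ⊙ᶻ column-pm i c)))

Lat : ℕ → Set
Lat zero    = ⊤
Lat (suc k) = ℤ × Lat k

coord : ∀ {k} → Lat k → ℕ → ℤ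
coord {zero}  _       _       = + 0
coord {suc k} (z , v) zero    = z
coord {suc k} (z , v) (suc i) = coord v i

tabulateLat : ∀ k → (ℕ → ℤ) → Lat k
tabulateLat zero    f = tt
tabulateLat (suc k) f = f 0 , tabulateLat k (f ∘ suc)

coord-tabulate : ∀ k f i → i ℕ.< k → coord (tabulateLat k f) i ≡ f i
coord-tabulate (suc k) f zero    _         = refl
coord-tabulate (suc k) f (suc i) (s≤s i<k) = coord-tabulate k (f ∘ suc) i i<k

Lat-ext : ∀ k (v v′ : Lat k) → (∀ i → i ℕ.< k → coord v i ≡ coord v′ i) → v ≡ v′
Lat-ext zero    _       _         _ = refl
Lat-ext (suc k) (z , v) (z′ , v′) e = cong₂ _,_ (e 0 (s≤s z≤n)) (Lat-ext k v v′ (λ i i<k → e (suc i) (s≤s i<k)))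

charge : ∀ {k} → Lat k → ℤ
charge {zero}  _       = + 0
charge {suc k} (z , v) = z ℤ.+ charge v

-- For i ≤ 6 this is 7z² + 2(i - 3)z.
weight : ℕ → ℤ → ℕ
weight i (+ zero)  = 0
weight i (+ suc k) = suc k ℕ.* (1 ℕ.+ 7 ℕ.* k ℕ.+ 2 ℕ.* i)
weight i -[1+ k ]  = suc k ℕ.* (1 ℕ.+ 7 ℕ.* k ℕ.+ 2 ℕ.* (6 ℕ.∸ i))

weight-formula : ∀ i z → i ℕ.≤ 6 → + weight i z ≡ z ℤ.* (+ 7 ℤ.* z ℤ.+ + 2 ℤ.* + i ℤ.- + 6)
weight-formula i (+ zero)  _ = refl
weight-formula i (+ suc k) _ = trans (ℤₚ.pos-* (suc k) (1 ℕ.+ 7 ℕ.* k ℕ.+ 2 ℕ.* i))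
  (trans (cong₂ (λ a b → + suc k ℤ.* (+ 1 ℤ.+ a ℤ.+ b)) (ℤₚ.pos-* 7 k) (ℤₚ.pos-* 2 i))
  (ℤR.solve (+ k ∷ + i ∷ []) (λ { (k ∷ i ∷ []) →
     (con (+ 1) :+ k) :* (con (+ 1) :+ 7 · k :+ 2 · i) ,
     (con (+ 1) :+ k) :* (7 · (con (+ 1) :+ k) :+ 2 · i :- con (+ 6)) }) refl))
weight-formula i -[1+ k ] i≤6 = trans (ℤₚ.pos-* (suc k) (1 ℕ.+ 7 ℕ.* k ℕ.+ 2 ℕ.* (6 ℕ.∸ i)))
  (trans (cong₂ (λ a b → + suc k ℤ.* (+ 1 ℤ.+ a ℤ.+ b)) (ℤₚ.pos-* 7 k) (ℤₚ.pos-* 2 (6 ℕ.∸ i))) (-≡0⇒≡ (trans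
  (ℤR.solve (+ k ∷ + i ∷ + (6 ℕ.∸ i) ∷ []) (λ { (k ∷ i ∷ j ∷ []) →
     (con (+ 1) :+ k) :* (con (+ 1) :+ 7 · k :+ 2 · j) :-
     :neg (con (+ 1) :+ k) :* (7 · :neg (con (+ 1) :+ k) :+ 2 · i :- con (+ 6)) ,
     (2 · (con (+ 1) :+ k)) :* (j :+ i :- con (+ 6)) }) refl)
  ((+ 2 ℤ.* (+ 1 ℤ.+ + k)) ⊙ᶻ cong +_ (ℕₚ.m∸n+n≡m i≤6)))))

∣z∣≤weight : ∀ i z → ℤ.∣ z ∣ ℕ.≤ weight i z
∣z∣≤weight i (+ zero)  = z≤n
∣z∣≤weight i (+ suc k) = ℕₚ.m≤m*n (suc k) (1 ℕ.+ 7 ℕ.* k ℕ.+ 2 ℕ.* i)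
∣z∣≤weight i -[1+ k ]  = ℕₚ.m≤m*n (suc k) (1 ℕ.+ 7 ℕ.* k ℕ.+ 2 ℕ.* (6 ℕ.∸ i))

Weight : ∀ k → ℕ → Lat k → ℕ
Weight zero    i _       = 0
Weight (suc k) i (z , v) = weight i z ℕ.+ Weight k (suc i) v

coord≤Weight : ∀ k j (v : Lat k) i → ℤ.∣ coord v i ∣ ℕ.≤ Weight k j v
coord≤Weight zero    j v       i       = z≤n
coord≤Weight (suc k) j (z , v) zero    = ℕₚ.≤-trans (∣z∣≤weight j z) (ℕₚ.m≤m+n _ _)
coord≤Weight (suc k) j (z , v) (suc i) = ℕₚ.≤-trans (coord≤Weight k (suc j) v i) (ℕₚ.m≤n+m _ _)

evenᵇ : ℕ → Bool
evenᵇ zero    = true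
evenᵇ (suc n) = not (evenᵇ n)

pm-even : ∀ n → pm n ≡ (if evenᵇ n then + 1 else - + 1)
pm-even zero    = refl
pm-even (suc n) with evenᵇ n | pm-even n
... | true  | e = cong -_ e
... | false | e = cong -_ e

-- 1 exactly when 7z + (i - 3) is odd.
oddness : ℕ → ℤ → ℕ
oddness i z = if evenᵇ (i ℕ.+ ℤ.∣ z ∣) then 1 else 0

oddness-pm : ∀ i z → + 2 ℤ.* + oddness i z ≡ + 1 ℤ.+ pm i ℤ.* pm ℤ.∣ z ∣
oddness-pm i z = trans (go (evenᵇ (i ℕ.+ ℤ.∣ z ∣))) (cong (λ p → + 1 ℤ.+ p) (trans (sym (pm-even (i ℕ.+ ℤ.∣ z ∣))) (pm-+ i ℤ.∣ z ∣)))
  where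
  go : ∀ b → + 2 ℤ.* + (if b then 1 else 0) ≡ + 1 ℤ.+ (if b then + 1 else - + 1)
  go true  = refl
  go false = refl

Oddness : ∀ k → ℕ → Lat k → ℕ
Oddness zero    i _       = 0
Oddness (suc k) i (z , v) = oddness i z ℕ.+ Oddness k (suc i) v

pm-shift : ∀ m z h → + m ≡ z ℤ.+ + h → pm m ≡ pm ℤ.∣ z ∣ ℤ.* pm h
pm-shift m (+ k) h e = trans (cong pm (ℤₚ.+-injective e)) (pm-+ k h)
pm-shift m -[1+ k ] h e = sym (trans (cong (pm (suc k) ℤ.*_) (trans (cong pm (sym eq)) (pm-+ (suc k) m)))
  (trans (sym (ℤₚ.*-assoc (pm (suc k)) (pm (suc k)) (pm m))) (trans (cong (ℤ._* pm m) (pm² (suc k))) (ℤₚ.*-identityˡ (pm m)))))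
  where
  eq : suc k ℕ.+ m ≡ h
  eq = ℤₚ.+-injective (trans (cong (λ z → + suc k ℤ.+ z) e) (ℤR.solve (+ suc k ∷ + h ∷ []) (λ { (a ∷ b ∷ []) → a :+ (:neg a :+ b) , b }) refl))

-- The common shift h makes every coordinate nonnegative: runner i holds zᵢ + h beads.
module Runners (v : Lat 7) (h H : ℕ) (m : ℕ → ℕ)
  (shifted : ∀ i → i ℕ.< 7 → + m i ≡ coord v i ℤ.+ + h) (m≤H : ∀ i → i ℕ.< 7 → m i ℕ.≤ H) where

  private
    b = runners m
    L = H ℕ.* 7
    z0 = coord v 0
    z1 = coord v 1
    z2 = coord v 2
    z3 = coord v 3
    z4 = coord v 4
    z5 = coord v 5
    z6 = coord v 6

  trues-runners : + trues b L ≡ charge v ℤ.+ + 7 ℤ.* + h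
  trues-runners = trans (trues-beadSum b L) (trans (beadSum-columns (λ _ → + 1) m H m≤H)
    (trans (Σ₇-cong (λ i i<7 → trans (column-one i (m i)) (shifted i i<7)))
    (ℤR.solve (z0 ∷ z1 ∷ z2 ∷ z3 ∷ z4 ∷ z5 ∷ z6 ∷ + h ∷ []) (λ { (a ∷ b ∷ c ∷ d ∷ e ∷ f ∷ g ∷ h ∷ []) →
       (a :+ h) :+ (b :+ h) :+ (c :+ h) :+ (d :+ h) :+ (e :+ h) :+ (f :+ h) :+ (g :+ h) ,
       (a :+ (b :+ (c :+ (d :+ (e :+ (f :+ (g :+ con (+ 0)))))))) :+ 7 · h }) refl)))

  2*positions : + 2 ℤ.* beadSum +_ b L ≡ Σ₇ (λ i → (coord v i ℤ.+ + h) ℤ.* (+ 2 ℤ.* + i ℤ.+ + 7 ℤ.* ((coord v i ℤ.+ + h) ℤ.- + 1)))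
  2*positions = trans (cong (+ 2 ℤ.*_) (beadSum-columns +_ m H m≤H)) (trans
    (ℤR.solve (s 0 ∷ s 1 ∷ s 2 ∷ s 3 ∷ s 4 ∷ s 5 ∷ s 6 ∷ []) (λ { (a ∷ b ∷ c ∷ d ∷ e ∷ f ∷ g ∷ []) →
       2 · (a :+ b :+ c :+ d :+ e :+ f :+ g) ,
       2 · a :+ 2 · b :+ 2 · c :+ 2 · d :+ 2 · e :+ 2 · f :+ 2 · g }) refl)
    (Σ₇-cong (λ i i<7 → trans (column-id i (m i)) (cong (λ c → c ℤ.* (+ 2 ℤ.* + i ℤ.+ + 7 ℤ.* (c ℤ.- + 1))) (shifted i i<7)))))
    where
    s : ℕ → ℤ
    s i = column +_ i (m i)

  -- Inserting M + 7h for the number of beads into `size-formula` makes all terms with h cancel;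
  -- what remains is a sum over the runners.
  size-runners : + 2 ℤ.* + sumℕ (parts b L) ℤ.+ charge v ℤ.* charge v ≡ + Weight 7 0 v
  size-runners = trans (-≡0⇒≡ (trans
    (ℤR.solve (z0 ∷ z1 ∷ z2 ∷ z3 ∷ z4 ∷ z5 ∷ z6 ∷ + h ∷ + sumℕ (parts b L) ∷ + trues b L ∷ beadSum +_ b L ∷ [])
      (λ { (a ∷ b ∷ c ∷ d ∷ e ∷ f ∷ g ∷ h ∷ s ∷ t ∷ q ∷ []) →
       let ch = a :+ (b :+ (c :+ (d :+ (e :+ (f :+ (g :+ con (+ 0)))))))
           term = λ z i → (z :+ h) :* (2 · con (+ i) :+ 7 · ((z :+ h) :- con (+ 1)))
           wt = λ z i → z :* (7 · z :+ 2 · con (+ i) :- con (+ 6)) in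
       (2 · s :+ ch :* ch) :- (wt a 0 :+ (wt b 1 :+ (wt c 2 :+ (wt d 3 :+ (wt e 4 :+ (wt f 5 :+ (wt g 6 :+ con (+ 0)))))))) ,
       1 · (2 · s :+ t :* t :- (2 · q :+ t))
       :+ 1 · (2 · q :- (term a 0 :+ term b 1 :+ term c 2 :+ term d 3 :+ term e 4 :+ term f 5 :+ term g 6))
       :+ (con (+ 1) :- t :- (ch :+ 7 · h)) :* (t :- (ch :+ 7 · h)) }) refl)
    ((+ 1) ⊙ᶻ size-formula b L ⊞ᶻ (+ 1) ⊙ᶻ 2*positions ⊞ᶻ (+ 1 ℤ.- + trues b L ℤ.- (charge v ℤ.+ + 7 ℤ.* + h)) ⊙ᶻ trues-runners)))
    (sym (cong₂ ℤ._+_ (wf 0 z0) (cong₂ ℤ._+_ (wf 1 z1) (cong₂ ℤ._+_ (wf 2 z2) (cong₂ ℤ._+_ (wf 3 z3)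
      (cong₂ ℤ._+_ (wf 4 z4) (cong₂ ℤ._+_ (wf 5 z5) (cong (ℤ._+ + 0) (wf 6 z6)))))))))
    where
    wf : ∀ i z {ok : T (i ℕ.≤ᵇ 6)} → + weight i z ≡ z ℤ.* (+ 7 ℤ.* z ℤ.+ + 2 ℤ.* + i ℤ.- + 6)
    wf i z {ok} = weight-formula i z (ℕₚ.≤ᵇ⇒≤ i 6 ok)

  -- An even shift leaves the parity of every runner and of the charge unchanged.
  module _ (h-even : pm h ≡ + 1) where

    pm-runner : ∀ i → i ℕ.< 7 → pm (m i) ≡ pm ℤ.∣ coord v i ∣
    pm-runner i i<7 = trans (pm-shift (m i) (coord v i) h (shifted i i<7)) (trans (cong (pm ℤ.∣ coord v i ∣ ℤ.*_) h-even) (ℤₚ.*-identityʳ _))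

    pm-trues : pm (trues b L) ≡ pm ℤ.∣ charge v ∣
    pm-trues = trans (pm-shift (trues b L) (charge v) (7 ℕ.* h) (trans trues-runners (cong (λ z → charge v ℤ.+ z) (sym (ℤₚ.pos-* 7 h)))))
      (trans (cong (pm ℤ.∣ charge v ∣ ℤ.*_) (trans (cong pm (ℕₚ.*-comm 7 h)) (trans (pm-*7 h) h-even))) (ℤₚ.*-identityʳ _))

    2*alternating : + 2 ℤ.* beadSum pm b L ≡ Σ₇ (λ i → pm i ℤ.- (+ 2 ℤ.* + oddness i (coord v i) ℤ.- + 1))
    2*alternating = trans (cong (+ 2 ℤ.*_) (beadSum-columns pm m H m≤H)) (trans
      (ℤR.solve (s 0 ∷ s 1 ∷ s 2 ∷ s 3 ∷ s 4 ∷ s 5 ∷ s 6 ∷ []) (λ { (a ∷ b ∷ c ∷ d ∷ e ∷ f ∷ g ∷ []) →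
         2 · (a :+ b :+ c :+ d :+ e :+ f :+ g) ,
         2 · a :+ 2 · b :+ 2 · c :+ 2 · d :+ 2 · e :+ 2 · f :+ 2 · g }) refl)
      (Σ₇-cong (λ i i<7 → trans (column-pm i (m i)) (trans (cong (λ p → pm i ℤ.* (+ 1 ℤ.- p)) (pm-runner i i<7))
        (trans (ℤR.solve (pm i ∷ pm ℤ.∣ coord v i ∣ ∷ []) (λ { (p ∷ q ∷ []) → p :* (con (+ 1) :- q) , p :- ((con (+ 1) :+ p :* q) :- con (+ 1)) }) refl)
          (cong (λ o → pm i ℤ.- (o ℤ.- + 1)) (sym (oddness-pm i (coord v i)))))))))
      where
      s : ℕ → ℤ
      s i = column pm i (m i)

    bgRank-runners : + 4 ℤ.* bgRank (parts b L) ≡ pm ℤ.∣ charge v ∣ ℤ.* (+ 7 ℤ.- + 2 ℤ.* + Oddness 7 0 v) ℤ.+ + 1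
    bgRank-runners = trans (bgRank-formula b L) (cong₂ (λ p d → p ℤ.* d ℤ.+ + 1) pm-trues
      (trans (cong (ℤ._- + 1) 2*alternating)
        (ℤR.solve (o 0 ∷ o 1 ∷ o 2 ∷ o 3 ∷ o 4 ∷ o 5 ∷ o 6 ∷ []) (λ { (a ∷ b ∷ c ∷ d ∷ e ∷ f ∷ g ∷ []) →
           let t : ℤ → Expr 7 → Expr 7
               t = λ s x → con s :- (2 · x :- con (+ 1)) in
           t (+ 1) a :+ t (- + 1) b :+ t (+ 1) c :+ t (- + 1) d :+ t (+ 1) e :+ t (- + 1) f :+ t (+ 1) g :- con (+ 1) ,
           con (+ 7) :- 2 · (a :+ (b :+ (c :+ (d :+ (e :+ (f :+ (g :+ con (+ 0)))))))) }) refl)))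
      where
      o : ℕ → ℤ
      o i = + oddness i (coord v i)

-- Partitions, 7-cores and lattice vectors as graded families

unique-concatMap : {A B : Set} (f : A → List B) {xs : List A} → Unique xs → (∀ x → Unique (f x)) →
  (∀ {x y b} → b ∈ f x → b ∈ f y → x ≡ y) → Unique (concatMap f xs)
unique-concatMap f {xs} u each disjoint = Unique.concat⁺ (All.map⁺ (All.tabulate λ {x} _ → each x))
  (AllPairs.map⁺ (AllPairs.map (λ x≢y {_} pq → x≢y (disjoint (proj₁ pq) (proj₂ pq))) u))

listsOfLength-∈ : ∀ xs λs → All (_∈ xs) λs → λs ∈ listsOfLength (length λs) xs
listsOfLength-∈ xs []       []       = here refl
listsOfLength-∈ xs (y ∷ ys) (p ∷ ps) = ∈-concat⁺′ (∈-map⁺ (y ∷_) (listsOfLength-∈ xs ys ps))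
  (∈-map⁺ (λ x → map (x ∷_) (listsOfLength (length ys) xs)) p)

listsOfLength-length : ∀ L xs {λs} → λs ∈ listsOfLength L xs → length λs ≡ L
listsOfLength-length zero    xs (here refl) = refl
listsOfLength-length (suc L) xs λs∈ with ∈-concat⁻′ (map (λ x → map (x ∷_) (listsOfLength L xs)) xs) λs∈
... | zs , λs∈zs , zs∈ with ∈-map⁻ (λ x → map (x ∷_) (listsOfLength L xs)) zs∈
... | x , _ , refl with ∈-map⁻ (x ∷_) λs∈zs
... | ys , ys∈ , refl = cong suc (listsOfLength-length L xs ys∈)

listsOfLength-unique : ∀ L {xs} → Unique xs → Unique (listsOfLength L xs)
listsOfLength-unique zero    u = [] ∷ []
listsOfLength-unique (suc L) {xs} u = unique-concatMap (λ x → map (x ∷_) (listsOfLength L xs)) u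
  (λ x → unique-map (x ∷_) (λ { _ _ refl → refl }) (listsOfLength-unique L u))
  λ {x} {y} p q → case ∈-map⁻ (x ∷_) p , ∈-map⁻ (y ∷_) q of λ { ((_ , _ , refl) , (_ , _ , refl)) → refl }

partitions-unique : ∀ n → Unique (partitions n)
partitions-unique n = Unique.filter⁺ (λ λs → T? (isPartitionOf n λs))
  (unique-concatMap (λ l → listsOfLength l (map suc (upTo n))) (Unique.upTo⁺ (suc n))
    (λ l → listsOfLength-unique l (unique-map suc (λ _ _ → ℕₚ.suc-injective) (Unique.upTo⁺ n)))
    (λ {l} {l′} p q → trans (sym (listsOfLength-length l _ p)) (listsOfLength-length l′ _ q)))

descending-length : ∀ {m λs} → Descending m λs → length λs ℕ.≤ sumℕ λs
descending-length []              = z≤n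
descending-length ((p , _) ∷ d) = ℕₚ.+-mono-≤ p (descending-length d)

head₀≤sum : ∀ λs → head₀ λs ℕ.≤ sumℕ λs
head₀≤sum []       = z≤n
head₀≤sum (y ∷ ys) = ℕₚ.m≤m+n y (sumℕ ys)

parts-in-range : ∀ {m λs} → Descending m λs → ∀ n → sumℕ λs ℕ.≤ n → All (_∈ map suc (upTo n)) λs
parts-in-range [] n le = []
parts-in-range {λs = suc y ∷ ys} ((_ , _) ∷ d) n le =
  ∈-map⁺ suc (∈-upTo⁺ (ℕₚ.≤-trans (ℕₚ.m≤m+n (suc y) (sumℕ ys)) le)) ∷
  parts-in-range d n (ℕₚ.≤-trans (ℕₚ.m≤n+m (sumℕ ys) (suc y)) le)

partitions⁺ : ∀ {m λs} → Descending m λs → λs ∈ partitions (sumℕ λs)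
partitions⁺ {m} {λs} d = ∈-filter⁺ (λ μs → T? (isPartitionOf (sumℕ λs) μs))
  (∈-concat⁺′ (listsOfLength-∈ _ λs (parts-in-range d (sumℕ λs) ℕₚ.≤-refl))
    (∈-map⁺ (λ l → listsOfLength l (map suc (upTo (sumℕ λs)))) (∈-upTo⁺ (s≤s (descending-length d)))))
  (T∧ (descending⇒nonIncreasing d) (T∧ (descending⇒positive d) (ℕₚ.≡⇒≡ᵇ (sumℕ λs) (sumℕ λs) refl)))

partitions⁻ : ∀ {n λs} → λs ∈ partitions n → Descending (head₀ λs) λs × sumℕ λs ≡ n
partitions⁻ {n} {λs} λs∈ with ∈-filter⁻ (λ μs → T? (isPartitionOf n μs)) {xs = listsUpTo n (map suc (upTo n))} λs∈
... | _ , ok with ∧T {nonIncreasing λs} ok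
... | p , ok′ with ∧T {allB (1 ℕ.≤ᵇ_) λs} ok′
... | q , r = ⇒descending λs p q , ℕₚ.≡ᵇ⇒≡ (sumℕ λs) n r

Core₇ : List ℕ → Set
Core₇ λs = Descending (head₀ λs) λs × T (isCore 7 λs)

core? : ∀ λs → Dec (T (isCore 7 λs))
core? λs = T? (isCore 7 λs)

cores : Fibres Core₇ sumℕ
cores = record
  { fibre = λ n → filter core? (partitions n)
  ; unique = λ n → Unique.filter⁺ core? (partitions-unique n)
  ; sound = λ {n} λs∈ → let (p , c) = ∈-filter⁻ core? {xs = partitions n} λs∈ ; (d , e) = partitions⁻ p in (d , c) , e
  ; complete = λ (d , c) → ∈-filter⁺ core? (partitions⁺ d) c }

square : ℤ → ℕ
square z = ℤ.∣ z ∣ ℕ.* ℤ.∣ z ∣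

square-+ : ∀ z → + square z ≡ z ℤ.* z
square-+ (+ k)    = ℤₚ.pos-* k k
square-+ -[1+ k ] = refl

+-cancel : ∀ c {i j} → i ℤ.+ c ≡ j ℤ.+ c → i ≡ j
+-cancel c {i} {j} e = -≡0⇒≡ (trans (ℤR.solve (i ∷ j ∷ c ∷ [])
  (λ { (i ∷ j ∷ c ∷ []) → i :- j , 1 · (i :+ c :- (j :+ c)) }) refl) ((+ 1) ⊙ᶻ e))

∣z∣≤square : ∀ z → ℤ.∣ z ∣ ℕ.≤ square z
∣z∣≤square (+ zero)  = z≤n
∣z∣≤square (+ suc k) = ℕₚ.m≤m*n (suc k) (suc k)
∣z∣≤square -[1+ k ]  = ℕₚ.m≤m*n (suc k) (suc k)

chargedCores : Fibres (λ (c : List ℕ × ℤ) → Core₇ (proj₁ c) × Always (proj₂ c)) (λ c → sumℕ (proj₁ c) ℕ.* 2 ℕ.+ square (proj₂ c))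
chargedCores = dilate 2 cores ×ᶠ ℤ-fibres square ∣z∣≤square

lattice : ∀ k i → Fibres {Lat k} Always (Weight k i)
lattice zero    i = record
  { fibre = λ { zero → tt ∷ [] ; (suc n) → [] }
  ; unique = λ { zero → [] ∷ [] ; (suc n) → [] }
  ; sound = λ { {zero} _ → tt , refl ; {suc n} () }
  ; complete = λ _ → here refl }
lattice (suc k) i = record
  { fibre = fibre pair ; unique = unique pair
  ; sound = λ a∈ → tt , proj₂ (sound pair a∈) ; complete = λ _ → complete pair (tt , tt) }
  where pair = ℤ-fibres (weight i) (∣z∣≤weight i) ×ᶠ lattice k (suc i)

[x+7]/7 : ∀ x → (x ℕ.+ 7) / 7 ≡ suc (x / 7)
[x+7]/7 x = trans (DM.+-distrib-/-∣ʳ x Div.∣-refl) (ℕₚ.+-comm (x / 7) 1)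

runners-closed : ∀ m L → Closed 7 (runners m) L
runners-closed m L x _ e = <ᵇ-true (ℕₚ.<-trans (ℕₚ.n<1+n (x / 7))
  (subst₂ (λ q r → q ℕ.< m r) ([x+7]/7 x) (DM.[m+n]%n≡m%n x 7) (ℕₚ.<ᵇ⇒< ((x ℕ.+ 7) / 7) (m ((x ℕ.+ 7) % 7)) (≡⇒T e))))

below-equal : ∀ H c c′ → c ℕ.≤ H → c′ ℕ.≤ H → (∀ k → k ℕ.< H → (k ℕ.<ᵇ c) ≡ (k ℕ.<ᵇ c′)) → c ≡ c′
below-equal H c c′ c≤ c′≤ e with ℕₚ.<-cmp c c′
... | tri≈ _ c≡c′ _ = c≡c′
... | tri< c<c′ _ _ = case trans (sym (<ᵇ-false (ℕₚ.≤-refl {c}))) (trans (e c (ℕₚ.<-≤-trans c<c′ c′≤)) (<ᵇ-true c<c′)) of λ ()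
... | tri> _ _ c′<c = case trans (sym (<ᵇ-true c′<c)) (trans (e c′ (ℕₚ.<-≤-trans c′<c c≤)) (<ᵇ-false (ℕₚ.≤-refl {c′}))) of λ ()

trues≤ : ∀ b L → trues b L ℕ.≤ L
trues≤ b L = subst (trues b L ℕ.≤_) (falses+trues b L) (ℕₚ.m≤n+m (trues b L) (falses b L))

downward : ∀ d → (∀ k → d (suc k) ≡ true → d k ≡ true) → ∀ L k → k ℕ.< L → d k ≡ (k ℕ.<ᵇ trues d L)
downward d down (suc L) k (s≤s k≤L) with d L in eq
... | true = trans (full k k≤L) (sym (<ᵇ-true (s≤s (ℕₚ.≤-trans k≤L (ℕₚ.≤-reflexive (sym (all-true L ℕₚ.≤-refl)))))))
  where
  descend : ∀ j i → d (j ℕ.+ i) ≡ true → d i ≡ true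
  descend zero    i e = e
  descend (suc j) i e = descend j i (down (j ℕ.+ i) e)
  full : ∀ k → k ℕ.≤ L → d k ≡ true
  full k k≤L = descend (L ℕ.∸ k) k (trans (cong d (ℕₚ.m∸n+n≡m k≤L)) eq)
  step : ∀ n c → c ≡ true → (if c then suc n else n) ≡ suc n
  step n _ refl = refl
  all-true : ∀ n → n ℕ.≤ L → trues d n ≡ n
  all-true zero    _  = refl
  all-true (suc n) le = trans (step (trues d n) (d n) (full n (ℕₚ.<⇒≤ le))) (cong suc (all-true n (ℕₚ.<⇒≤ le)))
... | false with ℕₚ.m≤n⇒m<n∨m≡n k≤L
...   | inj₁ k<L  = downward d down L k k<L
...   | inj₂ refl = trans eq (sym (<ᵇ-false (trues≤ d L)))

shift-nonneg : ∀ z h → ℤ.∣ z ∣ ℕ.≤ h → + ℤ.∣ z ℤ.+ + h ∣ ≡ z ℤ.+ + h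
shift-nonneg (+ k)    h le = refl
shift-nonneg -[1+ k ] h le = trans (cong (λ w → + ℤ.∣ w ∣) (ℤₚ.⊖-≥ le)) (sym (ℤₚ.⊖-≥ le))

∣shift∣≤ : ∀ z h → ℤ.∣ z ℤ.+ + h ∣ ℕ.≤ ℤ.∣ z ∣ ℕ.+ h
∣shift∣≤ z h = ℤₚ.∣i+j∣≤∣i∣+∣j∣ z (+ h)

module CoreBijection (n : ℕ) where

  h H L : ℕ
  -- Coordinates of a vector of weight n have absolute value at most n, so the shift 2n makes them
  -- nonnegative, and it is even. H bounds the shifted heights, and L covers seven runners of height
  -- H.
  h = n ℕ.* 2
  H = n ℕ.+ h
  L = H ℕ.* 7

  heights : Lat 7 → ℕ → ℕ
  heights v i = ℤ.∣ coord v i ℤ.+ + h ∣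

  toCore : Lat 7 → List ℕ × ℤ
  toCore v = parts (runners (heights v)) L , charge v

  pm-h : pm h ≡ + 1
  pm-h = go n
    where
    go : ∀ n → pm (n ℕ.* 2) ≡ + 1
    go zero    = refl
    go (suc n) = trans (ℤₚ.neg-involutive (pm (n ℕ.* 2))) (go n)

  n≤h : n ℕ.≤ h
  n≤h = ℕₚ.m≤m*n n 2

  module Of (v : Lat 7) (w : Weight 7 0 v ≡ n) where

    coord≤ : ∀ i → ℤ.∣ coord v i ∣ ℕ.≤ n
    coord≤ i = subst (ℤ.∣ coord v i ∣ ℕ.≤_) w (coord≤Weight 7 0 v i)

    shifted : ∀ i → i ℕ.< 7 → + heights v i ≡ coord v i ℤ.+ + h
    shifted i _ = shift-nonneg (coord v i) h (ℕₚ.≤-trans (coord≤ i) n≤h)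

    heights≤ : ∀ i → i ℕ.< 7 → heights v i ℕ.≤ H
    heights≤ i _ = ℕₚ.≤-trans (∣shift∣≤ (coord v i) h) (ℕₚ.+-monoˡ-≤ h (coord≤ i))

    open Runners v h H (heights v) shifted heights≤ public

  to-weight : ∀ v s → + 2 ℤ.* + s ℤ.+ charge v ℤ.* charge v ≡ + Weight 7 0 v → s ℕ.* 2 ℕ.+ square (charge v) ≡ Weight 7 0 v
  to-weight v s e = ℤₚ.+-injective (trans (cong₂ ℤ._+_ (trans (ℤₚ.pos-* s 2) (ℤₚ.*-comm (+ s) (+ 2))) (square-+ (charge v))) e)

  toCore-core : ∀ v → Core₇ (proj₁ (toCore v))
  toCore-core v = ⇒descending (parts (runners (heights v)) L) (descending⇒nonIncreasing d) (descending⇒positive d)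
    , NoHook⇒isCore 7 (parts (runners (heights v)) L) (closed⇒core 7 (runners (heights v)) L (runners-closed (heights v) L))
    where d = parts-descending (runners (heights v)) L

  toCore-injective : ∀ v v′ → Weight 7 0 v ≡ n → Weight 7 0 v′ ≡ n → toCore v ≡ toCore v′ → v ≡ v′
  toCore-injective v v′ w w′ e = Lat-ext 7 v v′ λ i i<7 → +-cancel (+ h)
    (trans (sym (Of.shifted v w i i<7)) (trans (cong +_ (below-equal H _ _ (Of.heights≤ v w i i<7) (Of.heights≤ v′ w′ i i<7)
      λ k k<H → trans (sym (runners-at (heights v) i k i<7)) (trans (agree (i ℕ.+ k ℕ.* 7) (in-range i k i<7 k<H)) (runners-at (heights v′) i k i<7))))
      (Of.shifted v′ w′ i i<7)))
    where
    agree = parts-injective (runners (heights v)) (runners (heights v′)) L (cong proj₁ e)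
      (ℤₚ.+-injective (trans (Of.trues-runners v w) (trans (cong (λ c → c ℤ.+ + 7 ℤ.* + h) (cong proj₂ e)) (sym (Of.trues-runners v′ w′)))))
    in-range : ∀ i k → i ℕ.< 7 → k ℕ.< H → i ℕ.+ k ℕ.* 7 ℕ.< L
    in-range i k i<7 k<H = ℕₚ.≤-trans (ℕₚ.+-monoˡ-≤ (k ℕ.* 7) i<7) (ℕₚ.*-monoˡ-≤ 7 k<H)

  -- The inverse direction: on every runner the word of a core is filled from the bottom, so seven
  -- counts of beads describe it.
  module From (λs : List ℕ) (M : ℤ) (core : Core₇ λs) (w : sumℕ λs ℕ.* 2 ℕ.+ square M ≡ n) where

    N : ℕ
    N = ℤ.∣ M ℤ.+ + (7 ℕ.* h) ∣

    sum≤n : sumℕ λs ℕ.≤ n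
    sum≤n = ℕₚ.≤-trans (ℕₚ.m≤m*n (sumℕ λs) 2) (ℕₚ.≤-trans (ℕₚ.m≤m+n _ _) (ℕₚ.≤-reflexive w))

    M≤n : ℤ.∣ M ∣ ℕ.≤ n
    M≤n = ℕₚ.≤-trans (∣z∣≤square M) (ℕₚ.≤-trans (ℕₚ.m≤n+m _ _) (ℕₚ.≤-reflexive w))

    N-shift : + N ≡ M ℤ.+ + (7 ℕ.* h)
    N-shift = shift-nonneg M (7 ℕ.* h) (ℕₚ.≤-trans M≤n (ℕₚ.≤-trans n≤h (ℕₚ.m≤n*m h 7)))

    -- The word of the core needs at least as many beads as the core has parts, and there are at
    -- most n parts.
    n≤N : n ℕ.≤ N
    n≤N = ℤₚ.drop‿+≤+ (subst (+ n ℤ.≤_) (sym N-shift) (go M M≤n))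
      where
      go : ∀ M → ℤ.∣ M ∣ ℕ.≤ n → + n ℤ.≤ M ℤ.+ + (7 ℕ.* h)
      go (+ k) _ = ℤ.+≤+ (ℕₚ.≤-trans n≤h (ℕₚ.≤-trans (ℕₚ.m≤n*m h 7) (ℕₚ.m≤n+m _ k)))
      go -[1+ k ] le = subst (+ n ℤ.≤_) (sym (ℤₚ.⊖-≥ (ℕₚ.≤-trans le (ℕₚ.≤-trans n≤h (ℕₚ.m≤n*m h 7)))))
        (ℤ.+≤+ (ℕₚ.≤-trans (ℕₚ.≤-reflexive (sym (ℕₚ.m+n∸n≡m n (suc k))))
          (ℕₚ.∸-monoˡ-≤ (suc k) (ℕₚ.≤-trans (ℕₚ.+-monoʳ-≤ n le) (ℕₚ.≤-trans (ℕₚ.≤-reflexive n+n≡h) (ℕₚ.m≤n*m h 7))))))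
        where
        n+n≡h : n ℕ.+ n ≡ h
        n+n≡h = trans (cong (n ℕ.+_) (sym (ℕₚ.+-identityʳ n))) (ℕₚ.*-comm 2 n)

    top≤L : head₀ λs ℕ.+ N ℕ.≤ L
    top≤L = ℕₚ.≤-trans (ℕₚ.+-mono-≤ (ℕₚ.≤-trans (head₀≤sum λs) sum≤n) (ℕₚ.≤-trans (∣shift∣≤ M (7 ℕ.* h)) (ℕₚ.+-monoˡ-≤ (7 ℕ.* h) M≤n)))
      (ℕₚ.≤-trans (ℕₚ.≤-reflexive (sym (ℕₚ.+-assoc n n (7 ℕ.* h))))
      (ℕₚ.≤-trans (ℕₚ.+-monoˡ-≤ (7 ℕ.* h) n+n≤7n) (ℕₚ.≤-reflexive (trans (sym (ℕₚ.*-distribˡ-+ 7 n h)) (ℕₚ.*-comm 7 H)))))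
      where
      n+n≤7n : n ℕ.+ n ℕ.≤ 7 ℕ.* n
      n+n≤7n = ℕₚ.+-monoʳ-≤ n (ℕₚ.m≤m+n n (5 ℕ.* n))

    β : ℕ → Bool
    β = beads λs N

    β-parts = beads-parts (proj₁ core) N (ℕₚ.≤-trans (descending-length (proj₁ core)) (ℕₚ.≤-trans sum≤n n≤N)) L top≤L

    β-above : ∀ x → L ℕ.≤ x → β x ≡ false
    β-above x le = beads-above (proj₁ core) N x (ℕₚ.≤-trans top≤L le)

    β-closed : ∀ x → β (x ℕ.+ 7) ≡ true → β x ≡ true
    β-closed x e with (x ℕ.+ 7) ℕ.<? L
    ... | yes lt = core⇒closed 7 β L (subst (NoHook 7) (sym (proj₂ β-parts)) (isCore⇒NoHook 7 λs (proj₂ core))) x lt e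
    ... | no ≮L  = case trans (sym e) (β-above (x ℕ.+ 7) (ℕₚ.≮⇒≥ ≮L)) of λ ()

    count : ℕ → ℕ
    count i = trues (λ k → β (i ℕ.+ k ℕ.* 7)) H

    count≤H : ∀ i → count i ℕ.≤ H
    count≤H i = trues≤ (λ k → β (i ℕ.+ k ℕ.* 7)) H

    β-column : ∀ i k → β (i ℕ.+ k ℕ.* 7) ≡ (k ℕ.<ᵇ count i)
    β-column i k with k ℕ.<? H
    ... | yes k<H = downward (λ k → β (i ℕ.+ k ℕ.* 7)) (λ k e → β-closed (i ℕ.+ k ℕ.* 7) (trans (cong β (shift-7 k)) e)) H k k<H
      where
      shift-7 : ∀ k → i ℕ.+ k ℕ.* 7 ℕ.+ 7 ≡ i ℕ.+ suc k ℕ.* 7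
      shift-7 k = trans (ℕₚ.+-assoc i (k ℕ.* 7) 7) (cong (i ℕ.+_) (ℕₚ.+-comm (k ℕ.* 7) 7))
    ... | no k≮H = trans (β-above _ (ℕₚ.≤-trans (ℕₚ.*-monoˡ-≤ 7 (ℕₚ.≮⇒≥ k≮H)) (ℕₚ.m≤n+m _ i)))
                         (sym (<ᵇ-false (ℕₚ.≤-trans (count≤H i) (ℕₚ.≮⇒≥ k≮H))))

    v : Lat 7
    v = tabulateLat 7 (λ i → + count i ℤ.- + h)

    coord-v : ∀ i → i ℕ.< 7 → coord v i ℤ.+ + h ≡ + count i
    coord-v i i<7 = trans (cong (ℤ._+ + h) (coord-tabulate 7 (λ i → + count i ℤ.- + h) i i<7))
      (ℤR.solve (+ count i ∷ + h ∷ []) (λ { (a ∷ b ∷ []) → a :- b :+ b , a }) refl)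

    heights-v : ∀ i → i ℕ.< 7 → heights v i ≡ count i
    heights-v i i<7 = cong ℤ.∣_∣ (coord-v i i<7)

    open Runners v h H (heights v) (λ i i<7 → trans (cong +_ (heights-v i i<7)) (sym (coord-v i i<7)))
      (λ i i<7 → subst (ℕ._≤ H) (sym (heights-v i i<7)) (count≤H i))

    runners≡β : ∀ x → runners (heights v) x ≡ β x
    runners≡β x = trans (cong (x / 7 ℕ.<ᵇ_) (heights-v (x % 7) (DM.m%n<n x 7)))
      (trans (sym (β-column (x % 7) (x / 7))) (cong β (sym (DM.m≡m%n+[m/n]*n x 7))))

    words = word-cong (runners (heights v)) β L (λ x _ → runners≡β x)

    charge-v : charge v ≡ M
    charge-v = +-cancel (+ (7 ℕ.* h)) (trans (cong (λ z → charge v ℤ.+ z) (ℤₚ.pos-* 7 h))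
      (trans (sym trues-runners) (trans (cong +_ (trans (proj₁ words) (proj₁ β-parts))) N-shift)))

    toCore-v : toCore v ≡ (λs , M)
    toCore-v = cong₂ _,_ (trans (proj₂ (proj₂ words)) (proj₂ β-parts)) charge-v

    weight-v : Weight 7 0 v ≡ n
    weight-v = trans (sym (to-weight v (sumℕ (proj₁ (toCore v))) size-runners)) (trans (cong₂ (λ s c → sumℕ s ℕ.* 2 ℕ.+ square c)
      (cong proj₁ toCore-v) charge-v) w)

-- The hypothesis on the weights relates the BG-rank of a core to the parities of its vector.
lattice≈chargedCores : (s : Lat 7 → ℤ) (s′ : List ℕ × ℤ → ℤ) →
  (∀ v λs → + 4 ℤ.* bgRank λs ≡ pm ℤ.∣ charge v ∣ ℤ.* (+ 7 ℤ.- + 2 ℤ.* + Oddness 7 0 v) ℤ.+ + 1 → s v ≡ s′ (λs , charge v)) →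
  gen (lattice 7 0) s ≈ gen chargedCores s′
lattice≈chargedCores s s′ weights = gen-bijection (lattice 7 0) chargedCores s s′ (λ n → CoreBijection.toCore n)
  (λ n v _ w → let open CoreBijection n in (toCore-core v , tt) , trans (to-weight v (sumℕ (proj₁ (toCore v))) (Of.size-runners v w)) w
     , weights v _ (Of.bgRank-runners v w pm-h))
  (λ n v v′ _ w _ w′ → CoreBijection.toCore-injective n v v′ w w′)
  (λ n c q w → let open CoreBijection.From n (proj₁ c) (proj₂ c) (proj₁ q) w in v , tt , weight-v , toCore-v)

-- Charge zero gives every core a vector, so the formula for the BG-rank applies to each core and
-- bounds its rank.
core-vector : ∀ λs → Core₇ λs → ∃ λ (v : Lat 7) → charge v ≡ + 0 ×
  + 4 ℤ.* bgRank λs ≡ pm ℤ.∣ charge v ∣ ℤ.* (+ 7 ℤ.- + 2 ℤ.* + Oddness 7 0 v) ℤ.+ + 1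
core-vector λs core = v , charge-v , trans (cong (λ μs → + 4 ℤ.* bgRank μs) (sym (cong proj₁ toCore-v)))
    (CoreBijection.Of.bgRank-runners n v weight-v (CoreBijection.pm-h n))
  where
  n = sumℕ λs ℕ.* 2 ℕ.+ 0
  open CoreBijection.From n λs (+ 0) core refl

-- Signs and exponents of charged cores in terms of the parities of the coordinates.

-- The sign (-1)^(n(n-1)/2), which runs +, +, -, - with period four.
sg : ℕ → ℤ
sg zero    = + 1
sg (suc n) = pm n ℤ.* sg n

-- The binomial coefficient of m + n over 2 is the sum of those of m and of n, plus mn.
sg-+ : ∀ m n → sg (m ℕ.+ n) ≡ sg m ℤ.* sg n ℤ.* pm (m ℕ.* n)
sg-+ zero    n = sym (trans (ℤₚ.*-identityʳ (+ 1 ℤ.* sg n)) (ℤₚ.*-identityˡ (sg n)))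
sg-+ (suc m) n = trans (cong₂ ℤ._*_ (pm-+ m n) (sg-+ m n)) (trans
  (ℤR.solve (pm m ∷ pm n ∷ sg m ∷ sg n ∷ pm (m ℕ.* n) ∷ []) (λ { (a ∷ b ∷ c ∷ d ∷ e ∷ []) →
    a :* b :* (c :* d :* e) , a :* c :* d :* (b :* e) }) refl)
  (cong (λ z → pm m ℤ.* sg m ℤ.* sg n ℤ.* z) (sym (pm-+ n (m ℕ.* n)))))

sg² : ∀ n → sg n ℤ.* sg n ≡ + 1
sg² zero    = refl
sg² (suc n) = trans (ℤR.solve (pm n ∷ sg n ∷ []) (λ { (a ∷ b ∷ []) → a :* b :* (a :* b) , a :* a :* (b :* b) }) refl)
  (cong₂ ℤ._*_ (pm² n) (sg² n))

sg-*4 : ∀ h → sg (h ℕ.* 4) ≡ + 1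
sg-*4 zero    = refl
sg-*4 (suc h) = trans (ℤR.solve (pm (h ℕ.* 4) ∷ sg (h ℕ.* 4) ∷ []) (λ { (p ∷ s ∷ []) →
    :neg (:neg (:neg p)) :* (:neg (:neg p) :* (:neg p :* (p :* s))) , p :* p :* (p :* p) :* s }) refl)
  (cong₂ ℤ._*_ (cong₂ ℤ._*_ (pm² (h ℕ.* 4)) (pm² (h ℕ.* 4))) (sg-*4 h))

pm-*-+1 : ∀ m n → pm n ≡ + 1 → pm (m ℕ.* n) ≡ + 1
pm-*-+1 zero    n e = refl
pm-*-+1 (suc m) n e = trans (pm-+ n (m ℕ.* n)) (cong₂ ℤ._*_ e (pm-*-+1 m n e))

pm-*--1 : ∀ m n → pm n ≡ - + 1 → pm (m ℕ.* n) ≡ pm m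
pm-*--1 zero    n e = refl
pm-*--1 (suc m) n e = trans (pm-+ n (m ℕ.* n)) (trans (cong₂ ℤ._*_ e (pm-*--1 m n e)) (ℤₚ.-1*i≡-i (pm m)))

pm-cases : ∀ n → pm n ≡ + 1 ⊎ pm n ≡ - + 1
pm-cases zero = inj₁ refl
pm-cases (suc n) with pm-cases n
... | inj₁ e = inj₂ (cong -_ e)
... | inj₂ e = inj₁ (cong -_ e)

pm-*-cong : ∀ m m′ n n′ → pm m ≡ pm m′ → pm n ≡ pm n′ → pm (m ℕ.* n) ≡ pm (m′ ℕ.* n′)
pm-*-cong m m′ n n′ e e′ with pm-cases n
... | inj₁ f = trans (pm-*-+1 m n f) (sym (pm-*-+1 m′ n′ (trans (sym e′) f)))
... | inj₂ f = trans (pm-*--1 m n f) (trans e (sym (pm-*--1 m′ n′ (trans (sym e′) f))))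

-- The extension of `sg` to ℤ with period four.
sgn : ℤ → ℤ
sgn (+ n)    = sg n
sgn -[1+ k ] = - sg k

pm-*4 : ∀ h → pm (h ℕ.* 4) ≡ + 1
pm-*4 h = pm-*-+1 h 4 refl

sg-shift : ∀ m z h → + m ≡ z ℤ.+ + (h ℕ.* 4) → sg m ≡ sgn z
sg-shift m (+ k) h e = trans (cong sg (ℤₚ.+-injective e)) (trans (sg-+ k (h ℕ.* 4))
  (trans (cong₂ (λ a b → sg k ℤ.* a ℤ.* b) (sg-*4 h) (pm-*-+1 k (h ℕ.* 4) (pm-*4 h)))
    (ℤR.solve (sg k ∷ []) (λ { (a ∷ []) → a :* con (+ 1) :* con (+ 1) , a }) refl)))
sg-shift m -[1+ k ] h e = -≡0⇒≡ (trans
  (ℤR.solve (sg m ∷ sg k ∷ pm k ∷ pm m ∷ pm (m ℕ.* suc k) ∷ []) (λ { (a ∷ b ∷ p ∷ q ∷ c ∷ []) →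
     a :- :neg b ,
     (:neg b) :* (a :* (p :* b) :* c :- con (+ 1)) :+ a :* p :* b :* b :* (c :- :neg p) :+ a :* (:neg b :* b) :* (p :* p :- con (+ 1)) :+ (:neg a) :* (b :* b :- con (+ 1)) }) refl)
  ((- sg k) ⊙ᶻ trans (sym (sg-+ m (suc k))) (trans (cong sg sum) (sg-*4 h))
   ⊞ᶻ (sg m ℤ.* pm k ℤ.* sg k ℤ.* sg k) ⊙ᶻ trans (pm-*-cong m (suc k) (suc k) (suc k) pm-m refl) (pm-square (suc k))
   ⊞ᶻ (sg m ℤ.* (- sg k ℤ.* sg k)) ⊙ᶻ pm² k ⊞ᶻ (- sg m) ⊙ᶻ sg² k))
  where
  sum : m ℕ.+ suc k ≡ h ℕ.* 4
  sum = ℤₚ.+-injective (trans (cong (λ z → z ℤ.+ + suc k) e) (ℤR.solve (+ suc k ∷ + (h ℕ.* 4) ∷ []) (λ { (a ∷ b ∷ []) → (:neg a :+ b) :+ a , b }) refl))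
  pm-m : pm m ≡ pm (suc k)
  pm-m = trans (pm-shift m -[1+ k ] (h ℕ.* 4) e) (trans (cong (pm (suc k) ℤ.*_) (pm-*4 h)) (ℤₚ.*-identityʳ (pm (suc k))))
  pm-square : ∀ n → pm (n ℕ.* n) ≡ pm n
  pm-square n with pm-cases n
  ... | inj₁ f = trans (pm-*-+1 n n f) (sym f)
  ... | inj₂ f = pm-*--1 n n f

-- Adding the same multiple of 4 to a and b moves both into ℕ, where the addition formulas are
-- already proved; neither `pm` nor `sgn` notices the shift.
module Shifts (a b : ℤ) where
  h = ℤ.∣ a ∣ ℕ.+ ℤ.∣ b ∣
  m = ℤ.∣ a ℤ.+ + (h ℕ.* 4) ∣
  n = ℤ.∣ b ℤ.+ + (h ℕ.* 4) ∣
  em : + m ≡ a ℤ.+ + (h ℕ.* 4)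
  em = shift-nonneg a (h ℕ.* 4) (ℕₚ.≤-trans (ℕₚ.m≤m+n ℤ.∣ a ∣ ℤ.∣ b ∣) (ℕₚ.m≤m*n h 4))
  en : + n ≡ b ℤ.+ + (h ℕ.* 4)
  en = shift-nonneg b (h ℕ.* 4) (ℕₚ.≤-trans (ℕₚ.m≤n+m ℤ.∣ b ∣ ℤ.∣ a ∣) (ℕₚ.m≤m*n h 4))
  emn : + (m ℕ.+ n) ≡ (a ℤ.+ b) ℤ.+ + ((h ℕ.+ h) ℕ.* 4)
  emn = trans (cong₂ ℤ._+_ em en) (trans (ℤR.solve (a ∷ b ∷ + (h ℕ.* 4) ∷ []) (λ { (a ∷ b ∷ c ∷ []) → (a :+ c) :+ (b :+ c) , (a :+ b) :+ (c :+ c) }) refl)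
    (cong (λ z → (a ℤ.+ b) ℤ.+ + z) (sym (ℕₚ.*-distribʳ-+ 4 h h))))
  pm-of : ∀ k z h → + k ≡ z ℤ.+ + (h ℕ.* 4) → pm k ≡ pm ℤ.∣ z ∣
  pm-of k z h e = trans (pm-shift k z (h ℕ.* 4) e) (trans (cong (pm ℤ.∣ z ∣ ℤ.*_) (pm-*4 h)) (ℤₚ.*-identityʳ (pm ℤ.∣ z ∣)))

pm-ℤ+ : ∀ a b → pm ℤ.∣ a ℤ.+ b ∣ ≡ pm ℤ.∣ a ∣ ℤ.* pm ℤ.∣ b ∣
pm-ℤ+ a b = trans (sym (pm-of (m ℕ.+ n) (a ℤ.+ b) (h ℕ.+ h) emn)) (trans (pm-+ m n) (cong₂ ℤ._*_ (pm-of m a h em) (pm-of n b h en)))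
  where open Shifts a b

sgn-+ : ∀ a b → sgn (a ℤ.+ b) ≡ sgn a ℤ.* sgn b ℤ.* pm (ℤ.∣ a ∣ ℕ.* ℤ.∣ b ∣)
sgn-+ a b = trans (sym (sg-shift (m ℕ.+ n) (a ℤ.+ b) (h ℕ.+ h) emn)) (trans (sg-+ m n)
  (cong₂ ℤ._*_ (cong₂ ℤ._*_ (sg-shift m a h em) (sg-shift n b h en)) (pm-*-cong m ℤ.∣ a ∣ n ℤ.∣ b ∣ (pm-of m a h em) (pm-of n b h en))))
  where open Shifts a b

sgn² : ∀ z → sgn z ℤ.* sgn z ≡ + 1
sgn² (+ n)    = sg² n
sgn² -[1+ k ] = trans (ℤR.solve (sg k ∷ []) (λ { (a ∷ []) → :neg a :* :neg a , a :* a }) refl) (sg² k)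

xnor : Bool → Bool → Bool
xnor true  b = b
xnor false b = not b

even-+ : ∀ m n → evenᵇ (m ℕ.+ n) ≡ xnor (evenᵇ m) (evenᵇ n)
even-+ zero    n = refl
even-+ (suc m) n = trans (cong not (even-+ m n)) (go (evenᵇ m) (evenᵇ n))
  where
  go : ∀ a b → not (xnor a b) ≡ xnor (not a) b
  go true  b = refl
  go false true = refl
  go false false = refl

isEven : ℤ → Bool
isEven z = evenᵇ ℤ.∣ z ∣

bit-sign : Bool → ℤ
bit-sign b = if b then + 1 else - + 1

bit-sign-injective : ∀ {a b} → bit-sign a ≡ bit-sign b → a ≡ b
bit-sign-injective {true}  {true}  _ = refl
bit-sign-injective {false} {false} _ = refl

isEven-+ : ∀ a b → isEven (a ℤ.+ b) ≡ xnor (isEven a) (isEven b)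
isEven-+ a b = bit-sign-injective (trans (sym (pm-even ℤ.∣ a ℤ.+ b ∣)) (trans (pm-ℤ+ a b)
  (trans (cong₂ ℤ._*_ (pm-even ℤ.∣ a ∣) (pm-even ℤ.∣ b ∣)) (go (isEven a) (isEven b)))))
  where
  go : ∀ a b → bit-sign a ℤ.* bit-sign b ≡ bit-sign (xnor a b)
  go true  true  = refl
  go true  false = refl
  go false true  = refl
  go false false = refl

bits : ∀ {k} → Lat k → Vec Bool k
bits {zero}  _       = []
bits {suc k} (z , v) = isEven z ∷ bits v

chargeBit : ∀ {k} → Vec Bool k → Bool
chargeBit []       = true
chargeBit (e ∷ es) = xnor e (chargeBit es)

chargeBit-correct : ∀ {k} (v : Lat k) → isEven (charge v) ≡ chargeBit (bits v)
chargeBit-correct {zero}  _       = refl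
chargeBit-correct {suc k} (z , v) = trans (isEven-+ z (charge v)) (cong (xnor (isEven z)) (chargeBit-correct v))

oddBits : ∀ {k} → ℕ → Vec Bool k → ℕ
oddBits i []       = 0
oddBits i (e ∷ es) = (if xnor (evenᵇ i) e then 1 else 0) ℕ.+ oddBits (suc i) es

oddBits-correct : ∀ k i (v : Lat k) → Oddness k i v ≡ oddBits i (bits v)
oddBits-correct zero    i _       = refl
oddBits-correct (suc k) i (z , v) = cong₂ (λ b n → (if b then 1 else 0) ℕ.+ n) (even-+ i ℤ.∣ z ∣) (oddBits-correct k (suc i) v)

-- The sign i^z (up to a factor depending on the parities), normalised to be real.
twist : ℕ → ℤ → ℤ
twist i z = sgn z ℤ.* (if evenᵇ i ∧ not (isEven z) then - + 1 else + 1)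

Product : (ℕ → ℤ → ℤ) → ∀ k → ℕ → Lat k → ℤ
Product s zero    i _       = + 1
Product s (suc k) i (z , v) = s i z ℤ.* Product s k (suc i) v

twistBits : ∀ {k} → ℕ → Vec Bool k → ℤ
twistBits i []       = + 1
twistBits i (e ∷ es) = bit-sign (e ∨ chargeBit es) ℤ.* (if evenᵇ i ∧ not e then - + 1 else + 1) ℤ.* twistBits (suc i) es

pm-product-bits : ∀ a b → pm (ℤ.∣ a ∣ ℕ.* ℤ.∣ b ∣) ≡ bit-sign (isEven a ∨ isEven b)
pm-product-bits a b with isEven b | pm-even ℤ.∣ b ∣
... | true  | e = trans (pm-*-+1 ℤ.∣ a ∣ ℤ.∣ b ∣ e) (sym (go (isEven a)))
  where
  go : ∀ c → bit-sign (c ∨ true) ≡ + 1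
  go true = refl
  go false = refl
... | false | e = trans (pm-*--1 ℤ.∣ a ∣ ℤ.∣ b ∣ e) (trans (pm-even ℤ.∣ a ∣) (go (isEven a)))
  where
  go : ∀ c → bit-sign c ≡ bit-sign (c ∨ false)
  go true = refl
  go false = refl

-- By `sgn-+` the sign of a sum is the product of the signs up to (-1)^(ab), and this correction
-- depends on parities only.
twistBits-correct : ∀ k i (v : Lat k) → Product twist k i v ≡ sgn (charge v) ℤ.* twistBits i (bits v)
twistBits-correct zero    i _       = refl
twistBits-correct (suc k) i (z , v) = trans (cong (twist i z ℤ.*_) (twistBits-correct k (suc i) v)) (-≡0⇒≡ (trans
  (ℤR.solve (sgn z ∷ u ∷ sgn (charge v) ∷ twistBits (suc i) (bits v) ∷ sgn (z ℤ.+ charge v) ∷ p ∷ [])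
    (λ { (s ∷ u ∷ c ∷ t ∷ sc ∷ p ∷ []) →
      s :* u :* (c :* t) :- sc :* (p :* u :* t) ,
      (:neg (p :* u :* t)) :* (sc :- s :* c :* p) :+ (:neg (s :* c :* u :* t)) :* (p :* p :- con (+ 1)) }) refl)
  ((- (p ℤ.* u ℤ.* twistBits (suc i) (bits v))) ⊙ᶻ trans (sgn-+ z (charge v)) (cong (λ q → sgn z ℤ.* sgn (charge v) ℤ.* q)
      (trans (pm-product-bits z (charge v)) (cong (λ b → bit-sign (isEven z ∨ b)) (chargeBit-correct v))))
   ⊞ᶻ (- (sgn z ℤ.* sgn (charge v) ℤ.* u ℤ.* twistBits (suc i) (bits v))) ⊙ᶻ bit² (isEven z ∨ chargeBit (bits v)))))
  where
  u = if evenᵇ i ∧ not (isEven z) then - + 1 else + 1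
  p = bit-sign (isEven z ∨ chargeBit (bits v))
  bit² : ∀ b → bit-sign b ℤ.* bit-sign b ≡ + 1
  bit² true = refl
  bit² false = refl

-- BG-rank and power of x determined by the parity of the charge.
rankOf : Bool → ℕ → ℤ
rankOf true 0 = + 2
rankOf true 2 = + 1
rankOf true 4 = + 0
rankOf true _ = - + 1
rankOf false 1 = - + 1
rankOf false 3 = + 0
rankOf false 5 = + 1
rankOf false _ = + 2

-- The number k of odd entries, solved from 4b = ±(7 - 2k) + 1, where the sign is + for even charge
-- and - for odd charge.
exponent : Bool → ℤ → ℕ
exponent true  b = ℤ.∣ + 4 ℤ.- + 2 ℤ.* b ∣
exponent false b = ℤ.∣ + 2 ℤ.* b ℤ.+ + 3 ∣

State : Set
State = Bool × ℕ × ℤ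

stateOf : ∀ {k} → ℕ → Vec Bool k → State
stateOf i es = chargeBit es , oddBits i es , twistBits i es

extend : ℕ → Bool → State → State
extend i e (c , k , t) = xnor e c , (if xnor (evenᵇ i) e then 1 else 0) ℕ.+ k ,
  bit-sign (e ∨ c) ℤ.* (if evenᵇ i ∧ not e then - + 1 else + 1) ℤ.* t

states : ℕ → ℕ → List State
states zero    i = (true , 0 , + 1) ∷ []
states (suc n) i = map (extend i true) (states n (suc i)) ++ map (extend i false) (states n (suc i))

stateOf∈states : ∀ n i (es : Vec Bool n) → stateOf i es ∈ states n i
stateOf∈states zero    i []           = here refl
stateOf∈states (suc n) i (true ∷ es)  = ∈-++⁺ˡ (∈-map⁺ (extend i true) (stateOf∈states n (suc i) es))
stateOf∈states (suc n) i (false ∷ es) = ∈-++⁺ʳ (map (extend i true) (states n (suc i))) (∈-map⁺ (extend i false) (stateOf∈states n (suc i) es))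

Consistent : State → Set
Consistent (c , k , t) = + 4 ℤ.* rankOf c k ≡ bit-sign c ℤ.* (+ 7 ℤ.- + 2 ℤ.* + k) ℤ.+ + 1 ×
  k ≡ exponent c (rankOf c k) × t ≡ bit-sign c ℤ.* pm ℤ.∣ rankOf c k ∣

consistent? : ∀ st → Dec (Consistent st)
consistent? (c , k , t) = (_ ℤ.≟ _) ×-dec (_ ℕ.≟ _) ×-dec (_ ℤ.≟ _)

allB-dec : {A : Set} {P : A → Set} (P? : ∀ a → Dec (P a)) (xs : List A) → T (allB (λ x → isYes (P? x)) xs) → ∀ {x} → x ∈ xs → P x
allB-dec P? xs ok {x} x∈ = toWitness {a? = P? x} (allB⁻ (λ x → isYes (P? x)) xs ok x∈)

-- Everything here depends on the seven parities alone, so 128 cases are evaluated; `states`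
-- tabulates only the resulting triples. The check also shows that the default clauses of `rankOf`
-- receive no values other than 6 and 7.
consistent : ∀ (es : Vec Bool 7) → Consistent (stateOf 0 es)
consistent es = allB-dec consistent? (states 7 0) tt (stateOf∈states 7 0 es)

determined : ∀ c k τ → Consistent (c , k , τ) → ∀ {p t s} b → p ≡ bit-sign c → t ≡ s ℤ.* τ →
  + 4 ℤ.* b ≡ p ℤ.* (+ 7 ℤ.- + 2 ℤ.* + k) ℤ.+ + 1 → b ≡ rankOf c k × k ≡ exponent c b × t ≡ bit-sign c ℤ.* s ℤ.* pm ℤ.∣ b ∣
determined c k τ (e₁ , e₂ , e₃) {s = s} b refl refl e = b≡ , trans e₂ (cong (exponent c) (sym b≡)) ,
    trans (cong (s ℤ.*_) (trans e₃ (cong (λ r → bit-sign c ℤ.* pm ℤ.∣ r ∣) (sym b≡))))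
      (ℤR.solve (s ∷ bit-sign c ∷ pm ℤ.∣ b ∣ ∷ []) (λ { (a ∷ b ∷ c ∷ []) → a :* (b :* c) , b :* a :* c }) refl)
  where
  b≡ : b ≡ rankOf c k
  b≡ = ℤₚ.*-cancelˡ-≡ (+ 4) b (rankOf c k) (trans e (sym e₁))

consistent-vector : ∀ (v : Lat 7) → ∃ λ τ → Consistent (isEven (charge v) , Oddness 7 0 v , τ) × Product twist 7 0 v ≡ sgn (charge v) ℤ.* τ
consistent-vector v = twistBits 0 (bits v) ,
  subst₂ (λ c k → Consistent (c , k , twistBits 0 (bits v))) (sym (chargeBit-correct v)) (sym (oddBits-correct 7 0 v)) (consistent (bits v)) ,
  twistBits-correct 7 0 v

rank-determined : ∀ (v : Lat 7) b → + 4 ℤ.* b ≡ pm ℤ.∣ charge v ∣ ℤ.* (+ 7 ℤ.- + 2 ℤ.* + Oddness 7 0 v) ℤ.+ + 1 →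
  b ≡ rankOf (isEven (charge v)) (Oddness 7 0 v) × Oddness 7 0 v ≡ exponent (isEven (charge v)) b ×
  Product twist 7 0 v ≡ bit-sign (isEven (charge v)) ℤ.* sgn (charge v) ℤ.* pm ℤ.∣ b ∣
rank-determined v b = let (τ , c , e) = consistent-vector v in
  determined (isEven (charge v)) (Oddness 7 0 v) τ c {p = pm ℤ.∣ charge v ∣} {t = Product twist 7 0 v} {s = sgn (charge v)} b (pm-even ℤ.∣ charge v ∣) e

InRange : ℤ → Set
InRange b = b ≡ - + 1 ⊎ b ≡ + 0 ⊎ b ≡ + 1 ⊎ b ≡ + 2

rankOf-range : ∀ k → InRange (rankOf true k)
rankOf-range 0 = inj₂ (inj₂ (inj₂ refl))
rankOf-range 1 = inj₁ refl
rankOf-range 2 = inj₂ (inj₂ (inj₁ refl))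
rankOf-range 3 = inj₁ refl
rankOf-range 4 = inj₂ (inj₁ refl)
rankOf-range (suc (suc (suc (suc (suc k))))) = inj₁ refl

range-of-charge-zero : ∀ c k {b} → c ≡ + 0 → b ≡ rankOf (isEven c) k → InRange b
range-of-charge-zero _ k refl refl = rankOf-range k

rank-range : ∀ λs → Core₇ λs → InRange (bgRank λs)
rank-range λs core = go (core-vector λs core)
  where
  go : (∃ λ (v : Lat 7) → charge v ≡ + 0 × + 4 ℤ.* bgRank λs ≡ pm ℤ.∣ charge v ∣ ℤ.* (+ 7 ℤ.- + 2 ℤ.* + Oddness 7 0 v) ℤ.+ + 1) →
    InRange (bgRank λs)
  go (v , ch , e) = range-of-charge-zero (charge v) (Oddness 7 0 v) ch (proj₁ (rank-determined v (bgRank λs) e))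

-- The lattice sum as a product over the runners and as a sum over ranks

Θ : ℕ → (ℤ → ℤ) → Series
Θ i s = gen (ℤ-fibres (weight i) (∣z∣≤weight i)) s

squares : Fibres Always square
squares = ℤ-fibres square ∣z∣≤square

gen-lattice : ∀ s k i → gen (lattice (suc k) i) (Product s (suc k) i) ≈ Θ i (s i) * gen (lattice k (suc i)) (Product s k (suc i))
gen-lattice s k i = ≈-trans
  (coeffs λ n → trans (coeff-gen (lattice (suc k) i) (Product s (suc k) i) n)
    (sym (coeff-gen (ℤ-fibres (weight i) (∣z∣≤weight i) ×ᶠ lattice k (suc i)) (Product s (suc k) i) n)))
  (gen-× (ℤ-fibres (weight i) (∣z∣≤weight i)) (lattice k (suc i)) (s i) (Product s k (suc i)))

gen-lattice₀ : ∀ s i → gen (lattice 0 i) (Product s 0 i) ≈ 𝟙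
gen-lattice₀ s i = ≈-trans (coeffs λ n → trans (coeff-gen (lattice 0 i) (Product s 0 i) n) (go n)) (≈-sym 𝟙≈oneS)
  where
  go : ∀ n → sumOver (Product s 0 i) (fibre (lattice 0 i) n) ≡ oneS n
  go zero    = refl
  go (suc n) = refl

coreGen : (ℤ → ℤ) → Series
coreGen f = gen (dilate 2 cores) (f ∘ bgRank)

C : ℤ → Series
C j = dil 2 (C7 j)

byRank : (ℤ → ℤ) → Series
byRank f = const (f (- + 1)) * C (- + 1) + const (f (+ 0)) * C (+ 0) + const (f (+ 1)) * C (+ 1) + const (f (+ 2)) * C (+ 2)

δ : Bool → ℤ
δ b = if b then + 1 else + 0

length-filter-∷ : {A : Set} {P : A → Set} (P? : ∀ a → Dec (P a)) (x : A) (xs : List A) →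
  + length (filter P? (x ∷ xs)) ≡ δ (does (P? x)) ℤ.+ + length (filter P? xs)
length-filter-∷ P? x xs with does (P? x)
... | true  = refl
... | false = sym (ℤₚ.+-identityˡ (+ length (filter P? xs)))

sumOver-filter : {A : Set} {P : A → Set} (P? : ∀ a → Dec (P a)) (s : A → ℤ) (xs : List A) →
  sumOver s (filter P? xs) ≡ sumOver (λ a → if does (P? a) then s a else + 0) xs
sumOver-filter P? s [] = refl
sumOver-filter P? s (x ∷ xs) with does (P? x)
... | true  = cong (λ z → s x ℤ.+ z) (sumOver-filter P? s xs)
... | false = trans (sumOver-filter P? s xs) (sym (ℤₚ.+-identityˡ (sumOver (λ a → if does (P? a) then s a else + 0) xs)))

module ByRank (f : ℤ → ℤ) where

  combine : ℤ → ℤ → ℤ → ℤ → ℤ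
  combine p q r s = f (- + 1) ℤ.* p ℤ.+ f (+ 0) ℤ.* q ℤ.+ f (+ 1) ℤ.* r ℤ.+ f (+ 2) ℤ.* s

  combine-+ : ∀ p q r s t u v w → combine (p ℤ.+ t) (q ℤ.+ u) (r ℤ.+ v) (s ℤ.+ w) ≡ combine p q r s ℤ.+ combine t u v w
  combine-+ p q r s t u v w = ℤR.solve (f (- + 1) ∷ f (+ 0) ∷ f (+ 1) ∷ f (+ 2) ∷ p ∷ q ∷ r ∷ s ∷ t ∷ u ∷ v ∷ w ∷ [])
    (λ { (a ∷ b ∷ c ∷ d ∷ p ∷ q ∷ r ∷ s ∷ t ∷ u ∷ v ∷ w ∷ []) →
      a :* (p :+ t) :+ b :* (q :+ u) :+ c :* (r :+ v) :+ d :* (s :+ w) ,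
      (a :* p :+ b :* q :+ c :* r :+ d :* s) :+ (a :* t :+ b :* u :+ c :* v :+ d :* w) }) refl

  combine-0 : combine (+ 0) (+ 0) (+ 0) (+ 0) ≡ + 0
  combine-0 = ℤR.solve (f (- + 1) ∷ f (+ 0) ∷ f (+ 1) ∷ f (+ 2) ∷ []) (λ { (a ∷ b ∷ c ∷ d ∷ []) →
    a :* con (+ 0) :+ b :* con (+ 0) :+ c :* con (+ 0) :+ d :* con (+ 0) , con (+ 0) }) refl

  is : Bool → ℤ → ℤ → ℤ
  is c b j = δ (c ∧ does (b ℤ.≟ j))

  pick : ∀ c b → (c ≡ true → InRange b) → (if c then f b else + 0) ≡ combine (is c b (- + 1)) (is c b (+ 0)) (is c b (+ 1)) (is c b (+ 2))
  pick false b _ = sym combine-0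
  pick true b range = go (range refl)
    where
    go : ∀ {b} → InRange b → f b ≡ combine (is true b (- + 1)) (is true b (+ 0)) (is true b (+ 1)) (is true b (+ 2))
    go (inj₁ refl) = ℤR.solve (f (- + 1) ∷ f (+ 0) ∷ f (+ 1) ∷ f (+ 2) ∷ []) (λ { (a ∷ b ∷ c ∷ d ∷ []) →
      a , a :* con (+ 1) :+ b :* con (+ 0) :+ c :* con (+ 0) :+ d :* con (+ 0) }) refl
    go (inj₂ (inj₁ refl)) = ℤR.solve (f (- + 1) ∷ f (+ 0) ∷ f (+ 1) ∷ f (+ 2) ∷ []) (λ { (a ∷ b ∷ c ∷ d ∷ []) →
      b , a :* con (+ 0) :+ b :* con (+ 1) :+ c :* con (+ 0) :+ d :* con (+ 0) }) refl
    go (inj₂ (inj₂ (inj₁ refl))) = ℤR.solve (f (- + 1) ∷ f (+ 0) ∷ f (+ 1) ∷ f (+ 2) ∷ []) (λ { (a ∷ b ∷ c ∷ d ∷ []) →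
      c , a :* con (+ 0) :+ b :* con (+ 0) :+ c :* con (+ 1) :+ d :* con (+ 0) }) refl
    go (inj₂ (inj₂ (inj₂ refl))) = ℤR.solve (f (- + 1) ∷ f (+ 0) ∷ f (+ 1) ∷ f (+ 2) ∷ []) (λ { (a ∷ b ∷ c ∷ d ∷ []) →
      d , a :* con (+ 0) :+ b :* con (+ 0) :+ c :* con (+ 0) :+ d :* con (+ 1) }) refl

  hasRank? : ∀ j λs → Dec (T (isCore 7 λs ∧ does (bgRank λs ℤ.≟ j)))
  hasRank? j λs = T? (isCore 7 λs ∧ does (bgRank λs ℤ.≟ j))

  count : ℤ → List (List ℕ) → ℤ
  count j xs = + length (filter (hasRank? j) xs)

  total : List (List ℕ) → ℤ
  total xs = combine (count (- + 1) xs) (count (+ 0) xs) (count (+ 1) xs) (count (+ 2) xs)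

  is-of : List ℕ → ℤ → ℤ
  is-of x j = is (isCore 7 x) (bgRank x) j

  total-∷ : ∀ x xs → total (x ∷ xs) ≡ combine (is-of x (- + 1)) (is-of x (+ 0)) (is-of x (+ 1)) (is-of x (+ 2)) ℤ.+ total xs
  total-∷ x xs = trans (cong₂ (λ p q → combine p q (count (+ 1) (x ∷ xs)) (count (+ 2) (x ∷ xs))) (step (- + 1)) (step (+ 0)))
    (trans (cong₂ (combine (is-of x (- + 1) ℤ.+ count (- + 1) xs) (is-of x (+ 0) ℤ.+ count (+ 0) xs)) (step (+ 1)) (step (+ 2)))
    (combine-+ (is-of x (- + 1)) (is-of x (+ 0)) (is-of x (+ 1)) (is-of x (+ 2)) (count (- + 1) xs) (count (+ 0) xs) (count (+ 1) xs) (count (+ 2) xs)))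
    where
    step : ∀ j → count j (x ∷ xs) ≡ is-of x j ℤ.+ count j xs
    step j = length-filter-∷ (hasRank? j) x xs

  sum-cores : ∀ xs → (∀ {λs} → λs ∈ xs → Descending (head₀ λs) λs) →
    sumOver (λ λs → if isCore 7 λs then f (bgRank λs) else + 0) xs ≡ total xs
  sum-cores [] _ = sym combine-0
  sum-cores (x ∷ xs) d = trans (cong₂ ℤ._+_
      (pick (isCore 7 x) (bgRank x) (λ e → rank-range x (d (here refl) , ≡⇒T e))) (sum-cores xs (λ x∈ → d (there x∈))))
    (sym (total-∷ x xs))

  byRank₇ : Series
  byRank₇ = const (f (- + 1)) * C7 (- + 1) + const (f (+ 0)) * C7 (+ 0) + const (f (+ 1)) * C7 (+ 1) + const (f (+ 2)) * C7 (+ 2)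

  undilated : gen cores (f ∘ bgRank) ≈ byRank₇
  undilated = coeffs λ n → trans (coeff-gen cores (f ∘ bgRank) n) (trans (sumOver-filter core? (f ∘ bgRank) (partitions n))
    (trans (sum-cores (partitions n) (λ λs∈ → proj₁ (partitions⁻ {n} λs∈))) (sym (coefficient n))))
    where
    t : ℤ → Series
    t j = const (f j) * C7 j
    coefficient : ∀ n → byRank₇ n ≡ total (partitions n)
    coefficient n = trans (coeff-+ (t (- + 1) + t (+ 0) + t (+ 1)) (t (+ 2)) n) (cong₂ ℤ._+_
      (trans (coeff-+ (t (- + 1) + t (+ 0)) (t (+ 1)) n) (cong₂ ℤ._+_
        (trans (coeff-+ (t (- + 1)) (t (+ 0)) n) (cong₂ ℤ._+_ (coeff-const-* (f (- + 1)) (C7 (- + 1)) n) (coeff-const-* (f (+ 0)) (C7 (+ 0)) n)))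
        (coeff-const-* (f (+ 1)) (C7 (+ 1)) n)))
      (coeff-const-* (f (+ 2)) (C7 (+ 2)) n))

-- By `rank-range` the four listed ranks are the only ones.
coreGen≈byRank : ∀ f → coreGen f ≈ byRank f
coreGen≈byRank f = ≈-trans (gen-dilate 2 cores (f ∘ bgRank)) (≈-trans (dil-cong 2 (ByRank.undilated f))
  (≈-trans (dil-+ 2 _ _) (+-cong (≈-trans (dil-+ 2 _ _) (+-cong (≈-trans (dil-+ 2 _ _)
    (+-cong (dil-const-* 2 _ _) (dil-const-* 2 _ _))) (dil-const-* 2 _ _))) (dil-const-* 2 _ _))))

isOddAt : ℕ → ℤ → Bool
isOddAt i z = evenᵇ (i ℕ.+ ℤ.∣ z ∣)

-- A sign g on the coordinates that becomes u(M) r(b) on a core of BG-rank b and charge M.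
module SignedLattice (g : ℕ → ℤ → ℤ) (u r : ℤ → ℤ)
  (g-ur : ∀ (v : Lat 7) b → + 4 ℤ.* b ≡ pm ℤ.∣ charge v ∣ ℤ.* (+ 7 ℤ.- + 2 ℤ.* + Oddness 7 0 v) ℤ.+ + 1 →
    Product g 7 0 v ≡ u (charge v) ℤ.* r b) where

  even-part odd-part : ℕ → Series
  even-part i = Θ i (λ z → if isOddAt i z then + 0 else g i z)
  odd-part i  = Θ i (λ z → if isOddAt i z then g i z else + 0)

  evens odds : Series
  evens = gen squares (λ M → if isEven M then u M else + 0)
  odds  = gen squares (λ M → if isEven M then + 0 else u M)

  -- The marker of odd entries is an arbitrary integer and not a second variable; `horner-zero`
  -- recovers the coefficients.
  module _ (x : ℤ) where

    factor : ℕ → Series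
    factor i = even-part i + const x * odd-part i

    s : ℕ → ℤ → ℤ
    s i z = g i z ℤ.* x ℤ.^ oddness i z

    Θ-factor : ∀ i → Θ i (s i) ≈ factor i
    Θ-factor i = ≈-trans (gen-cong _ λ z _ → go (isOddAt i z) (g i z)) (≈-trans (gen-+ _ _ _) (+-congˡ (gen-scale _ x _)))
      where
      go : ∀ b y → y ℤ.* x ℤ.^ (if b then 1 else 0) ≡ (if b then + 0 else y) ℤ.+ x ℤ.* (if b then y else + 0)
      go true  y = ℤR.solve (x ∷ y ∷ []) (λ { (x ∷ y ∷ []) → y :* (x :* con (+ 1)) , con (+ 0) :+ x :* y }) refl
      go false y = ℤR.solve (x ∷ y ∷ []) (λ { (x ∷ y ∷ []) → y :* con (+ 1) , y :+ x :* con (+ 0) }) refl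

    Product-s : ∀ k i v → Product s k i v ≡ Product g k i v ℤ.* x ℤ.^ Oddness k i v
    Product-s zero    i _       = refl
    Product-s (suc k) i (z , v) = trans (cong (s i z ℤ.*_) (Product-s k (suc i) v)) (trans
      (ℤR.solve (g i z ∷ x ℤ.^ oddness i z ∷ Product g k (suc i) v ∷ x ℤ.^ Oddness k (suc i) v ∷ [])
        (λ { (a ∷ b ∷ c ∷ d ∷ []) → a :* b :* (c :* d) , a :* c :* (b :* d) }) refl)
      (cong (Product g (suc k) i (z , v) ℤ.*_) (sym (ℤₚ.^-distribˡ-+-* x (oddness i z) (Oddness k (suc i) v)))))

    term : Bool → ℤ → ℤ
    term e b = r b ℤ.* x ℤ.^ exponent e b

    -- The left side sums over vectors one coordinate at a time, the right side over pairs of a core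
    -- and a charge. The power of x depends on the charge only through its parity, hence two
    -- products.
    lattice-product : factor 0 * (factor 1 * (factor 2 * (factor 3 * (factor 4 * (factor 5 * factor 6))))) ≈
      byRank (term true) * evens + byRank (term false) * odds
    lattice-product = ≈-trans (≈-sym lhs) (≈-trans (lattice≈chargedCores (Product s 7 0) s′ weights) rhs)
      where
      s′ : List ℕ × ℤ → ℤ
      s′ (λs , M) = term true (bgRank λs) ℤ.* (if isEven M then u M else + 0) ℤ.+ term false (bgRank λs) ℤ.* (if isEven M then + 0 else u M)
      weights : ∀ v λs → + 4 ℤ.* bgRank λs ≡ pm ℤ.∣ charge v ∣ ℤ.* (+ 7 ℤ.- + 2 ℤ.* + Oddness 7 0 v) ℤ.+ + 1 →
        Product s 7 0 v ≡ s′ (λs , charge v)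
      weights v λs e = trans (Product-s 7 0 v) (trans (cong₂ ℤ._*_ (g-ur v (bgRank λs) e)
        (cong (x ℤ.^_) (proj₁ (proj₂ (rank-determined v (bgRank λs) e))))) (go (isEven (charge v)) (u (charge v)) (r (bgRank λs)) (bgRank λs)))
        where
        go : ∀ c a ρ b → a ℤ.* ρ ℤ.* x ℤ.^ exponent c b ≡
          ρ ℤ.* x ℤ.^ exponent true b ℤ.* (if c then a else + 0) ℤ.+ ρ ℤ.* x ℤ.^ exponent false b ℤ.* (if c then + 0 else a)
        go true a ρ b = ℤR.solve (a ∷ ρ ∷ x ℤ.^ exponent true b ∷ x ℤ.^ exponent false b ∷ []) (λ { (a ∷ ρ ∷ e ∷ o ∷ []) →
          a :* ρ :* e , ρ :* e :* a :+ ρ :* o :* con (+ 0) }) refl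
        go false a ρ b = ℤR.solve (a ∷ ρ ∷ x ℤ.^ exponent true b ∷ x ℤ.^ exponent false b ∷ []) (λ { (a ∷ ρ ∷ e ∷ o ∷ []) →
          a :* ρ :* o , ρ :* e :* con (+ 0) :+ ρ :* o :* a }) refl
      lhs : gen (lattice 7 0) (Product s 7 0) ≈ factor 0 * (factor 1 * (factor 2 * (factor 3 * (factor 4 * (factor 5 * factor 6)))))
      lhs = step 6 0 (step 5 1 (step 4 2 (step 3 3 (step 2 4 (step 1 5
              (≈-trans (gen-lattice s 0 6) (≈-trans (*-cong (Θ-factor 6) (gen-lattice₀ s 7)) (*-identityʳ _))))))))
        where
        step : ∀ k i {f} → gen (lattice k (suc i)) (Product s k (suc i)) ≈ f → gen (lattice (suc k) i) (Product s (suc k) i) ≈ factor i * f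
        step k i e = ≈-trans (gen-lattice s k i) (*-cong (Θ-factor i) e)
      rhs : gen chargedCores s′ ≈ byRank (term true) * evens + byRank (term false) * odds
      rhs = ≈-trans (gen-+ chargedCores _ _) (+-cong
        (≈-trans (gen-× (dilate 2 cores) squares (term true ∘ bgRank) _) (*-congʳ (coreGen≈byRank (term true))))
        (≈-trans (gen-× (dilate 2 cores) squares (term false ∘ bgRank) _) (*-congʳ (coreGen≈byRank (term false)))))

-- Comparing coefficients of polynomials in x

horner : List Series → Series → Series
horner []       X = const (+ 0)
horner (c ∷ cs) X = c + X * horner cs X

hornerℤ : List ℤ → ℤ → ℤ
hornerℤ []       x = + 0
hornerℤ (c ∷ cs) x = c ℤ.+ x ℤ.* hornerℤ cs x

coeff-horner : ∀ cs x n → horner cs (const x) n ≡ hornerℤ (map (λ c → c n) cs) x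
coeff-horner []       x n = trans (at-degree const-0 n) (coeff-𝟘 n)
coeff-horner (c ∷ cs) x n = trans (coeff-+ c _ n) (cong (λ z → c n ℤ.+ z) (trans (coeff-const-* x (horner cs (const x)) n)
  (cong (x ℤ.*_) (coeff-horner cs x n))))

-- The constant term is tested at a point larger than its absolute value. Once it is zero, dividing
-- by the nonzero value of x passes the hypothesis on to the remaining coefficients.
hornerℤ-zero : ∀ cs → (∀ k → hornerℤ cs (+ suc k) ≡ + 0) → All (_≡ + 0) cs
hornerℤ-zero []       _ = []
hornerℤ-zero (c ∷ cs) p = c≡0 ∷ hornerℤ-zero cs (λ k → case ℤₚ.i*j≡0⇒i≡0∨j≡0 (+ suc k) (trans (sym (ℤₚ.+-identityˡ _))
    (trans (cong (ℤ._+ (+ suc k ℤ.* hornerℤ cs (+ suc k))) (sym c≡0)) (p k))) of λ { (inj₁ ()) ; (inj₂ e) → e })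
  where
  k = ℤ.∣ c ∣
  y = hornerℤ cs (+ suc k)
  -- c is a multiple of 1 + ∣ c ∣.
  abs : k ≡ suc k ℕ.* ℤ.∣ y ∣
  abs = trans (trans (cong ℤ.∣_∣ (-≡0⇒≡ {c} { - (+ suc k ℤ.* y)} (trans (ℤR.solve (c ∷ + suc k ∷ y ∷ []) (λ { (c ∷ x ∷ y ∷ []) → c :- :neg (x :* y) , 1 · (c :+ x :* y :- con (+ 0)) }) refl) ((+ 1) ⊙ᶻ p k))))
    (ℤₚ.∣-i∣≡∣i∣ (+ suc k ℤ.* y))) (ℤₚ.∣i*j∣≡∣i∣*∣j∣ (+ suc k) y)
  zero-abs : ∀ m → k ≡ suc k ℕ.* m → k ≡ 0
  zero-abs zero    e = trans e (ℕₚ.*-zeroʳ (suc k))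
  zero-abs (suc m) e = contradiction (ℕₚ.≤-trans (ℕₚ.m≤m*n (suc k) (suc m)) (ℕₚ.≤-reflexive (sym e))) (ℕₚ.<-irrefl refl)
  c≡0 : c ≡ + 0
  c≡0 = ℤₚ.∣i∣≡0⇒i≡0 (zero-abs ℤ.∣ y ∣ abs)

horner-zero : ∀ cs → (∀ k → horner cs (const (+ suc k)) ≈ 𝟘) → All (_≈ 𝟘) cs
horner-zero cs p = All.tabulate λ {c} c∈ → coeffs λ n → trans
  (All.lookup (hornerℤ-zero (map (λ d → d n) cs) (λ k → trans (sym (coeff-horner cs (+ suc k) n)) (trans (at-degree (p k) n) (coeff-𝟘 n))))
    (∈-map⁺ (λ d → d n) c∈)) (sym (coeff-𝟘 n))

-- Identification of the one-dimensional theta series.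

gen-restrict : {A : Set} {P Q : A → Set} {w : A → ℕ} (Q? : ∀ a → Dec (Q a)) (Φ : Fibres P w) (s : A → ℤ) →
  gen (restrict Q? Φ) s ≈ gen Φ (λ a → if does (Q? a) then s a else + 0)
gen-restrict Q? Φ s = coeffs λ n → trans (coeff-gen (restrict Q? Φ) s n) (trans (go (fibre Φ n)) (sym (coeff-gen Φ _ n)))
  where
  go : ∀ xs → sumOver s (filter Q? xs) ≡ sumOver (λ a → if does (Q? a) then s a else + 0) xs
  go [] = refl
  go (x ∷ xs) with does (Q? x)
  ... | true  = cong (λ z → s x ℤ.+ z) (go xs)
  ... | false = trans (go xs) (sym (ℤₚ.+-identityˡ _))

-- Odd numbers are written 2l - 1 and not 2l + 1: with this choice the weights on the runners 4, 5,
-- 6 become, up to a constant and a dilation, `jacobi a c l` with a and c both positive.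
dbl dbl⁻ : ℤ → ℤ
dbl l  = l ℤ.+ l
dbl⁻ l = l ℤ.+ l ℤ.- + 1

xnor-same : ∀ b → xnor b b ≡ true
xnor-same true  = refl
xnor-same false = refl

isEven-dbl : ∀ l → isEven (dbl l) ≡ true
isEven-dbl l = trans (isEven-+ l l) (xnor-same (isEven l))

isEven-dbl⁻ : ∀ l → isEven (dbl⁻ l) ≡ false
isEven-dbl⁻ l = trans (isEven-+ (l ℤ.+ l) (- + 1)) (cong (λ b → xnor b false) (isEven-dbl l))

dbl-injective : ∀ {l l′} → dbl l ≡ dbl l′ → l ≡ l′
dbl-injective {l} {l′} e = ℤₚ.*-cancelˡ-≡ (+ 2) l l′ (trans (two l) (trans e (sym (two l′))))
  where
  two : ∀ l → + 2 ℤ.* l ≡ dbl l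
  two l = ℤR.solve (l ∷ []) (λ { (l ∷ []) → 2 · l , l :+ l }) refl

dbl⁻-injective : ∀ {l l′} → dbl⁻ l ≡ dbl⁻ l′ → l ≡ l′
dbl⁻-injective e = dbl-injective (+-cancel (- + 1) e)

halves : ∀ n → (∃ λ k → n ≡ k ℕ.+ k) ⊎ (∃ λ k → n ≡ suc (k ℕ.+ k))
halves zero = inj₁ (0 , refl)
halves (suc n) with halves n
... | inj₁ (k , e) = inj₂ (k , cong suc e)
... | inj₂ (k , e) = inj₁ (suc k , trans (cong suc e) (cong suc (sym (ℕₚ.+-suc k k))))

double-even : ∀ k → evenᵇ (k ℕ.+ k) ≡ true
double-even k = trans (even-+ k k) (xnor-same (evenᵇ k))

even-half : ∀ z → isEven z ≡ true → ∃ λ l → dbl l ≡ z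
even-half (+ n) e with halves n
... | inj₁ (k , refl) = + k , refl
... | inj₂ (k , refl) = case trans (sym e) (cong not (double-even k)) of λ ()
even-half -[1+ n ] e with halves n
... | inj₁ (k , refl) = case trans (sym e) (cong not (double-even k)) of λ ()
... | inj₂ (k , refl) = -[1+ k ] , refl

odd-half : ∀ z → isEven z ≡ false → ∃ λ l → dbl⁻ l ≡ z
odd-half (+ n) e with halves n
... | inj₁ (k , refl) = case trans (sym e) (double-even k) of λ ()
... | inj₂ (k , refl) = + suc k , ℤR.solve (+ k ∷ []) (λ { (k ∷ []) → (con (+ 1) :+ k) :+ (con (+ 1) :+ k) :- con (+ 1) , con (+ 1) :+ (k :+ k) }) refl
odd-half -[1+ n ] e with halves n
... | inj₁ (k , refl) = - + k , ℤR.solve (+ k ∷ []) (λ { (k ∷ []) → :neg k :+ :neg k :- con (+ 1) , :neg (con (+ 1) :+ (k :+ k)) }) refl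
... | inj₂ (k , refl) = case trans (sym e) (cong (not ∘ not) (double-even k)) of λ ()

even? : ∀ z → Dec (isEven z ≡ true)
even? z = isEven z Bool.≟ true

odd? : ∀ z → Dec (isEven z ≡ false)
odd? z = isEven z Bool.≟ false

if-even : ∀ {A : Set} b (x y : A) → (if does (b Bool.≟ true) then x else y) ≡ (if b then x else y)
if-even true  x y = refl
if-even false x y = refl

if-odd : ∀ {A : Set} b (x y : A) → (if does (b Bool.≟ false) then x else y) ≡ (if b then y else x)
if-odd true  x y = refl
if-odd false x y = refl

module _ {w : ℤ → ℕ} (Φ : Fibres Always w) (s : ℤ → ℤ) where

  gen-evens : {v : ℤ → ℕ} (Ψ : Fibres Always v) (s′ : ℤ → ℤ) → (∀ l → v l ≡ w (dbl l)) → (∀ l → s′ l ≡ s (dbl l)) →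
    gen Φ (λ z → if isEven z then s z else + 0) ≈ gen Ψ s′
  gen-evens Ψ s′ wt e = ≈-sym (≈-trans (gen-bijection Ψ (restrict even? Φ) s′ s (λ _ → dbl)
    (λ n l _ q → (tt , isEven-dbl l) , trans (sym (wt l)) q , e l)
    (λ n l l′ _ _ _ _ → dbl-injective)
    (λ n z (_ , ev) q → let (l , el) = even-half z ev in l , tt , trans (wt l) (trans (cong w el) q) , el))
    (≈-trans (gen-restrict even? Φ s) (gen-cong Φ λ z _ → if-even (isEven z) (s z) (+ 0))))

  gen-odds : {v : ℤ → ℕ} (Ψ : Fibres Always v) (s′ : ℤ → ℤ) → (∀ l → v l ≡ w (dbl⁻ l)) → (∀ l → s′ l ≡ s (dbl⁻ l)) →
    gen Φ (λ z → if isEven z then + 0 else s z) ≈ gen Ψ s′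
  gen-odds Ψ s′ wt e = ≈-sym (≈-trans (gen-bijection Ψ (restrict odd? Φ) s′ s (λ _ → dbl⁻)
    (λ n l _ q → (tt , isEven-dbl⁻ l) , trans (sym (wt l)) q , e l)
    (λ n l l′ _ _ _ _ → dbl⁻-injective)
    (λ n z (_ , ev) q → let (l , el) = odd-half z ev in l , tt , trans (wt l) (trans (cong w el) q) , el))
    (≈-trans (gen-restrict odd? Φ s) (gen-cong Φ λ z _ → if-odd (isEven z) (s z) (+ 0))))

-- For a weight that is even in z, the odd integers of either sign are indexed by ℕ in the same way;
-- this accounts for the factor 2 in T and H.
gen-odds-ℕ : {w : ℤ → ℕ} {v : ℕ → ℕ} (Φ : Fibres Always w) (Ψ : Fibres Always v) →
  (∀ k → v k ≡ w (+ suc (k ℕ.+ k))) → (∀ k → v k ≡ w -[1+ k ℕ.+ k ]) →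
  gen Φ (λ z → if isEven z then + 0 else + 1) ≈ gen Ψ (λ _ → + 1) + gen Ψ (λ _ → + 1)
gen-odds-ℕ {w} Φ Ψ wt⁺ wt⁻ = ≈-sym (≈-trans (≈-sym (gen-⊎ Ψ Ψ _ _)) (≈-trans
  (gen-bijection (Ψ ⊎ᶠ Ψ) (restrict odd? Φ) _ (λ _ → + 1) (λ _ → f)
    (λ { n (inj₁ k) _ q → (tt , cong not (double-even k)) , trans (sym (wt⁺ k)) q , refl
       ; n (inj₂ k) _ q → (tt , cong not (double-even k)) , trans (sym (wt⁻ k)) q , refl })
    (λ { n (inj₁ k) (inj₁ k′) _ _ _ _ e → cong inj₁ (half-injective (ℕₚ.suc-injective (ℤₚ.+-injective e)))
       ; n (inj₂ k) (inj₂ k′) _ _ _ _ e → cong inj₂ (half-injective (ℤₚ.-[1+-injective e)) })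
    onto)
  (≈-trans (gen-restrict odd? Φ _) (gen-cong Φ λ z _ → if-odd (isEven z) (+ 1) (+ 0)))))
  where
  f : ℕ ⊎ ℕ → ℤ
  f (inj₁ k) = + suc (k ℕ.+ k)
  f (inj₂ k) = -[1+ k ℕ.+ k ]
  half-injective : ∀ {k k′} → k ℕ.+ k ≡ k′ ℕ.+ k′ → k ≡ k′
  half-injective {k} {k′} e = ℤₚ.+-injective (dbl-injective (cong +_ e))
  onto : ∀ n z → ⊤ × isEven z ≡ false → w z ≡ n → ∃ λ x → Sum.[ Always , Always ] x × Sum.[ _ , _ ] x ≡ n × f x ≡ z
  onto n (+ m) (_ , ev) q with halves m
  ... | inj₁ (k , refl) = case trans (sym (double-even k)) ev of λ ()
  ... | inj₂ (k , refl) = inj₁ k , tt , trans (wt⁺ k) q , refl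
  onto n -[1+ m ] (_ , ev) q with halves m
  ... | inj₁ (k , refl) = inj₂ k , tt , trans (wt⁻ k) q , refl
  ... | inj₂ (k , refl) = case trans (sym (cong (not ∘ not) (double-even k))) ev of λ ()

gen-reflect : {w v : ℤ → ℕ} (Φ : Fibres Always w) (Ψ : Fibres Always v) {s s′ : ℤ → ℤ} →
  (∀ z → v z ≡ w (- z)) → (∀ z → s (- z) ≡ s′ z) → gen Φ s ≈ gen Ψ s′
gen-reflect {w} {v} Φ Ψ {s} {s′} wt e = gen-iso Φ Ψ -_ -_ ℤₚ.neg-involutive ℤₚ.neg-involutive
  (λ z → trans (wt (- z)) (cong w (ℤₚ.neg-involutive z)))
  (λ z → trans (cong s (sym (ℤₚ.neg-involutive z))) (e (- z)))

-- The binomial coefficient n(n - 1)/2.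
b₂ : ℕ → ℕ
b₂ zero    = 0
b₂ (suc n) = n ℕ.+ b₂ n

2*b₂ : ∀ n → + 2 ℤ.* + b₂ n ≡ + n ℤ.* (+ n ℤ.- + 1)
2*b₂ zero    = refl
2*b₂ (suc n) = -≡0⇒≡ (trans (ℤR.solve (+ n ∷ + b₂ n ∷ []) (λ { (n ∷ b ∷ []) →
  2 · (n :+ b) :- (con (+ 1) :+ n) :* (con (+ 1) :+ n :- con (+ 1)) , 1 · (2 · b :- n :* (n :- con (+ 1))) }) refl)
  ((+ 1) ⊙ᶻ 2*b₂ n))

-- (a + c) l(l-1)/2 + a l
jacobi : ℕ → ℕ → ℤ → ℕ
jacobi a c (+ n)    = (a ℕ.+ c) ℕ.* b₂ n ℕ.+ a ℕ.* n
jacobi a c -[1+ k ] = (a ℕ.+ c) ℕ.* b₂ (suc k) ℕ.+ c ℕ.* suc k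

2*jacobi : ∀ a c l → + 2 ℤ.* + jacobi a c l ≡ (+ a ℤ.+ + c) ℤ.* (l ℤ.* (l ℤ.- + 1)) ℤ.+ + 2 ℤ.* + a ℤ.* l
2*jacobi a c (+ n) = trans (cong₂ (λ x y → + 2 ℤ.* (x ℤ.+ y)) (ℤₚ.pos-* (a ℕ.+ c) (b₂ n)) (ℤₚ.pos-* a n)) (-≡0⇒≡ (trans
  (ℤR.solve (+ a ∷ + c ∷ + n ∷ + b₂ n ∷ []) (λ { (a ∷ c ∷ n ∷ b ∷ []) →
    2 · ((a :+ c) :* b :+ a :* n) :- ((a :+ c) :* (n :* (n :- con (+ 1))) :+ 2 · a :* n) ,
    (a :+ c) :* (2 · b :- n :* (n :- con (+ 1))) }) refl)
  ((+ a ℤ.+ + c) ⊙ᶻ 2*b₂ n)))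
2*jacobi a c -[1+ k ] = trans (cong₂ (λ x y → + 2 ℤ.* (x ℤ.+ y)) (ℤₚ.pos-* (a ℕ.+ c) (b₂ (suc k))) (ℤₚ.pos-* c (suc k))) (-≡0⇒≡ (trans
  (ℤR.solve (+ a ∷ + c ∷ + suc k ∷ + b₂ (suc k) ∷ []) (λ { (a ∷ c ∷ n ∷ b ∷ []) →
    2 · ((a :+ c) :* b :+ c :* n) :- ((a :+ c) :* (:neg n :* (:neg n :- con (+ 1))) :+ 2 · a :* :neg n) ,
    (a :+ c) :* (2 · b :- n :* (n :- con (+ 1))) }) refl)
  ((+ a ℤ.+ + c) ⊙ᶻ 2*b₂ (suc k))))

∣l∣≤jacobi : ∀ a c l .{{_ : NonZero a}} .{{_ : NonZero c}} → ℤ.∣ l ∣ ℕ.≤ jacobi a c l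
∣l∣≤jacobi a c (+ n)    = ℕₚ.≤-trans (ℕₚ.m≤n*m n a) (ℕₚ.m≤n+m _ _)
∣l∣≤jacobi a c -[1+ k ] = ℕₚ.≤-trans (ℕₚ.m≤n*m (suc k) c) (ℕₚ.m≤n+m _ _)

jacobiFibres : ∀ a c .{{_ : NonZero a}} .{{_ : NonZero c}} → Fibres Always (jacobi a c)
jacobiFibres a c = ℤ-fibres (jacobi a c) (λ l → ∣l∣≤jacobi a c l)

alternating : ℤ → ℤ
alternating l = pm ℤ.∣ l ∣

-- Ramanujan's theta function f(-q^a, -q^c).
ϑ : ∀ a c .{{_ : NonZero a}} .{{_ : NonZero c}} → Series
ϑ a c = gen (jacobiFibres a c) alternating

triangular : ℕ → ℕ
triangular k = b₂ (suc k)

triangularFibres : Fibres Always triangular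
triangularFibres = ℕ-fibres triangular (λ k → ℕₚ.m≤m+n k (b₂ k))

ψ≈gen : ψ ≈ gen triangularFibres (λ _ → + 1)
ψ≈gen = coeffs λ n → sym (trans (coeff-gen triangularFibres _ n) (trans (sumOver-filter (λ k → triangular k ℕ.≟ n) _ (upTo (suc n)))
  (sumOver-cong (upTo (suc n)) λ {k} _ → cong (λ b → if b then + 1 else + 0) (same-test k n))))
  where
  twice : ∀ k → k ℕ.* suc k ≡ 2 ℕ.* triangular k
  twice k = ℤₚ.+-injective (trans (ℤₚ.pos-* k (suc k)) (trans (ℤR.solve (+ k ∷ []) (λ { (k ∷ []) → k :* (con (+ 1) :+ k) , (con (+ 1) :+ k) :* (con (+ 1) :+ k :- con (+ 1)) }) refl)
    (trans (sym (2*b₂ (suc k))) (sym (ℤₚ.pos-* 2 (triangular k))))))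
  same-test : ∀ k n → does (triangular k ℕ.≟ n) ≡ (k ℕ.* suc k ℕ.≡ᵇ 2 ℕ.* n)
  same-test k n with triangular k ℕ.≟ n
  ... | yes refl = trans (≡ᵇ-true (triangular k)) (sym (T⇒≡ (ℕₚ.≡⇒≡ᵇ (k ℕ.* suc k) (2 ℕ.* triangular k) (twice k))))
  ... | no ≢n    = trans (≡ᵇ-false ≢n) (sym (≡ᵇ-false (λ e → ≢n (ℕₚ.*-cancelˡ-≡ (triangular k) n 2 (trans (sym (twice k)) e)))))

sqℕ : ℕ → ℕ
sqℕ k = k ℕ.* k

k≤sqℕ : ∀ k → k ℕ.≤ sqℕ k
k≤sqℕ zero    = z≤n
k≤sqℕ (suc k) = ℕₚ.m≤m*n (suc k) (suc k)

φ≈gen : φ ≈ gen squares (λ _ → + 1)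
φ≈gen = ≈-trans φ-ℕ (≈-trans split (≈-sym φ-ℤ))
  where
  one : {A : Set} → A → ℤ
  one _ = + 1
  sqF : Fibres Always sqℕ
  sqF = ℕ-fibres sqℕ k≤sqℕ
  sqF⁺ : Fibres Always (sqℕ ∘ suc)
  sqF⁺ = ℕ-fibres (sqℕ ∘ suc) (λ k → ℕₚ.≤-trans (ℕₚ.n≤1+n k) (k≤sqℕ (suc k)))
  origin : Fibres {⊤} Always (λ _ → 0)
  origin = bounded (λ _ → tt ∷ []) (λ _ → 0) (λ _ → [] ∷ []) (λ _ → here refl)
  multiplicity : ℕ → ℤ
  multiplicity k = if k ℕ.≡ᵇ 0 then + 1 else + 2
  φ-ℕ : φ ≈ gen sqF multiplicity
  φ-ℕ = coeffs λ n → sym (trans (coeff-gen sqF multiplicity n) (sumOver-filter (λ k → sqℕ k ℕ.≟ n) multiplicity (upTo (suc n))))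
  zero-or-suc : (s : ℕ → ℤ) → gen sqF s ≈ gen origin (λ _ → s 0) + gen sqF⁺ (s ∘ suc)
  zero-or-suc s = ≈-sym (≈-trans (≈-sym (gen-⊎ origin sqF⁺ _ _)) (gen-bijection (origin ⊎ᶠ sqF⁺) sqF _ s
    (λ _ → λ { (inj₁ _) → 0 ; (inj₂ k) → suc k })
    (λ { n (inj₁ _) _ q → tt , q , refl ; n (inj₂ k) _ q → tt , q , refl })
    (λ { n (inj₁ _) (inj₁ _) _ _ _ _ _ → refl ; n (inj₂ _) (inj₂ _) _ _ _ _ e → cong inj₂ (ℕₚ.suc-injective e) })
    (λ { n zero _ q → inj₁ tt , tt , q , refl ; n (suc k) _ q → inj₂ k , tt , q , refl })))
  φ-ℤ : gen squares one ≈ gen sqF one + gen sqF⁺ one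
  φ-ℤ = ≈-sym (≈-trans (≈-sym (gen-⊎ sqF sqF⁺ one one)) (gen-bijection (sqF ⊎ᶠ sqF⁺) squares _ one
    (λ _ → λ { (inj₁ k) → + k ; (inj₂ k) → -[1+ k ] })
    (λ { n (inj₁ _) _ q → tt , q , refl ; n (inj₂ k) _ q → tt , q , refl })
    (λ { n (inj₁ _) (inj₁ _) _ _ _ _ e → cong inj₁ (ℤₚ.+-injective e) ; n (inj₂ _) (inj₂ _) _ _ _ _ e → cong inj₂ (ℤₚ.-[1+-injective e) })
    (λ { n (+ k) _ q → inj₁ k , tt , q , refl ; n -[1+ k ] _ q → inj₂ k , tt , q , refl })))
  split : gen sqF multiplicity ≈ gen sqF one + gen sqF⁺ one
  split = ≈-trans (zero-or-suc multiplicity) (≈-trans (+-congˡ (gen-+ sqF⁺ one one))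
    (≈-trans (≈-sym (+-assoc _ _ _)) (+-congʳ (≈-sym (zero-or-suc one)))))

dilatedTheta : ∀ e d a c .{{_ : NonZero d}} .{{_ : NonZero a}} .{{_ : NonZero c}} → Fibres Always (λ l → e ℕ.+ jacobi a c l ℕ.* d)
dilatedTheta e d a c = shift e (dilate d (jacobiFibres a c))

gen-dilatedTheta : ∀ e d a c .{{_ : NonZero d}} .{{_ : NonZero a}} .{{_ : NonZero c}} → gen (dilatedTheta e d a c) alternating ≈ X^ e * dil d (ϑ a c)
gen-dilatedTheta e d a c = ≈-trans (gen-shift e _ alternating) (*-congˡ (gen-dilate d (jacobiFibres a c) alternating))

fromDouble : ∀ {m n} → + 2 ℤ.* + m ≡ + 2 ℤ.* + n → m ≡ n
fromDouble {m} {n} e = ℤₚ.+-injective (ℤₚ.*-cancelˡ-≡ (+ 2) (+ m) (+ n) e)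

weight-jacobi : ∀ i z e d a c l {ok : T (i ℕ.≤ᵇ 6)} →
  + 2 ℤ.* + e ℤ.+ + d ℤ.* ((+ a ℤ.+ + c) ℤ.* (l ℤ.* (l ℤ.- + 1)) ℤ.+ + 2 ℤ.* + a ℤ.* l) ≡ + 2 ℤ.* (z ℤ.* (+ 7 ℤ.* z ℤ.+ + 2 ℤ.* + i ℤ.- + 6)) →
  e ℕ.+ jacobi a c l ℕ.* d ≡ weight i z
weight-jacobi i z e d a c l {ok} eq = fromDouble (trans (cong (λ j → + 2 ℤ.* (+ e ℤ.+ j)) (ℤₚ.pos-* (jacobi a c l) d))
  (trans (ℤR.solve (+ e ∷ + jacobi a c l ∷ + d ∷ []) (λ { (e ∷ j ∷ d ∷ []) → 2 · (e :+ j :* d) , 2 · e :+ d :* (2 · j) }) refl)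
  (trans (cong (λ j → + 2 ℤ.* + e ℤ.+ + d ℤ.* j) (2*jacobi a c l)) (trans eq (cong (λ u → + 2 ℤ.* u) (sym (weight-formula i z (ℕₚ.≤ᵇ⇒≤ i 6 ok))))))))

square-jacobi : ∀ l → jacobi 1 1 l ℕ.* 4 ≡ square (dbl l)
square-jacobi l = fromDouble (trans (cong (λ u → + 2 ℤ.* u) (ℤₚ.pos-* (jacobi 1 1 l) 4)) (trans
  (-≡0⇒≡ (trans (ℤR.solve (l ∷ + jacobi 1 1 l ∷ []) (λ { (l ∷ j ∷ []) →
     2 · (j :* con (+ 4)) :- 2 · ((l :+ l) :* (l :+ l)) ,
     4 · (2 · j :- ((con (+ 1) :+ con (+ 1)) :* (l :* (l :- con (+ 1))) :+ 2 · con (+ 1) :* l)) }) refl) ((+ 4) ⊙ᶻ 2*jacobi 1 1 l)))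
  (cong (λ u → + 2 ℤ.* u) (sym (square-+ (dbl l))))))

oddAt-even : ∀ i z → evenᵇ i ≡ true → isOddAt i z ≡ isEven z
oddAt-even i z e = trans (even-+ i ℤ.∣ z ∣) (cong (λ b → xnor b (isEven z)) e)

oddAt-odd : ∀ i z → evenᵇ i ≡ false → isOddAt i z ≡ not (isEven z)
oddAt-odd i z e = trans (even-+ i ℤ.∣ z ∣) (cong (λ b → xnor b (isEven z)) e)

if-not : ∀ {A : Set} b (x y : A) → (if not b then x else y) ≡ (if b then y else x)
if-not true  x y = refl
if-not false x y = refl

Θ-parity-even : ∀ i → evenᵇ i ≡ true → (p q : ℤ → ℤ) → Θ i (λ z → if isOddAt i z then p z else q z) ≈ Θ i (λ z → if isEven z then p z else q z)
Θ-parity-even i e p q = gen-cong _ λ z _ → cong (λ b → if b then p z else q z) (oddAt-even i z e)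

Θ-parity-odd : ∀ i → evenᵇ i ≡ false → (p q : ℤ → ℤ) → Θ i (λ z → if isOddAt i z then p z else q z) ≈ Θ i (λ z → if isEven z then q z else p z)
Θ-parity-odd i e p q = gen-cong _ λ z _ → trans (cong (λ b → if b then p z else q z) (oddAt-odd i z e)) (if-not (isEven z) (p z) (q z))

-- The symmetry i ↦ 6 - i, z ↦ -z pairs the six outer runners, which is why the product over them
-- becomes a square.
weight-reflect : ∀ i z {ok : T (i ℕ.≤ᵇ 3)} → weight (6 ℕ.∸ i) z ≡ weight i (- z)
weight-reflect 0 (+ zero) = refl
weight-reflect 0 (+ suc k) = refl
weight-reflect 0 -[1+ k ] = refl
weight-reflect 1 (+ zero) = refl
weight-reflect 1 (+ suc k) = refl
weight-reflect 1 -[1+ k ] = refl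
weight-reflect 2 (+ zero) = refl
weight-reflect 2 (+ suc k) = refl
weight-reflect 2 -[1+ k ] = refl
weight-reflect 3 (+ zero) = refl
weight-reflect 3 (+ suc k) = refl
weight-reflect 3 -[1+ k ] = refl

isEven-neg : ∀ z → isEven (- z) ≡ isEven z
isEven-neg z = cong evenᵇ (ℤₚ.∣-i∣≡∣i∣ z)

Θ-reflect : ∀ i {ok : T (i ℕ.≤ᵇ 3)} (s s′ : ℤ → ℤ) → (∀ z → s (- z) ≡ s′ z) → Θ i s ≈ Θ (6 ℕ.∸ i) s′
Θ-reflect i {ok} s s′ e = gen-reflect _ _ (λ z → weight-reflect i z {ok}) e

Product-one : ∀ k i (v : Lat k) → Product (λ _ _ → + 1) k i v ≡ + 1
Product-one zero    i _       = refl
Product-one (suc k) i (z , v) = trans (ℤₚ.*-identityˡ (Product (λ _ _ → + 1) k (suc i) v)) (Product-one k (suc i) v)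

-- The unsigned and the signed lattice sum

module Plain = SignedLattice (λ _ _ → + 1) (λ _ → + 1) (λ _ → + 1) (λ v b _ → Product-one 7 0 v)

-- For odd charges the sign is odd under M ↦ -M, so these cancel, and the middle runner loses its
-- odd part in the same manner: T and H have no counterpart in the signed sum.
module Twisted = SignedLattice twist (λ M → bit-sign (isEven M) ℤ.* sgn M) (λ b → pm ℤ.∣ b ∣)
  (λ v b e → proj₂ (proj₂ (rank-determined v b e)))

F G T′ H : Series
F  = dil 4 φ
G  = dil 28 φ
T′ = const (+ 2) * (X^ 1 * dil 8 ψ)
H  = const (+ 2) * (X^ 7 * dil 56 ψ)

double : ∀ f → f + f ≈ const (+ 2) * f
double f = SR.solve (f ∷ []) (λ { (f ∷ []) → f :+ f , 2 · f }) refl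

gen-shift-triangular : ∀ e d .{{_ : NonZero d}} → gen (shift e (dilate d triangularFibres)) (λ _ → + 1) ≈ X^ e * dil d ψ
gen-shift-triangular e d = ≈-trans (gen-shift e _ _) (*-congˡ (≈-trans (gen-dilate d triangularFibres _) (dil-cong d (≈-sym ψ≈gen))))

2*triangular : ∀ k → + 2 ℤ.* + triangular k ≡ (+ 1 ℤ.+ + k) ℤ.* + k
2*triangular k = trans (2*b₂ (suc k)) (ℤR.solve (+ k ∷ []) (λ { (k ∷ []) → (con (+ 1) :+ k) :* (con (+ 1) :+ k :- con (+ 1)) , (con (+ 1) :+ k) :* k }) refl)

plain-evens : Plain.evens ≈ F
plain-evens = ≈-trans (gen-evens squares (λ _ → + 1) (dilate 4 squares) (λ _ → + 1) (λ l → ℤₚ.+-injective (trans (ℤₚ.pos-* (square l) 4)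
    (trans (cong (λ u → u ℤ.* + 4) (square-+ l)) (trans (ℤR.solve (l ∷ []) (λ { (l ∷ []) → l :* l :* con (+ 4) , (l :+ l) :* (l :+ l) }) refl) (sym (square-+ (dbl l))))))) (λ _ → refl))
  (≈-trans (gen-dilate 4 squares _) (dil-cong 4 (≈-sym φ≈gen)))

plain-odds : Plain.odds ≈ T′
plain-odds = ≈-trans (gen-odds-ℕ squares (shift 1 (dilate 8 triangularFibres)) wt wt)
  (≈-trans (+-cong (gen-shift-triangular 1 8) (gen-shift-triangular 1 8)) (double _))
  where
  wt : ∀ k → 1 ℕ.+ triangular k ℕ.* 8 ≡ suc (k ℕ.+ k) ℕ.* suc (k ℕ.+ k)
  wt k = ℤₚ.+-injective (trans (cong (λ u → + 1 ℤ.+ u) (ℤₚ.pos-* (triangular k) 8)) (trans (-≡0⇒≡ (trans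
    (ℤR.solve (+ k ∷ + triangular k ∷ []) (λ { (k ∷ t ∷ []) → con (+ 1) :+ t :* con (+ 8) :- (con (+ 1) :+ (k :+ k)) :* (con (+ 1) :+ (k :+ k)) ,
      4 · (2 · t :- (con (+ 1) :+ k) :* k) }) refl) ((+ 4) ⊙ᶻ 2*triangular k))) (sym (ℤₚ.pos-* (suc (k ℕ.+ k)) (suc (k ℕ.+ k))))))

plain-even-3 : Plain.even-part 3 ≈ G
plain-even-3 = ≈-trans (Θ-parity-odd 3 refl (λ _ → + 0) (λ _ → + 1))
  (≈-trans (gen-evens _ (λ _ → + 1) (dilate 28 squares) (λ _ → + 1) (λ l → ℤₚ.+-injective (trans (ℤₚ.pos-* (square l) 28)
    (trans (cong (λ u → u ℤ.* + 28) (square-+ l)) (trans (ℤR.solve (l ∷ []) (λ { (l ∷ []) → l :* l :* con (+ 28) , (l :+ l) :* (7 · (l :+ l) :+ 2 · con (+ 3) :- con (+ 6)) }) refl)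
      (sym (weight-formula 3 (dbl l) (s≤s (s≤s (s≤s z≤n)))))))))  (λ _ → refl))
  (≈-trans (gen-dilate 28 squares _) (dil-cong 28 (≈-sym φ≈gen))))

plain-odd-3 : Plain.odd-part 3 ≈ H
plain-odd-3 = ≈-trans (Θ-parity-odd 3 refl (λ _ → + 1) (λ _ → + 0))
  (≈-trans (gen-odds-ℕ _ (shift 7 (dilate 56 triangularFibres)) (λ k → wt (+ suc (k ℕ.+ k)) k (inj₁ refl)) (λ k → wt -[1+ k ℕ.+ k ] k (inj₂ refl)))
  (≈-trans (+-cong (gen-shift-triangular 7 56) (gen-shift-triangular 7 56)) (double _)))
  where
  wt : ∀ z k → z ≡ + suc (k ℕ.+ k) ⊎ z ≡ - + suc (k ℕ.+ k) → 7 ℕ.+ triangular k ℕ.* 56 ≡ weight 3 z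
  wt z k e = ℤₚ.+-injective (trans (cong (λ u → + 7 ℤ.+ u) (ℤₚ.pos-* (triangular k) 56)) (trans (-≡0⇒≡ (trans
    (ℤR.solve (+ k ∷ + triangular k ∷ []) (λ { (k ∷ t ∷ []) → con (+ 7) :+ t :* con (+ 56) :- 7 · ((con (+ 1) :+ (k :+ k)) :* (con (+ 1) :+ (k :+ k))) ,
      28 · (2 · t :- (con (+ 1) :+ k) :* k) }) refl) ((+ 28) ⊙ᶻ 2*triangular k)))
    (trans (cong (λ u → + 7 ℤ.* u) (sq e)) (trans (ℤR.solve (z ∷ []) (λ { (z ∷ []) → 7 · (z :* z) , z :* (7 · z :+ 2 · con (+ 3) :- con (+ 6)) }) refl)
      (sym (weight-formula 3 z (s≤s (s≤s (s≤s z≤n)))))))))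
    where
    sq : z ≡ + suc (k ℕ.+ k) ⊎ z ≡ - + suc (k ℕ.+ k) → + suc (k ℕ.+ k) ℤ.* + suc (k ℕ.+ k) ≡ z ℤ.* z
    sq (inj₁ refl) = refl
    sq (inj₂ refl) = ℤR.solve (+ suc (k ℕ.+ k) ∷ []) (λ { (a ∷ []) → a :* a , :neg a :* :neg a }) refl

plain-even-reflect : ∀ i {ok : T (i ℕ.≤ᵇ 3)} → (∀ z → isOddAt i (- z) ≡ isOddAt (6 ℕ.∸ i) z) → Plain.even-part i ≈ Plain.even-part (6 ℕ.∸ i)
plain-even-reflect i {ok} e = Θ-reflect i {ok} _ _ λ z → cong (λ b → if b then + 0 else + 1) (e z)

plain-odd-reflect : ∀ i {ok : T (i ℕ.≤ᵇ 3)} → (∀ z → isOddAt i (- z) ≡ isOddAt (6 ℕ.∸ i) z) → Plain.odd-part i ≈ Plain.odd-part (6 ℕ.∸ i)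
plain-odd-reflect i {ok} e = Θ-reflect i {ok} _ _ λ z → cong (λ b → if b then + 1 else + 0) (e z)

oddAt-reflect : ∀ i j → evenᵇ i ≡ evenᵇ j → ∀ z → isOddAt i (- z) ≡ isOddAt j z
oddAt-reflect i j e z = trans (even-+ i ℤ.∣ - z ∣) (trans (cong₂ xnor e (isEven-neg z)) (sym (even-+ j ℤ.∣ z ∣)))

sgn-dbl : ∀ l → sgn (dbl l) ≡ alternating l
sgn-dbl l = trans (sgn-+ l l) (trans (cong₂ ℤ._*_ (sgn² l) (pm-sq ℤ.∣ l ∣)) (ℤₚ.*-identityˡ (alternating l)))
  where
  pm-sq : ∀ n → pm (n ℕ.* n) ≡ pm n
  pm-sq n with pm-cases n
  ... | inj₁ f = trans (pm-*-+1 n n f) (sym f)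
  ... | inj₂ f = pm-*--1 n n f

pm-dbl : ∀ l → pm ℤ.∣ dbl l ∣ ≡ + 1
pm-dbl l = trans (pm-even ℤ.∣ dbl l ∣) (cong bit-sign (isEven-dbl l))

sgn-dbl⁻ : ∀ l → sgn (dbl⁻ l) ≡ - alternating l
sgn-dbl⁻ l = trans (sgn-+ (dbl l) (- + 1)) (trans (cong₂ (λ a b → a ℤ.* - + 1 ℤ.* b) (sgn-dbl l) (trans (cong pm (ℕₚ.*-identityʳ ℤ.∣ dbl l ∣)) (pm-dbl l)))
  (ℤR.solve (alternating l ∷ []) (λ { (a ∷ []) → a :* con (- + 1) :* con (+ 1) , :neg a }) refl))

sgn-neg : ∀ z → sgn (- z) ≡ sgn z ℤ.* pm ℤ.∣ z ∣
sgn-neg (+ zero)  = refl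
sgn-neg (+ suc k) = sym (trans (ℤR.solve (pm k ∷ sg k ∷ []) (λ { (p ∷ s ∷ []) → p :* s :* :neg p , :neg (p :* p :* s) }) refl)
  (trans (cong (λ u → - (u ℤ.* sg k)) (pm² k)) (cong -_ (ℤₚ.*-identityˡ (sg k)))))
sgn-neg -[1+ k ] = ℤR.solve (pm k ∷ sg k ∷ []) (λ { (p ∷ s ∷ []) → p :* s , :neg s :* :neg p }) refl

twist-even : ∀ i z → isEven z ≡ true → twist i z ≡ sgn z
twist-even i z e with evenᵇ i
... | true rewrite e = ℤₚ.*-identityʳ (sgn z)
... | false = ℤₚ.*-identityʳ (sgn z)

twist-odd-odd : ∀ i z → evenᵇ i ≡ false → twist i z ≡ sgn z
twist-odd-odd i z e rewrite e = ℤₚ.*-identityʳ (sgn z)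

twist-even-odd : ∀ i z → evenᵇ i ≡ true → isEven z ≡ false → twist i z ≡ - sgn z
twist-even-odd i z e e′ rewrite e | e′ = trans (ℤₚ.*-comm (sgn z) (- + 1)) (ℤₚ.-1*i≡-i (sgn z))

twist-neg : ∀ i j z → evenᵇ i ≡ evenᵇ j → twist i (- z) ≡ pm ℤ.∣ z ∣ ℤ.* twist j z
twist-neg i j z e = trans (cong₂ ℤ._*_ (sgn-neg z) (cong₂ (λ a b → if a ∧ not b then - + 1 else + 1) e (isEven-neg z)))
  (ℤR.solve (sgn z ∷ pm ℤ.∣ z ∣ ∷ w ∷ []) (λ { (s ∷ p ∷ w ∷ []) → s :* p :* w , p :* (s :* w) }) refl)
  where w = if evenᵇ j ∧ not (isEven z) then - + 1 else + 1

twisted-evens : Twisted.evens ≈ dil 4 (ϑ 1 1)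
twisted-evens = ≈-trans (gen-evens squares _ (dilate 4 (jacobiFibres 1 1)) alternating square-jacobi
    (λ l → sym (trans (cong (λ b → bit-sign b ℤ.* sgn (dbl l)) (isEven-dbl l)) (trans (ℤₚ.*-identityˡ (sgn (dbl l))) (sgn-dbl l)))))
  (gen-dilate 4 (jacobiFibres 1 1) alternating)

vanish : ∀ {f} → f ≈ const (- + 1) * f → f ≈ const (+ 0)
vanish {f} e = ≈-trans (regular-const (+ 2) (λ ()) f (≈-trans (SR.solve (f ∷ []) (λ { (f ∷ []) → 2 · f , f :- con (- + 1) :* f }) refl) (≈⇒-≈𝟘 e))) (≈-sym const-0)

twisted-odds : Twisted.odds ≈ const (+ 0)
twisted-odds = vanish (≈-trans (gen-reflect squares squares {s′ = λ z → (- + 1) ℤ.* s z} (λ z → cong (λ m → m ℕ.* m) (sym (ℤₚ.∣-i∣≡∣i∣ z))) (λ z → go z (isEven z) refl))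
  (gen-scale squares (- + 1) s))
  where
  s : ℤ → ℤ
  s M = if isEven M then + 0 else bit-sign (isEven M) ℤ.* sgn M
  go : ∀ z b → isEven z ≡ b → s (- z) ≡ (- + 1) ℤ.* s z
  go z true e rewrite isEven-neg z | e = refl
  go z false e = trans (cong (λ b → if b then + 0 else bit-sign b ℤ.* sgn (- z)) (trans (isEven-neg z) e))
    (trans (cong (λ u → - + 1 ℤ.* u) (trans (sgn-neg z) (trans (cong (sgn z ℤ.*_) (trans (pm-even ℤ.∣ z ∣) (cong bit-sign e))) (ℤₚ.*-comm (sgn z) (- + 1)))))
      (cong (λ b → - + 1 ℤ.* (if b then + 0 else bit-sign b ℤ.* sgn z)) (sym e)))

-- This is φ(-t⁴), the signed counterpart of `F`.
N : Series
N = dil 4 (ϑ 1 1)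

weight-4-even : ∀ l → jacobi 4 3 l ℕ.* 8 ≡ weight 4 (dbl l)
weight-4-even l = weight-jacobi 4 (dbl l) 0 8 4 3 l (ℤR.solve (l ∷ []) (λ { (l ∷ []) →
  2 · con (+ 0) :+ 8 · ((con (+ 4) :+ con (+ 3)) :* (l :* (l :- con (+ 1))) :+ 2 · con (+ 4) :* l) ,
  2 · ((l :+ l) :* (7 · (l :+ l) :+ 2 · con (+ 4) :- con (+ 6))) }) refl)

weight-5-odd : ∀ l → 3 ℕ.+ jacobi 1 6 l ℕ.* 8 ≡ weight 5 (dbl⁻ l)
weight-5-odd l = weight-jacobi 5 (dbl⁻ l) 3 8 1 6 l (ℤR.solve (l ∷ []) (λ { (l ∷ []) →
  2 · con (+ 3) :+ 8 · ((con (+ 1) :+ con (+ 6)) :* (l :* (l :- con (+ 1))) :+ 2 · con (+ 1) :* l) ,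
  2 · ((l :+ l :- con (+ 1)) :* (7 · (l :+ l :- con (+ 1)) :+ 2 · con (+ 5) :- con (+ 6))) }) refl)

weight-6-even : ∀ l → jacobi 5 2 l ℕ.* 8 ≡ weight 6 (dbl l)
weight-6-even l = weight-jacobi 6 (dbl l) 0 8 5 2 l (ℤR.solve (l ∷ []) (λ { (l ∷ []) →
  2 · con (+ 0) :+ 8 · ((con (+ 5) :+ con (+ 2)) :* (l :* (l :- con (+ 1))) :+ 2 · con (+ 5) :* l) ,
  2 · ((l :+ l) :* (7 · (l :+ l) :+ 2 · con (+ 6) :- con (+ 6))) }) refl)

weight-3-even : ∀ l → jacobi 7 7 l ℕ.* 4 ≡ weight 3 (dbl l)
weight-3-even l = weight-jacobi 3 (dbl l) 0 4 7 7 l (ℤR.solve (l ∷ []) (λ { (l ∷ []) →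
  2 · con (+ 0) :+ 4 · ((con (+ 7) :+ con (+ 7)) :* (l :* (l :- con (+ 1))) :+ 2 · con (+ 7) :* l) ,
  2 · ((l :+ l) :* (7 · (l :+ l) :+ 2 · con (+ 3) :- con (+ 6))) }) refl)

weight-4-odd : ∀ l → 5 ℕ.+ jacobi 1 13 l ℕ.* 4 ≡ weight 4 (dbl⁻ l)
weight-4-odd l = weight-jacobi 4 (dbl⁻ l) 5 4 1 13 l (ℤR.solve (l ∷ []) (λ { (l ∷ []) →
  2 · con (+ 5) :+ 4 · ((con (+ 1) :+ con (+ 13)) :* (l :* (l :- con (+ 1))) :+ 2 · con (+ 1) :* l) ,
  2 · ((l :+ l :- con (+ 1)) :* (7 · (l :+ l :- con (+ 1)) :+ 2 · con (+ 4) :- con (+ 6))) }) refl)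

weight-5-even : ∀ l → jacobi 9 5 l ℕ.* 4 ≡ weight 5 (dbl l)
weight-5-even l = weight-jacobi 5 (dbl l) 0 4 9 5 l (ℤR.solve (l ∷ []) (λ { (l ∷ []) →
  2 · con (+ 0) :+ 4 · ((con (+ 9) :+ con (+ 5)) :* (l :* (l :- con (+ 1))) :+ 2 · con (+ 9) :* l) ,
  2 · ((l :+ l) :* (7 · (l :+ l) :+ 2 · con (+ 5) :- con (+ 6))) }) refl)

weight-6-odd : ∀ l → 1 ℕ.+ jacobi 3 11 l ℕ.* 4 ≡ weight 6 (dbl⁻ l)
weight-6-odd l = weight-jacobi 6 (dbl⁻ l) 1 4 3 11 l (ℤR.solve (l ∷ []) (λ { (l ∷ []) →
  2 · con (+ 1) :+ 4 · ((con (+ 3) :+ con (+ 11)) :* (l :* (l :- con (+ 1))) :+ 2 · con (+ 3) :* l) ,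
  2 · ((l :+ l :- con (+ 1)) :* (7 · (l :+ l :- con (+ 1)) :+ 2 · con (+ 6) :- con (+ 6))) }) refl)

twisted-odd-4 : Twisted.odd-part 4 ≈ dil 8 (ϑ 4 3)
twisted-odd-4 = ≈-trans (Θ-parity-even 4 refl (twist 4) (λ _ → + 0))
  (≈-trans (gen-evens (ℤ-fibres (weight 4) (∣z∣≤weight 4)) (twist 4) (dilate 8 (jacobiFibres 4 3)) alternating
  weight-4-even
  (λ l → trans (sym (sgn-dbl l)) (sym (twist-even 4 (dbl l) (isEven-dbl l)))))
  (gen-dilate 8 (jacobiFibres 4 3) alternating))

twisted-odd-5 : Twisted.odd-part 5 ≈ const (- + 1) * (X^ 3 * dil 8 (ϑ 1 6))
twisted-odd-5 = ≈-trans (Θ-parity-odd 5 refl (twist 5) (λ _ → + 0))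
  (≈-trans (gen-odds (ℤ-fibres (weight 5) (∣z∣≤weight 5)) (twist 5) (dilatedTheta 3 8 1 6) (λ l → - + 1 ℤ.* alternating l)
  weight-5-odd
  (λ l → trans (ℤₚ.-1*i≡-i (alternating l)) (trans (sym (sgn-dbl⁻ l)) (sym (twist-odd-odd 5 (dbl⁻ l) refl)))))
  (≈-trans (gen-scale (dilatedTheta 3 8 1 6) (- + 1) alternating) (*-congˡ (gen-dilatedTheta 3 8 1 6))))

twisted-odd-6 : Twisted.odd-part 6 ≈ dil 8 (ϑ 5 2)
twisted-odd-6 = ≈-trans (Θ-parity-even 6 refl (twist 6) (λ _ → + 0))
  (≈-trans (gen-evens (ℤ-fibres (weight 6) (∣z∣≤weight 6)) (twist 6) (dilate 8 (jacobiFibres 5 2)) alternating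
  weight-6-even
  (λ l → trans (sym (sgn-dbl l)) (sym (twist-even 6 (dbl l) (isEven-dbl l)))))
  (gen-dilate 8 (jacobiFibres 5 2) alternating))

twisted-even-3 : Twisted.even-part 3 ≈ dil 4 (ϑ 7 7)
twisted-even-3 = ≈-trans (Θ-parity-odd 3 refl (λ _ → + 0) (twist 3))
  (≈-trans (gen-evens (ℤ-fibres (weight 3) (∣z∣≤weight 3)) (twist 3) (dilate 4 (jacobiFibres 7 7)) alternating
  weight-3-even
  (λ l → trans (sym (sgn-dbl l)) (sym (twist-even 3 (dbl l) (isEven-dbl l)))))
  (gen-dilate 4 (jacobiFibres 7 7) alternating))

twisted-even-4 : Twisted.even-part 4 ≈ X^ 5 * dil 4 (ϑ 1 13)
twisted-even-4 = ≈-trans (Θ-parity-even 4 refl (λ _ → + 0) (twist 4))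
  (≈-trans (gen-odds (ℤ-fibres (weight 4) (∣z∣≤weight 4)) (twist 4) (dilatedTheta 5 4 1 13) alternating
  weight-4-odd
  (λ l → sym (trans (twist-even-odd 4 (dbl⁻ l) refl (isEven-dbl⁻ l)) (trans (cong -_ (sgn-dbl⁻ l)) (ℤₚ.neg-involutive (alternating l))))))
  (gen-dilatedTheta 5 4 1 13))

twisted-even-5 : Twisted.even-part 5 ≈ dil 4 (ϑ 9 5)
twisted-even-5 = ≈-trans (Θ-parity-odd 5 refl (λ _ → + 0) (twist 5))
  (≈-trans (gen-evens (ℤ-fibres (weight 5) (∣z∣≤weight 5)) (twist 5) (dilate 4 (jacobiFibres 9 5)) alternating
  weight-5-even
  (λ l → trans (sym (sgn-dbl l)) (sym (twist-even 5 (dbl l) (isEven-dbl l)))))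
  (gen-dilate 4 (jacobiFibres 9 5) alternating))

twisted-even-6 : Twisted.even-part 6 ≈ X^ 1 * dil 4 (ϑ 3 11)
twisted-even-6 = ≈-trans (Θ-parity-even 6 refl (λ _ → + 0) (twist 6))
  (≈-trans (gen-odds (ℤ-fibres (weight 6) (∣z∣≤weight 6)) (twist 6) (dilatedTheta 1 4 3 11) alternating
  weight-6-odd
  (λ l → sym (trans (twist-even-odd 6 (dbl⁻ l) refl (isEven-dbl⁻ l)) (trans (cong -_ (sgn-dbl⁻ l)) (ℤₚ.neg-involutive (alternating l))))))
  (gen-dilatedTheta 1 4 3 11))

conditional-scale : ∀ b (p ε w : ℤ) → (b ≡ true → p ≡ ε) → (if b then p ℤ.* w else + 0) ≡ ε ℤ.* (if b then w else + 0)
conditional-scale true  p ε w e = cong (ℤ._* w) (e refl)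
conditional-scale false p ε w e = sym (ℤₚ.*-zeroʳ ε)

if-swap : ∀ b (w : ℤ) → (if b then + 0 else w) ≡ (if not b then w else + 0)
if-swap true  w = refl
if-swap false w = refl

not-true : ∀ {b} → not b ≡ true → b ≡ false
not-true {false} _ = refl

-- On the odd part of a runner the parity of z is fixed, so the sign in `twist-neg` is a constant ε.
twisted-odd-reflect : ∀ i {ok : T (i ℕ.≤ᵇ 3)} ε → evenᵇ i ≡ evenᵇ (6 ℕ.∸ i) → (∀ z → isOddAt (6 ℕ.∸ i) z ≡ true → pm ℤ.∣ z ∣ ≡ ε) →
  Twisted.odd-part i ≈ const ε * Twisted.odd-part (6 ℕ.∸ i)
twisted-odd-reflect i {ok} ε e p = ≈-trans (Θ-reflect i {ok} _ (λ z → ε ℤ.* (if isOddAt j z then twist j z else + 0))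
    (λ z → trans (cong₂ (λ b w → if b then w else + 0) (oddAt-reflect i j e z) (twist-neg i j z e))
      (conditional-scale (isOddAt j z) (pm ℤ.∣ z ∣) ε (twist j z) (p z))))
  (gen-scale _ ε _)
  where j = 6 ℕ.∸ i

twisted-even-reflect : ∀ i {ok : T (i ℕ.≤ᵇ 3)} ε → evenᵇ i ≡ evenᵇ (6 ℕ.∸ i) → (∀ z → isOddAt (6 ℕ.∸ i) z ≡ false → pm ℤ.∣ z ∣ ≡ ε) →
  Twisted.even-part i ≈ const ε * Twisted.even-part (6 ℕ.∸ i)
twisted-even-reflect i {ok} ε e p = ≈-trans (Θ-reflect i {ok} _ (λ z → ε ℤ.* (if isOddAt j z then + 0 else twist j z))
    (λ z → trans (cong₂ (λ b w → if b then + 0 else w) (oddAt-reflect i j e z) (twist-neg i j z e))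
      (trans (if-swap (isOddAt j z) _) (trans (conditional-scale (not (isOddAt j z)) (pm ℤ.∣ z ∣) ε (twist j z) (p z ∘ not-true))
        (cong (ε ℤ.*_) (sym (if-swap (isOddAt j z) (twist j z))))))))
  (gen-scale _ ε _)
  where j = 6 ℕ.∸ i

pm-from-even : ∀ z b → isEven z ≡ b → pm ℤ.∣ z ∣ ≡ bit-sign b
pm-from-even z b e = trans (pm-even ℤ.∣ z ∣) (cong bit-sign e)

pm-oddAt-even : ∀ j → evenᵇ j ≡ true → ∀ z b → isOddAt j z ≡ b → pm ℤ.∣ z ∣ ≡ bit-sign b
pm-oddAt-even j e z b f = pm-from-even z b (trans (sym (oddAt-even j z e)) f)

not-swap : ∀ {a b} → not a ≡ b → a ≡ not b
not-swap {true}  refl = refl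
not-swap {false} refl = refl

pm-oddAt-odd : ∀ j → evenᵇ j ≡ false → ∀ z b → isOddAt j z ≡ b → pm ℤ.∣ z ∣ ≡ bit-sign (not b)
pm-oddAt-odd j e z b f = pm-from-even z (not b) (not-swap (trans (sym (oddAt-odd j z e)) f))

twisted-odd-3 : Twisted.odd-part 3 ≈ const (+ 0)
twisted-odd-3 = vanish (twisted-odd-reflect 3 (- + 1) refl (λ z → pm-oddAt-odd 3 refl z true))

const-^ : ∀ x n → const (x ℤ.^ n) ≈ const x ↑ n
const-^ x zero    = const-1
const-^ x (suc n) = ≈-trans (const-* x (x ℤ.^ n)) (*-congˡ (const-^ x n))

byRank-^ : ∀ x (ρ : ℤ → ℤ) (e : ℤ → ℕ) → byRank (λ b → ρ b ℤ.* x ℤ.^ e b) ≈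
  const (ρ (- + 1)) * const x ↑ e (- + 1) * C (- + 1) + const (ρ (+ 0)) * const x ↑ e (+ 0) * C (+ 0) +
  const (ρ (+ 1)) * const x ↑ e (+ 1) * C (+ 1) + const (ρ (+ 2)) * const x ↑ e (+ 2) * C (+ 2)
byRank-^ x ρ e = +-cong (+-cong (+-cong (term (- + 1)) (term (+ 0))) (term (+ 1))) (term (+ 2))
  where
  term : ∀ b → const (ρ b ℤ.* x ℤ.^ e b) * C b ≈ const (ρ b) * const x ↑ e b * C b
  term b = *-congʳ (≈-trans (const-* (ρ b) (x ℤ.^ e b)) (*-congˡ (const-^ x (e b))))

a₁ a₂ a₃ b₁ b₂′ b₃ A A′ B′ B : Series
a₁ = Plain.even-part 4
a₂ = Plain.even-part 5
a₃ = Plain.even-part 6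
b₁ = Plain.odd-part 4
b₂′ = Plain.odd-part 5
b₃ = Plain.odd-part 6
A  = a₁ * a₂ * a₃
A′ = b₁ * a₂ * a₃ + a₁ * b₂′ * a₃ + a₁ * a₂ * b₃
B′ = a₁ * b₂′ * b₃ + b₁ * a₂ * b₃ + b₁ * b₂′ * a₃
B  = b₁ * b₂′ * b₃

-- The coefficients of x⁰ to x⁷ of the unsigned product, with the runners 0, 1, 2 replaced by their
-- mirror images 6, 5, 4.
coreRelations : All (_≈ 𝟘) (
    (C (+ 2) * F - (G * (A * A))) ∷
    (C (- + 1) * T′ - (H * (A * A) + const (+ 2) * G * (A * A′))) ∷
    (C (+ 1) * F - (G * (A′ * A′ + const (+ 2) * (A * B′)) + const (+ 2) * H * (A * A′))) ∷
    (C (+ 0) * T′ - (const (+ 2) * G * (A * B + A′ * B′) + H * (A′ * A′ + const (+ 2) * (A * B′)))) ∷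
    (C (+ 0) * F - (G * (B′ * B′ + const (+ 2) * (A′ * B)) + const (+ 2) * H * (A * B + A′ * B′))) ∷
    (C (+ 1) * T′ - (H * (B′ * B′ + const (+ 2) * (A′ * B)) + const (+ 2) * G * (B * B′))) ∷
    (C (- + 1) * F - (G * (B * B) + const (+ 2) * H * (B * B′))) ∷
    (C (+ 2) * T′ - (H * (B * B))) ∷ [])
coreRelations = horner-zero _ λ k → ≈-trans (SR.solve (G ∷ H ∷ a₁ ∷ a₂ ∷ a₃ ∷ b₁ ∷ b₂′ ∷ b₃ ∷ C (- + 1) ∷ C (+ 0) ∷ C (+ 1) ∷ C (+ 2) ∷ F ∷ T′ ∷ const (+ suc k) ∷ [])
      (λ { (G ∷ H ∷ a1 ∷ a2 ∷ a3 ∷ b1 ∷ b2′ ∷ b3 ∷ Cm ∷ C0 ∷ C1 ∷ C2 ∷ F ∷ T ∷ X ∷ []) →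
      (C2 :* F :- (G :* ((a1 :* a2 :* a3) :* (a1 :* a2 :* a3)))) :+ X :* ((Cm :* T :- (H :* ((a1 :* a2 :* a3) :* (a1 :* a2 :* a3)) :+ 2 · G :* ((a1 :* a2 :* a3) :* (b1 :* a2 :* a3 :+ a1 :* b2′ :* a3 :+ a1 :* a2 :* b3)))) :+ X :* ((C1 :* F :- (G :* ((b1 :* a2 :* a3 :+ a1 :* b2′ :* a3 :+ a1 :* a2 :* b3) :* (b1 :* a2 :* a3 :+ a1 :* b2′ :* a3 :+ a1 :* a2 :* b3) :+ 2 · ((a1 :* a2 :* a3) :* (a1 :* b2′ :* b3 :+ b1 :* a2 :* b3 :+ b1 :* b2′ :* a3))) :+ 2 · H :* ((a1 :* a2 :* a3) :* (b1 :* a2 :* a3 :+ a1 :* b2′ :* a3 :+ a1 :* a2 :* b3)))) :+ X :* ((C0 :* T :- (2 · G :* ((a1 :* a2 :* a3) :* (b1 :* b2′ :* b3) :+ (b1 :* a2 :* a3 :+ a1 :* b2′ :* a3 :+ a1 :* a2 :* b3) :* (a1 :* b2′ :* b3 :+ b1 :* a2 :* b3 :+ b1 :* b2′ :* a3)) :+ H :* ((b1 :* a2 :* a3 :+ a1 :* b2′ :* a3 :+ a1 :* a2 :* b3) :* (b1 :* a2 :* a3 :+ a1 :* b2′ :* a3 :+ a1 :* a2 :* b3) :+ 2 · ((a1 :* a2 :* a3) :* (a1 :* b2′ :* b3 :+ b1 :* a2 :* b3 :+ b1 :* b2′ :* a3))))) :+ X :* ((C0 :* F :- (G :* ((a1 :*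 b2′ :* b3 :+ b1 :* a2 :* b3 :+ b1 :* b2′ :* a3) :* (a1 :* b2′ :* b3 :+ b1 :* a2 :* b3 :+ b1 :* b2′ :* a3) :+ 2 · ((b1 :* a2 :* a3 :+ a1 :* b2′ :* a3 :+ a1 :* a2 :* b3) :* (b1 :* b2′ :* b3))) :+ 2 · H :* ((a1 :* a2 :* a3) :* (b1 :* b2′ :* b3) :+ (b1 :* a2 :* a3 :+ a1 :* b2′ :* a3 :+ a1 :* a2 :* b3) :* (a1 :* b2′ :* b3 :+ b1 :* a2 :* b3 :+ b1 :* b2′ :* a3)))) :+ X :* ((C1 :* T :- (H :* ((a1 :* b2′ :* b3 :+ b1 :* a2 :* b3 :+ b1 :* b2′ :* a3) :* (a1 :* b2′ :* b3 :+ b1 :* a2 :* b3 :+ b1 :* b2′ :* a3) :+ 2 · ((b1 :* a2 :* a3 :+ a1 :* b2′ :* a3 :+ a1 :* a2 :* b3) :* (b1 :* b2′ :* b3))) :+ 2 · G :* ((b1 :* b2′ :* b3) :* (a1 :* b2′ :* b3 :+ b1 :* a2 :* b3 :+ b1 :* b2′ :* a3)))) :+ X :* ((Cm :* F :- (G :* ((b1 :* b2′ :* b3) :* (b1 :* b2′ :* b3)) :+ 2 · H :* ((b1 :* b2′ :* b3) :* (a1 :* b2′ :* b3 :+ b1 :* a2 :* b3 :+ b1 :* b2′ :* a3)))) :+ X :* ((C2 :* T :- (H :* ((b1 :* b2′ :* b3) :* (b1 :* b2′ :* b3)))) :+ X :* (con (+ 0))))))))) ,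
      (1 · X :^ 6 :* Cm :+ 1 · X :^ 4 :* C0 :+ 1 · X :^ 2 :* C1 :+ 1 · X :^ 0 :* C2) :* F :+ (1 · X :^ 1 :* Cm :+ 1 · X :^ 3 :* C0 :+ 1 · X :^ 5 :* C1 :+ 1 · X :^ 7 :* C2) :* T :- (a3 :+ X :* b3) :* ((a2 :+ X :* b2′) :* ((a1 :+ X :* b1) :* ((G :+ X :* H) :* ((a1 :+ X :* b1) :* ((a2 :+ X :* b2′) :* (a3 :+ X :* b3)))))) }) refl)
    (≈-trans (+-congˡ (-‿cong (product k))) (-‿inverseʳ _))
  where
  factor = λ k → Plain.factor (+ suc k)
  product : ∀ k → let X = const (+ suc k) in
    (a₃ + X * b₃) * ((a₂ + X * b₂′) * ((a₁ + X * b₁) * ((G + X * H) * ((a₁ + X * b₁) * ((a₂ + X * b₂′) * (a₃ + X * b₃)))))) ≈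
    (const (+ 1) * X ↑ 6 * C (- + 1) + const (+ 1) * X ↑ 4 * C (+ 0) + const (+ 1) * X ↑ 2 * C (+ 1) + const (+ 1) * X ↑ 0 * C (+ 2)) * F +
    (const (+ 1) * X ↑ 1 * C (- + 1) + const (+ 1) * X ↑ 3 * C (+ 0) + const (+ 1) * X ↑ 5 * C (+ 1) + const (+ 1) * X ↑ 7 * C (+ 2)) * T′
  product k = ≈-trans (≈-sym (*-cong (reflected 0 refl) (*-cong (reflected 1 refl) (*-cong (reflected 2 refl)
      (*-cong (+-cong plain-even-3 (*-congˡ plain-odd-3)) ≈-refl)))))
    (≈-trans (Plain.lattice-product (+ suc k)) (+-cong (*-cong (byRank-^ (+ suc k) (λ _ → + 1) (exponent true)) plain-evens)
      (*-cong (byRank-^ (+ suc k) (λ _ → + 1) (exponent false)) plain-odds)))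
    where
    reflected : ∀ i {ok : T (i ℕ.≤ᵇ 3)} → evenᵇ i ≡ evenᵇ (6 ℕ.∸ i) → factor k i ≈ factor k (6 ℕ.∸ i)
    reflected i {ok} e = +-cong (plain-even-reflect i {ok} (oddAt-reflect i (6 ℕ.∸ i) e)) (*-congˡ (plain-odd-reflect i {ok} (oddAt-reflect i (6 ℕ.∸ i) e)))

e3 e4 e5 e6 o4 o5 o6 : Series
e3 = Twisted.even-part 3
e4 = Twisted.even-part 4
e5 = Twisted.even-part 5
e6 = Twisted.even-part 6
o4 = Twisted.odd-part 4
o5 = Twisted.odd-part 5
o6 = Twisted.odd-part 6

-- Up to sign, the mirror image of a factor e + xo is e - xo, so the signed product is a polynomial
-- in x². Its two extreme coefficients are single products of theta functions, to which the triple
-- product applies.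
twistedRelations : All (_≈ 𝟘) (
    (C (+ 2) * N - e3 * ((e4 * e5 * e6) * (e4 * e5 * e6))) ∷
    (const (+ 0)) ∷
    (const (- + 1) * (C (+ 1) * N) + e3 * (o4 * o4 * (e5 * e5) * (e6 * e6) + e4 * e4 * (o5 * o5) * (e6 * e6) + e4 * e4 * (e5 * e5) * (o6 * o6))) ∷
    (const (+ 0)) ∷
    (C (+ 0) * N - e3 * (o4 * o4 * (o5 * o5) * (e6 * e6) + o4 * o4 * (e5 * e5) * (o6 * o6) + e4 * e4 * (o5 * o5) * (o6 * o6))) ∷
    (const (+ 0)) ∷
    (e3 * ((o4 * o5 * o6) * (o4 * o5 * o6)) - C (- + 1) * N) ∷ [])
twistedRelations = horner-zero _ λ k → ≈-trans (SR.solve (e3 ∷ e4 ∷ e5 ∷ e6 ∷ o4 ∷ o5 ∷ o6 ∷ C (- + 1) ∷ C (+ 0) ∷ C (+ 1) ∷ C (+ 2) ∷ N ∷ const (+ suc k) ∷ [])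
      (λ { (e3 ∷ e4 ∷ e5 ∷ e6 ∷ o4 ∷ o5 ∷ o6 ∷ Cm ∷ C0 ∷ C1 ∷ C2 ∷ N ∷ X ∷ []) →
      (C2 :* N :- e3 :* ((e4 :* e5 :* e6) :* (e4 :* e5 :* e6))) :+ X :* ((con (+ 0)) :+ X :* ((con (- + 1) :* (C1 :* N) :+ e3 :* (o4 :* o4 :* (e5 :* e5) :* (e6 :* e6) :+ e4 :* e4 :* (o5 :* o5) :* (e6 :* e6) :+ e4 :* e4 :* (e5 :* e5) :* (o6 :* o6))) :+ X :* ((con (+ 0)) :+ X :* ((C0 :* N :- e3 :* (o4 :* o4 :* (o5 :* o5) :* (e6 :* e6) :+ o4 :* o4 :* (e5 :* e5) :* (o6 :* o6) :+ e4 :* e4 :* (o5 :* o5) :* (o6 :* o6))) :+ X :* ((con (+ 0)) :+ X :* ((e3 :* ((o4 :* o5 :* o6) :* (o4 :* o5 :* o6)) :- Cm :* N) :+ X :* (con (+ 0)))))))) ,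
      (con (- + 1) :* X :^ 6 :* Cm :+ 1 · X :^ 4 :* C0 :+ con (- + 1) :* X :^ 2 :* C1 :+ 1 · X :^ 0 :* C2) :* N :+ (con (- + 1) :* X :^ 1 :* Cm :+ 1 · X :^ 3 :* C0 :+ con (- + 1) :* X :^ 5 :* C1 :+ 1 · X :^ 7 :* C2) :* con (+ 0) :- (con (- + 1) :* e6 :+ X :* (1 · o6)) :* ((1 · e5 :+ X :* (con (- + 1) :* o5)) :* ((con (- + 1) :* e4 :+ X :* (1 · o4)) :* ((e3 :+ X :* con (+ 0)) :* ((e4 :+ X :* o4) :* ((e5 :+ X :* o5) :* (e6 :+ X :* o6)))))) }) refl)
    (≈-trans (+-congˡ (-‿cong (product k))) (-‿inverseʳ _))
  where
  product : ∀ k → let X = const (+ suc k) in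
    ((const (- + 1) * e6 + X * (const (+ 1) * o6)) * ((const (+ 1) * e5 + X * (const (- + 1) * o5)) * ((const (- + 1) * e4 + X * (const (+ 1) * o4)) * ((e3 + X * const (+ 0)) * ((e4 + X * o4) * ((e5 + X * o5) * (e6 + X * o6))))))) ≈
    (const (- + 1) * X ↑ 6 * C (- + 1) + const (+ 1) * X ↑ 4 * C (+ 0) + const (- + 1) * X ↑ 2 * C (+ 1) + const (+ 1) * X ↑ 0 * C (+ 2)) * N + (const (- + 1) * X ↑ 1 * C (- + 1) + const (+ 1) * X ↑ 3 * C (+ 0) + const (- + 1) * X ↑ 5 * C (+ 1) + const (+ 1) * X ↑ 7 * C (+ 2)) * const (+ 0)
  product k = ≈-trans (≈-sym (*-cong (+-cong (even-reflect 0) (*-congˡ (odd-reflect 0))) (*-cong (+-cong (even-reflect 1) (*-congˡ (odd-reflect 1)))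
      (*-cong (+-cong (even-reflect 2) (*-congˡ (odd-reflect 2))) (*-cong (+-cong ≈-refl (*-congˡ twisted-odd-3)) ≈-refl)))))
    (≈-trans (Twisted.lattice-product (+ suc k)) (+-cong (*-cong (byRank-^ (+ suc k) (λ b → pm ℤ.∣ b ∣) (exponent true)) twisted-evens)
      (*-cong (byRank-^ (+ suc k) (λ b → pm ℤ.∣ b ∣) (exponent false)) twisted-odds)))
    where
    sign : ℕ → ℤ
    sign i = bit-sign (evenᵇ i)
    even-reflect : ∀ i {ok : T (i ℕ.<ᵇ 3)} → Twisted.even-part i ≈ const (- sign i) * Twisted.even-part (6 ℕ.∸ i)
    even-reflect 0 = twisted-even-reflect 0 (- + 1) refl (λ z → pm-oddAt-even 6 refl z false)
    even-reflect 1 = twisted-even-reflect 1 (+ 1) refl (λ z → pm-oddAt-odd 5 refl z false)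
    even-reflect 2 = twisted-even-reflect 2 (- + 1) refl (λ z → pm-oddAt-even 4 refl z false)
    odd-reflect : ∀ i {ok : T (i ℕ.<ᵇ 3)} → Twisted.odd-part i ≈ const (sign i) * Twisted.odd-part (6 ℕ.∸ i)
    odd-reflect 0 = twisted-odd-reflect 0 (+ 1) refl (λ z → pm-oddAt-even 6 refl z true)
    odd-reflect 1 = twisted-odd-reflect 1 (- + 1) refl (λ z → pm-oddAt-odd 5 refl z true)
    odd-reflect 2 = twisted-odd-reflect 2 (+ 1) refl (λ z → pm-oddAt-even 4 refl z true)

-- Infinite products and the Jacobi triple product.

infix 4 _≈[_]_
_≈[_]_ : Series → ℕ → Series → Set
f ≈[ K ] g = ∀ k → k ℕ.< K → f k ≡ g k

≈⇒≈[] : ∀ {f g K} → f ≈ g → f ≈[ K ] g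
≈⇒≈[] p k _ = at-degree p k

≈[]-sym : ∀ {f g K} → f ≈[ K ] g → g ≈[ K ] f
≈[]-sym p k k<K = sym (p k k<K)

≈[]-trans : ∀ {f g h K} → f ≈[ K ] g → g ≈[ K ] h → f ≈[ K ] h
≈[]-trans p q k k<K = trans (p k k<K) (q k k<K)

≈[]-limit : ∀ {f g} → (∀ K → f ≈[ K ] g) → f ≈ g
≈[]-limit p = coeffs λ n → p (suc n) n ℕₚ.≤-refl

≈[]-+ : ∀ {f f′ g g′ K} → f ≈[ K ] f′ → g ≈[ K ] g′ → f + g ≈[ K ] f′ + g′
≈[]-+ {f} {f′} {g} {g′} p q k k<K = trans (coeff-+ f g k) (trans (cong₂ ℤ._+_ (p k k<K) (q k k<K)) (sym (coeff-+ f′ g′ k)))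

≈[]-* : ∀ {f f′ g g′ K} → f ≈[ K ] f′ → g ≈[ K ] g′ → f * g ≈[ K ] f′ * g′
≈[]-* {f} {f′} {g} {g′} {K} p q k k<K = go k f f′ k<K (λ j j≤k → p j (ℕₚ.≤-<-trans j≤k k<K))
  where
  go : ∀ k f f′ → k ℕ.< K → (∀ j → j ℕ.≤ k → f j ≡ f′ j) → (f * g) k ≡ (f′ * g′) k
  go zero f f′ k<K p = trans (coeff-*-zero f g) (trans (cong₂ ℤ._*_ (p 0 z≤n) (q 0 k<K)) (sym (coeff-*-zero f′ g′)))
  go (suc k) f f′ k<K p = trans (coeff-*-suc f g k) (trans (cong₂ ℤ._+_ (cong₂ ℤ._*_ (p 0 z≤n) (q (suc k) k<K))
      (go k (tail f) (tail f′) (ℕₚ.<⇒≤ k<K) (λ j j≤k → p (suc j) (s≤s j≤k)))) (sym (coeff-*-suc f′ g′ k)))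

≈[]-cancel : ∀ {f g h K} → f 0 ≢ + 0 → f * g ≈[ K ] f * h → g ≈[ K ] h
≈[]-cancel {f} {g} {h} {K} f≢0 p k k<K = ℤₚ.i-j≡0⇒i≡j (g k) (h k) (trans (sym (coeff-- g h k)) (strong-induction (λ n → n ℕ.< K → (g - h) n ≡ + 0) step k k<K))
  where
  product : ∀ n → n ℕ.< K → (f * (g - h)) n ≡ + 0
  product n n<K = trans (at-degree (SR.solve (f ∷ g ∷ h ∷ []) (λ { (f ∷ g ∷ h ∷ []) → f :* (g :- h) , f :* g :- f :* h }) refl) n)
    (trans (coeff-- (f * g) (f * h) n) (trans (cong (ℤ._- (f * h) n) (p n n<K)) (ℤₚ.+-inverseʳ ((f * h) n))))
  step : ∀ n → (∀ k → k ℕ.< n → k ℕ.< K → (g - h) k ≡ + 0) → n ℕ.< K → (g - h) n ≡ + 0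
  step n ih n<K with ℤₚ.i*j≡0⇒i≡0∨j≡0 (f 0) (trans (sym (coeff-*-lowest 0 n f (g - h) (λ _ ()) (λ k k<n → ih k k<n (ℕₚ.<-trans k<n n<K)))) (product n n<K))
  ... | inj₁ e = contradiction e f≢0
  ... | inj₂ e = e

X^-≈[]-0 : ∀ {K} m f → K ℕ.≤ m → X^ m * f ≈[ K ] 𝟘
X^-≈[]-0 m f K≤m k k<K = trans (coeff-X^*-< m f k (ℕₚ.≤-trans k<K K≤m)) (sym (coeff-𝟘 k))

-- For ε = 1 and ε = -1 these are partial products of (q^a; q^m) and (-q^a; q^m); one proof of the
-- triple product then covers both signs.
module Products (ε : ℤ) where

  factor : ℕ → Series
  factor e = 𝟙 - const ε * X^ e

  P : ℕ → ℕ → ℕ → Series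
  P a m zero    = 𝟙
  P a m (suc n) = P a m n * factor (a ℕ.+ m ℕ.* n)

  -- The infinite product: for positive a and m the factors from index n on have exponents above n,
  -- so n factors give the coefficient of degree n.
  Pr : ℕ → ℕ → Series
  Pr a m n = P a m n n

  factor-≈[] : ∀ {K} e f → K ℕ.≤ e → f * factor e ≈[ K ] f
  factor-≈[] {K} e f K≤e = ≈[]-trans (≈⇒≈[] (≈-trans
      (SR.solve (f ∷ X^ e ∷ const ε ∷ 𝟙 ∷ []) (λ { (f ∷ x ∷ c ∷ o ∷ []) → f :* (o :- c :* x) , f :* o :+ x :* :neg (c :* f) }) refl)
      (+-congʳ (*-identityʳ f))))
    (≈[]-trans (≈[]-+ {f = f} {f′ = f} (λ _ _ → refl) (X^-≈[]-0 e (neg (const ε * f)) K≤e)) (≈⇒≈[] (+-identityʳ f)))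

  P-stable : ∀ a m .{{_ : NonZero a}} .{{_ : NonZero m}} K n → P a m (n ℕ.+ K) ≈[ suc K ] P a m K
  P-stable a m K zero    = λ _ _ → refl
  P-stable a m K (suc n) = ≈[]-trans (factor-≈[] (a ℕ.+ m ℕ.* (n ℕ.+ K)) (P a m (n ℕ.+ K)) big) (P-stable a m K n)
    where
    big : suc K ℕ.≤ a ℕ.+ m ℕ.* (n ℕ.+ K)
    big = ℕₚ.+-mono-≤ (ℕ.>-nonZero⁻¹ a) (ℕₚ.≤-trans (ℕₚ.m≤n+m K n) (ℕₚ.m≤n*m (n ℕ.+ K) m))

  Pr≈[]P : ∀ a m .{{_ : NonZero a}} .{{_ : NonZero m}} K n → K ℕ.≤ suc n → Pr a m ≈[ K ] P a m n
  Pr≈[]P a m K n K≤ k k<K = sym (trans (cong (λ j → P a m j k) (sym (ℕₚ.m∸n+n≡m {n} {k} (ℕₚ.≤-pred (ℕₚ.≤-trans k<K K≤)))))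
    (P-stable a m k (n ℕ.∸ k) k ℕₚ.≤-refl))

open Products (+ 1) public

E≈Pr : E ≈ Pr 1 1
E≈Pr = coeffs λ n → at-degree (Eprod≈P n) n
  where
  factor≈ : ∀ N → oneS ⊕ scale (- + 1) (qpow (suc N) oneS) ≈ factor (1 ℕ.+ 1 ℕ.* N)
  factor≈ N = begin
    oneS ⊕ scale (- + 1) (qpow (suc N) oneS)           ≈⟨ +≈⊕ oneS (scale (- + 1) (qpow (suc N) oneS)) ⟨
    oneS + scale (- + 1) (qpow (suc N) oneS)           ≈⟨ +-cong (≈-sym 𝟙≈oneS) (≈-trans (scale≈const (- + 1) (qpow (suc N) oneS))
                                                            (*-congˡ (≈-trans (qpow≈ (suc N) oneS) (≈-trans (*-congˡ (≈-sym 𝟙≈oneS)) (*-identityʳ (X^ (suc N))))))) ⟩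
    𝟙 + const (- + 1) * X^ (suc N)                      ≈⟨ SR.solve (𝟙 ∷ X^ (suc N) ∷ []) (λ { (o ∷ x ∷ []) → o :+ con (- + 1) :* x , o :- 1 · x }) refl ⟩
    𝟙 - const (+ 1) * X^ (suc N)                        ≡⟨ cong (λ e → 𝟙 - const (+ 1) * X^ (suc e)) (sym (ℕₚ.*-identityˡ N)) ⟩
    factor (1 ℕ.+ 1 ℕ.* N)                              ∎
    where open ≈-Reasoning
  Eprod≈P : ∀ N → Eprod N ≈ P 1 1 N
  Eprod≈P zero    = ≈-sym 𝟙≈oneS
  Eprod≈P (suc N) = ≈-trans (≈-sym (*≈⊗ (Eprod N) _)) (*-cong (Eprod≈P N) (factor≈ N))

dil-≈[] : ∀ d .{{_ : NonZero d}} {f g K} → f ≈[ K ] g → dil d f ≈[ K ] dil d g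
dil-≈[] d {f} {g} {K} p k k<K = trans (sym (at-degree (at≈dil d f) k)) (trans (go (k % d ℕ.≡ᵇ 0) (p (k / d) (ℕₚ.≤-trans (s≤s (DM.m/n≤m k d)) k<K))) (at-degree (at≈dil d g) k))
  where
  go : ∀ b {x y : ℤ} → x ≡ y → (if b then x else + 0) ≡ (if b then y else + 0)
  go b refl = refl

module _ (ε : ℤ) where
  open Products ε using () renaming (P to Pε; Pr to Prε; Pr≈[]P to Prε≈[]P; factor to factorε)

  dil-P : ∀ d .{{_ : NonZero d}} a m n → dil d (Pε a m n) ≈ Pε (a ℕ.* d) (m ℕ.* d) n
  dil-P d a m zero    = dil-𝟙 d
  dil-P d a m (suc n) = ≈-trans (dil-* d _ _) (*-cong (dil-P d a m n) (≈-trans (dil-+ d _ _) (+-cong (dil-𝟙 d)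
    (≈-trans (dil-neg d _) (-‿cong (≈-trans (dil-const-* d ε _) (*-congˡ (≈-trans (dil-X^ d (a ℕ.+ m ℕ.* n))
      (subst (λ e → X^ ((a ℕ.+ m ℕ.* n) ℕ.* d) ≈ X^ e) exponent≡ ≈-refl)))))))))
    where
    exponent≡ : (a ℕ.+ m ℕ.* n) ℕ.* d ≡ a ℕ.* d ℕ.+ m ℕ.* d ℕ.* n
    exponent≡ = trans (ℕₚ.*-distribʳ-+ d a (m ℕ.* n)) (cong (a ℕ.* d ℕ.+_) (trans (ℕₚ.*-assoc m n d) (trans (cong (m ℕ.*_) (ℕₚ.*-comm n d)) (sym (ℕₚ.*-assoc m d n)))))

  dil-Pr : ∀ d a m .{{_ : NonZero d}} .{{_ : NonZero a}} .{{_ : NonZero m}} .{{_ : NonZero (a ℕ.* d)}} .{{_ : NonZero (m ℕ.* d)}} →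
    dil d (Prε a m) ≈ Prε (a ℕ.* d) (m ℕ.* d)
  dil-Pr d a m = ≈[]-limit λ K → ≈[]-trans (dil-≈[] d (Prε≈[]P a m K K (ℕₚ.n≤1+n K)))
    (≈[]-trans (≈⇒≈[] (dil-P d a m K)) (≈[]-sym (Prε≈[]P (a ℕ.* d) (m ℕ.* d) K K (ℕₚ.n≤1+n K))))

-- The sum over i + j = n, the index set that suits Gaussian binomials written in terms of both i
-- and j.
diag : ℕ → (ℕ → ℕ → Series) → Series
diag zero    f = f 0 0
diag (suc n) f = f 0 (suc n) + diag n (λ i j → f (suc i) j)

diag-cong : ∀ n {f g : ℕ → ℕ → Series} → (∀ i j → i ℕ.+ j ≡ n → f i j ≈ g i j) → diag n f ≈ diag n g
diag-cong zero    p = p 0 0 refl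
diag-cong (suc n) p = +-cong (p 0 (suc n) refl) (diag-cong n (λ i j e → p (suc i) j (cong suc e)))

diag-≈[] : ∀ {K} n {f g : ℕ → ℕ → Series} → (∀ i j → i ℕ.+ j ≡ n → f i j ≈[ K ] g i j) → diag n f ≈[ K ] diag n g
diag-≈[] zero    p = p 0 0 refl
diag-≈[] (suc n) p = ≈[]-+ (p 0 (suc n) refl) (diag-≈[] n (λ i j e → p (suc i) j (cong suc e)))

diag-+ : ∀ n f g → diag n (λ i j → f i j + g i j) ≈ diag n f + diag n g
diag-+ zero    f g = ≈-refl
diag-+ (suc n) f g = ≈-trans (+-congˡ (diag-+ n (λ i j → f (suc i) j) (λ i j → g (suc i) j)))
  (SR.solve (f 0 (suc n) ∷ g 0 (suc n) ∷ diag n (λ i j → f (suc i) j) ∷ diag n (λ i j → g (suc i) j) ∷ [])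
    (λ { (a ∷ b ∷ c ∷ d ∷ []) → a :+ b :+ (c :+ d) , a :+ c :+ (b :+ d) }) refl)

diag-* : ∀ n c f → diag n (λ i j → c * f i j) ≈ c * diag n f
diag-* zero    c f = ≈-refl
diag-* (suc n) c f = ≈-trans (+-congˡ (diag-* n c (λ i j → f (suc i) j))) (≈-sym (distribˡ _ _ _))

diag-right : ∀ n f → diag (suc n) f ≈ diag n (λ i j → f i (suc j)) + f (suc n) 0
diag-right zero    f = ≈-refl
diag-right (suc n) f = ≈-trans (+-congˡ (diag-right n (λ i j → f (suc i) j))) (≈-sym (+-assoc _ _ _))

diag-flip : ∀ n f → diag n f ≈ diag n (λ i j → f j i)
diag-flip zero    f = ≈-refl
diag-flip (suc n) f = ≈-trans (diag-right n f) (≈-trans (+-comm _ _) (+-congˡ (diag-flip n (λ i j → f i (suc j)))))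

diag-split : ∀ M n f → diag (suc M ℕ.+ n) f ≈ diag M (λ i j → f i (suc (j ℕ.+ n))) + diag n (λ i j → f (suc M ℕ.+ i) j)
diag-split zero    n f = ≈-refl
diag-split (suc M) n f = ≈-trans (+-congˡ (diag-split M n (λ i j → f (suc i) j))) (≈-sym (+-assoc _ _ _))

Sum : (ℕ → Series) → ℕ → Series
Sum f zero    = 𝟘
Sum f (suc n) = f 0 + Sum (f ∘ suc) n

diag≈Sum : ∀ n g → diag n (λ i _ → g i) ≈ Sum g (suc n)
diag≈Sum zero    g = ≈-sym (+-identityʳ _)
diag≈Sum (suc n) g = +-congˡ (diag≈Sum n (g ∘ suc))

mono : ℤ → ℕ → Series
mono s e = const s * X^ e

mono-* : ∀ s e s′ e′ → mono s e * mono s′ e′ ≈ mono (s ℤ.* s′) (e ℕ.+ e′)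
mono-* s e s′ e′ = ≈-trans (SR.solve (const s ∷ X^ e ∷ const s′ ∷ X^ e′ ∷ []) (λ { (a ∷ b ∷ c ∷ d ∷ []) → a :* b :* (c :* d) , a :* c :* (b :* d) }) refl)
  (*-cong (≈-sym (const-* s s′)) (≈-sym (X^-+ e e′)))

mono-cong : ∀ {s s′ e e′} → s ≡ s′ → e ≡ e′ → mono s e ≈ mono s′ e′
mono-cong refl refl = ≈-refl

coeff-mono : ∀ s e d → mono s e d ≡ (if does (e ℕ.≟ d) then s else + 0)
coeff-mono s e d = trans (at-degree (*-comm (const s) (X^ e)) d) (go (e ℕ.≟ d))
  where
  go : (D : Dec (e ≡ d)) → (X^ e * const s) d ≡ (if does D then s else + 0)
  go (yes refl) = trans (cong (X^ e * const s) (sym (ℕₚ.+-identityʳ e))) (trans (coeff-X^*-≥ e (const s) 0) (const-zero s))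
  go (no e≢d) with ℕₚ.<-cmp d e
  ... | tri< d<e _ _ = coeff-X^*-< e (const s) d d<e
  ... | tri≈ _ d≡e _ = contradiction (sym d≡e) e≢d
  ... | tri> _ _ e<d = trans (cong (X^ e * const s) (sym (trans (ℕₚ.+-suc e _) (ℕₚ.m+[n∸m]≡n {suc e} e<d)))) (trans (coeff-X^*-≥ e (const s) (suc (d ℕ.∸ suc e))) (const-suc s _))

gen≈[]Sum : (w : ℕ → ℕ) (le : ∀ k → k ℕ.≤ w k) (s : ℕ → ℤ) → ∀ K n → K ℕ.≤ n → gen (ℕ-fibres w le) s ≈[ K ] Sum (λ k → mono (s k) (w k)) n
gen≈[]Sum w le s K n K≤n d d<K = trans (coeff-gen (ℕ-fibres w le) s d) (trans (sumOver-filter (λ k → w k ℕ.≟ d) s (upTo (suc d)))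
  (trans (cong sumℤ (map-upTo (λ a → if does (w a ℕ.≟ d) then s a else + 0) (suc d))) (trans (go (suc d) (λ k → k)) (trans (sym (stable (suc d) (λ k → k) (λ k d<k → beyond k d<k) (n ℕ.∸ suc d)))
    (cong (λ j → Sum (λ k → mono (s k) (w k)) j d) (ℕₚ.m+[n∸m]≡n (ℕₚ.≤-trans d<K K≤n)))))))
  where
  go : ∀ j (h : ℕ → ℕ) → sumℤ (applyUpTo (λ k → if does (w (h k) ℕ.≟ d) then s (h k) else + 0) j) ≡ Sum (λ k → mono (s (h k)) (w (h k))) j d
  go zero    h = sym (coeff-𝟘 d)
  go (suc j) h = sym (trans (coeff-+ _ _ d) (cong₂ ℤ._+_ (coeff-mono (s (h 0)) (w (h 0)) d) (sym (go j (h ∘ suc)))))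
  beyond : ∀ k → d ℕ.< k → mono (s k) (w k) d ≡ + 0
  beyond k d<k = trans (at-degree (*-comm (const (s k)) (X^ (w k))) d) (coeff-X^*-< (w k) (const (s k)) d (ℕₚ.<-≤-trans d<k (le k)))
  vanish-from : ∀ r (h : ℕ → ℕ) → (∀ k → d ℕ.< h k) → Sum (λ k → mono (s (h k)) (w (h k))) r d ≡ + 0
  vanish-from zero    h p = coeff-𝟘 d
  vanish-from (suc r) h p = trans (coeff-+ _ _ d) (trans (cong₂ ℤ._+_ (beyond (h 0) (p 0)) (vanish-from r (h ∘ suc) (p ∘ suc))) refl)
  stable : ∀ j (h : ℕ → ℕ) → (∀ k → j ℕ.≤ k → mono (s (h k)) (w (h k)) d ≡ + 0) → ∀ r →
    Sum (λ k → mono (s (h k)) (w (h k))) (j ℕ.+ r) d ≡ Sum (λ k → mono (s (h k)) (w (h k))) j d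
  stable zero    h p zero    = refl
  stable zero    h p (suc r) = trans (coeff-+ _ _ d) (trans (cong₂ ℤ._+_ (p 0 z≤n) (trans (stable zero (h ∘ suc) (λ k _ → p (suc k) z≤n) r) (coeff-𝟘 d))) (sym (coeff-𝟘 d)))
  stable (suc j) h p r = trans (coeff-+ _ _ d) (trans (cong (λ z → mono (s (h 0)) (w (h 0)) d ℤ.+ z) (stable j (h ∘ suc) (λ k j≤k → p (suc k) (s≤s j≤k)) r)) (sym (coeff-+ _ _ d)))

X^-≡ : ∀ {e e′} → e ≡ e′ → X^ e ≈ X^ e′
X^-≡ refl = ≈-refl

b₂-+ : ∀ p q → b₂ (p ℕ.+ q) ≡ b₂ p ℕ.+ b₂ q ℕ.+ p ℕ.* q
b₂-+ zero    q = sym (ℕₚ.+-identityʳ (b₂ q))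
b₂-+ (suc p) q = trans (cong (p ℕ.+ q ℕ.+_) (b₂-+ p q)) (solve 4 (λ p q b d → p :+ₙ q :+ₙ (b :+ₙ d :+ₙ p :*ₙ q) := p :+ₙ b :+ₙ d :+ₙ (q :+ₙ p :*ₙ q)) refl p q (b₂ p) (b₂ q))
  where open +-*-Solver using (solve; _:=_) renaming (_:*_ to _:*ₙ_; _:+_ to _:+ₙ_; con to conₙ)

square-b₂ : ∀ n → n ℕ.* n ≡ n ℕ.+ 2 ℕ.* b₂ n
square-b₂ zero    = refl
square-b₂ (suc n) = trans (solve 1 (λ n → (conₙ 1 :+ₙ n) :*ₙ (conₙ 1 :+ₙ n) := conₙ 1 :+ₙ n :+ₙ n :+ₙ n :*ₙ n) refl n)
  (trans (cong (1 ℕ.+ n ℕ.+ n ℕ.+_) (square-b₂ n)) (solve 2 (λ n b → conₙ 1 :+ₙ n :+ₙ n :+ₙ (n :+ₙ conₙ 2 :*ₙ b) := conₙ 1 :+ₙ n :+ₙ conₙ 2 :*ₙ (n :+ₙ b)) refl n (b₂ n)))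
  where open +-*-Solver using (solve; _:=_) renaming (_:*_ to _:*ₙ_; _:+_ to _:+ₙ_; con to conₙ)

-- The finite q-binomial theorem with 2J factors is centred at its middle term; as J grows, the
-- Gaussian binomials tend to the inverse of (q^m; q^m).
module TripleProduct (ε : ℤ) (ε² : ε ℤ.* ε ≡ + 1) (a c : ℕ) .{{_ : NonZero a}} .{{_ : NonZero c}} where

  open Products ε using () renaming (P to Pε; Pr to Prε; Pr≈[]P to Prε≈[]P; factor to factorε)

  m : ℕ
  m = a ℕ.+ c

  instance
    m-nonZero : NonZero m
    m-nonZero = ℕ.>-nonZero (ℕₚ.<-≤-trans (ℕ.>-nonZero⁻¹ a) (ℕₚ.m≤m+n a c))

  -- The Gaussian binomial coefficient [i+j, i] in the variable X^m.
  gauss : ℕ → ℕ → Series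
  gauss zero    j       = 𝟙
  gauss (suc i) zero    = 𝟙
  gauss (suc i) (suc j) = gauss i (suc j) + X^ (m ℕ.* suc i) * gauss (suc i) j

  gauss-zero : ∀ i → gauss i 0 ≈ 𝟙
  gauss-zero zero    = ≈-refl
  gauss-zero (suc i) = ≈-refl

  -- The quotient formula for Gaussian binomials with the denominators cleared. It provides the
  -- limit, since all three products tend to the same infinite product.
  gauss-product : ∀ i j → gauss i j * P m m i * P m m j ≈ P m m (i ℕ.+ j)
  gauss-product zero    j       = ≈-trans (*-congʳ (*-identityˡ 𝟙)) (*-identityˡ _)
  gauss-product (suc i) zero    = ≈-trans (*-identityʳ _) (≈-trans (*-identityˡ _) (subst (λ k → P m m (suc i) ≈ P m m (suc k)) (sym (ℕₚ.+-identityʳ i)) ≈-refl))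
  gauss-product (suc i) (suc j) = begin
    (gauss i (suc j) + Y * gauss (suc i) j) * (P m m i * factor (m ℕ.+ m ℕ.* i)) * (P m m j * factor (m ℕ.+ m ℕ.* j))
      ≈⟨ SR.solve (gauss i (suc j) ∷ Y ∷ gauss (suc i) j ∷ P m m i ∷ factor (m ℕ.+ m ℕ.* i) ∷ P m m j ∷ factor (m ℕ.+ m ℕ.* j) ∷ [])
           (λ { (g ∷ y ∷ g′ ∷ p ∷ f ∷ q ∷ f′ ∷ []) → (g :+ y :* g′) :* (p :* f) :* (q :* f′) , f :* (g :* p :* (q :* f′)) :+ y :* f′ :* (g′ :* (p :* f) :* q) }) refl ⟩
    factor (m ℕ.+ m ℕ.* i) * (gauss i (suc j) * P m m i * P m m (suc j)) + Y * factor (m ℕ.+ m ℕ.* j) * (gauss (suc i) j * P m m (suc i) * P m m j)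
      ≈⟨ +-cong (*-congˡ (≈-trans (gauss-product i (suc j)) (subst (λ k → P m m (i ℕ.+ suc j) ≈ P m m k) (ℕₚ.+-suc i j) ≈-refl))) (*-congˡ (gauss-product (suc i) j)) ⟩
    factor (m ℕ.+ m ℕ.* i) * Z + Y * factor (m ℕ.+ m ℕ.* j) * Z
      ≈⟨ +-cong (*-congʳ (+-congˡ (-‿cong (*-congˡ (X^-≡ (sym (ℕₚ.*-suc m i))))))) ≈-refl ⟩
    (𝟙 - const (+ 1) * Y) * Z + Y * (𝟙 - const (+ 1) * X^ (m ℕ.+ m ℕ.* j)) * Z
      ≈⟨ SR.solve (𝟙 ∷ Y ∷ X^ (m ℕ.+ m ℕ.* j) ∷ Z ∷ []) (λ { (o ∷ y ∷ w ∷ z ∷ []) → (o :- 1 · y) :* z :+ y :* (o :- 1 · w) :* z , z :* (o :- 1 · (y :* w)) :+ z :* (y :* o :- y) }) refl ⟩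
    Z * (𝟙 - const (+ 1) * (Y * X^ (m ℕ.+ m ℕ.* j))) + Z * (Y * 𝟙 - Y)
      ≈⟨ +-cong (*-congˡ (+-congˡ (-‿cong (*-congˡ (≈-trans (≈-sym (X^-+ _ _)) (X^-≡ exponents)))))) (≈-trans (*-congˡ (≈⇒-≈𝟘 (*-identityʳ Y))) (zeroʳ Z)) ⟩
    Z * factor (m ℕ.+ m ℕ.* (suc i ℕ.+ j)) + 𝟘
      ≈⟨ +-identityʳ _ ⟩
    P m m (suc (suc i ℕ.+ j))
      ≡⟨ cong (λ k → P m m (suc k)) (sym (ℕₚ.+-suc i j)) ⟩
    P m m (suc i ℕ.+ suc j) ∎
    where
    open ≈-Reasoning
    Y = X^ (m ℕ.* suc i)
    Z = P m m (suc i ℕ.+ j)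
    exponents : m ℕ.* suc i ℕ.+ (m ℕ.+ m ℕ.* j) ≡ m ℕ.+ m ℕ.* (suc i ℕ.+ j)
    exponents = solve 3 (λ m i j → m :*ₙ (conₙ 1 :+ₙ i) :+ₙ (m :+ₙ m :*ₙ j) := m :+ₙ m :*ₙ (conₙ 1 :+ₙ i :+ₙ j)) refl m i j
      where open +-*-Solver renaming (_:*_ to _:*ₙ_; _:+_ to _:+ₙ_; con to conₙ)

  gauss-limit : ∀ K i j → K ℕ.≤ i → K ℕ.≤ j → gauss i j * Pr m m ≈[ K ] 𝟙
  gauss-limit K i j K≤i K≤j = ≈[]-cancel {f = Pr m m} (λ e → case trans (sym (at-degree 𝟙≈oneS 0)) e of λ ()) (≈[]-trans (≈⇒≈[] (SR.solve (Pr m m ∷ gauss i j ∷ []) (λ { (p ∷ g ∷ []) → p :* (g :* p) , g :* p :* p }) refl))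
    (≈[]-trans (≈[]-* (≈[]-* {f = gauss i j} {f′ = gauss i j} (λ _ _ → refl) (lim i K≤i)) (lim j K≤j))
    (≈[]-trans (≈⇒≈[] (gauss-product i j)) (≈[]-trans (≈[]-sym (lim (i ℕ.+ j) (ℕₚ.≤-trans K≤i (ℕₚ.m≤m+n i j)))) (≈⇒≈[] (≈-sym (*-identityʳ _)))))))
    where
    lim : ∀ i → K ℕ.≤ i → Pr m m ≈[ K ] P m m i
    lim i K≤i = Pr≈[]P m m K i (ℕₚ.≤-trans K≤i (ℕₚ.n≤1+n i))

  sign : ℕ → ℤ
  sign i = (- ε) ℤ.^ i

  neg-const : neg (const ε) ≈ const (- ε)
  neg-const = ≈-trans (SR.solve (const ε ∷ []) (λ { (c ∷ []) → :neg c , con (- + 1) :* c }) refl)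
    (≈-trans (≈-sym (const-* (- + 1) ε)) (subst (λ z → const (- + 1 ℤ.* ε) ≈ const z) (ℤₚ.-1*i≡-i ε) ≈-refl))

  -- Centring introduces negative exponents. Multiplying each factor 1 - ε q^(e - w) by q^w keeps
  -- all exponents in ℕ.
  module Rothe (w : ℕ) where

    L : ℕ → ℕ → Series
    L e zero    = 𝟙
    L e (suc n) = (X^ w - const ε * X^ e) * L (e ℕ.+ m) n

    term : ℕ → ℕ → ℕ → Series
    term e i j = mono (sign i) (m ℕ.* b₂ i ℕ.+ e ℕ.* i ℕ.+ w ℕ.* j) * gauss i j

    open +-*-Solver using (solve; _:=_) renaming (_:*_ to _:*ₙ_; _:+_ to _:+ₙ_; con to conₙ)
    private

      left right : ℕ → ℕ → ℕ → Series
      left  e i zero    = 𝟘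
      left  e i (suc j) = X^ w * term (e ℕ.+ m) i j
      right e zero    j = 𝟘
      right e (suc i) j = mono (- ε) e * term (e ℕ.+ m) i j

    term-split : ∀ e i j n → i ℕ.+ j ≡ suc n → term e i j ≈ left e i j + right e i j
    term-split e zero (suc j) n _ = ≈-trans (SR.solve (const (sign 0) ∷ X^ (m ℕ.* 0 ℕ.+ e ℕ.* 0 ℕ.+ w ℕ.* suc j) ∷ 𝟙 ∷ []) (λ { (s ∷ x ∷ o ∷ []) → s :* x :* o , x :* (s :* o) }) refl)
      (≈-trans (*-congʳ (≈-trans (X^-≡ exps) (X^-+ w _))) (≈-trans (SR.solve (const (sign 0) ∷ X^ w ∷ X^ (m ℕ.* 0 ℕ.+ (e ℕ.+ m) ℕ.* 0 ℕ.+ w ℕ.* j) ∷ 𝟙 ∷ [])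
         (λ { (s ∷ x ∷ y ∷ o ∷ []) → x :* y :* (s :* o) , x :* (s :* y :* o) }) refl) (≈-sym (+-identityʳ _))))
      where
      exps : m ℕ.* 0 ℕ.+ e ℕ.* 0 ℕ.+ w ℕ.* suc j ≡ w ℕ.+ (m ℕ.* 0 ℕ.+ (e ℕ.+ m) ℕ.* 0 ℕ.+ w ℕ.* j)
      exps = solve 4 (λ m e w j → m :*ₙ conₙ 0 :+ₙ e :*ₙ conₙ 0 :+ₙ w :*ₙ (conₙ 1 :+ₙ j) := w :+ₙ (m :*ₙ conₙ 0 :+ₙ (e :+ₙ m) :*ₙ conₙ 0 :+ₙ w :*ₙ j)) refl m e w j
    term-split e (suc i) zero n _ = ≈-trans (*-cong (≈-trans (mono-cong refl exps) (≈-sym (mono-* (- ε) e (sign i) _))) (≈-sym (gauss-zero i)))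
      (≈-trans (*-assoc _ _ _) (≈-sym (+-identityˡ _)))
      where
      exps : m ℕ.* b₂ (suc i) ℕ.+ e ℕ.* suc i ℕ.+ w ℕ.* 0 ≡ e ℕ.+ (m ℕ.* b₂ i ℕ.+ (e ℕ.+ m) ℕ.* i ℕ.+ w ℕ.* 0)
      exps = solve 5 (λ m e w i b → m :*ₙ (i :+ₙ b) :+ₙ e :*ₙ (conₙ 1 :+ₙ i) :+ₙ w :*ₙ conₙ 0 := e :+ₙ (m :*ₙ b :+ₙ (e :+ₙ m) :*ₙ i :+ₙ w :*ₙ conₙ 0)) refl m e w i (b₂ i)
    term-split e (suc i) (suc j) n _ = begin
      mono (sign (suc i)) (exponent₀ (suc i) (suc j)) * (gauss i (suc j) + X^ (m ℕ.* suc i) * gauss (suc i) j)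
        ≈⟨ SR.solve (const (sign (suc i)) ∷ X^ (exponent₀ (suc i) (suc j)) ∷ gauss i (suc j) ∷ X^ (m ℕ.* suc i) ∷ gauss (suc i) j ∷ [])
             (λ { (s ∷ x ∷ g ∷ y ∷ g′ ∷ []) → s :* x :* (g :+ y :* g′) , s :* (x :* y) :* g′ :+ s :* x :* g }) refl ⟩
      const (sign (suc i)) * (X^ (exponent₀ (suc i) (suc j)) * X^ (m ℕ.* suc i)) * gauss (suc i) j + mono (sign (suc i)) (exponent₀ (suc i) (suc j)) * gauss i (suc j)
        ≈⟨ +-cong (*-congʳ (*-congˡ (≈-trans (≈-sym (X^-+ _ _)) (≈-trans (X^-≡ exps₁) (X^-+ w _)))))
                  (*-congʳ (≈-trans (mono-cong refl exps₂) (≈-sym (mono-* (- ε) e (sign i) _)))) ⟩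
      const (sign (suc i)) * (X^ w * X^ (m ℕ.* b₂ (suc i) ℕ.+ (e ℕ.+ m) ℕ.* suc i ℕ.+ w ℕ.* j)) * gauss (suc i) j
        + mono (- ε) e * mono (sign i) (m ℕ.* b₂ i ℕ.+ (e ℕ.+ m) ℕ.* i ℕ.+ w ℕ.* suc j) * gauss i (suc j)
        ≈⟨ +-cong (SR.solve (const (sign (suc i)) ∷ X^ w ∷ X^ (m ℕ.* b₂ (suc i) ℕ.+ (e ℕ.+ m) ℕ.* suc i ℕ.+ w ℕ.* j) ∷ gauss (suc i) j ∷ [])
             (λ { (s ∷ x ∷ y ∷ g ∷ []) → s :* (x :* y) :* g , x :* (s :* y :* g) }) refl) (*-assoc _ _ _) ⟩
      left e (suc i) (suc j) + right e (suc i) (suc j) ∎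
      where
      open ≈-Reasoning
      exponent₀ : ℕ → ℕ → ℕ
      exponent₀ i j = m ℕ.* b₂ i ℕ.+ e ℕ.* i ℕ.+ w ℕ.* j
      exps₁ : exponent₀ (suc i) (suc j) ℕ.+ m ℕ.* suc i ≡ w ℕ.+ (m ℕ.* b₂ (suc i) ℕ.+ (e ℕ.+ m) ℕ.* suc i ℕ.+ w ℕ.* j)
      exps₁ = solve 6 (λ m e w i j b → m :*ₙ b :+ₙ e :*ₙ (conₙ 1 :+ₙ i) :+ₙ w :*ₙ (conₙ 1 :+ₙ j) :+ₙ m :*ₙ (conₙ 1 :+ₙ i) := w :+ₙ (m :*ₙ b :+ₙ (e :+ₙ m) :*ₙ (conₙ 1 :+ₙ i) :+ₙ w :*ₙ j)) refl m e w i j (b₂ (suc i))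
      exps₂ : exponent₀ (suc i) (suc j) ≡ e ℕ.+ (m ℕ.* b₂ i ℕ.+ (e ℕ.+ m) ℕ.* i ℕ.+ w ℕ.* suc j)
      exps₂ = solve 6 (λ m e w i j b → m :*ₙ (i :+ₙ b) :+ₙ e :*ₙ (conₙ 1 :+ₙ i) :+ₙ w :*ₙ (conₙ 1 :+ₙ j) := e :+ₙ (m :*ₙ b :+ₙ (e :+ₙ m) :*ₙ i :+ₙ w :*ₙ (conₙ 1 :+ₙ j))) refl m e w i j (b₂ i)

    -- Rothe's q-binomial theorem. Taking out one factor corresponds to the Pascal rule by which
    -- `gauss` is defined (`term-split`).
    rothe : ∀ n e → L e n ≈ diag n (term e)
    rothe zero e = ≈-sym (≈-trans (*-congʳ (≈-trans (*-cong const-1 (X^-≡ zero-exp)) (*-identityˡ _))) (≈-trans (*-identityʳ _) X^-zero))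
      where
      zero-exp : m ℕ.* 0 ℕ.+ e ℕ.* 0 ℕ.+ w ℕ.* 0 ≡ 0
      zero-exp = solve 3 (λ m e w → m :*ₙ conₙ 0 :+ₙ e :*ₙ conₙ 0 :+ₙ w :*ₙ conₙ 0 := conₙ 0) refl m e w
    rothe (suc n) e = begin
      (X^ w - const ε * X^ e) * L (e ℕ.+ m) n
        ≈⟨ *-cong (SR.solve (X^ w ∷ const ε ∷ X^ e ∷ []) (λ { (x ∷ c ∷ y ∷ []) → x :- c :* y , x :+ :neg c :* y }) refl) (rothe n (e ℕ.+ m)) ⟩
      (X^ w + neg (const ε) * X^ e) * diag n (term (e ℕ.+ m))
        ≈⟨ *-congʳ (+-congˡ (*-congʳ neg-const)) ⟩
      (X^ w + mono (- ε) e) * diag n (term (e ℕ.+ m))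
        ≈⟨ distribʳ _ _ _ ⟩
      X^ w * diag n (term (e ℕ.+ m)) + mono (- ε) e * diag n (term (e ℕ.+ m))
        ≈⟨ +-cong (≈-trans (≈-sym (diag-* n (X^ w) _)) (≈-sym (≈-trans (diag-right n (left e)) (+-identityʳ _))))
                  (≈-trans (≈-sym (diag-* n (mono (- ε) e) _)) (≈-sym (+-identityˡ _))) ⟩
      diag (suc n) (left e) + diag (suc n) (right e)
        ≈⟨ ≈-sym (diag-+ (suc n) (left e) (right e)) ⟩
      diag (suc n) (λ i j → left e i j + right e i j)
        ≈⟨ diag-cong (suc n) (λ i j q → ≈-sym (term-split e i j n q)) ⟩
      diag (suc n) (term e) ∎
      where
      open ≈-Reasoning

    L-≡ : ∀ {e e′} n → e ≡ e′ → L e n ≈ L e′ n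
    L-≡ n refl = ≈-refl

    -- In these factors e lies below w, so -ε q^e is taken out; ε² = 1 leaves 1 - ε q^(w - e), where
    -- w - e descends through an arithmetic progression down to c.
    first-half : ∀ k e n → w ℕ.+ m ≡ e ℕ.+ (c ℕ.+ m ℕ.* k) →
      L e (k ℕ.+ n) ≈ mono (sign k) (e ℕ.* k ℕ.+ m ℕ.* b₂ k) * Pε c m k * L (e ℕ.+ m ℕ.* k) n
    first-half zero e n _ = ≈-sym (≈-trans (*-cong (≈-trans (*-identityʳ _) (≈-trans (*-cong const-1 (≈-trans (X^-≡ z₁) X^-zero)) (*-identityˡ 𝟙))) (L-≡ n z₂)) (*-identityˡ _))
      where
      z₁ : e ℕ.* 0 ℕ.+ m ℕ.* 0 ≡ 0
      z₁ = solve 2 (λ e m → e :*ₙ conₙ 0 :+ₙ m :*ₙ conₙ 0 := conₙ 0) refl e m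
      z₂ : e ℕ.+ m ℕ.* 0 ≡ e
      z₂ = solve 2 (λ e m → e :+ₙ m :*ₙ conₙ 0 := e) refl e m
    first-half (suc k) e n q = begin
      (X^ w - const ε * X^ e) * L (e ℕ.+ m) (k ℕ.+ n)
        ≈⟨ *-cong pull (≈-trans (first-half k (e ℕ.+ m) n next) (*-congˡ (L-≡ n z₂))) ⟩
      (mono (- ε) e * factorε (c ℕ.+ m ℕ.* k)) * (mono (sign k) ((e ℕ.+ m) ℕ.* k ℕ.+ m ℕ.* b₂ k) * Pε c m k * L (e ℕ.+ m ℕ.* suc k) n)
        ≈⟨ SR.solve (mono (- ε) e ∷ factorε (c ℕ.+ m ℕ.* k) ∷ mono (sign k) ((e ℕ.+ m) ℕ.* k ℕ.+ m ℕ.* b₂ k) ∷ Pε c m k ∷ L (e ℕ.+ m ℕ.* suc k) n ∷ [])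
             (λ { (u ∷ f ∷ v ∷ p ∷ l ∷ []) → (u :* f) :* (v :* p :* l) , u :* v :* (p :* f) :* l }) refl ⟩
      mono (- ε) e * mono (sign k) ((e ℕ.+ m) ℕ.* k ℕ.+ m ℕ.* b₂ k) * Pε c m (suc k) * L (e ℕ.+ m ℕ.* suc k) n
        ≈⟨ *-congʳ (*-congʳ (≈-trans (mono-* (- ε) e (sign k) _) (mono-cong refl z₁))) ⟩
      mono (sign (suc k)) (e ℕ.* suc k ℕ.+ m ℕ.* b₂ (suc k)) * Pε c m (suc k) * L (e ℕ.+ m ℕ.* suc k) n ∎
      where
      open ≈-Reasoning
      f = c ℕ.+ m ℕ.* k
      z₁ : e ℕ.+ ((e ℕ.+ m) ℕ.* k ℕ.+ m ℕ.* b₂ k) ≡ e ℕ.* suc k ℕ.+ m ℕ.* b₂ (suc k)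
      z₁ = solve 4 (λ e m k b → e :+ₙ ((e :+ₙ m) :*ₙ k :+ₙ m :*ₙ b) := e :*ₙ (conₙ 1 :+ₙ k) :+ₙ m :*ₙ (k :+ₙ b)) refl e m k (b₂ k)
      z₂ : e ℕ.+ m ℕ.+ m ℕ.* k ≡ e ℕ.+ m ℕ.* suc k
      z₂ = solve 3 (λ e m k → e :+ₙ m :+ₙ m :*ₙ k := e :+ₙ m :*ₙ (conₙ 1 :+ₙ k)) refl e m k
      next : w ℕ.+ m ≡ e ℕ.+ m ℕ.+ (c ℕ.+ m ℕ.* k)
      next = trans q (solve 4 (λ e m k c → e :+ₙ (c :+ₙ m :*ₙ (conₙ 1 :+ₙ k)) := e :+ₙ m :+ₙ (c :+ₙ m :*ₙ k)) refl e m k c)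
      w≡ : w ≡ e ℕ.+ f
      w≡ = ℕₚ.+-cancelʳ-≡ m w (e ℕ.+ f) (trans q (solve 4 (λ e m k c → e :+ₙ (c :+ₙ m :*ₙ (conₙ 1 :+ₙ k)) := e :+ₙ (c :+ₙ m :*ₙ k) :+ₙ m) refl e m k c))
      pull : X^ w - const ε * X^ e ≈ mono (- ε) e * factorε f
      pull = ≈-sym (begin
        const (- ε) * X^ e * (𝟙 - const ε * X^ f)
          ≈⟨ *-congʳ (*-congʳ (≈-sym neg-const)) ⟩
        neg (const ε) * X^ e * (𝟙 - const ε * X^ f)
          ≈⟨ SR.solve (const ε ∷ X^ e ∷ 𝟙 ∷ X^ f ∷ []) (λ { (c ∷ x ∷ o ∷ y ∷ []) → :neg c :* x :* (o :- c :* y) , c :* c :* (x :* y) :- c :* x :* o }) refl ⟩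
        const ε * const ε * (X^ e * X^ f) - const ε * X^ e * 𝟙
          ≈⟨ +-cong (≈-trans (*-cong (≈-trans (≈-sym (const-* ε ε)) (subst (λ z → const z ≈ 𝟙) (sym ε²) const-1)) (≈-trans (≈-sym (X^-+ e f)) (X^-≡ (sym w≡)))) (*-identityˡ _))
                    (-‿cong (*-identityʳ _)) ⟩
        X^ w - const ε * X^ e ∎)

    -- Here the exponents exceed w, so q^w is taken out of every factor.
    second-half : ∀ n k → L (w ℕ.+ (a ℕ.+ m ℕ.* k)) n * Pε a m k ≈ X^ (w ℕ.* n) * Pε a m (k ℕ.+ n)
    second-half zero k = *-cong (≈-sym (≈-trans (X^-≡ (ℕₚ.*-zeroʳ w)) X^-zero)) (subst (λ j → Pε a m k ≈ Pε a m j) (sym (ℕₚ.+-identityʳ k)) ≈-refl)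
    second-half (suc n) k = begin
      (X^ w - const ε * X^ (w ℕ.+ f)) * L (w ℕ.+ f ℕ.+ m) n * Pε a m k
        ≈⟨ *-congʳ (*-cong (+-congˡ (-‿cong (*-congˡ (X^-+ w f)))) (L-≡ n z)) ⟩
      (X^ w - const ε * (X^ w * X^ f)) * L (w ℕ.+ (a ℕ.+ m ℕ.* suc k)) n * Pε a m k
        ≈⟨ *-congʳ (*-congʳ (≈-trans (+-congʳ (≈-sym (*-identityʳ (X^ w)))) (SR.solve (X^ w ∷ const ε ∷ X^ f ∷ 𝟙 ∷ []) (λ { (x ∷ c ∷ y ∷ o ∷ []) → x :* o :- c :* (x :* y) , x :* (o :- c :* y) }) refl))) ⟩
      X^ w * factorε f * L (w ℕ.+ (a ℕ.+ m ℕ.* suc k)) n * Pε a m k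
        ≈⟨ SR.solve (X^ w ∷ factorε f ∷ L (w ℕ.+ (a ℕ.+ m ℕ.* suc k)) n ∷ Pε a m k ∷ []) (λ { (x ∷ f ∷ l ∷ p ∷ []) → x :* f :* l :* p , x :* (l :* (p :* f)) }) refl ⟩
      X^ w * (L (w ℕ.+ (a ℕ.+ m ℕ.* suc k)) n * Pε a m (suc k))
        ≈⟨ *-congˡ (second-half n (suc k)) ⟩
      X^ w * (X^ (w ℕ.* n) * Pε a m (suc k ℕ.+ n))
        ≈⟨ ≈-trans (≈-sym (*-assoc _ _ _)) (*-cong (≈-trans (≈-sym (X^-+ w (w ℕ.* n))) (X^-≡ (sym (ℕₚ.*-suc w n)))) (subst (λ j → Pε a m (suc k ℕ.+ n) ≈ Pε a m j) (sym (ℕₚ.+-suc k n)) ≈-refl)) ⟩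
      X^ (w ℕ.* suc n) * Pε a m (k ℕ.+ suc n) ∎
      where
      open ≈-Reasoning
      f = a ℕ.+ m ℕ.* k
      z : w ℕ.+ f ℕ.+ m ≡ w ℕ.+ (a ℕ.+ m ℕ.* suc k)
      z = solve 4 (λ w a m k → w :+ₙ (a :+ₙ m :*ₙ k) :+ₙ m := w :+ₙ (a :+ₙ m :*ₙ (conₙ 1 :+ₙ k))) refl w a m k

  sign-+ : ∀ i j → sign (i ℕ.+ j) ≡ sign i ℤ.* sign j
  sign-+ i j = ℤₚ.^-distribˡ-+-* (- ε) i j

  sign² : ∀ i → sign i ℤ.* sign i ≡ + 1
  sign² zero    = refl
  sign² (suc i) = trans (ℤR.solve (ε ∷ sign i ∷ []) (λ { (e ∷ s ∷ []) → :neg e :* s :* (:neg e :* s) , e :* e :* (s :* s) }) refl) (cong₂ ℤ._*_ ε² (sign² i))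

  positive negative : ℕ → Series
  positive l = mono (sign l) (jacobi a c (+ l))
  negative j = mono (sign (suc j)) (jacobi a c -[1+ j ])

  module Finite (M : ℕ) where

    J w e₀ : ℕ
    J = suc M
    w = m ℕ.* J
    -- The exponent of the middle term i = J; cancelling it centres the sum.
    e₀ = a ℕ.* J ℕ.+ m ℕ.* b₂ J ℕ.+ w ℕ.* J

    open Rothe w
    open +-*-Solver using (solve; _:=_) renaming (_:*_ to _:*ₙ_; _:+_ to _:+ₙ_; con to conₙ)

    product-side : L a (J ℕ.+ J) ≈ mono (sign J) e₀ * (Pε c m J * Pε a m J)
    product-side = begin
      L a (J ℕ.+ J)
        ≈⟨ first-half J a J (solve 4 (λ m n a c → m :*ₙ n :+ₙ (a :+ₙ c) := a :+ₙ (c :+ₙ m :*ₙ n)) refl m J a c) ⟩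
      mono (sign J) (a ℕ.* J ℕ.+ m ℕ.* b₂ J) * Pε c m J * L (a ℕ.+ w) J
        ≈⟨ *-congˡ (≈-trans (≈-sym (*-identityʳ _)) (≈-trans (*-congʳ (L-≡ J (solve 3 (λ a w m → a :+ₙ w := w :+ₙ (a :+ₙ m :*ₙ conₙ 0)) refl a w m))) (second-half J 0))) ⟩
      mono (sign J) (a ℕ.* J ℕ.+ m ℕ.* b₂ J) * Pε c m J * (X^ (w ℕ.* J) * Pε a m J)
        ≈⟨ SR.solve (const (sign J) ∷ X^ (a ℕ.* J ℕ.+ m ℕ.* b₂ J) ∷ Pε c m J ∷ X^ (w ℕ.* J) ∷ Pε a m J ∷ []) (λ { (s ∷ x ∷ p ∷ y ∷ q ∷ []) → s :* x :* p :* (y :* q) , s :* (x :* y) :* (p :* q) }) refl ⟩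
      const (sign J) * (X^ (a ℕ.* J ℕ.+ m ℕ.* b₂ J) * X^ (w ℕ.* J)) * (Pε c m J * Pε a m J)
        ≈⟨ *-congʳ (*-congˡ (≈-sym (X^-+ _ _))) ⟩
      mono (sign J) e₀ * (Pε c m J * Pε a m J) ∎
      where open ≈-Reasoning

    term-positive : ∀ l j → l ℕ.+ j ≡ J → term a (J ℕ.+ l) j ≈ mono (sign J) e₀ * (positive l * gauss (J ℕ.+ l) j)
    term-positive l j q = ≈-trans (*-congʳ (≈-trans (mono-cong (sign-+ J l) exps) (≈-sym (mono-* (sign J) e₀ (sign l) _)))) (*-assoc _ _ _)
      where
      exps : m ℕ.* b₂ (J ℕ.+ l) ℕ.+ a ℕ.* (J ℕ.+ l) ℕ.+ w ℕ.* j ≡ e₀ ℕ.+ (m ℕ.* b₂ l ℕ.+ a ℕ.* l)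
      exps = trans (cong (λ b → m ℕ.* b ℕ.+ a ℕ.* (J ℕ.+ l) ℕ.+ w ℕ.* j) (b₂-+ J l)) (trans
        (solve 7 (λ m a n l j b d → m :*ₙ (b :+ₙ d :+ₙ n :*ₙ l) :+ₙ a :*ₙ (n :+ₙ l) :+ₙ m :*ₙ n :*ₙ j := a :*ₙ n :+ₙ m :*ₙ b :+ₙ m :*ₙ n :*ₙ (l :+ₙ j) :+ₙ (m :*ₙ d :+ₙ a :*ₙ l)) refl m a J l j (b₂ J) (b₂ l))
        (cong (λ n → a ℕ.* J ℕ.+ m ℕ.* b₂ J ℕ.+ w ℕ.* n ℕ.+ (m ℕ.* b₂ l ℕ.+ a ℕ.* l)) q))

    term-negative : ∀ i j → i ℕ.+ j ≡ M → term a i (suc (j ℕ.+ J)) ≈ mono (sign J) e₀ * (negative j * gauss i (suc (j ℕ.+ J)))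
    term-negative i j q = ≈-trans (*-congʳ (≈-trans (mono-cong signs exps) (≈-sym (mono-* (sign J) e₀ (sign (suc j)) _)))) (*-assoc _ _ _)
      where
      J≡ : J ≡ i ℕ.+ suc j
      J≡ = trans (cong suc (sym q)) (sym (ℕₚ.+-suc i j))
      signs : sign i ≡ sign J ℤ.* sign (suc j)
      signs = sym (trans (cong (λ n → sign n ℤ.* sign (suc j)) J≡) (trans (cong (ℤ._* sign (suc j)) (sign-+ i (suc j)))
        (trans (ℤₚ.*-assoc (sign i) (sign (suc j)) (sign (suc j))) (trans (cong (sign i ℤ.*_) (sign² (suc j))) (ℤₚ.*-identityʳ (sign i))))))
      exps : m ℕ.* b₂ i ℕ.+ a ℕ.* i ℕ.+ w ℕ.* suc (j ℕ.+ J) ≡ e₀ ℕ.+ (m ℕ.* b₂ (suc j) ℕ.+ c ℕ.* suc j)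
      exps = trans (solve 7 (λ a c i s n b m → m :*ₙ b :+ₙ a :*ₙ i :+ₙ m :*ₙ n :*ₙ (s :+ₙ n) := m :*ₙ b :+ₙ a :*ₙ i :+ₙ m :*ₙ (n :*ₙ s) :+ₙ m :*ₙ n :*ₙ n) refl a c i (suc j) J (b₂ i) m)
        (trans (cong (λ n → m ℕ.* b₂ i ℕ.+ a ℕ.* i ℕ.+ m ℕ.* (n ℕ.* suc j) ℕ.+ w ℕ.* J) J≡)
        (trans (solve 6 (λ a m i s b z → m :*ₙ b :+ₙ a :*ₙ i :+ₙ m :*ₙ ((i :+ₙ s) :*ₙ s) :+ₙ z := m :*ₙ b :+ₙ a :*ₙ i :+ₙ m :*ₙ (i :*ₙ s) :+ₙ m :*ₙ (s :*ₙ s) :+ₙ z) refl a m i (suc j) (b₂ i) (w ℕ.* J))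
        (trans (cong (λ n → m ℕ.* b₂ i ℕ.+ a ℕ.* i ℕ.+ m ℕ.* (i ℕ.* suc j) ℕ.+ m ℕ.* n ℕ.+ w ℕ.* J) (square-b₂ (suc j)))
        (trans (solve 7 (λ a c i s b d z → (a :+ₙ c) :*ₙ b :+ₙ a :*ₙ i :+ₙ (a :+ₙ c) :*ₙ (i :*ₙ s) :+ₙ (a :+ₙ c) :*ₙ (s :+ₙ conₙ 2 :*ₙ d) :+ₙ z :=
             a :*ₙ (i :+ₙ s) :+ₙ (a :+ₙ c) :*ₙ (b :+ₙ d :+ₙ i :*ₙ s) :+ₙ z :+ₙ ((a :+ₙ c) :*ₙ d :+ₙ c :*ₙ s)) refl a c i (suc j) (b₂ i) (b₂ (suc j)) (w ℕ.* J))
        (trans (cong (λ b → a ℕ.* (i ℕ.+ suc j) ℕ.+ m ℕ.* b ℕ.+ w ℕ.* J ℕ.+ (m ℕ.* b₂ (suc j) ℕ.+ c ℕ.* suc j)) (sym (b₂-+ i (suc j))))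
          (cong (λ n → a ℕ.* n ℕ.+ m ℕ.* b₂ n ℕ.+ w ℕ.* J ℕ.+ (m ℕ.* b₂ (suc j) ℕ.+ c ℕ.* suc j)) (sym J≡)))))))

    finite : Pε c m J * Pε a m J ≈ diag M (λ i j → negative j * gauss i (suc (j ℕ.+ J))) + diag J (λ l j → positive l * gauss (J ℕ.+ l) j)
    finite = cancel (regular-* (regular-const (sign J) sign≢0) (regular-X^ e₀)) (begin
      mono (sign J) e₀ * (Pε c m J * Pε a m J)     ≈⟨ product-side ⟨
      L a (J ℕ.+ J)                                ≈⟨ rothe (J ℕ.+ J) a ⟩
      diag (J ℕ.+ J) (term a)                      ≈⟨ diag-split M J (term a) ⟩
      diag M (λ i j → term a i (suc (j ℕ.+ J))) + diag J (λ i j → term a (J ℕ.+ i) j)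
        ≈⟨ +-cong (≈-trans (diag-cong M term-negative) (diag-* M (mono (sign J) e₀) (λ i j → negative j * gauss i (suc (j ℕ.+ J))))) (≈-trans (diag-cong J term-positive) (diag-* J (mono (sign J) e₀) (λ l j → positive l * gauss (J ℕ.+ l) j))) ⟩
      _ ≈⟨ ≈-sym (distribˡ _ _ _) ⟩
      _ ∎)
      where
      open ≈-Reasoning
      sign≢0 : sign J ≢ + 0
      sign≢0 e = case trans (sym (sign² J)) (cong (ℤ._* sign J) e) of λ ()

  ϑε : Series
  ϑε = gen (jacobiFibres a c) (λ l → sign ℤ.∣ l ∣)

  jacobi⁺-bound : ∀ k → k ℕ.≤ jacobi a c (+ k)
  jacobi⁺-bound k = ∣l∣≤jacobi a c (+ k)

  jacobi⁻-bound : ∀ k → suc k ℕ.≤ jacobi a c -[1+ k ]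
  jacobi⁻-bound k = ∣l∣≤jacobi a c -[1+ k ]

  ϑε-halves : ϑε ≈ gen (ℕ-fibres (λ k → jacobi a c (+ k)) jacobi⁺-bound) sign +
                   gen (ℕ-fibres (λ k → jacobi a c -[1+ k ]) (λ k → ℕₚ.≤-trans (ℕₚ.n≤1+n k) (jacobi⁻-bound k))) (sign ∘ suc)
  ϑε-halves = ≈-sym (≈-trans (≈-sym (gen-⊎ F⁺ F⁻ sign (sign ∘ suc))) (gen-bijection (F⁺ ⊎ᶠ F⁻) (jacobiFibres a c) _ _
    (λ _ → λ { (inj₁ k) → + k ; (inj₂ k) → -[1+ k ] })
    (λ { n (inj₁ k) _ q → tt , q , refl ; n (inj₂ k) _ q → tt , q , refl })
    (λ { n (inj₁ _) (inj₁ _) _ _ _ _ e → cong inj₁ (ℤₚ.+-injective e) ; n (inj₂ _) (inj₂ _) _ _ _ _ e → cong inj₂ (ℤₚ.-[1+-injective e) })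
    (λ { n (+ k) _ q → inj₁ k , tt , q , refl ; n -[1+ k ] _ q → inj₂ k , tt , q , refl })))
    where
    F⁺ = ℕ-fibres (λ k → jacobi a c (+ k)) jacobi⁺-bound
    F⁻ = ℕ-fibres (λ k → jacobi a c -[1+ k ]) (λ k → ℕₚ.≤-trans (ℕₚ.n≤1+n k) (jacobi⁻-bound k))

  tripleProduct : ϑε ≈ Prε a m * Prε c m * Pr m m
  tripleProduct = ≈[]-limit approx
    where
    approx : ∀ K → ϑε ≈[ K ] Prε a m * Prε c m * Pr m m
    approx K = ≈[]-sym (≈[]-trans (≈⇒≈[] (*-congʳ (*-comm _ _))) (≈[]-trans truncated (≈[]-trans (≈⇒≈[] expanded) (≈[]-trans limits
      (≈[]-trans (≈⇒≈[] sums) (≈[]-trans thetas (≈⇒≈[] (≈-sym ϑε-halves))))))))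
      where
      -- Room for both ends: a term of exponent below K has index below K, so both arguments of its
      -- Gaussian binomial are at least K.
      M = K ℕ.+ K
      open Finite M
      K≤M : K ℕ.≤ M
      K≤M = ℕₚ.m≤m+n K K
      K≤ : K ℕ.≤ suc J
      K≤ = ℕₚ.≤-trans K≤M (ℕₚ.≤-trans (ℕₚ.n≤1+n M) (ℕₚ.n≤1+n J))
      drop : ∀ g e s → (e ℕ.< K → g * Pr m m ≈[ K ] 𝟙) → Pr m m * (mono s e * g) ≈[ K ] mono s e
      drop g e s limit with e ℕ.<? K
      ... | yes e<K = ≈[]-trans (≈⇒≈[] (SR.solve (Pr m m ∷ mono s e ∷ g ∷ []) (λ { (p ∷ f ∷ g ∷ []) → p :* (f :* g) , f :* (g :* p) }) refl))
        (≈[]-trans (≈[]-* {f = mono s e} {f′ = mono s e} (λ _ _ → refl) (limit e<K)) (≈⇒≈[] (*-identityʳ _)))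
      ... | no e≮K = ≈[]-trans (≈⇒≈[] (SR.solve (Pr m m ∷ const s ∷ X^ e ∷ g ∷ []) (λ { (p ∷ c ∷ x ∷ g ∷ []) → p :* (c :* x :* g) , x :* (p :* c :* g) }) refl))
        (≈[]-trans (X^-≈[]-0 e _ (ℕₚ.≮⇒≥ e≮K)) (≈[]-sym (≈[]-trans (≈⇒≈[] (*-comm (const s) (X^ e))) (X^-≈[]-0 e (const s) (ℕₚ.≮⇒≥ e≮K)))))
      low : ∀ {i j} → i ℕ.+ j ≡ M → jacobi a c -[1+ j ] ℕ.< K → K ℕ.≤ i
      low {i} {j} q small = ℕₚ.+-cancelʳ-≤ K K i (ℕₚ.≤-trans (ℕₚ.≤-reflexive (sym q)) (ℕₚ.+-monoʳ-≤ i (ℕₚ.≤-trans (ℕₚ.n≤1+n j) (ℕₚ.≤-trans (jacobi⁻-bound j) (ℕₚ.<⇒≤ small)))))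
      high : ∀ {l j} → l ℕ.+ j ≡ J → jacobi a c (+ l) ℕ.< K → K ℕ.≤ j
      high {l} {j} q small = ℕₚ.+-cancelˡ-≤ K K j (ℕₚ.≤-trans (ℕₚ.n≤1+n M) (ℕₚ.≤-trans (ℕₚ.≤-reflexive (sym q)) (ℕₚ.+-monoˡ-≤ j (ℕₚ.≤-trans (jacobi⁺-bound l) (ℕₚ.<⇒≤ small)))))

      f⁻ f⁺ : ℕ → ℕ → Series
      f⁻ i j = negative j * gauss i (suc (j ℕ.+ J))
      f⁺ l j = positive l * gauss (J ℕ.+ l) j
      truncated : Prε c m * Prε a m * Pr m m ≈[ K ] Pε c m J * Pε a m J * Pr m m
      truncated = ≈[]-* {g = Pr m m} {g′ = Pr m m} (≈[]-* (Prε≈[]P c m K J K≤) (Prε≈[]P a m K J K≤)) (λ _ _ → refl)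
      expanded : Pε c m J * Pε a m J * Pr m m ≈ diag M (λ i j → Pr m m * f⁻ i j) + diag J (λ l j → Pr m m * f⁺ l j)
      expanded = ≈-trans (*-congʳ finite) (≈-trans (distribʳ _ _ _) (+-cong
        (≈-trans (*-comm _ _) (≈-sym (diag-* M (Pr m m) f⁻))) (≈-trans (*-comm _ _) (≈-sym (diag-* J (Pr m m) f⁺)))))
      limits : diag M (λ i j → Pr m m * f⁻ i j) + diag J (λ l j → Pr m m * f⁺ l j) ≈[ K ] diag M (λ _ j → negative j) + diag J (λ l _ → positive l)
      limits = ≈[]-+
        (diag-≈[] M (λ i j q → drop (gauss i (suc (j ℕ.+ J))) (jacobi a c -[1+ j ]) (sign (suc j))
          (λ small → gauss-limit K i (suc (j ℕ.+ J)) (low q small) (ℕₚ.≤-trans (ℕₚ.≤-trans K≤M (ℕₚ.n≤1+n M)) (ℕₚ.≤-trans (ℕₚ.m≤n+m J j) (ℕₚ.n≤1+n _))))))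
        (diag-≈[] J (λ l j q → drop (gauss (J ℕ.+ l) j) (jacobi a c (+ l)) (sign l)
          (λ small → gauss-limit K (J ℕ.+ l) j (ℕₚ.≤-trans (ℕₚ.≤-trans K≤M (ℕₚ.n≤1+n M)) (ℕₚ.m≤m+n J l)) (high q small))))
      sums : diag M (λ _ j → negative j) + diag J (λ l _ → positive l) ≈ Sum positive (suc J) + Sum negative (suc M)
      sums = ≈-trans (+-cong (≈-trans (diag-flip M _) (diag≈Sum M negative)) (diag≈Sum J positive)) (+-comm _ _)
      thetas : Sum positive (suc J) + Sum negative (suc M) ≈[ K ] _
      thetas = ≈[]-sym (≈[]-+ (gen≈[]Sum _ jacobi⁺-bound sign K (suc J) K≤)
        (gen≈[]Sum _ (λ k → ℕₚ.≤-trans (ℕₚ.n≤1+n k) (jacobi⁻-bound k)) (sign ∘ suc) K (suc M) (ℕₚ.≤-trans K≤M (ℕₚ.n≤1+n M))))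

Prod : (ℕ → Series) → ℕ → Series
Prod f zero    = 𝟙
Prod f (suc n) = Prod f n * f n

Prod-cong : ∀ {f g} → (∀ r → f r ≈ g r) → ∀ n → Prod f n ≈ Prod g n
Prod-cong p zero    = ≈-refl
Prod-cong p (suc n) = *-cong (Prod-cong p n) (p n)

Prod-* : ∀ f g n → Prod (λ r → f r * g r) n ≈ Prod f n * Prod g n
Prod-* f g zero    = ≈-sym (*-identityˡ 𝟙)
Prod-* f g (suc n) = ≈-trans (*-congʳ (Prod-* f g n)) (SR.solve (Prod f n ∷ Prod g n ∷ f n ∷ g n ∷ [])
  (λ { (a ∷ b ∷ c ∷ d ∷ []) → a :* b :* (c :* d) , a :* c :* (b :* d) }) refl)

Prod-𝟙 : ∀ {f} n → (∀ r → f r ≈ 𝟙) → Prod f n ≈ 𝟙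
Prod-𝟙 zero    p = ≈-refl
Prod-𝟙 (suc n) p = ≈-trans (*-cong (Prod-𝟙 n p) (p n)) (*-identityˡ 𝟙)

≈[]-Prod : ∀ {K f g} n → (∀ r → f r ≈[ K ] g r) → Prod f n ≈[ K ] Prod g n
≈[]-Prod zero    p = λ _ _ → refl
≈[]-Prod (suc n) p = ≈[]-* (≈[]-Prod n p) (p n)

module _ (ε : ℤ) where
  open Products ε using () renaming (P to Pε; Pr to Prε; Pr≈[]P to Prε≈[]P; factor to factorε)

  P-+ : ∀ a m k j → Pε a m (k ℕ.+ j) ≈ Pε a m k * Prod (λ r → factorε (a ℕ.+ m ℕ.* (k ℕ.+ r))) j
  P-+ a m k zero    = ≈-trans (subst (λ n → Pε a m (k ℕ.+ 0) ≈ Pε a m n) (ℕₚ.+-identityʳ k) ≈-refl) (≈-sym (*-identityʳ _))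
  P-+ a m k (suc j) = ≈-trans (subst (λ n → Pε a m (k ℕ.+ suc j) ≈ Pε a m n) (ℕₚ.+-suc k j) ≈-refl)
    (≈-trans (*-congʳ (P-+ a m k j)) (*-assoc _ _ _))

  P-split : ∀ d a m n → Pε a m (n ℕ.* d) ≈ Prod (λ r → Pε (a ℕ.+ m ℕ.* r) (m ℕ.* d) n) d
  P-split d a m zero    = ≈-sym (Prod-𝟙 d (λ _ → ≈-refl))
  P-split d a m (suc n) = ≈-trans (subst (λ k → Pε a m (d ℕ.+ n ℕ.* d) ≈ Pε a m k) (ℕₚ.+-comm d (n ℕ.* d)) ≈-refl)
    (≈-trans (P-+ a m (n ℕ.* d) d) (≈-trans (*-cong (P-split d a m n)
      (Prod-cong (λ r → subst (λ e → factorε (a ℕ.+ m ℕ.* (n ℕ.* d ℕ.+ r)) ≈ factorε e) (exponents≡ r) ≈-refl) d)) (≈-sym (Prod-* _ _ d))))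
    where
    open +-*-Solver using (_:=_) renaming (solve to solveₙ; _:*_ to _:*ₙ_; _:+_ to _:+ₙ_)
    exponents≡ : ∀ r → a ℕ.+ m ℕ.* (n ℕ.* d ℕ.+ r) ≡ a ℕ.+ m ℕ.* r ℕ.+ m ℕ.* d ℕ.* n
    exponents≡ r = solveₙ 5 (λ a m n d r → a :+ₙ m :*ₙ (n :*ₙ d :+ₙ r) := a :+ₙ m :*ₙ r :+ₙ m :*ₙ d :*ₙ n) refl a m n d r

  -- The factors are sorted by the residue of their index modulo d.
  Pr-split : ∀ d a m .{{_ : NonZero d}} .{{_ : NonZero a}} .{{_ : NonZero m}} → Prε a m ≈ Prod (λ r → Prε (a ℕ.+ m ℕ.* r) (m ℕ.* d)) d
  Pr-split d a m = ≈[]-limit λ K → ≈[]-trans (Prε≈[]P a m K (K ℕ.* d) (ℕₚ.≤-trans (ℕₚ.m≤m*n K d) (ℕₚ.n≤1+n _)))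
    (≈[]-trans (≈⇒≈[] (P-split d a m K)) (≈[]-sym (≈[]-Prod d (λ r →
      Prε≈[]P (a ℕ.+ m ℕ.* r) (m ℕ.* d) {{ℕ.>-nonZero (ℕₚ.<-≤-trans (ℕ.>-nonZero⁻¹ a) (ℕₚ.m≤m+n a _))}} {{ℕₚ.m*n≢0 m d}} K K (ℕₚ.n≤1+n K)))))

open Products (- + 1) using () renaming (P to P⁻; Pr to Pr⁻; Pr≈[]P to Pr⁻≈[]P; factor to factor⁻) public

Pr⁻*Pr : ∀ a m .{{_ : NonZero a}} .{{_ : NonZero m}} → Pr⁻ a m * Pr a m ≈ Pr (a ℕ.* 2) (m ℕ.* 2)
Pr⁻*Pr a m = ≈[]-limit λ K → ≈[]-trans (≈[]-* (Pr⁻≈[]P a m K K (ℕₚ.n≤1+n K)) (Pr≈[]P a m K K (ℕₚ.n≤1+n K)))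
  (≈[]-trans (≈⇒≈[] (finite K)) (≈[]-sym (Pr≈[]P (a ℕ.* 2) (m ℕ.* 2) {{ℕₚ.m*n≢0 a 2}} {{ℕₚ.m*n≢0 m 2}} K K (ℕₚ.n≤1+n K))))
  where
  open +-*-Solver using (_:=_) renaming (solve to solveₙ; _:*_ to _:*ₙ_; _:+_ to _:+ₙ_; con to conₙ)
  conjugate : ∀ e e′ → e ℕ.+ e ≡ e′ → factor⁻ e * factor e ≈ factor e′
  conjugate e _ refl = ≈-trans (SR.solve (X^ e ∷ 𝟙 ∷ []) (λ { (x ∷ o ∷ []) → (o :- con (- + 1) :* x) :* (o :- 1 · x) , o :* o :- 1 · (x :* x) }) refl)
    (+-cong (*-identityʳ 𝟙) (-‿cong (*-congˡ (≈-sym (X^-+ e e)))))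
  finite : ∀ n → P⁻ a m n * P a m n ≈ P (a ℕ.* 2) (m ℕ.* 2) n
  finite zero    = *-identityʳ 𝟙
  finite (suc n) = ≈-trans (SR.solve (P⁻ a m n ∷ factor⁻ (a ℕ.+ m ℕ.* n) ∷ P a m n ∷ factor (a ℕ.+ m ℕ.* n) ∷ [])
      (λ { (p ∷ f ∷ q ∷ g ∷ []) → p :* f :* (q :* g) , p :* q :* (f :* g) }) refl)
    (*-cong (finite n) (conjugate (a ℕ.+ m ℕ.* n) _ (solveₙ 3 (λ a m n → a :+ₙ m :*ₙ n :+ₙ (a :+ₙ m :*ₙ n) := a :*ₙ conₙ 2 :+ₙ m :*ₙ conₙ 2 :*ₙ n) refl a m n)))

ϑ-product : ∀ a c .{{_ : NonZero a}} .{{_ : NonZero c}} → ϑ a c ≈ Pr a (a ℕ.+ c) * Pr c (a ℕ.+ c) * Pr (a ℕ.+ c) (a ℕ.+ c)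
ϑ-product a c = ≈-trans (gen-cong (jacobiFibres a c) (λ l _ → pm-power ℤ.∣ l ∣)) (TripleProduct.tripleProduct (+ 1) refl a c)
  where
  pm-power : ∀ n → pm n ≡ (- + 1) ℤ.^ n
  pm-power zero    = refl
  pm-power (suc n) = trans (sym (ℤₚ.-1*i≡-i (pm n))) (cong (- + 1 ℤ.*_) (pm-power n))

-- Infinite products for ψ, C₂ and C₋₁

odds-product evens-product : Series
odds-product  = Pr 1 2
evens-product = Pr 2 2

E-parity : E ≈ odds-product * evens-product
E-parity = ≈-trans E≈Pr (≈-trans (Pr-split (+ 1) 2 1 1) (*-congʳ (*-identityˡ _)))

b₂-double : ∀ n → b₂ (n ℕ.+ n) ≡ 4 ℕ.* b₂ n ℕ.+ n
b₂-double n = trans (b₂-+ n n) (trans (cong (b₂ n ℕ.+ b₂ n ℕ.+_) (square-b₂ n))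
    (solveₙ 2 (λ n b → b :+ₙ b :+ₙ (n :+ₙ conₙ 2 :*ₙ b) := conₙ 4 :*ₙ b :+ₙ n) refl n (b₂ n)))
  where open +-*-Solver using (_:=_) renaming (solve to solveₙ; _:*_ to _:*ₙ_; _:+_ to _:+ₙ_; con to conₙ)

-- The exponents of ϑ 1 3 run through the triangular numbers once.
ψ≈jacobi : ψ ≈ gen (jacobiFibres 1 3) (λ _ → + 1)
ψ≈jacobi = ≈-trans ψ≈gen (≈-sym (gen-bijection (jacobiFibres 1 3) triangularFibres (λ _ → + 1) (λ _ → + 1)
    (λ _ → index) (λ n l _ q → tt , trans (weights l) q , refl) (λ n l l′ _ _ _ _ → index-injective l l′)
    (λ n k _ q → let (l , e) = index-surjective k in l , tt , trans (sym (weights l)) (trans (cong triangular e) q) , e)))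
  where
  index : ℤ → ℕ
  index (+ zero)  = 0
  index (+ suc k) = suc (k ℕ.+ k)
  index -[1+ k ]  = suc (suc (k ℕ.+ k))
  suc-double : ∀ k → b₂ (suc (suc (k ℕ.+ k))) ≡ 4 ℕ.* b₂ (suc k) ℕ.+ suc k
  suc-double k = trans (cong (λ n → b₂ (suc n)) (sym (ℕₚ.+-suc k k))) (b₂-double (suc k))
  weights : ∀ l → triangular (index l) ≡ jacobi 1 3 l
  weights (+ zero)  = refl
  weights (+ suc k) = trans (suc-double k) (cong (4 ℕ.* b₂ (suc k) ℕ.+_) (sym (ℕₚ.*-identityˡ (suc k))))
  weights -[1+ k ]  = trans (cong (suc (suc (k ℕ.+ k)) ℕ.+_) (suc-double k))
    (solveₙ 2 (λ k b → conₙ 2 :+ₙ (k :+ₙ k) :+ₙ (conₙ 4 :*ₙ b :+ₙ (conₙ 1 :+ₙ k)) := conₙ 4 :*ₙ b :+ₙ conₙ 3 :*ₙ (conₙ 1 :+ₙ k)) refl k (b₂ (suc k)))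
    where open +-*-Solver using (_:=_) renaming (solve to solveₙ; _:*_ to _:*ₙ_; _:+_ to _:+ₙ_; con to conₙ)
  half-injective : ∀ {k k′} → k ℕ.+ k ≡ k′ ℕ.+ k′ → k ≡ k′
  half-injective {k} {k′} e = ℤₚ.+-injective (dbl-injective (cong +_ e))
  parity : ∀ {k k′} → k ℕ.+ k ≢ suc (k′ ℕ.+ k′)
  parity {k} {k′} e = case trans (sym (double-even k)) (trans (cong evenᵇ e) (cong not (double-even k′))) of λ ()
  index-injective : ∀ l l′ → index l ≡ index l′ → l ≡ l′
  index-injective (+ zero)  (+ zero)  _ = refl
  index-injective (+ suc k) (+ suc j) e = cong (λ n → + suc n) (half-injective (ℕₚ.suc-injective e))
  index-injective (+ suc k) -[1+ j ]  e = contradiction (ℕₚ.suc-injective e) (parity {k} {j})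
  index-injective -[1+ k ]  (+ suc j) e = contradiction (sym (ℕₚ.suc-injective e)) (parity {j} {k})
  index-injective -[1+ k ]  -[1+ j ]  e = cong -[1+_] (half-injective (ℕₚ.suc-injective (ℕₚ.suc-injective e)))
  index-surjective : ∀ k → ∃ λ l → index l ≡ k
  index-surjective zero = + 0 , refl
  index-surjective (suc n) with halves n
  ... | inj₁ (k , refl) = + suc k , refl
  ... | inj₂ (k , refl) = -[1+ k ] , refl

unsigned-product : ∀ a c .{{_ : NonZero a}} .{{_ : NonZero c}} →
  gen (jacobiFibres a c) (λ _ → + 1) ≈ Pr⁻ a (a ℕ.+ c) * Pr⁻ c (a ℕ.+ c) * Pr (a ℕ.+ c) (a ℕ.+ c)
unsigned-product a c = ≈-trans (gen-cong (jacobiFibres a c) (λ l _ → sym (sign-one ℤ.∣ l ∣))) (TripleProduct.tripleProduct (- + 1) refl a c)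
  where
  sign-one : ∀ n → (+ 1) ℤ.^ n ≡ + 1
  sign-one zero    = refl
  sign-one (suc n) = cong (+ 1 ℤ.*_) (sign-one n)

-- Gauss' product for ψ: the triple product for f(q, q³) yields (-q; q²)(q⁴; q⁴), and (-q; q²)(q;
-- q²) = (q²; q⁴).
ψ*odds : ψ * odds-product ≈ evens-product
ψ*odds = begin
  ψ * odds-product                        ≈⟨ *-congʳ (≈-trans ψ≈jacobi (unsigned-product 1 3)) ⟩
  Pr⁻ 1 4 * Pr⁻ 3 4 * Pr 4 4 * Pr 1 2     ≈⟨ SR.solve (Pr⁻ 1 4 ∷ Pr⁻ 3 4 ∷ Pr 4 4 ∷ Pr 1 2 ∷ 𝟙 ∷ [])
                                              (λ { (a ∷ b ∷ c ∷ d ∷ _ ∷ []) → a :* b :* c :* d , c :* (a :* b :* d) }) refl ⟩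
  Pr 4 4 * (Pr⁻ 1 4 * Pr⁻ 3 4 * Pr 1 2)   ≈⟨ *-congˡ (*-congʳ (≈-sym (≈-trans (Pr-split (- + 1) 2 1 2) (*-congʳ (*-identityˡ _))))) ⟩
  Pr 4 4 * (Pr⁻ 1 2 * Pr 1 2)             ≈⟨ *-congˡ (Pr⁻*Pr 1 2) ⟩
  Pr 4 4 * Pr 2 4                         ≈⟨ *-comm _ _ ⟩
  Pr 2 4 * Pr 4 4                         ≈⟨ ≈-trans (Pr-split (+ 1) 2 2 2) (*-congʳ (*-identityˡ _)) ⟨
  evens-product                           ∎
  where open ≈-Reasoning

-- The reversed list in `invRev` pairs the coefficient of f at k with that of the inverse at n - k,
-- so its recursion states that the convolution vanishes in positive degrees.
invS-inverse : ∀ f → f 0 ≡ + 1 → f ⊗ invS f ≈ oneS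
invS-inverse f f₀ = coeffs λ { zero → trans (⊗-head f (invS f)) (cong (ℤ._* + 1) f₀) ; (suc n) → step n }
  where
  reversed : ∀ n → invRev f n ≡ map (λ k → invS f (n ℕ.∸ k)) (upTo (suc n))
  reversed zero    = refl
  reversed (suc n) = cong (invS f (suc n) ∷_) (trans (reversed n) (trans (map-upTo _ (suc n)) (sym (map-applyUpTo suc _ (suc n)))))
  zip-map : ∀ (g h : ℕ → ℤ) xs → List.zipWith ℤ._*_ (map g xs) (map h xs) ≡ map (λ k → g k ℤ.* h k) xs
  zip-map g h []       = refl
  zip-map g h (x ∷ xs) = cong (g x ℤ.* h x ∷_) (zip-map g h xs)
  step : ∀ n → (f ⊗ invS f) (suc n) ≡ + 0
  step n = trans (⊗-suc f (invS f) n) (trans (cong₂ ℤ._+_ (trans (cong (ℤ._* b) f₀) (ℤₚ.*-identityˡ b))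
      (cong sumℤ (sym (trans (cong (List.zipWith ℤ._*_ (map (λ i → f (suc i)) (upTo (suc n)))) (reversed n)) (zip-map (λ i → f (suc i)) (λ k → invS f (n ℕ.∸ k)) (upTo (suc n)))))))
    (ℤₚ.+-inverseˡ (sumℤ (List.zipWith ℤ._*_ (map (λ i → f (suc i)) (upTo (suc n))) (invRev f n)))))
    where b = invS f (suc n)

pr : ℕ → Series
pr r = Pr r 14

rule-ϑ : ∀ {a c} .{{_ : NonZero a}} .{{_ : NonZero c}} → a ℕ.+ c ≡ 14 → dil 4 (ϑ a c) ≈ dil 4 (pr a * pr c * pr 14)
rule-ϑ {a} {c} e = dil-cong 4 (subst (λ m → ϑ a c ≈ Pr a m * Pr c m * Pr m m) e (ϑ-product a c))

rule-ϑ₈ : ∀ {a c} .{{a≢0 : NonZero a}} .{{c≢0 : NonZero c}} → a ℕ.+ c ≡ 7 → dil 8 (ϑ a c) ≈ dil 4 (pr (a ℕ.* 2) * pr (c ℕ.* 2) * pr 14)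
rule-ϑ₈ {a} {c} {{a≢0}} {{c≢0}} e = ≈-trans (≈-sym (dil-dil 4 2 (ϑ a c))) (dil-cong 4 (≈-trans (dil-cong 2 (subst (λ m → ϑ a c ≈ Pr a m * Pr c m * Pr m m) e (ϑ-product a c)))
  (≈-trans (dil-* 2 _ _) (*-cong (≈-trans (dil-* 2 _ _) (*-cong
    (dil-Pr (+ 1) 2 a 7 {{_}} {{a≢0}} {{_}} {{ℕₚ.m*n≢0 a 2}}) (dil-Pr (+ 1) 2 c 7 {{_}} {{c≢0}} {{_}} {{ℕₚ.m*n≢0 c 2}}))) (dil-Pr (+ 1) 2 7 7)))))

drop-𝟙 : ∀ a b c d e f g → 𝟙 * a * b * c * d * e * f * g ≈ a * b * c * d * e * f * g
drop-𝟙 a b c d e f g = *-congʳ (*-congʳ (*-congʳ (*-congʳ (*-congʳ (*-congʳ (*-identityˡ a))))))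

odds-14 : odds-product ≈ pr 1 * pr 3 * pr 5 * pr 7 * pr 9 * pr 11 * pr 13
odds-14 = ≈-trans (Pr-split (+ 1) 7 1 2) (drop-𝟙 (pr 1) (pr 3) (pr 5) (pr 7) (pr 9) (pr 11) (pr 13))

evens-14 : evens-product ≈ pr 2 * pr 4 * pr 6 * pr 8 * pr 10 * pr 12 * pr 14
evens-14 = ≈-trans (Pr-split (+ 1) 7 2 2) (drop-𝟙 (pr 2) (pr 4) (pr 6) (pr 8) (pr 10) (pr 12) (pr 14))

Pr-0 : ∀ a m → Pr a m 0 ≢ + 0
Pr-0 a m e = case trans (sym (at-degree 𝟙≈oneS 0)) e of λ ()

regular-dil : ∀ d .{{_ : NonZero d}} f → f 0 ≢ + 0 → Regular (dil d f)
regular-dil d f f≢0 = regular-unit (dil d f) (λ e → f≢0 (trans (sym (dil-zero d f)) e))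

od ev P₁ P₃ P₅ P₇ : Series
od = odds-product
ev = evens-product
P₁ = pr 1 * pr 13 * pr 14
P₃ = pr 3 * pr 11 * pr 14
P₅ = pr 9 * pr 5 * pr 14
P₇ = pr 7 * pr 7 * pr 14
Q₁ = pr 2 * pr 12 * pr 14
Q₄ = pr 8 * pr 6 * pr 14
Q₅ = pr 10 * pr 4 * pr 14

dil-*³ : ∀ a b c → dil 4 (a * b * c) ≈ dil 4 a * dil 4 b * dil 4 c
dil-*³ a b c = ≈-trans (dil-* 4 (a * b) c) (*-congʳ (dil-* 4 a b))

dil-square : ∀ x a b c → dil 4 (x * (a * b * c * (a * b * c))) ≈ dil 4 x * (dil 4 a * dil 4 b * dil 4 c * (dil 4 a * dil 4 b * dil 4 c))
dil-square x a b c = ≈-trans (dil-* 4 x _) (*-congˡ (≈-trans (dil-* 4 _ _) (*-cong (dil-*³ a b c) (dil-*³ a b c))))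

N-product : N ≈ dil 4 (od * od * ev)
N-product = dil-cong 4 (ϑ-product 1 1)

-- The residues 1, 13, 9, 5, 3, 11, each taken twice by the square, together with the double residue
-- 7 exhaust the odd residues modulo 14 twice. This gives the factor (q; q²)² that also occurs in
-- `N`.
even-product : P₇ * (P₁ * P₅ * P₃ * (P₁ * P₅ * P₃)) ≈ od * od * (pr 14 ↑ 7)
even-product = ≈-trans (SR.solve (pr 1 ∷ pr 3 ∷ pr 5 ∷ pr 7 ∷ pr 9 ∷ pr 11 ∷ pr 13 ∷ pr 14 ∷ [])
    (λ { (a ∷ b ∷ c ∷ d ∷ e ∷ f ∷ g ∷ h ∷ []) → d :* d :* h :* (a :* g :* h :* (e :* c :* h) :* (b :* f :* h) :* (a :* g :* h :* (e :* c :* h) :* (b :* f :* h))) ,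
      a :* b :* c :* d :* e :* f :* g :* (a :* b :* c :* d :* e :* f :* g) :* h :^ 7 }) refl)
  (*-congʳ (≈-sym (*-cong odds-14 odds-14)))

odd-product : P₇ * (Q₄ * Q₁ * Q₅ * (Q₄ * Q₁ * Q₅)) ≈ pr 7 * pr 7 * (ev * ev) * (pr 14 ↑ 5)
odd-product = ≈-trans (SR.solve (pr 2 ∷ pr 4 ∷ pr 6 ∷ pr 8 ∷ pr 10 ∷ pr 12 ∷ pr 7 ∷ pr 14 ∷ [])
    (λ { (a ∷ b ∷ c ∷ d ∷ e ∷ f ∷ g ∷ h ∷ []) → g :* g :* h :* (d :* c :* h :* (a :* f :* h) :* (e :* b :* h) :* (d :* c :* h :* (a :* f :* h) :* (e :* b :* h))) ,
      g :* g :* (a :* b :* c :* d :* e :* f :* h :* (a :* b :* c :* d :* e :* f :* h)) :* h :^ 5 }) refl)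
  (*-congʳ (*-congˡ (≈-sym (*-cong evens-14 evens-14))))

-- In terms of q this is C₂ = q⁶E(q²⁸)⁷ / E(q⁴).
C₂-product : C (+ 2) * dil 4 ev ≈ X^ 12 * dil 4 (pr 14 ↑ 7)
C₂-product = cancel (regular-dil 4 (od * od) oo≢0) (begin
  dil 4 (od * od) * (C (+ 2) * dil 4 ev)      ≈⟨ SR.solve (dil 4 (od * od) ∷ C (+ 2) ∷ dil 4 ev ∷ []) (λ { (a ∷ b ∷ c ∷ []) → a :* (b :* c) , b :* (a :* c) }) refl ⟩
  C (+ 2) * (dil 4 (od * od) * dil 4 ev)      ≈⟨ *-congˡ (≈-trans N-product (dil-* 4 (od * od) ev)) ⟨
  C (+ 2) * N                               ≈⟨ relation twistedRelations ⟩
  Twisted.even-part 3 * (Twisted.even-part 4 * Twisted.even-part 5 * Twisted.even-part 6 * (Twisted.even-part 4 * Twisted.even-part 5 * Twisted.even-part 6))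
    ≈⟨ *-cong e₃ (*-cong (*-cong (*-cong e₄ e₅) e₆) (*-cong (*-cong e₄ e₅) e₆)) ⟩
  dil 4 P₇ * (X^ 5 * dil 4 P₁ * dil 4 P₅ * (X^ 1 * dil 4 P₃) * (X^ 5 * dil 4 P₁ * dil 4 P₅ * (X^ 1 * dil 4 P₃)))
    ≈⟨ SR.solve (dil 4 P₇ ∷ dil 4 P₁ ∷ dil 4 P₅ ∷ dil 4 P₃ ∷ X^ 5 ∷ X^ 1 ∷ []) (λ { (a ∷ b ∷ c ∷ d ∷ x ∷ y ∷ []) →
         a :* (x :* b :* c :* (y :* d) :* (x :* b :* c :* (y :* d))) , x :* x :* (y :* y) :* (a :* (b :* c :* d :* (b :* c :* d))) }) refl ⟩
  X^ 5 * X^ 5 * (X^ 1 * X^ 1) * (dil 4 P₇ * (dil 4 P₁ * dil 4 P₅ * dil 4 P₃ * (dil 4 P₁ * dil 4 P₅ * dil 4 P₃)))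
    ≈⟨ *-cong (≈-sym (≈-trans (X^-+ 10 2) (*-cong (X^-+ 5 5) (X^-+ 1 1)))) (≈-sym (dil-square P₇ P₁ P₅ P₃)) ⟩
  X^ 12 * dil 4 (P₇ * (P₁ * P₅ * P₃ * (P₁ * P₅ * P₃)))
    ≈⟨ *-congˡ (≈-trans (dil-cong 4 even-product) (dil-* 4 (od * od) (pr 14 ↑ 7))) ⟩
  X^ 12 * (dil 4 (od * od) * dil 4 (pr 14 ↑ 7))
    ≈⟨ SR.solve (X^ 12 ∷ dil 4 (od * od) ∷ dil 4 (pr 14 ↑ 7) ∷ []) (λ { (a ∷ b ∷ c ∷ []) → a :* (b :* c) , b :* (a :* c) }) refl ⟩
  dil 4 (od * od) * (X^ 12 * dil 4 (pr 14 ↑ 7)) ∎)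
  where
  open ≈-Reasoning
  oo≢0 : (od * od) 0 ≢ + 0
  oo≢0 e = Sum.[ Pr-0 1 2 , Pr-0 1 2 ] (ℤₚ.i*j≡0⇒i≡0∨j≡0 (od 0) (trans (sym (coeff-*-zero od od)) e))
  relation : All (_≈ 𝟘) _ → C (+ 2) * N ≈ _
  relation (t ∷ _) = -≈𝟘⇒≈ t
  e₃ : Twisted.even-part 3 ≈ dil 4 P₇
  e₃ = ≈-trans twisted-even-3 (rule-ϑ refl)
  e₄ : Twisted.even-part 4 ≈ X^ 5 * dil 4 P₁
  e₄ = ≈-trans twisted-even-4 (*-congˡ (rule-ϑ refl))
  e₅ : Twisted.even-part 5 ≈ dil 4 P₅
  e₅ = ≈-trans twisted-even-5 (rule-ϑ refl)
  e₆ : Twisted.even-part 6 ≈ X^ 1 * dil 4 P₃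
  e₆ = ≈-trans twisted-even-6 (*-congˡ (rule-ϑ refl))

-- The odd parts of the runners supply the even residues modulo 14, while the residue 7 comes from
-- the middle runner.
C₋₁-product : C (- + 1) * dil 4 (od * od) ≈ X^ 6 * dil 4 (pr 7 * pr 7 * ev * (pr 14 ↑ 5))
C₋₁-product = cancel (regular-dil 4 ev (Pr-0 2 2)) (begin
  dil 4 ev * (C (- + 1) * dil 4 (od * od))      ≈⟨ SR.solve (dil 4 (od * od) ∷ C (- + 1) ∷ dil 4 ev ∷ []) (λ { (a ∷ b ∷ c ∷ []) → c :* (b :* a) , b :* (a :* c) }) refl ⟩
  C (- + 1) * (dil 4 (od * od) * dil 4 ev)      ≈⟨ *-congˡ (≈-trans N-product (dil-* 4 (od * od) ev)) ⟨
  C (- + 1) * N                               ≈⟨ relation twistedRelations ⟩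
  Twisted.even-part 3 * (Twisted.odd-part 4 * Twisted.odd-part 5 * Twisted.odd-part 6 * (Twisted.odd-part 4 * Twisted.odd-part 5 * Twisted.odd-part 6))
    ≈⟨ *-cong e₃ (*-cong (*-cong (*-cong o₄ o₅) o₆) (*-cong (*-cong o₄ o₅) o₆)) ⟩
  dil 4 P₇ * (dil 4 Q₄ * (const (- + 1) * (X^ 3 * dil 4 Q₁)) * dil 4 Q₅ * (dil 4 Q₄ * (const (- + 1) * (X^ 3 * dil 4 Q₁)) * dil 4 Q₅))
    ≈⟨ SR.solve (dil 4 P₇ ∷ dil 4 Q₄ ∷ dil 4 Q₁ ∷ dil 4 Q₅ ∷ X^ 3 ∷ []) (λ { (a ∷ b ∷ c ∷ d ∷ x ∷ []) →
         a :* (b :* (con (- + 1) :* (x :* c)) :* d :* (b :* (con (- + 1) :* (x :* c)) :* d)) , x :* x :* (a :* (b :* c :* d :* (b :* c :* d))) }) refl ⟩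
  X^ 3 * X^ 3 * (dil 4 P₇ * (dil 4 Q₄ * dil 4 Q₁ * dil 4 Q₅ * (dil 4 Q₄ * dil 4 Q₁ * dil 4 Q₅)))
    ≈⟨ *-cong (≈-sym (X^-+ 3 3)) (≈-sym (dil-square P₇ Q₄ Q₁ Q₅)) ⟩
  X^ 6 * dil 4 (P₇ * (Q₄ * Q₁ * Q₅ * (Q₄ * Q₁ * Q₅)))
    ≈⟨ *-congˡ (≈-trans (dil-cong 4 (≈-trans odd-product (SR.solve (pr 7 ∷ ev ∷ (pr 14 ↑ 5) ∷ []) (λ { (a ∷ b ∷ c ∷ []) → a :* a :* (b :* b) :* c , b :* (a :* a :* b :* c) }) refl)))
         (dil-* 4 ev (pr 7 * pr 7 * ev * (pr 14 ↑ 5)))) ⟩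
  X^ 6 * (dil 4 ev * dil 4 (pr 7 * pr 7 * ev * (pr 14 ↑ 5)))
    ≈⟨ SR.solve (X^ 6 ∷ dil 4 ev ∷ dil 4 (pr 7 * pr 7 * ev * (pr 14 ↑ 5)) ∷ []) (λ { (a ∷ b ∷ c ∷ []) → a :* (b :* c) , b :* (a :* c) }) refl ⟩
  dil 4 ev * (X^ 6 * dil 4 (pr 7 * pr 7 * ev * (pr 14 ↑ 5))) ∎)
  where
  open ≈-Reasoning
  relation : All (_≈ 𝟘) _ → C (- + 1) * N ≈ _
  relation (_ ∷ _ ∷ _ ∷ _ ∷ _ ∷ _ ∷ t ∷ []) = ≈-sym (-≈𝟘⇒≈ t)
  e₃ : Twisted.even-part 3 ≈ dil 4 P₇
  e₃ = ≈-trans twisted-even-3 (rule-ϑ refl)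
  o₄ : Twisted.odd-part 4 ≈ dil 4 Q₄
  o₄ = ≈-trans twisted-odd-4 (rule-ϑ₈ refl)
  o₅ : Twisted.odd-part 5 ≈ const (- + 1) * (X^ 3 * dil 4 Q₁)
  o₅ = ≈-trans twisted-odd-5 (*-congˡ (*-congˡ (rule-ϑ₈ refl)))
  o₆ : Twisted.odd-part 6 ≈ dil 4 Q₅
  o₆ = ≈-trans twisted-odd-6 (rule-ϑ₈ refl)

-- The form X² + 7Y² and the identity for ψ(q)ψ(q⁷)

-- A weight on ℤ × ℤ described by two families, for the two parities of the second coordinate (the first one, when c swaps them).
record Halves {B₁ B₂ : Set} {P₁ : B₁ → Set} {P₂ : B₂ → Set} {u₁ : B₁ → ℕ} {u₂ : B₂ → ℕ}
  (Ψ₁ : Fibres P₁ u₁) (Ψ₂ : Fibres P₂ u₂) (w : ℤ × ℤ → ℕ) : Set where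
  field
    all₁ : ∀ b → P₁ b
    all₂ : ∀ b → P₂ b
    c    : ℤ × ℤ → ℤ × ℤ
    cc   : ∀ a → c (c a) ≡ a
    i₁   : B₁ → ℤ × ℤ
    i₂   : B₂ → ℤ × ℤ
    j₁   : ℤ × ℤ → B₁
    j₂   : ℤ × ℤ → B₂
    j₁i₁ : ∀ b → j₁ (i₁ b) ≡ b
    j₂i₂ : ∀ b → j₂ (i₂ b) ≡ b
    i₁j₁ : ∀ a → i₁ (j₁ a) ≡ a
    i₂j₂ : ∀ a → i₂ (j₂ a) ≡ a
    weight₁ : ∀ b → w (c (proj₁ (i₁ b) , dbl (proj₂ (i₁ b)))) ≡ u₁ b
    weight₂ : ∀ b → w (c (proj₁ (i₂ b) , dbl⁻ (proj₂ (i₂ b)))) ≡ u₂ b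

  raw join : B₁ ⊎ B₂ → ℤ × ℤ
  raw (inj₁ b) = proj₁ (i₁ b) , dbl (proj₂ (i₁ b))
  raw (inj₂ b) = proj₁ (i₂ b) , dbl⁻ (proj₂ (i₂ b))
  join x = c (raw x)

  join-injective : ∀ x y → join x ≡ join y → x ≡ y
  join-injective x y e = go x y (trans (sym (cc _)) (trans (cong c e) (cc _)))
    where
    go : ∀ x y → raw x ≡ raw y → x ≡ y
    go (inj₁ b) (inj₁ b′) e = cong inj₁ (trans (sym (j₁i₁ b)) (trans (cong j₁ (cong₂ _,_ (cong proj₁ e) (dbl-injective (cong proj₂ e)))) (j₁i₁ b′)))
    go (inj₁ b) (inj₂ b′) e = case trans (sym (isEven-dbl (proj₂ (i₁ b)))) (trans (cong (isEven ∘ proj₂) e) (isEven-dbl⁻ (proj₂ (i₂ b′)))) of λ ()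
    go (inj₂ b) (inj₁ b′) e = case trans (sym (isEven-dbl⁻ (proj₂ (i₂ b)))) (trans (cong (isEven ∘ proj₂) e) (isEven-dbl (proj₂ (i₁ b′)))) of λ ()
    go (inj₂ b) (inj₂ b′) e = cong inj₂ (trans (sym (j₂i₂ b)) (trans (cong j₂ (cong₂ _,_ (cong proj₁ e) (dbl⁻-injective (cong proj₂ e)))) (j₂i₂ b′)))

  join-onto : ∀ a → ∃ λ x → join x ≡ a
  join-onto a = let (x , e) = go (c a) in x , trans e (cc a)
    where
    go : ∀ a → ∃ λ x → join x ≡ c a
    go (r , z) with isEven z in eq
    ... | true  = let (l , e) = even-half z eq ; q = i₁j₁ (r , l) in inj₁ (j₁ (r , l)) , cong c (cong₂ _,_ (cong proj₁ q) (trans (cong (dbl ∘ proj₂) q) e))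
    ... | false = let (l , e) = odd-half z eq ; q = i₂j₂ (r , l) in inj₂ (j₂ (r , l)) , cong c (cong₂ _,_ (cong proj₁ q) (trans (cong (dbl⁻ ∘ proj₂) q) e))

  join-weight : ∀ x → w (join x) ≡ Sum.[ u₁ , u₂ ] x
  join-weight (inj₁ b) = weight₁ b
  join-weight (inj₂ b) = weight₂ b

  join-all : ∀ x → Sum.[ P₁ , P₂ ] x
  join-all (inj₁ b) = all₁ b
  join-all (inj₂ b) = all₂ b

  family : Fibres Always w
  family = record
    { fibre = λ n → map join (fibre (Ψ₁ ⊎ᶠ Ψ₂) n)
    ; unique = λ n → unique-map join (λ _ _ → join-injective _ _) (unique (Ψ₁ ⊎ᶠ Ψ₂) n)
    ; sound = λ {n} a∈ → case ∈-map⁻ join a∈ of λ { (x , x∈ , refl) → tt , trans (join-weight x) (proj₂ (sound (Ψ₁ ⊎ᶠ Ψ₂) x∈)) }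
    ; complete = λ {a} _ → case join-onto a of λ { (x , refl) →
        subst (λ n → join x ∈ map join (fibre (Ψ₁ ⊎ᶠ Ψ₂) n)) (sym (join-weight x)) (∈-map⁺ join (complete (Ψ₁ ⊎ᶠ Ψ₂) {x} (join-all x))) } }

  gen-halves : (Φ : Fibres Always w) → gen Φ (λ _ → + 1) ≈ gen Ψ₁ (λ _ → + 1) + gen Ψ₂ (λ _ → + 1)
  gen-halves Φ = ≈-sym (≈-trans (≈-sym (gen-⊎ Ψ₁ Ψ₂ _ _)) (gen-bijection (Ψ₁ ⊎ᶠ Ψ₂) Φ _ (λ _ → + 1) (λ _ → join)
    (λ { n x@(inj₁ _) _ q → tt , trans (join-weight x) q , refl ; n x@(inj₂ _) _ q → tt , trans (join-weight x) q , refl })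
    (λ n x y _ _ _ _ → join-injective x y)
    (λ n a _ q → let (x , e) = join-onto a in x , join-all x , trans (sym (join-weight x)) (trans (cong w e) q) , e)))

norm-weight : ∀ {i : ℤ} {n : ℕ} → + n ≡ i → ℤ.∣ i ∣ ≡ n
norm-weight refl = refl

jacobi-1-3 : ∀ l → + jacobi 1 3 l ≡ + 2 ℤ.* (l ℤ.* l) ℤ.- l
jacobi-1-3 l = ℤₚ.*-cancelˡ-≡ (+ 2) _ _ (trans (2*jacobi 1 3 l) (ℤR.solve (l ∷ []) (λ { (l ∷ []) →
  4 · (l :* (l :- con (+ 1))) :+ 2 · con (+ 1) :* l , 2 · (2 · (l :* l) :- l) }) refl))

ones : {A : Set} {P : A → Set} {w : A → ℕ} → Fibres P w → Series
ones Φ = gen Φ (λ _ → + 1)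

ones-× : {A B : Set} {P : A → Set} {Q : B → Set} {w : A → ℕ} {v : B → ℕ} (Φ : Fibres P w) (Ψ : Fibres Q v) → ones (Φ ×ᶠ Ψ) ≈ ones Φ * ones Ψ
ones-× Φ Ψ = gen-× Φ Ψ (λ _ → + 1) (λ _ → + 1)

-- Pairs of odd X ≡ Y (mod 4), with Y = 2y+1 and X = Y-4b, weighted by (X²+7Y²)/8 - 1.
pairs : ℤ → ℤ → ℤ
pairs b y = (+ 2 ℤ.* y ℤ.+ + 1) ℤ.* (+ 2 ℤ.* y ℤ.+ + 1) ℤ.- b ℤ.* (+ 2 ℤ.* y ℤ.+ + 1) ℤ.+ + 2 ℤ.* (b ℤ.* b) ℤ.- + 1

pairs-weight : ℤ × ℤ → ℕ
pairs-weight (b , y) = ℤ.∣ pairs b y ∣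

-- As 2x² - x = ((4x - 1)² - 1)/8, this is the half of the pairs with X and Y both congruent to -1
-- modulo 4.
P₁₇ : Fibres {ℤ × ℤ} _ _
P₁₇ = jacobiFibres 1 3 ×ᶠ dilate 7 (jacobiFibres 1 3)

ψψ₇ : Series
ψψ₇ = ψ * dil 7 ψ

ones-P₁₇ : ones P₁₇ ≈ ψψ₇
ones-P₁₇ = ≈-trans (ones-× (jacobiFibres 1 3) (dilate 7 (jacobiFibres 1 3))) (*-cong (≈-sym ψ≈jacobi)
  (≈-trans (gen-dilate 7 (jacobiFibres 1 3) _) (dil-cong 7 (≈-sym ψ≈jacobi))))

P₁₇-weight : ∀ x y → + (jacobi 1 3 x ℕ.+ jacobi 1 3 y ℕ.* 7) ≡ + 2 ℤ.* (x ℤ.* x) ℤ.- x ℤ.+ (+ 2 ℤ.* (y ℤ.* y) ℤ.- y) ℤ.* + 7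
P₁₇-weight x y = cong₂ ℤ._+_ (jacobi-1-3 x) (trans (ℤₚ.pos-* (jacobi 1 3 y) 7) (cong (ℤ._* + 7) (jacobi-1-3 y)))

pairs-even : ∀ x y → + (jacobi 1 3 x ℕ.+ jacobi 1 3 y ℕ.* 7) ≡ pairs (x ℤ.- y) (dbl (- y))
pairs-even x y = trans (P₁₇-weight x y) (ℤR.solve (x ∷ y ∷ []) (λ { (x ∷ y ∷ []) →
     2 · (x :* x) :- x :+ (2 · (y :* y) :- y) :* con (+ 7) ,
     (2 · (:neg y :+ :neg y) :+ con (+ 1)) :* (2 · (:neg y :+ :neg y) :+ con (+ 1)) :- (x :- y) :* (2 · (:neg y :+ :neg y) :+ con (+ 1)) :+ 2 · ((x :- y) :* (x :- y)) :- con (+ 1) }) refl)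

pairs-odd : ∀ x y → + (jacobi 1 3 x ℕ.+ jacobi 1 3 y ℕ.* 7) ≡ pairs (y ℤ.- x) (dbl⁻ y)
pairs-odd x y = trans (P₁₇-weight x y) (ℤR.solve (x ∷ y ∷ []) (λ { (x ∷ y ∷ []) →
     2 · (x :* x) :- x :+ (2 · (y :* y) :- y) :* con (+ 7) ,
     (2 · (y :+ y :- con (+ 1)) :+ con (+ 1)) :* (2 · (y :+ y :- con (+ 1)) :+ con (+ 1)) :- (y :- x) :* (2 · (y :+ y :- con (+ 1)) :+ con (+ 1)) :+ 2 · ((y :- x) :* (y :- x)) :- con (+ 1) }) refl)

-- The parity of y decides whether X and Y are 1 or -1 modulo 4. Changing both signs exchanges the
-- two halves, so the pairs count ψ(q)ψ(q⁷) twice.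
pairsHalves : Halves P₁₇ P₁₇ pairs-weight
pairsHalves = record
  { all₁ = λ _ → tt , tt
  ; all₂ = λ _ → tt , tt
  ; c = id
  ; cc = λ _ → refl
  ; i₁ = λ (x , y) → x ℤ.- y , - y
  ; i₂ = λ (x , y) → y ℤ.- x , y
  ; j₁ = λ (b , l) → b ℤ.- l , - l
  ; j₂ = λ (b , l) → l ℤ.- b , l
  ; j₁i₁ = λ (x , y) → cong₂ _,_ (ℤR.solve (x ∷ y ∷ []) (λ { (x ∷ y ∷ []) → x :- y :- :neg y , x }) refl) (ℤₚ.neg-involutive y)
  ; j₂i₂ = λ (x , y) → cong (_, y) (ℤR.solve (x ∷ y ∷ []) (λ { (x ∷ y ∷ []) → y :- (y :- x) , x }) refl)
  ; i₁j₁ = λ (b , l) → cong₂ _,_ (ℤR.solve (b ∷ l ∷ []) (λ { (b ∷ l ∷ []) → b :- l :- :neg l , b }) refl) (ℤₚ.neg-involutive l)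
  ; i₂j₂ = λ (b , l) → cong (_, l) (ℤR.solve (b ∷ l ∷ []) (λ { (b ∷ l ∷ []) → l :- (l :- b) , b }) refl)
  ; weight₁ = λ (x , y) → norm-weight (pairs-even x y)
  ; weight₂ = λ (x , y) → norm-weight (pairs-odd x y)
  }

module Pairs = Halves pairsHalves

swap-× : ℤ × ℤ → ℤ × ℤ
swap-× (x , y) = y , x

pairs-nonneg : ∀ b y → + pairs-weight (b , y) ≡ pairs b y
pairs-nonneg b y = case Pairs.join-onto (b , y) of λ { (inj₁ (p , q) , refl) → nonneg (pairs-even p q) ; (inj₂ (p , q) , refl) → nonneg (pairs-odd p q) }
  where
  nonneg : ∀ {i n} → + n ≡ i → + ℤ.∣ i ∣ ≡ i
  nonneg refl = refl

-- The integers as ℕ ⊎ ℕ, so that z² + z is twice a triangular number.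
index : ℕ ⊎ ℕ → ℤ
index (inj₁ k) = + k
index (inj₂ k) = -[1+ k ]

unindex : ℤ → ℕ ⊎ ℕ
unindex (+ k)    = inj₁ k
unindex -[1+ k ] = inj₂ k

unindex-index : ∀ t → unindex (index t) ≡ t
unindex-index (inj₁ k) = refl
unindex-index (inj₂ k) = refl

index-unindex : ∀ z → index (unindex z) ≡ z
index-unindex (+ k)    = refl
index-unindex -[1+ k ] = refl

triangular± : ℕ ⊎ ℕ → ℕ
triangular± = Sum.[ triangular , triangular ]

Always± : ℕ ⊎ ℕ → Set
Always± = Sum.[ Always {ℕ} , Always {ℕ} ]

triangularFibres± : Fibres Always± triangular±
triangularFibres± = triangularFibres ⊎ᶠ triangularFibres

always± : ∀ t → Always± t
always± (inj₁ _) = tt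
always± (inj₂ _) = tt

ones-triangular± : ones triangularFibres± ≈ const (+ 2) * ψ
ones-triangular± = ≈-trans (gen-cong triangularFibres± {s′ = Sum.[ (λ _ → + 1) , (λ _ → + 1) ]} (λ { (inj₁ _) _ → refl ; (inj₂ _) _ → refl }))
  (≈-trans (gen-⊎ triangularFibres triangularFibres _ _) (≈-trans (+-cong (≈-sym ψ≈gen) (≈-sym ψ≈gen))
    (SR.solve (ψ ∷ []) (λ { (p ∷ []) → p :+ p , 2 · p }) refl)))

2*triangular± : ∀ t → + 2 ℤ.* + triangular± t ≡ index t ℤ.* index t ℤ.+ index t
2*triangular± (inj₁ k) = trans (2*b₂ (suc k)) (ℤR.solve (+ k ∷ []) (λ { (k ∷ []) → (con (+ 1) :+ k) :* (con (+ 1) :+ k :- con (+ 1)) , k :* k :+ k }) refl)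
2*triangular± (inj₂ k) = trans (2*b₂ (suc k)) (ℤR.solve (+ k ∷ []) (λ { (k ∷ []) → (con (+ 1) :+ k) :* (con (+ 1) :+ k :- con (+ 1)) , :neg (con (+ 1) :+ k) :* :neg (con (+ 1) :+ k) :+ :neg (con (+ 1) :+ k) }) refl)

Φ₁ : Fibres {(ℕ ⊎ ℕ) × ℤ} _ _
Φ₁ = dilate 8 triangularFibres± ×ᶠ dilate 28 squares

Φ₂ : Fibres {(ℕ ⊎ ℕ) × ℤ} _ _
Φ₂ = shift 6 (dilate 56 triangularFibres±) ×ᶠ dilate 4 squares

Φ₁-weight : ∀ t m → let z = index t in + (triangular± t ℕ.* 8 ℕ.+ square m ℕ.* 28) ≡ + 4 ℤ.* (z ℤ.* z ℤ.+ z) ℤ.+ m ℤ.* m ℤ.* + 28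
Φ₁-weight t m = cong₂ ℤ._+_ (trans (ℤₚ.pos-* (triangular± t) 8) (trans (ℤR.solve (+ triangular± t ∷ []) (λ { (t ∷ []) → t :* con (+ 8) , 4 · (2 · t) }) refl)
    (cong (+ 4 ℤ.*_) (2*triangular± t)))) (trans (ℤₚ.pos-* (square m) 28) (cong (ℤ._* + 28) (square-+ m)))

Φ₂-weight : ∀ t m → let z = index t in + (6 ℕ.+ triangular± t ℕ.* 56 ℕ.+ square m ℕ.* 4) ≡ + 6 ℤ.+ + 28 ℤ.* (z ℤ.* z ℤ.+ z) ℤ.+ m ℤ.* m ℤ.* + 4
Φ₂-weight t m = cong₂ ℤ._+_ (cong (λ u → + 6 ℤ.+ u) (trans (ℤₚ.pos-* (triangular± t) 56) (trans (ℤR.solve (+ triangular± t ∷ []) (λ { (t ∷ []) → t :* con (+ 56) , 28 · (2 · t) }) refl)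
    (cong (+ 28 ℤ.*_) (2*triangular± t))))) (trans (ℤₚ.pos-* (square m) 4) (cong (ℤ._* + 4) (square-+ m)))

-- The pairs with b = 2l: k² + 7l² - 1 with k = 2y+1-l.
even-pairs : ℤ × ℤ → ℕ
even-pairs (y , l) = ℤ.∣ (+ 2 ℤ.* y ℤ.+ + 1 ℤ.- l) ℤ.* (+ 2 ℤ.* y ℤ.+ + 1 ℤ.- l) ℤ.+ + 7 ℤ.* (l ℤ.* l) ℤ.- + 1 ∣

-- k and l have opposite parity. The odd one contributes triangular numbers and hence ψ, the even
-- one squares and hence φ.
evenPairsHalves : Halves Φ₁ Φ₂ even-pairs
evenPairsHalves = record
  { all₁ = λ (t , _) → always± t , tt
  ; all₂ = λ (t , _) → always± t , tt
  ; c = id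
  ; cc = λ _ → refl
  ; i₁ = λ (t , m) → index t ℤ.+ m , m
  ; i₂ = λ (t , s) → s ℤ.+ index t , index t ℤ.+ + 1
  ; j₁ = λ (y , m) → unindex (y ℤ.- m) , m
  ; j₂ = λ (y , m) → unindex (m ℤ.- + 1) , y ℤ.- (m ℤ.- + 1)
  ; j₁i₁ = λ (t , m) → cong (_, m) (trans (cong unindex (ℤR.solve (index t ∷ m ∷ []) (λ { (z ∷ m ∷ []) → z :+ m :- m , z }) refl)) (unindex-index t))
  ; j₂i₂ = λ (t , s) → cong₂ _,_ (trans (cong unindex (ℤR.solve (index t ∷ []) (λ { (z ∷ []) → z :+ con (+ 1) :- con (+ 1) , z }) refl)) (unindex-index t))
    (ℤR.solve (index t ∷ s ∷ []) (λ { (z ∷ s ∷ []) → s :+ z :- (z :+ con (+ 1) :- con (+ 1)) , s }) refl)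
  ; i₁j₁ = λ (y , m) → cong (_, m) (trans (cong (ℤ._+ m) (index-unindex (y ℤ.- m))) (ℤR.solve (y ∷ m ∷ []) (λ { (y ∷ m ∷ []) → y :- m :+ m , y }) refl))
  ; i₂j₂ = λ (y , m) → cong₂ _,_ (trans (cong (λ z → y ℤ.- (m ℤ.- + 1) ℤ.+ z) (index-unindex (m ℤ.- + 1))) (ℤR.solve (y ∷ m ∷ []) (λ { (y ∷ m ∷ []) → y :- (m :- con (+ 1)) :+ (m :- con (+ 1)) , y }) refl))
    (trans (cong (λ z → z ℤ.+ + 1) (index-unindex (m ℤ.- + 1))) (ℤR.solve (m ∷ []) (λ { (m ∷ []) → m :- con (+ 1) :+ con (+ 1) , m }) refl))
  ; weight₁ = λ (t , m) → norm-weight (trans (Φ₁-weight t m) (ℤR.solve (index t ∷ m ∷ []) (λ { (z ∷ m ∷ []) → 4 · (z :* z :+ z) :+ m :* m :* con (+ 28) ,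
    (2 · (z :+ m) :+ con (+ 1) :- (m :+ m)) :* (2 · (z :+ m) :+ con (+ 1) :- (m :+ m)) :+ 7 · ((m :+ m) :* (m :+ m)) :- con (+ 1) }) refl))
  ; weight₂ = λ (t , s) → norm-weight (trans (Φ₂-weight t s) (ℤR.solve (index t ∷ s ∷ []) (λ { (z ∷ s ∷ []) → con (+ 6) :+ 28 · (z :* z :+ z) :+ s :* s :* con (+ 4) ,
    (2 · (s :+ z) :+ con (+ 1) :- (z :+ con (+ 1) :+ (z :+ con (+ 1)) :- con (+ 1))) :* (2 · (s :+ z) :+ con (+ 1) :- (z :+ con (+ 1) :+ (z :+ con (+ 1)) :- con (+ 1))) :+
      7 · ((z :+ con (+ 1) :+ (z :+ con (+ 1)) :- con (+ 1)) :* (z :+ con (+ 1) :+ (z :+ con (+ 1)) :- con (+ 1))) :- con (+ 1) }) refl))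
  }

module EvenPairs = Halves evenPairsHalves

-- For odd b, the pair ((X+7Y)/4 , (Y-X)/4) is again a pair of this kind.
pairsByKeyHalves : Halves EvenPairs.family (shift 1 (dilate 2 Pairs.family)) pairs-weight
pairsByKeyHalves = record
  { all₁ = λ _ → tt
  ; all₂ = λ _ → tt
  ; c = swap-×
  ; cc = λ _ → refl
  ; i₁ = id
  ; i₂ = λ (b , y) → y ℤ.- b , y ℤ.+ + 1
  ; j₁ = id
  ; j₂ = λ (y , c) → c ℤ.- + 1 ℤ.- y , c ℤ.- + 1
  ; j₁i₁ = λ _ → refl
  ; j₂i₂ = λ (b , y) → cong₂ _,_ (ℤR.solve (b ∷ y ∷ []) (λ { (b ∷ y ∷ []) → y :+ con (+ 1) :- con (+ 1) :- (y :- b) , b }) refl) (ℤR.solve (y ∷ []) (λ { (y ∷ []) → y :+ con (+ 1) :- con (+ 1) , y }) refl)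
  ; i₁j₁ = λ _ → refl
  ; i₂j₂ = λ (y , c) → cong₂ _,_ (ℤR.solve (y ∷ c ∷ []) (λ { (y ∷ c ∷ []) → c :- con (+ 1) :- (c :- con (+ 1) :- y) , y }) refl) (ℤR.solve (c ∷ []) (λ { (c ∷ []) → c :- con (+ 1) :+ con (+ 1) , c }) refl)
  ; weight₁ = λ (y , l) → cong ℤ.∣_∣ (ℤR.solve (y ∷ l ∷ []) (λ { (y ∷ l ∷ []) →
    (2 · y :+ con (+ 1)) :* (2 · y :+ con (+ 1)) :- (l :+ l) :* (2 · y :+ con (+ 1)) :+ 2 · ((l :+ l) :* (l :+ l)) :- con (+ 1) ,
    (2 · y :+ con (+ 1) :- l) :* (2 · y :+ con (+ 1) :- l) :+ 7 · (l :* l) :- con (+ 1) }) refl)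
  ; weight₂ = λ (b , y) → norm-weight (trans (cong (λ u → + 1 ℤ.+ u) (trans (ℤₚ.pos-* (pairs-weight (b , y)) 2) (cong (ℤ._* + 2) (pairs-nonneg b y)))) (ℤR.solve (b ∷ y ∷ []) (λ { (b ∷ y ∷ []) →
    con (+ 1) :+ ((2 · y :+ con (+ 1)) :* (2 · y :+ con (+ 1)) :- b :* (2 · y :+ con (+ 1)) :+ 2 · (b :* b) :- con (+ 1)) :* con (+ 2) ,
    (2 · (y :- b) :+ con (+ 1)) :* (2 · (y :- b) :+ con (+ 1)) :- (y :+ con (+ 1) :+ (y :+ con (+ 1)) :- con (+ 1)) :* (2 · (y :- b) :+ con (+ 1)) :+
      2 · ((y :+ con (+ 1) :+ (y :+ con (+ 1)) :- con (+ 1)) :* (y :+ con (+ 1) :+ (y :+ con (+ 1)) :- con (+ 1))) :- con (+ 1) }) refl))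
  }

module PairsByKey = Halves pairsByKeyHalves

Ω : Series
Ω = dil 4 ψ * dil 14 φ + X^ 3 * (dil 28 ψ * dil 2 φ)

-- Twice the left side counts the pairs, which are now divided by the parity of b. Even b gives the
-- two terms of Ω. Odd b is division of X + Y√-7 by (1 + √-7)/2, an element of norm 2, which leads
-- back to a pair and turns the weight n into (n - 1)/2.
ψψ₇-dissection : ψψ₇ ≈ dil 2 Ω + X^ 1 * dil 2 ψψ₇
ψψ₇-dissection = cancel (regular-const (+ 2) (λ ())) (begin
  const (+ 2) * ψψ₇                                 ≈⟨ twice ⟨
  ones Pairs.family                                 ≈⟨ PairsByKey.gen-halves Pairs.family ⟩
  ones EvenPairs.family + ones (shift 1 (dilate 2 Pairs.family))
    ≈⟨ +-cong (≈-trans (EvenPairs.gen-halves EvenPairs.family) (+-cong first second)) (≈-trans (gen-shift 1 _ _) (*-congˡ (≈-trans (gen-dilate 2 Pairs.family _) (≈-trans (dil-cong 2 twice) (dil-const-* 2 (+ 2) ψψ₇))))) ⟩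
  const (+ 2) * dil 8 ψ * dil 28 φ + X^ 6 * (const (+ 2) * dil 56 ψ) * dil 4 φ + X^ 1 * (const (+ 2) * dil 2 ψψ₇)
    ≈⟨ SR.solve (dil 8 ψ ∷ dil 28 φ ∷ X^ 6 ∷ dil 56 ψ ∷ dil 4 φ ∷ X^ 1 ∷ dil 2 ψψ₇ ∷ []) (λ { (a ∷ b ∷ x ∷ c ∷ d ∷ y ∷ e ∷ []) →
         2 · a :* b :+ x :* (2 · c) :* d :+ y :* (2 · e) , 2 · (a :* b :+ x :* (c :* d) :+ y :* e) }) refl ⟩
  const (+ 2) * (dil 8 ψ * dil 28 φ + X^ 6 * (dil 56 ψ * dil 4 φ) + X^ 1 * dil 2 ψψ₇)
    ≈⟨ *-congˡ (+-congʳ (≈-sym dil-Ω)) ⟩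
  const (+ 2) * (dil 2 Ω + X^ 1 * dil 2 ψψ₇) ∎)
  where
  open ≈-Reasoning
  twice : ones Pairs.family ≈ const (+ 2) * ψψ₇
  twice = ≈-trans (Pairs.gen-halves Pairs.family) (≈-trans (+-cong ones-P₁₇ ones-P₁₇) (SR.solve (ψψ₇ ∷ []) (λ { (p ∷ []) → p :+ p , 2 · p }) refl))
  first : ones Φ₁ ≈ const (+ 2) * dil 8 ψ * dil 28 φ
  first = ≈-trans (ones-× (dilate 8 triangularFibres±) (dilate 28 squares)) (*-cong (≈-trans (gen-dilate 8 triangularFibres± _) (≈-trans (dil-cong 8 ones-triangular±) (dil-const-* 8 (+ 2) ψ)))
    (≈-trans (gen-dilate 28 squares _) (dil-cong 28 (≈-sym φ≈gen))))
  second : ones Φ₂ ≈ X^ 6 * (const (+ 2) * dil 56 ψ) * dil 4 φ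
  second = ≈-trans (ones-× (shift 6 (dilate 56 triangularFibres±)) (dilate 4 squares)) (*-cong (≈-trans (gen-shift 6 _ _) (*-congˡ (≈-trans (gen-dilate 56 triangularFibres± _) (≈-trans (dil-cong 56 ones-triangular±) (dil-const-* 56 (+ 2) ψ)))))
    (≈-trans (gen-dilate 4 squares _) (dil-cong 4 (≈-sym φ≈gen))))
  dil-Ω : dil 2 Ω ≈ dil 8 ψ * dil 28 φ + X^ 6 * (dil 56 ψ * dil 4 φ)
  dil-Ω = ≈-trans (dil-+ 2 _ _) (+-cong (≈-trans (dil-* 2 _ _) (*-cong (dil-dil 2 4 ψ) (dil-dil 2 14 φ)))
    (≈-trans (dil-* 2 _ _) (*-cong (dil-X^ 2 3) (≈-trans (dil-* 2 _ _) (*-cong (dil-dil 2 28 ψ) (dil-dil 2 2 φ))))))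

-- Identities between ψ(q)ψ(q⁷), ω and σ

φ≈jacobi : φ ≈ gen (jacobiFibres 1 1) (λ _ → + 1)
φ≈jacobi = ≈-trans φ≈gen (gen-iso squares (jacobiFibres 1 1) id id (λ _ → refl) (λ _ → refl) weights (λ _ → refl))
  where
  weights : ∀ l → jacobi 1 1 l ≡ square l
  weights l = ℤₚ.+-injective (ℤₚ.*-cancelˡ-≡ (+ 2) _ _ (trans (2*jacobi 1 1 l) (trans
    (ℤR.solve (l ∷ []) (λ { (l ∷ []) → 2 · (l :* (l :- con (+ 1))) :+ 2 · con (+ 1) :* l , 2 · (l :* l) }) refl)
    (cong (+ 2 ℤ.*_) (sym (square-+ l))))))

-- A comparison of infinite products: φ(q)(q; q²)² = (q²; q⁴)²(q²; q²) and ψ(q²)(q²; q⁴) = (q⁴; q⁴).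
ψ² : ψ * ψ ≈ φ * dil 2 ψ
ψ² = cancel (regular-* (regular-* odds-regular odds-regular) (regular-unit b (Pr-0 2 4))) (begin
  o * o * b * (ψ * ψ)              ≈⟨ SR.solve (o ∷ b ∷ ψ ∷ []) (λ { (o ∷ b ∷ p ∷ []) → o :* o :* b :* (p :* p) , b :* (p :* o) :* (p :* o) }) refl ⟩
  b * (ψ * o) * (ψ * o)            ≈⟨ *-cong (*-congˡ ψ*odds) ψ*odds ⟩
  b * e * e                        ≈⟨ *-congˡ split ⟩
  b * e * (b * d)                  ≈⟨ SR.solve (b ∷ e ∷ d ∷ []) (λ { (b ∷ e ∷ d ∷ []) → b :* e :* (b :* d) , b :* b :* e :* d }) refl ⟩
  b * b * e * d                    ≈⟨ *-cong φ-odds ψ₂-odds ⟨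
  φ * (o * o) * (dil 2 ψ * b)      ≈⟨ SR.solve (o ∷ b ∷ φ ∷ dil 2 ψ ∷ []) (λ { (o ∷ b ∷ f ∷ p ∷ []) → f :* (o :* o) :* (p :* b) , o :* o :* b :* (f :* p) }) refl ⟩
  o * o * b * (φ * dil 2 ψ)        ∎)
  where
  open ≈-Reasoning
  o b e d g : Series
  o = odds-product
  e = evens-product
  b = Pr 2 4
  d = Pr 4 4
  g = Pr⁻ 1 2
  odds-regular : Regular o
  odds-regular = regular-unit o (Pr-0 1 2)
  split : e ≈ b * d
  split = ≈-trans (Pr-split (+ 1) 2 2 2) (*-congʳ (*-identityˡ _))
  φ-odds : φ * (o * o) ≈ b * b * e
  φ-odds = ≈-trans (*-congʳ (≈-trans φ≈jacobi (unsigned-product 1 1))) (≈-trans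
    (SR.solve (g ∷ e ∷ o ∷ []) (λ { (g ∷ e ∷ o ∷ []) → g :* g :* e :* (o :* o) , g :* o :* (g :* o) :* e }) refl)
    (*-congʳ (*-cong (Pr⁻*Pr 1 2) (Pr⁻*Pr 1 2))))
  ψ₂-odds : dil 2 ψ * b ≈ d
  ψ₂-odds = ≈-trans (*-congˡ (≈-sym (dil-Pr (+ 1) 2 1 2))) (≈-trans (≈-sym (dil-* 2 ψ o)) (≈-trans (dil-cong 2 ψ*odds) (dil-Pr (+ 1) 2 2 2)))

φ-dissection : φ ≈ dil 4 φ + const (+ 2) * (X^ 1 * dil 8 ψ)
φ-dissection = ≈-trans φ≈gen (≈-trans (gen-cong squares split) (≈-trans (gen-+ squares _ _) (+-cong plain-evens plain-odds)))
  where
  split : ∀ z → ⊤ → + 1 ≡ (if isEven z then + 1 else + 0) ℤ.+ (if isEven z then + 0 else + 1)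
  split z _ with isEven z
  ... | true  = refl
  ... | false = refl

φφ₇ σ₇ u v : Series
φφ₇ = φ * dil 7 φ
σ₇ = φφ₇ + const (+ 4) * (X^ 2 * dil 2 ψψ₇)
u = dil 2 ψ * dil 7 φ
v = dil 14 ψ * φ

dil-ψψ₇ : dil 2 ψψ₇ ≈ dil 2 ψ * dil 14 ψ
dil-ψψ₇ = ≈-trans (dil-* 2 ψ (dil 7 ψ)) (*-congˡ (dil-dil 2 7 ψ))

dil-φφ₇ : dil 4 φφ₇ ≈ dil 4 φ * dil 28 φ
dil-φφ₇ = ≈-trans (dil-* 4 φ (dil 7 φ)) (*-congˡ (dil-dil 4 7 φ))

ψψ₇² : ψψ₇ * ψψ₇ ≈ φφ₇ * dil 2 ψψ₇
ψψ₇² = begin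
  ψ * dil 7 ψ * (ψ * dil 7 ψ)                      ≈⟨ SR.solve (ψ ∷ dil 7 ψ ∷ []) (λ { (a ∷ b ∷ []) → a :* b :* (a :* b) , a :* a :* (b :* b) }) refl ⟩
  ψ * ψ * (dil 7 ψ * dil 7 ψ)                      ≈⟨ *-cong ψ² (≈-trans (≈-sym (dil-* 7 ψ ψ)) (≈-trans (dil-cong 7 ψ²) (≈-trans (dil-* 7 φ (dil 2 ψ)) (*-congˡ (dil-dil 7 2 ψ))))) ⟩
  φ * dil 2 ψ * (dil 7 φ * dil 14 ψ)               ≈⟨ SR.solve (φ ∷ dil 2 ψ ∷ dil 7 φ ∷ dil 14 ψ ∷ []) (λ { (a ∷ b ∷ c ∷ d ∷ []) → a :* b :* (c :* d) , a :* c :* (b :* d) }) refl ⟩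
  φφ₇ * (dil 2 ψ * dil 14 ψ)                       ≈⟨ *-congˡ (≈-sym dil-ψψ₇) ⟩
  φφ₇ * dil 2 ψψ₇                                  ∎
  where open ≈-Reasoning

Ω-uv : Ω ≈ dil 2 u + X^ 3 * dil 2 v
Ω-uv = ≈-sym (+-cong (≈-trans (dil-* 2 _ _) (*-cong (dil-dil 2 2 ψ) (dil-dil 2 7 φ))) (*-congˡ (≈-trans (dil-* 2 _ _) (*-congʳ (dil-dil 2 14 ψ)))))

dil-Ω₂ : dil 2 Ω ≈ dil 4 u + X^ 6 * dil 4 v
dil-Ω₂ = ≈-trans (dil-cong 2 Ω-uv) (≈-trans (dil-+ 2 _ _) (+-cong (dil-dil 2 2 u) (≈-trans (dil-* 2 _ _) (*-cong (dil-X^ 2 3) (dil-dil 2 2 v)))))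

dil-u : dil 4 u ≈ dil 8 ψ * dil 28 φ
dil-u = ≈-trans (dil-* 4 _ _) (*-cong (dil-dil 4 2 ψ) (dil-dil 4 7 φ))

dil-v : dil 4 v ≈ dil 56 ψ * dil 4 φ
dil-v = ≈-trans (dil-* 4 _ _) (*-congʳ (dil-dil 4 14 ψ))

dil-ψψ₇₈ : dil 8 ψψ₇ ≈ dil 8 ψ * dil 56 ψ
dil-ψψ₇₈ = ≈-trans (dil-* 8 _ _) (*-congˡ (dil-dil 8 7 ψ))

dil-σ₇ : dil 4 σ₇ ≈ dil 4 φ * dil 28 φ + const (+ 4) * (X^ 8 * (dil 8 ψ * dil 56 ψ))
dil-σ₇ = ≈-trans (dil-+ 4 _ _) (+-cong dil-φφ₇ (≈-trans (dil-const-* 4 (+ 4) _) (*-congˡ (≈-trans (dil-* 4 _ _) (*-cong (dil-X^ 4 2) (≈-trans (dil-dil 4 2 ψψ₇) dil-ψψ₇₈))))))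

φφ₇-dissection : φφ₇ ≈ dil 4 σ₇ + const (+ 2) * (X^ 1 * dil 2 Ω)
φφ₇-dissection = begin
  φ * dil 7 φ
    ≈⟨ *-cong φ-dissection (≈-trans (dil-cong 7 φ-dissection) (≈-trans (dil-+ 7 _ _) (+-cong (dil-dil 7 4 φ) (≈-trans (dil-const-* 7 (+ 2) _) (*-congˡ (≈-trans (dil-* 7 _ _) (*-cong (dil-X^ 7 1) (dil-dil 7 8 ψ)))))))) ⟩
  (dil 4 φ + const (+ 2) * (X^ 1 * dil 8 ψ)) * (dil 28 φ + const (+ 2) * (X^ 7 * dil 56 ψ))
    ≈⟨ SR.solve (dil 4 φ ∷ dil 8 ψ ∷ dil 28 φ ∷ dil 56 ψ ∷ X^ 1 ∷ X^ 7 ∷ []) (λ { (a ∷ b ∷ c ∷ d ∷ x ∷ y ∷ []) →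
         (a :+ 2 · (x :* b)) :* (c :+ 2 · (y :* d)) , a :* c :+ 4 · (x :* y :* (b :* d)) :+ 2 · (x :* (b :* c) :+ y :* (d :* a)) }) refl ⟩
  dil 4 φ * dil 28 φ + const (+ 4) * (X^ 1 * X^ 7 * (dil 8 ψ * dil 56 ψ)) + const (+ 2) * (X^ 1 * (dil 8 ψ * dil 28 φ) + X^ 7 * (dil 56 ψ * dil 4 φ))
    ≈⟨ +-cong (≈-sym (≈-trans dil-σ₇ (+-congˡ (*-congˡ (*-congʳ (X^-+ 1 7)))))) (*-congˡ (+-cong (*-congˡ (≈-sym dil-u)) (*-cong (X^-+ 1 6) (≈-sym dil-v)))) ⟩
  dil 4 σ₇ + const (+ 2) * (X^ 1 * dil 4 u + X^ 1 * X^ 6 * dil 4 v)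
    ≈⟨ SR.solve (dil 4 σ₇ ∷ dil 4 u ∷ dil 4 v ∷ X^ 1 ∷ X^ 6 ∷ []) (λ { (s ∷ u ∷ v ∷ x ∷ y ∷ []) →
         s :+ 2 · (x :* u :+ x :* y :* v) , s :+ 2 · (x :* (u :+ y :* v)) }) refl ⟩
  dil 4 σ₇ + const (+ 2) * (X^ 1 * (dil 4 u + X^ 6 * dil 4 v))
    ≈⟨ +-congˡ (*-congˡ (*-congˡ (≈-sym dil-Ω₂))) ⟩
  dil 4 σ₇ + const (+ 2) * (X^ 1 * dil 2 Ω) ∎
  where open ≈-Reasoning

-- The dissections of ψ(q)ψ(q⁷) and φ(q)φ(q⁷) are inserted into `ψψ₇²`; the odd terms on both sides
-- are the same, and what is left is the claim at q².
Ω²+ψψ₇² : Ω * Ω + X^ 1 * (ψψ₇ * ψψ₇) ≈ dil 2 σ₇ * ψψ₇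
Ω²+ψψ₇² = dil-injective 2 (begin
  dil 2 (Ω * Ω + X^ 1 * (ψψ₇ * ψψ₇))       ≈⟨ ≈-trans (dil-+ 2 _ _) (+-cong (dil-* 2 Ω Ω) (≈-trans (dil-* 2 _ _) (*-cong (≈-trans (dil-X^ 2 1) (X^-+ 1 1)) (dil-* 2 ψψ₇ ψψ₇)))) ⟩
  w * w + x * x * (p * p)                  ≈⟨ -≈𝟘⇒≈ (≈-trans (SR.solve (w ∷ x ∷ p ∷ s ∷ []) (λ { (w ∷ x ∷ p ∷ s ∷ []) →
                                                w :* w :+ x :* x :* (p :* p) :- s :* p , (w :+ x :* p) :* (w :+ x :* p) :- (s :+ 2 · (x :* w)) :* p }) refl)
                                              (≈⇒-≈𝟘 (≈-trans (≈-sym (*-cong ψψ₇-dissection ψψ₇-dissection)) (≈-trans ψψ₇² (*-congʳ φφ₇-dissection))))) ⟩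
  s * p                                    ≈⟨ *-congʳ (≈-sym (dil-dil 2 2 σ₇)) ⟩
  dil 2 (dil 2 σ₇) * p                     ≈⟨ dil-* 2 (dil 2 σ₇) ψψ₇ ⟨
  dil 2 (dil 2 σ₇ * ψψ₇)                   ∎)
  where
  open ≈-Reasoning
  w x p s : Series
  w = dil 2 Ω
  x = X^ 1
  p = dil 2 ψψ₇
  s = dil 4 σ₇

-- The coefficient at n is 0 for odd n and minus the coefficient at n/2 for even n.
antiperiodic : ∀ {f} → f ≈ neg (dil 2 f) → f ≈ 𝟘
antiperiodic {f} e = coeffs λ n → trans (strong-induction (λ n → f n ≡ + 0) step n) (sym (coeff-𝟘 n))
  where
  value : ∀ n → f n ≡ - dil 2 f n
  value n = trans (at-degree e n) (coeff-neg (dil 2 f) n)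
  self-negative : ∀ {i} → i ≡ - i → i ≡ + 0
  self-negative {+ zero} _ = refl
  step : ∀ n → (∀ k → k ℕ.< n → f k ≡ + 0) → f n ≡ + 0
  step n ih with halves n
  step _ ih | inj₁ (zero , refl)  = self-negative (trans (value 0) (cong -_ (dil-zero 2 f)))
  step _ ih | inj₁ (suc k , refl) = trans (value (suc k ℕ.+ suc k)) (cong -_ (trans (trans (cong (dil 2 f) (doubled (suc k))) (dil-multiple 2 f (suc k))) (ih (suc k) (s≤s (ℕₚ.m≤n+m (suc k) k)))))
    where
    doubled : ∀ k → k ℕ.+ k ≡ k ℕ.* 2
    doubled k = sym (trans (ℕₚ.*-comm k 2) (cong (k ℕ.+_) (ℕₚ.+-identityʳ k)))
  step _ ih | inj₂ (k , refl)     = trans (value (suc (k ℕ.+ k))) (cong -_ (trans (cong (dil 2 f) (doubled k)) (dil-nonmultiple 2 f k 1 (s≤s (s≤s z≤n)) (λ ()))))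
    where
    doubled : ∀ k → suc (k ℕ.+ k) ≡ k ℕ.* 2 ℕ.+ 1
    doubled k = sym (trans (ℕₚ.+-comm (k ℕ.* 2) 1) (cong suc (trans (ℕₚ.*-comm k 2) (cong (k ℕ.+_) (ℕₚ.+-identityʳ k)))))

-- Both sides of σ₇(q) - σ₇(q²) = 2 q ψψ₇ change by the same amount under q ↦ q², up to sign.
σ₇-dilated : dil 2 σ₇ ≈ σ₇ - const (+ 2) * (X^ 1 * ψψ₇)
σ₇-dilated = ≈-sym (-≈𝟘⇒≈ (≈-trans (SR.solve (σ₇ ∷ dil 2 σ₇ ∷ X^ 1 * ψψ₇ ∷ []) (λ { (s ∷ t ∷ p ∷ []) → s :- 2 · p :- t , s :- t :- 2 · p }) refl)
  (antiperiodic (begin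
    τ                                                                 ≈⟨ +-cong (+-congʳ (+-congʳ φφ₇-dissection)) (-‿cong (*-congˡ (*-congˡ ψψ₇-dissection))) ⟩
    s₄ + const (+ 2) * (x * w) + const (+ 4) * (X^ 2 * p) - s₂ - const (+ 2) * (x * (w + x * p))
      ≈⟨ +-congʳ (+-congʳ (+-congˡ (*-congˡ (*-congʳ (X^-+ 1 1))))) ⟩
    s₄ + const (+ 2) * (x * w) + const (+ 4) * (x * x * p) - s₂ - const (+ 2) * (x * (w + x * p))
      ≈⟨ SR.solve (s₄ ∷ s₂ ∷ x ∷ w ∷ p ∷ []) (λ { (s ∷ t ∷ x ∷ w ∷ p ∷ []) → s :+ 2 · (x :* w) :+ 4 · (x :* x :* p) :- t :- 2 · (x :* (w :+ x :* p)) ,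
           :neg (t :- s :- 2 · (x :* x :* p)) }) refl ⟩
    neg (s₂ - s₄ - const (+ 2) * (x * x * p))
      ≈⟨ -‿cong (≈-sym dil-τ) ⟩
    neg (dil 2 τ) ∎))))
  where
  open ≈-Reasoning
  τ s₂ s₄ x w p : Series
  τ = σ₇ - dil 2 σ₇ - const (+ 2) * (X^ 1 * ψψ₇)
  s₂ = dil 2 σ₇
  s₄ = dil 4 σ₇
  x = X^ 1
  w = dil 2 Ω
  p = dil 2 ψψ₇
  dil-- : ∀ f g → dil 2 (f - g) ≈ dil 2 f - dil 2 g
  dil-- f g = ≈-trans (dil-+ 2 f (neg g)) (+-congˡ (dil-neg 2 g))
  dil-τ : dil 2 τ ≈ s₂ - s₄ - const (+ 2) * (x * x * p)
  dil-τ = ≈-trans (dil-- _ _) (+-cong (≈-trans (dil-- _ _) (+-congˡ (-‿cong (dil-dil 2 2 σ₇))))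
    (-‿cong (≈-trans (dil-const-* 2 (+ 2) _) (*-congˡ (≈-trans (dil-* 2 _ _) (*-congʳ (≈-trans (dil-X^ 2 1) (X^-+ 1 1))))))))

Ω² : Ω * Ω ≈ ψψ₇ * (σ₇ - const (+ 3) * (X^ 1 * ψψ₇))
Ω² = -≈𝟘⇒≈ (≈-trans (SR.solve (Ω ∷ ψψ₇ ∷ σ₇ ∷ X^ 1 ∷ []) (λ { (w ∷ p ∷ s ∷ x ∷ []) → w :* w :- p :* (s :- 3 · (x :* p)) ,
    w :* w :+ x :* (p :* p) :- (s :- 2 · (x :* p)) :* p }) refl)
  (≈⇒-≈𝟘 (≈-trans Ω²+ψψ₇² (*-congʳ σ₇-dilated))))

-- These are the terms of even degree in `Ω²+ψψ₇²`, where Ω = u(q²) + q³v(q²) and ψ(q)ψ(q⁷) is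
-- replaced by its dissection.
u²+v² : u * u + X^ 3 * (v * v) ≈ Ω * (σ₇ - const (+ 2) * (X^ 1 * ψψ₇))
u²+v² = -≈𝟘⇒≈ (≈-trans (SR.solve (u ∷ v ∷ X^ 3 ∷ X^ 1 ∷ Ω ∷ ψψ₇ ∷ σ₇ ∷ []) (λ { (u ∷ v ∷ y ∷ x ∷ w ∷ p ∷ s ∷ []) →
    u :* u :+ y :* (v :* v) :- w :* (s :- 2 · (x :* p)) , u :* u :+ y :* (v :* v) :+ 2 · (x :* (w :* p)) :- s :* w }) refl)
  (≈⇒-≈𝟘 (proj₁ (dissect₂ even odd (σ₇ * Ω) (σ₇ * ψψ₇) (begin
    dil 2 even + X^ 1 * dil 2 odd
      ≈⟨ +-cong dil-even (*-congˡ dil-odd) ⟩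
    u₂ * u₂ + y * y * (v₂ * v₂) + const (+ 2) * (x * x * (w * p)) + x * (const (+ 2) * (x * x * (u₂ * v₂)) + w * w + x * x * (p * p))
      ≈⟨ SR.solve (u₂ ∷ v₂ ∷ x ∷ y ∷ w ∷ p ∷ []) (λ { (u ∷ v ∷ x ∷ y ∷ w ∷ p ∷ []) →
           u :* u :+ y :* y :* (v :* v) :+ 2 · (x :* x :* (w :* p)) :+ x :* (2 · (x :* x :* (u :* v)) :+ w :* w :+ x :* x :* (p :* p)) ,
           u :* u :+ y :* y :* (v :* v) :+ 2 · (x :* x :* x :* (u :* v)) :+ x :* ((w :+ x :* p) :* (w :+ x :* p)) }) refl ⟩
    u₂ * u₂ + y * y * (v₂ * v₂) + const (+ 2) * (x * x * x * (u₂ * v₂)) + x * ((w + x * p) * (w + x * p))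
      ≈⟨ +-cong (+-congˡ (*-congˡ (*-congʳ (≈-sym (≈-trans (X^-+ 2 1) (*-congʳ (X^-+ 1 1))))))) (*-congˡ (≈-sym (*-cong ψψ₇-dissection ψψ₇-dissection))) ⟩
    u₂ * u₂ + y * y * (v₂ * v₂) + const (+ 2) * (y * (u₂ * v₂)) + x * (ψψ₇ * ψψ₇)
      ≈⟨ +-congʳ (SR.solve (u₂ ∷ v₂ ∷ y ∷ []) (λ { (u ∷ v ∷ y ∷ []) → u :* u :+ y :* y :* (v :* v) :+ 2 · (y :* (u :* v)) , (u :+ y :* v) :* (u :+ y :* v) }) refl) ⟩
    (u₂ + y * v₂) * (u₂ + y * v₂) + x * (ψψ₇ * ψψ₇)
      ≈⟨ +-congʳ (≈-sym (*-cong Ω-uv Ω-uv)) ⟩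
    Ω * Ω + x * (ψψ₇ * ψψ₇)
      ≈⟨ Ω²+ψψ₇² ⟩
    dil 2 σ₇ * ψψ₇
      ≈⟨ *-congˡ ψψ₇-dissection ⟩
    dil 2 σ₇ * (w + x * p)
      ≈⟨ SR.solve (dil 2 σ₇ ∷ w ∷ x ∷ p ∷ []) (λ { (s ∷ w ∷ x ∷ p ∷ []) → s :* (w :+ x :* p) , s :* w :+ x :* (s :* p) }) refl ⟩
    dil 2 σ₇ * w + x * (dil 2 σ₇ * p)
      ≈⟨ +-cong (≈-sym (dil-* 2 σ₇ Ω)) (*-congˡ (≈-sym (dil-* 2 σ₇ ψψ₇))) ⟩
    dil 2 (σ₇ * Ω) + X^ 1 * dil 2 (σ₇ * ψψ₇) ∎)))))
  where
  open ≈-Reasoning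
  even odd u₂ v₂ x y w p : Series
  even = u * u + X^ 3 * (v * v) + const (+ 2) * (X^ 1 * (Ω * ψψ₇))
  odd = const (+ 2) * (X^ 1 * (u * v)) + Ω * Ω + X^ 1 * (ψψ₇ * ψψ₇)
  u₂ = dil 2 u
  v₂ = dil 2 v
  x = X^ 1
  y = X^ 3
  w = dil 2 Ω
  p = dil 2 ψψ₇
  dil-x : dil 2 (X^ 1) ≈ x * x
  dil-x = ≈-trans (dil-X^ 2 1) (X^-+ 1 1)
  dil-y : dil 2 (X^ 3) ≈ y * y
  dil-y = ≈-trans (dil-X^ 2 3) (X^-+ 3 3)
  dil-even : dil 2 even ≈ u₂ * u₂ + y * y * (v₂ * v₂) + const (+ 2) * (x * x * (w * p))
  dil-even = ≈-trans (dil-+ 2 _ _) (+-cong (≈-trans (dil-+ 2 _ _) (+-cong (dil-* 2 u u) (≈-trans (dil-* 2 _ _) (*-cong dil-y (dil-* 2 v v)))))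
    (≈-trans (dil-const-* 2 (+ 2) _) (*-congˡ (≈-trans (dil-* 2 _ _) (*-cong dil-x (dil-* 2 Ω ψψ₇))))))
  dil-odd : dil 2 odd ≈ const (+ 2) * (x * x * (u₂ * v₂)) + w * w + x * x * (p * p)
  dil-odd = ≈-trans (dil-+ 2 _ _) (+-cong (≈-trans (dil-+ 2 _ _) (+-cong (≈-trans (dil-const-* 2 (+ 2) _) (*-congˡ (≈-trans (dil-* 2 _ _) (*-cong dil-x (dil-* 2 u v))))) (dil-* 2 Ω Ω)))
    (≈-trans (dil-* 2 _ _) (*-cong dil-x (dil-* 2 ψψ₇ ψψ₇))))

-- Translation of ω and σ; lowest terms by computation

ω≈Ω : ω ≈ Ω
ω≈Ω = ≈-trans (≈-sym (+≈⊕ _ _)) (+-cong (≈-trans (≈-sym (*≈⊗ _ _)) (*-cong (at≈dil 4 ψ) (at≈dil 14 φ)))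
  (≈-trans (qpow≈ 3 _) (*-congˡ (≈-trans (≈-sym (*≈⊗ _ _)) (*-cong (at≈dil 28 ψ) (at≈dil 2 φ))))))

σ≈σ₇ : σ ≈ σ₇
σ≈σ₇ = ≈-trans (≈-sym (+≈⊕ _ _)) (+-cong (≈-trans (≈-sym (*≈⊗ _ _)) (*-congˡ (at≈dil 7 φ)))
  (≈-trans (scale≈const (+ 4) _) (*-congˡ (≈-trans (qpow≈ 2 _) (*-congˡ (≈-trans (≈-sym (*≈⊗ _ _)) (≈-trans (*-cong (at≈dil 2 ψ) (at≈dil 14 ψ)) (≈-sym dil-ψψ₇))))))))

ψψ₇≈ : ψψ₇ ≈ ψ ⊗ at 7 ψ
ψψ₇≈ = ≈-trans (*-congˡ (≈-sym (at≈dil 7 ψ))) (*≈⊗ _ _)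

prefix : ℕ → Series → List ℤ
prefix K f = applyUpTo f K

infixl 6 _+ₗ_
infixl 7 _*ₗ_
_+ₗ_ _*ₗ_ : List ℤ → List ℤ → List ℤ
_+ₗ_ = List.zipWith ℤ._+_
[]       *ₗ ys       = []
(x ∷ xs) *ₗ []       = []
(x ∷ xs) *ₗ (y ∷ ys) = x ℤ.* y ∷ (map (x ℤ.*_) ys +ₗ (xs *ₗ (y ∷ ys)))

prefix-cong : ∀ K {f g} → f ≈ g → prefix K f ≡ prefix K g
prefix-cong K {f} {g} p = go K id
  where
  go : ∀ K (h : ℕ → ℕ) → applyUpTo (f ∘ h) K ≡ applyUpTo (g ∘ h) K
  go zero    h = refl
  go (suc K) h = cong₂ _∷_ (at-degree p (h 0)) (go K (h ∘ suc))

prefix-+ : ∀ K K′ → K ℕ.≤ K′ → ∀ f g → prefix K (f + g) ≡ prefix K′ f +ₗ prefix K g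
prefix-+ K K′ K≤K′ f g = go K K′ K≤K′ id
  where
  go : ∀ K K′ → K ℕ.≤ K′ → (h : ℕ → ℕ) → applyUpTo ((f + g) ∘ h) K ≡ applyUpTo (f ∘ h) K′ +ₗ applyUpTo (g ∘ h) K
  go zero    zero     z≤n     h = refl
  go zero    (suc K′) z≤n     h = refl
  go (suc K) (suc K′) (s≤s q) h = cong₂ _∷_ (coeff-+ f g (h 0)) (go K K′ q (h ∘ suc))

prefix-scale : ∀ K c f → prefix K (const c * f) ≡ map (c ℤ.*_) (prefix K f)
prefix-scale K c f = go K id
  where
  go : ∀ K (h : ℕ → ℕ) → applyUpTo ((const c * f) ∘ h) K ≡ map (c ℤ.*_) (applyUpTo (f ∘ h) K)
  go zero    h = refl
  go (suc K) h = cong₂ _∷_ (coeff-const-* c f (h 0)) (go K (h ∘ suc))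

prefix-* : ∀ K K′ → K ℕ.≤ K′ → ∀ f g → prefix K (f * g) ≡ prefix K f *ₗ prefix K′ g
prefix-* zero    K′       z≤n     f g = refl
prefix-* (suc K) (suc K′) (s≤s q) f g = cong₂ _∷_ (coeff-*-zero f g) (trans (prefix-cong K (tail-* f g))
  (trans (prefix-+ K K′ q (const (f 0) * tail g) (tail f * g)) (cong₂ _+ₗ_ (prefix-scale K′ (f 0) (tail g))
    (prefix-* K (suc K′) (ℕₚ.≤-trans q (ℕₚ.n≤1+n K′)) (tail f) g))))

prefix-neg : ∀ K f → prefix K (neg f) ≡ map (λ i → - i) (prefix K f)
prefix-neg K f = go K id
  where
  go : ∀ K (h : ℕ → ℕ) → applyUpTo (neg f ∘ h) K ≡ map (λ i → - i) (applyUpTo (f ∘ h) K)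
  go zero    h = refl
  go (suc K) h = cong₂ _∷_ (coeff-neg f (h 0)) (go K (h ∘ suc))

constₗ : ℕ → ℤ → List ℤ
constₗ K c = applyUpTo (scale c oneS) K

-- The series operations are opaque and do not reduce, so initial coefficients of polynomial
-- expressions are computed on lists, starting from the transparent definitions of φ, ψ and ω.
module Truncation {n : ℕ} (K : ℕ) (ρ : Vec Series n) (xs : Vec (List ℤ) n) (known : Pointwise (λ f ys → prefix K f ≡ ys) ρ xs) where

  power-list : List ℤ → ℕ → List ℤ
  power-list ys zero    = constₗ K (+ 1)
  power-list ys (suc k) = ys *ₗ power-list ys k

  truncated : Expr n → List ℤ
  truncated (var i)  = Vec.lookup xs i
  truncated (con c)  = constₗ K c
  truncated (a :+ b) = truncated a +ₗ truncated b
  truncated (a :* b) = truncated a *ₗ truncated b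
  truncated (a :- b) = truncated a +ₗ map (λ i → - i) (truncated b)
  truncated (:neg a) = map (λ i → - i) (truncated a)
  truncated (a :^ k) = power-list (truncated a) k

  prefix-expr : ∀ e → prefix K (SR.⟦ e ⟧ ρ) ≡ truncated e
  prefix-expr (var i)  = Pointwise.lookup known i
  prefix-expr (con c)  = prefix-const c
    where
    prefix-const : ∀ c → prefix K (const c) ≡ constₗ K c
    prefix-const c = trans (prefix-cong K (≈-trans (≈-sym (*-identityʳ (const c))) (≈-trans (*-congˡ 𝟙≈oneS) (≈-sym (scale≈const c oneS))))) refl
  prefix-expr (a :+ b) = trans (prefix-+ K K ℕₚ.≤-refl _ _) (cong₂ _+ₗ_ (prefix-expr a) (prefix-expr b))
  prefix-expr (a :* b) = trans (prefix-* K K ℕₚ.≤-refl _ _) (cong₂ _*ₗ_ (prefix-expr a) (prefix-expr b))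
  prefix-expr (a :- b) = trans (prefix-+ K K ℕₚ.≤-refl _ _) (cong₂ _+ₗ_ (prefix-expr a) (trans (prefix-neg K _) (cong (map (λ i → - i)) (prefix-expr b))))
  prefix-expr (:neg a) = trans (prefix-neg K _) (cong (map (λ i → - i)) (prefix-expr a))
  prefix-expr (a :^ k) = go k
    where
    go : ∀ k → prefix K (SR.⟦ a ⟧ ρ ↑ k) ≡ power-list (truncated a) k
    go zero    = prefix-cong K 𝟙≈oneS₁
      where
      𝟙≈oneS₁ : 𝟙 ≈ scale (+ 1) oneS
      𝟙≈oneS₁ = coeffs λ n → trans (at-degree 𝟙≈oneS n) (sym (ℤₚ.*-identityˡ (oneS n)))
    go (suc k) = trans (prefix-* K K ℕₚ.≤-refl _ _) (cong₂ _*ₗ_ (prefix-expr a) (go k))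

prefix-lead : ∀ m c f → c ≢ + 0 → prefix (suc m) f ≡ List.replicate m (+ 0) ++ c ∷ [] → Regular f
prefix-lead m c f c≢0 e = regular-lead m f (λ k → proj₁ (go m id e) k) (λ z → c≢0 (trans (sym (proj₂ (go m id e))) z))
  where
  go : ∀ m (h : ℕ → ℕ) → applyUpTo (f ∘ h) (suc m) ≡ List.replicate m (+ 0) ++ c ∷ [] → (∀ k → k ℕ.< m → f (h k) ≡ + 0) × f (h m) ≡ c
  go zero    h e = (λ _ ()) , ∷-injectiveˡ e
  go (suc m) h e with go m (h ∘ suc) (∷-injectiveʳ e)
  ... | p , q = (λ { zero _ → ∷-injectiveˡ e ; (suc k) (s≤s k<m) → p k k<m }) , q

-- The relations among F, T, G, H, p, o and the C_j

pᵗ oᵗ : Series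
pᵗ = const (+ 2) * (X^ 4 * dil 4 ψψ₇)
oᵗ = const (+ 2) * (X^ 2 * dil 4 Ω)

coefficients : Vec Series 6
coefficients = F ∷ T′ ∷ G ∷ H ∷ pᵗ ∷ oᵗ ∷ []

leading : ℕ → Vec (List ℤ) 6
leading K = prefix K (at 4 φ) ∷ prefix K (scale (+ 2) (qpow 1 (at 8 ψ))) ∷ prefix K (at 28 φ) ∷ prefix K (scale (+ 2) (qpow 7 (at 56 ψ))) ∷
  prefix K (scale (+ 2) (qpow 4 (at 4 (ψ ⊗ at 7 ψ)))) ∷ prefix K (scale (+ 2) (qpow 2 (at 4 ω))) ∷ []

scaled≈ : ∀ c m {f g} → f ≈ g → const c * (X^ m * f) ≈ scale c (qpow m g)
scaled≈ c m p = ≈-sym (≈-trans (scale≈const c _) (*-congˡ (≈-trans (qpow≈ m _) (*-congˡ (≈-sym p)))))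

coefficients-known : ∀ K → Pointwise (λ f ys → prefix K f ≡ ys) coefficients (leading K)
coefficients-known K = prefix-cong K (≈-sym (at≈dil 4 φ)) ∷ prefix-cong K (scaled≈ (+ 2) 1 (≈-sym (at≈dil 8 ψ))) ∷
  prefix-cong K (≈-sym (at≈dil 28 φ)) ∷ prefix-cong K (scaled≈ (+ 2) 7 (≈-sym (at≈dil 56 ψ))) ∷
  prefix-cong K (scaled≈ (+ 2) 4 (≈-trans (dil-cong 4 ψψ₇≈) (≈-sym (at≈dil 4 _)))) ∷
  prefix-cong K (scaled≈ (+ 2) 2 (≈-trans (dil-cong 4 (≈-sym ω≈Ω)) (≈-sym (at≈dil 4 ω)))) ∷ []

regular-expr : ∀ m c → c ≢ + 0 → (expr : Vars 6 → Expr 6) → let e = expr (Vec.tabulate var) in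
  Truncation.truncated (suc m) coefficients (leading (suc m)) (coefficients-known (suc m)) e ≡ List.replicate m (+ 0) ++ c ∷ [] →
  Regular (SR.⟦ e ⟧ coefficients)
regular-expr m c c≢0 expr eq = prefix-lead m c _ c≢0 (trans (Truncation.prefix-expr (suc m) coefficients (leading (suc m)) (coefficients-known (suc m)) (expr (Vec.tabulate var))) eq)

regular-e : Regular (F * G - T′ * H)
regular-e = regular-expr 0 (+ 1) (λ ()) (λ { (F ∷ T ∷ G ∷ H ∷ p ∷ o ∷ []) → F :* G :- T :* H }) refl

regular-σ+2p : Regular (F * G + T′ * H + const (+ 2) * pᵗ)
regular-σ+2p = regular-expr 0 (+ 1) (λ ()) (λ { (F ∷ T ∷ G ∷ H ∷ p ∷ o ∷ []) → F :* G :+ T :* H :+ 2 · p }) refl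

regular-x+p : Regular (F * G + pᵗ)
regular-x+p = regular-expr 0 (+ 1) (λ ()) (λ { (F ∷ T ∷ G ∷ H ∷ p ∷ o ∷ []) → F :* G :+ p }) refl

regular-y+p : Regular (T′ * H + pᵗ)
regular-y+p = regular-expr 4 (+ 2) (λ ()) (λ { (F ∷ T ∷ G ∷ H ∷ p ∷ o ∷ []) → T :* H :+ p }) refl

-- All terms below t⁶ cancel; the lowest one is -64t⁶.
regular-f₂ : Regular (const (+ 8) * ((F * G) + (T′ * H)) * oᵗ * ((F * G) + (T′ * H) - pᵗ) * ((F * G) - (T′ * H)) - const (+ 2) * ((F * G) + (T′ * H) - const (+ 2) * pᵗ) * (const (+ 2) * ((F * G) - (T′ * H)) * (F * T′ * (F * T′)) - ((F * H * (F * H)) - (T′ * G * (T′ * G))) * ((F * G) + (T′ * H) + const (+ 2) * pᵗ) + const (+ 2) * ((F * G) - (T′ * H)) * oᵗ * ((F * G) + (T′ * H) + pᵗ)) - const (+ 4) * ((F * H * (F * H)) - (T′ * G * (T′ * G))) * (((F * G) + (T′ * H)) * ((F * G) + (T′ * H)) - const (+ 2) * pᵗ * ((F * G) + (T′ * H)) - const (+ 2) * (pᵗ * pᵗ)))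
regular-f₂ = regular-expr 6 (- + 64) (λ ()) (λ { (F ∷ T ∷ G ∷ H ∷ p ∷ o ∷ []) →
  8 · ((F :* G) :+ (T :* H)) :* o :* ((F :* G) :+ (T :* H) :- p) :* ((F :* G) :- (T :* H)) :- 2 · ((F :* G) :+ (T :* H) :- 2 · p) :* (2 · ((F :* G) :- (T :* H)) :* (F :* T :* (F :* T)) :- ((F :* H :* (F :* H)) :- (T :* G :* (T :* G))) :* ((F :* G) :+ (T :* H) :+ 2 · p) :+ 2 · ((F :* G) :- (T :* H)) :* o :* ((F :* G) :+ (T :* H) :+ p)) :- 4 · ((F :* H :* (F :* H)) :- (T :* G :* (T :* G))) :* (((F :* G) :+ (T :* H)) :* ((F :* G) :+ (T :* H)) :- 2 · p :* ((F :* G) :+ (T :* H)) :- 2 · (p :* p)) }) refl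

curve-p² : pᵗ * pᵗ ≈ F * T′ * (G * H)
curve-p² = begin
  pᵗ * pᵗ
    ≈⟨ SR.solve (X^ 4 ∷ dil 4 ψψ₇ ∷ []) (λ { (x ∷ p ∷ []) → 2 · (x :* p) :* (2 · (x :* p)) , 4 · (x :* x :* (p :* p)) }) refl ⟩
  const (+ 4) * (X^ 4 * X^ 4 * (dil 4 ψψ₇ * dil 4 ψψ₇))
    ≈⟨ *-congˡ (*-cong (≈-trans (≈-sym (X^-+ 4 4)) (X^-+ 1 7)) (≈-trans (≈-sym (dil-* 4 ψψ₇ ψψ₇)) (≈-trans (dil-cong 4 ψψ₇²) (≈-trans (dil-* 4 φφ₇ _) (*-cong dil-φφ₇ (≈-trans (dil-dil 4 2 ψψ₇) dil-ψψ₇₈)))))) ⟩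
  const (+ 4) * (X^ 1 * X^ 7 * (F * G * (dil 8 ψ * dil 56 ψ)))
    ≈⟨ SR.solve (X^ 1 ∷ X^ 7 ∷ F ∷ G ∷ dil 8 ψ ∷ dil 56 ψ ∷ []) (λ { (x ∷ y ∷ f ∷ g ∷ t ∷ h ∷ []) → 4 · (x :* y :* (f :* g :* (t :* h))) ,
         f :* (2 · (x :* t)) :* (g :* (2 · (y :* h))) }) refl ⟩
  F * T′ * (G * H) ∎
  where open ≈-Reasoning

curve-σ : F * G + T′ * H ≈ dil 4 σ₇
curve-σ = ≈-trans (+-congˡ (≈-trans (SR.solve (X^ 1 ∷ X^ 7 ∷ dil 8 ψ ∷ dil 56 ψ ∷ []) (λ { (x ∷ y ∷ t ∷ h ∷ []) →
    2 · (x :* t) :* (2 · (y :* h)) , 4 · (x :* y :* (t :* h)) }) refl) (*-congˡ (*-congʳ (≈-sym (X^-+ 1 7))))))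
  (≈-sym dil-σ₇)

T′G : T′ * G ≈ const (+ 2) * (X^ 1 * dil 4 u)
T′G = ≈-trans (SR.solve (X^ 1 ∷ dil 8 ψ ∷ G ∷ []) (λ { (x ∷ t ∷ g ∷ []) → 2 · (x :* t) :* g , 2 · (x :* (t :* g)) }) refl) (*-congˡ (*-congˡ (≈-sym dil-u)))

FH : F * H ≈ const (+ 2) * (X^ 7 * dil 4 v)
FH = ≈-trans (SR.solve (X^ 7 ∷ dil 56 ψ ∷ F ∷ []) (λ { (x ∷ h ∷ f ∷ []) → f :* (2 · (x :* h)) , 2 · (x :* (h :* f)) }) refl) (*-congˡ (*-congˡ (≈-sym dil-v)))

dil-4σ : ∀ c → dil 4 (σ₇ - const c * (X^ 1 * ψψ₇)) ≈ dil 4 σ₇ - const c * (X^ 4 * dil 4 ψψ₇)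
dil-4σ c = ≈-trans (dil-+ 4 _ _) (+-congˡ (≈-trans (dil-neg 4 _) (-‿cong (≈-trans (dil-const-* 4 c _) (*-congˡ (≈-trans (dil-* 4 _ _) (*-congʳ (dil-X^ 4 1))))))))

-- This is `u²+v²` at t⁴ times 4t², because TG = 2tu(t⁴) and FH = 2t⁷v(t⁴).
curve-S : F * H * (F * H) + T′ * G * (T′ * G) ≈ const (+ 2) * oᵗ * (F * G + T′ * H - pᵗ)
curve-S = begin
  F * H * (F * H) + T′ * G * (T′ * G)
    ≈⟨ +-cong (*-cong FH FH) (*-cong T′G T′G) ⟩
  const (+ 2) * (X^ 7 * v₄) * (const (+ 2) * (X^ 7 * v₄)) + const (+ 2) * (X^ 1 * u₄) * (const (+ 2) * (X^ 1 * u₄))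
    ≈⟨ SR.solve (X^ 7 ∷ X^ 1 ∷ u₄ ∷ v₄ ∷ []) (λ { (y ∷ x ∷ u ∷ v ∷ []) → 2 · (y :* v) :* (2 · (y :* v)) :+ 2 · (x :* u) :* (2 · (x :* u)) ,
         4 · (x :* x :* (u :* u) :+ y :* y :* (v :* v)) }) refl ⟩
  const (+ 4) * (X^ 1 * X^ 1 * (u₄ * u₄) + X^ 7 * X^ 7 * (v₄ * v₄))
    ≈⟨ *-congˡ (+-cong (*-congʳ (≈-sym (X^-+ 1 1))) (≈-trans (*-congʳ (≈-trans (≈-sym (X^-+ 7 7)) (X^-+ 2 12))) (*-assoc _ _ _))) ⟩
  const (+ 4) * (X^ 2 * (u₄ * u₄) + X^ 2 * (X^ 12 * (v₄ * v₄)))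
    ≈⟨ *-congˡ (≈-sym (distribˡ _ _ _)) ⟩
  const (+ 4) * (X^ 2 * (u₄ * u₄ + X^ 12 * (v₄ * v₄)))
    ≈⟨ *-congˡ (*-congˡ (≈-sym (≈-trans (dil-+ 4 _ _) (+-cong (dil-* 4 u u) (≈-trans (dil-* 4 _ _) (*-cong (dil-X^ 4 3) (dil-* 4 v v))))))) ⟩
  const (+ 4) * (X^ 2 * dil 4 (u * u + X^ 3 * (v * v)))
    ≈⟨ *-congˡ (*-congˡ (≈-trans (dil-cong 4 u²+v²) (≈-trans (dil-* 4 Ω _) (*-congˡ (dil-4σ (+ 2)))))) ⟩
  const (+ 4) * (X^ 2 * (dil 4 Ω * (dil 4 σ₇ - const (+ 2) * (X^ 4 * dil 4 ψψ₇))))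
    ≈⟨ SR.solve (X^ 2 ∷ dil 4 Ω ∷ dil 4 σ₇ ∷ pᵗ ∷ []) (λ { (x ∷ w ∷ s ∷ p ∷ []) → 4 · (x :* (w :* (s :- p))) , 2 · (2 · (x :* w)) :* (s :- p) }) refl ⟩
  const (+ 2) * oᵗ * (dil 4 σ₇ - pᵗ)
    ≈⟨ *-congˡ (+-congʳ (≈-sym curve-σ)) ⟩
  const (+ 2) * oᵗ * (F * G + T′ * H - pᵗ) ∎
  where
  open ≈-Reasoning
  u₄ v₄ : Series
  u₄ = dil 4 u
  v₄ = dil 4 v

curve-o² : oᵗ * oᵗ ≈ pᵗ * (const (+ 2) * (F * G + T′ * H) - const (+ 3) * pᵗ)
curve-o² = begin
  oᵗ * oᵗ
    ≈⟨ SR.solve (X^ 2 ∷ dil 4 Ω ∷ []) (λ { (x ∷ w ∷ []) → 2 · (x :* w) :* (2 · (x :* w)) , 4 · (x :* x :* (w :* w)) }) refl ⟩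
  const (+ 4) * (X^ 2 * X^ 2 * (dil 4 Ω * dil 4 Ω))
    ≈⟨ *-congˡ (*-cong (≈-sym (X^-+ 2 2)) (≈-trans (≈-sym (dil-* 4 Ω Ω)) (≈-trans (dil-cong 4 Ω²) (≈-trans (dil-* 4 ψψ₇ _) (*-congˡ (dil-4σ (+ 3))))))) ⟩
  const (+ 4) * (X^ 4 * (dil 4 ψψ₇ * (dil 4 σ₇ - const (+ 3) * (X^ 4 * dil 4 ψψ₇))))
    ≈⟨ SR.solve (X^ 4 ∷ dil 4 ψψ₇ ∷ dil 4 σ₇ ∷ []) (λ { (x ∷ p ∷ s ∷ []) → 4 · (x :* (p :* (s :- 3 · (x :* p)))) ,
         2 · (x :* p) :* (2 · s :- 3 · (2 · (x :* p))) }) refl ⟩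
  pᵗ * (const (+ 2) * dil 4 σ₇ - const (+ 3) * pᵗ)
    ≈⟨ *-congˡ (+-congʳ (*-congˡ (≈-sym curve-σ))) ⟩
  pᵗ * (const (+ 2) * (F * G + T′ * H) - const (+ 3) * pᵗ) ∎
  where open ≈-Reasoning

a₄ b₄ c₄ d₄ e₄ f₄ : Series
a₄ = dil 4 odds-product
b₄ = dil 4 evens-product
c₄ = dil 4 (Pr 7 14)
d₄ = dil 4 (Pr 14 14)
e₄ = dil 4 ψ
f₄ = dil 28 ψ

e₄a₄ : e₄ * a₄ ≈ b₄
e₄a₄ = ≈-trans (≈-sym (dil-* 4 _ _)) (dil-cong 4 ψ*odds)

f₄c₄ : f₄ * c₄ ≈ d₄
f₄c₄ = ≈-trans (*-congʳ (≈-sym (dil-dil 4 7 ψ))) (≈-trans (≈-sym (dil-* 4 _ _)) (dil-cong 4 (≈-trans (*-congˡ (≈-sym (dil-Pr (+ 1) 7 1 2)))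
  (≈-trans (≈-sym (dil-* 7 _ _)) (≈-trans (dil-cong 7 ψ*odds) (dil-Pr (+ 1) 7 2 2))))))

dil-↑ : ∀ d .{{_ : NonZero d}} f k → dil d (f ↑ k) ≈ dil d f ↑ k
dil-↑ d f zero    = dil-𝟙 d
dil-↑ d f (suc k) = ≈-trans (dil-* d f (f ↑ k)) (*-congˡ (dil-↑ d f k))

K-product : C (+ 2) * b₄ ≈ X^ 12 * d₄ ↑ 7
K-product = ≈-trans C₂-product (*-congˡ (dil-↑ 4 (Pr 14 14) 7))

L-product : C (- + 1) * (a₄ * a₄) ≈ X^ 6 * (c₄ * c₄ * b₄ * d₄ ↑ 5)
L-product = ≈-trans (*-congˡ (≈-sym (dil-* 4 _ _))) (≈-trans C₋₁-product (*-congˡ (≈-trans (dil-* 4 _ _)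
  (*-cong (≈-trans (dil-* 4 _ _) (*-congʳ (dil-* 4 _ _))) (dil-↑ 4 (Pr 14 14) 5)))))

regular-a₄ : Regular a₄
regular-a₄ = regular-dil 4 odds-product (Pr-0 1 2)
regular-b₄ : Regular b₄
regular-b₄ = regular-dil 4 evens-product (Pr-0 2 2)
regular-c₄ : Regular c₄
regular-c₄ = regular-dil 4 (Pr 7 14) (Pr-0 7 14)

FT′ : F * T′ ≈ const (+ 2) * (X^ 1 * (e₄ * e₄))
FT′ = ≈-trans (SR.solve (F ∷ X^ 1 ∷ dil 8 ψ ∷ []) (λ { (f ∷ x ∷ t ∷ []) → f :* (2 · (x :* t)) , 2 · (x :* (f :* t)) }) refl)
  (*-congˡ (*-congˡ (≈-trans (*-congˡ (≈-sym (dil-dil 4 2 ψ))) (≈-trans (≈-sym (dil-* 4 _ _)) (≈-trans (dil-cong 4 (≈-sym ψ²)) (dil-* 4 _ _))))))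

GH : G * H ≈ const (+ 2) * (X^ 7 * (dil 28 ψ * dil 28 ψ))
GH = ≈-trans (SR.solve (G ∷ X^ 7 ∷ dil 56 ψ ∷ []) (λ { (f ∷ x ∷ t ∷ []) → f :* (2 · (x :* t)) , 2 · (x :* (f :* t)) }) refl)
    (*-congˡ (*-congˡ (≈-trans (*-congˡ (≈-sym (dil-dil 28 2 ψ))) (≈-trans (≈-sym (dil-* 28 _ _)) (≈-trans (dil-cong 28 (≈-sym ψ²)) (dil-* 28 _ _))))))

-- FT = 2tψ(t⁴)² and GH = 2t⁷ψ(t²⁸)², so the claim is that the infinite products C₂ and C₋₁ are in
-- the ratio t⁶ψ(t²⁸)² : ψ(t⁴)².
curve-LK : C (- + 1) * (G * H) ≈ C (+ 2) * (F * T′)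
curve-LK = ≈-trans (*-congˡ GH) (≈-trans (-≈𝟘⇒≈ (regular-* (regular-* (regular-* regular-a₄ regular-a₄) (regular-* regular-c₄ regular-c₄)) regular-b₄ _ (≈-trans
    (SR.solve (C (- + 1) ∷ C (+ 2) ∷ a₄ ∷ b₄ ∷ c₄ ∷ d₄ ∷ e₄ ∷ f₄ ∷ X^ 1 ∷ X^ 6 ∷ X^ 7 ∷ X^ 12 ∷ []) (λ { (L ∷ K ∷ a ∷ b ∷ c ∷ d ∷ e ∷ f ∷ x ∷ x₆ ∷ x₇ ∷ x₁₂ ∷ []) →
      a :* a :* (c :* c) :* b :* (L :* (2 · (x₇ :* (f :* f))) :- K :* (2 · (x :* (e :* e)))) ,
      2 · x₇ :* b :* (f :* c) :* (f :* c) :* (L :* (a :* a) :- x₆ :* (c :* c :* b :* d :^ 5)) :+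
      2 · x₇ :* b :* x₆ :* (c :* c :* b :* d :^ 5) :* (f :* c :+ d) :* (f :* c :- d) :+
      2 · b :* b :* c :* c :* d :^ 7 :* (x₆ :* x₇ :- x₁₂ :* x) :+
      (con (+ 0) :- 2 · x :* c :* c :* (e :* a) :* (e :* a)) :* (K :* b :- x₁₂ :* d :^ 7) :+
      (con (+ 0) :- 2 · x :* c :* c :* x₁₂ :* d :^ 7 :* (e :* a :+ b)) :* (e :* a :- b) }) refl)
    ((_ ⊙ L-product) ⊞ (_ ⊙ f₄c₄) ⊞ (_ ⊙ ≈-trans (≈-sym (X^-+ 6 7)) (X^-+ 12 1)) ⊞ (_ ⊙ K-product) ⊞ (_ ⊙ e₄a₄)))))
  (*-congˡ (≈-sym FT′)))

-- Multiplying by a₄b₄ = E(t⁴) removes the inverse of E(q²) contained in `Q`.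
dil-Q : dil 2 Q * (a₄ * b₄) ≈ d₄ * (c₄ * d₄) ↑ 3 * b₄
dil-Q = begin
  dil 2 Q * (a₄ * b₄)                                ≈⟨ *-congˡ E₄ ⟨
  dil 2 Q * dil 4 E                                  ≈⟨ *-cong (dil-cong 2 Q≈) (≈-sym (≈-trans (dil-cong 2 (at≈dil 2 E)) (dil-dil 2 2 E))) ⟩
  dil 2 (R * invS (at 2 E)) * dil 2 (at 2 E)         ≈⟨ dil-* 2 _ _ ⟨
  dil 2 (R * invS (at 2 E) * at 2 E)                 ≈⟨ dil-cong 2 (≈-trans (*-assoc R _ _) (≈-trans (*-congˡ (≈-trans (*-comm _ _) (≈-trans (*≈⊗ _ _) (≈-trans (invS-inverse (at 2 E) refl) (≈-sym 𝟙≈oneS))))) (*-identityʳ R))) ⟩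
  dil 2 R                                            ≈⟨ ≈-trans (dil-* 2 _ _) (*-cong (≈-trans (dil-* 2 _ _) (*-cong (dil-dil 2 28 E) (≈-trans (dil-↑ 2 (dil 14 E) 3) (↑-cong 3 (dil-dil 2 14 E))))) (dil-dil 2 4 E)) ⟩
  dil 56 E * dil 28 E ↑ 3 * dil 8 E                  ≈⟨ *-cong (*-cong E₅₆ (↑-cong 3 E₂₈)) E₈ ⟩
  d₄ * (c₄ * d₄) ↑ 3 * b₄                            ∎
  where
  open ≈-Reasoning
  R : Series
  R = dil 28 E * dil 14 E ↑ 3 * dil 4 E
  ↑-cong : ∀ k {f g} → f ≈ g → f ↑ k ≈ g ↑ k
  ↑-cong zero    p = ≈-refl
  ↑-cong (suc k) p = *-cong p (↑-cong k p)
  powS≈ : ∀ f k → powS f k ≈ f ↑ k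
  powS≈ f zero    = ≈-sym 𝟙≈oneS
  powS≈ f (suc k) = ≈-trans (≈-sym (*≈⊗ f (powS f k))) (*-congˡ (powS≈ f k))
  Q≈ : Q ≈ R * invS (at 2 E)
  Q≈ = ≈-trans (≈-sym (*≈⊗ _ _)) (*-congʳ (≈-trans (≈-sym (*≈⊗ _ _)) (*-cong (≈-trans (≈-sym (*≈⊗ _ _)) (*-cong (at≈dil 28 E) (≈-trans (powS≈ (at 14 E) 3) (↑-cong 3 (at≈dil 14 E))))) (at≈dil 4 E))))
  E-even : dil 2 E ≈ evens-product
  E-even = ≈-trans (dil-cong 2 E≈Pr) (dil-Pr (+ 1) 2 1 1)
  E₄ : dil 4 E ≈ a₄ * b₄
  E₄ = ≈-trans (dil-cong 4 E-parity) (dil-* 4 _ _)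
  E₈ : dil 8 E ≈ b₄
  E₈ = ≈-trans (≈-sym (dil-dil 4 2 E)) (dil-cong 4 E-even)
  E₂₈ : dil 28 E ≈ c₄ * d₄
  E₂₈ = ≈-trans (≈-sym (dil-dil 4 7 E)) (≈-trans (dil-cong 4 (≈-trans (dil-cong 7 E-parity) (≈-trans (dil-* 7 _ _) (*-cong (dil-Pr (+ 1) 7 1 2) (dil-Pr (+ 1) 7 2 2))))) (dil-* 4 _ _))
  E₅₆ : dil 56 E ≈ d₄
  E₅₆ = ≈-trans (≈-sym (dil-dil 4 14 E)) (dil-cong 4 (≈-trans (dil-cong 14 E≈Pr) (dil-Pr (+ 1) 14 1 1)))

-- In terms of q this is C₋₁ = q³Qψ(q²)ψ(q¹⁴); through it the quotient `Q` enters the algebra.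
C₋₁-Q : C (- + 1) ≈ X^ 6 * dil 2 Q * (dil 4 ψ * dil 28 ψ)
C₋₁-Q = -≈𝟘⇒≈ (regular-* (regular-* regular-a₄ regular-a₄) (regular-* regular-b₄ regular-c₄) _ (≈-trans
    (SR.solve (C (- + 1) ∷ dil 2 Q ∷ a₄ ∷ b₄ ∷ c₄ ∷ d₄ ∷ e₄ ∷ f₄ ∷ X^ 6 ∷ []) (λ { (L ∷ q ∷ a ∷ b ∷ c ∷ d ∷ e ∷ f ∷ x ∷ []) →
      a :* a :* (b :* c) :* (L :- x :* q :* (e :* f)) ,
      b :* c :* (L :* (a :* a) :- x :* (c :* c :* b :* d :^ 5)) :+
      (con (+ 0) :- x :* (e :* a) :* (f :* c)) :* (q :* (a :* b) :- d :* (c :* d) :^ 3 :* b) :+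
      (con (+ 0) :- x :* d :* (c :* d) :^ 3 :* b :* (f :* c)) :* (e :* a :- b) :+
      (con (+ 0) :- x :* d :* (c :* d) :^ 3 :* b :* b) :* (f :* c :- d) }) refl)
    ((_ ⊙ L-product) ⊞ (_ ⊙ dil-Q) ⊞ (_ ⊙ e₄a₄) ⊞ (_ ⊙ f₄c₄))))

-- The shape of A and B and the common factor

θ : ∀ a c .{{_ : NonZero a}} .{{_ : NonZero c}} → Series
θ a c = gen (jacobiFibres a c) (λ _ → + 1)

ones-dilated : ∀ e d a c .{{_ : NonZero d}} .{{_ : NonZero a}} .{{_ : NonZero c}} → gen (dilatedTheta e d a c) (λ _ → + 1) ≈ X^ e * dil d (θ a c)
ones-dilated e d a c = ≈-trans (gen-shift e _ _) (*-congˡ (gen-dilate d (jacobiFibres a c) _))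

plain-even-4 : a₁ ≈ X^ 5 * dil 4 (θ 1 13)
plain-even-4 = ≈-trans (Θ-parity-even 4 refl (λ _ → + 0) (λ _ → + 1))
  (≈-trans (gen-odds (ℤ-fibres (weight 4) (∣z∣≤weight 4)) (λ _ → + 1) (dilatedTheta 5 4 1 13) (λ _ → + 1)
  weight-4-odd
  (λ _ → refl)) (ones-dilated 5 4 1 13))

plain-even-5 : a₂ ≈ dil 4 (θ 9 5)
plain-even-5 = ≈-trans (Θ-parity-odd 5 refl (λ _ → + 0) (λ _ → + 1))
  (≈-trans (gen-evens (ℤ-fibres (weight 5) (∣z∣≤weight 5)) (λ _ → + 1) (dilate 4 (jacobiFibres 9 5)) (λ _ → + 1)
  weight-5-even
  (λ _ → refl)) (gen-dilate 4 (jacobiFibres 9 5) _))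

plain-even-6 : a₃ ≈ X^ 1 * dil 4 (θ 3 11)
plain-even-6 = ≈-trans (Θ-parity-even 6 refl (λ _ → + 0) (λ _ → + 1))
  (≈-trans (gen-odds (ℤ-fibres (weight 6) (∣z∣≤weight 6)) (λ _ → + 1) (dilatedTheta 1 4 3 11) (λ _ → + 1)
  weight-6-odd
  (λ _ → refl)) (ones-dilated 1 4 3 11))

plain-odd-4 : b₁ ≈ dil 8 (θ 4 3)
plain-odd-4 = ≈-trans (Θ-parity-even 4 refl (λ _ → + 1) (λ _ → + 0))
  (≈-trans (gen-evens (ℤ-fibres (weight 4) (∣z∣≤weight 4)) (λ _ → + 1) (dilate 8 (jacobiFibres 4 3)) (λ _ → + 1)
  weight-4-even
  (λ _ → refl)) (gen-dilate 8 (jacobiFibres 4 3) _))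

plain-odd-5 : b₂′ ≈ X^ 3 * dil 8 (θ 1 6)
plain-odd-5 = ≈-trans (Θ-parity-odd 5 refl (λ _ → + 1) (λ _ → + 0))
  (≈-trans (gen-odds (ℤ-fibres (weight 5) (∣z∣≤weight 5)) (λ _ → + 1) (dilatedTheta 3 8 1 6) (λ _ → + 1)
  weight-5-odd
  (λ _ → refl)) (ones-dilated 3 8 1 6))

plain-odd-6 : b₃ ≈ dil 8 (θ 5 2)
plain-odd-6 = ≈-trans (Θ-parity-even 6 refl (λ _ → + 1) (λ _ → + 0))
  (≈-trans (gen-evens (ℤ-fibres (weight 6) (∣z∣≤weight 6)) (λ _ → + 1) (dilate 8 (jacobiFibres 5 2)) (λ _ → + 1)
  weight-6-even
  (λ _ → refl)) (gen-dilate 8 (jacobiFibres 5 2) _))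

whole : ∀ i → Plain.even-part i + Plain.odd-part i ≈ Θ i (λ _ → + 1)
whole i = ≈-trans (≈-sym (gen-+ _ _ _)) (gen-cong _ λ z _ → go (isOddAt i z))
  where
  go : ∀ b → (if b then + 0 else + 1) ℤ.+ (if b then + 1 else + 0) ≡ + 1
  go true  = refl
  go false = refl

jacobi-weight : ∀ i a c l z {ok : T (i ℕ.≤ᵇ 6)} →
  (+ a ℤ.+ + c) ℤ.* (l ℤ.* (l ℤ.- + 1)) ℤ.+ + 2 ℤ.* + a ℤ.* l ≡ + 2 ℤ.* (z ℤ.* (+ 7 ℤ.* z ℤ.+ + 2 ℤ.* + i ℤ.- + 6)) → weight i z ≡ jacobi a c l
jacobi-weight i a c l z {ok} e = sym (fromDouble (trans (2*jacobi a c l) (trans e (cong (+ 2 ℤ.*_) (sym (weight-formula i z (ℕₚ.≤ᵇ⇒≤ i 6 ok)))))))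

-- The whole of runner 4 in the variable t is the series that, taken at t⁴, gives the even part of
-- runner 5. Likewise runner 5 passes to 6 and runner 6 to 4, up to powers of t; this cyclic
-- exchange is behind A = t⁶Â(t⁴).
whole-4 : a₁ + b₁ ≈ θ 9 5
whole-4 = ≈-trans (whole 4) (gen-iso _ (jacobiFibres 9 5) id id (λ _ → refl) (λ _ → refl) (λ z → sym (jacobi-weight 4 9 5 z z (ℤR.solve (z ∷ []) (λ { (z ∷ []) →
  (con (+ 9) :+ con (+ 5)) :* (z :* (z :- con (+ 1))) :+ 2 · con (+ 9) :* z , 2 · (z :* (7 · z :+ 2 · con (+ 4) :- con (+ 6))) }) refl))) (λ _ → refl))

whole-5 : a₂ + b₂′ ≈ θ 3 11
whole-5 = ≈-trans (whole 5) (gen-iso _ (jacobiFibres 3 11) -_ -_ ℤₚ.neg-involutive ℤₚ.neg-involutive (λ z → sym (jacobi-weight 5 3 11 (- z) z (ℤR.solve (z ∷ []) (λ { (z ∷ []) →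
  (con (+ 3) :+ con (+ 11)) :* (:neg z :* (:neg z :- con (+ 1))) :+ 2 · con (+ 3) :* :neg z , 2 · (z :* (7 · z :+ 2 · con (+ 5) :- con (+ 6))) }) refl))) (λ _ → refl))

whole-6 : a₃ + b₃ ≈ θ 1 13
whole-6 = ≈-trans (whole 6) (gen-iso _ (jacobiFibres 1 13) -_ -_ ℤₚ.neg-involutive ℤₚ.neg-involutive (λ z → sym (jacobi-weight 6 1 13 (- z) z (ℤR.solve (z ∷ []) (λ { (z ∷ []) →
  (con (+ 1) :+ con (+ 13)) :* (:neg z :* (:neg z :- con (+ 1))) :+ 2 · con (+ 1) :* :neg z , 2 · (z :* (7 · z :+ 2 · con (+ 6) :- con (+ 6))) }) refl))) (λ _ → refl))

Â B̂ : Series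
Â = θ 1 13 * θ 9 5 * θ 3 11
B̂ = θ 4 3 * θ 1 6 * θ 5 2

A-shape : A ≈ X^ 6 * dil 4 Â
A-shape = ≈-trans (*-cong (*-cong plain-even-4 plain-even-5) plain-even-6) (≈-trans
  (SR.solve (X^ 5 ∷ X^ 1 ∷ dil 4 (θ 1 13) ∷ dil 4 (θ 9 5) ∷ dil 4 (θ 3 11) ∷ []) (λ { (x ∷ y ∷ a ∷ b ∷ c ∷ []) → x :* a :* b :* (y :* c) , x :* y :* (a :* b :* c) }) refl)
  (*-cong (≈-sym (X^-+ 5 1)) (≈-sym (≈-trans (dil-* 4 _ _) (*-congʳ (dil-* 4 _ _))))))

B-shape : B ≈ X^ 3 * dil 8 B̂
B-shape = ≈-trans (*-cong (*-cong plain-odd-4 plain-odd-5) plain-odd-6) (≈-trans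
  (SR.solve (X^ 3 ∷ dil 8 (θ 4 3) ∷ dil 8 (θ 1 6) ∷ dil 8 (θ 5 2) ∷ []) (λ { (x ∷ a ∷ b ∷ c ∷ []) → a :* (x :* b) :* c , x :* (a :* b :* c) }) refl)
  (*-congˡ (≈-sym (≈-trans (dil-* 8 _ _) (*-congʳ (dil-* 8 _ _))))))

total : A + A′ + B′ + B ≈ Â
total = ≈-trans (SR.solve (a₁ ∷ a₂ ∷ a₃ ∷ b₁ ∷ b₂′ ∷ b₃ ∷ []) (λ { (a ∷ b ∷ c ∷ x ∷ y ∷ z ∷ []) →
    a :* b :* c :+ (x :* b :* c :+ a :* y :* c :+ a :* b :* z) :+ (a :* y :* z :+ x :* b :* z :+ x :* y :* c) :+ x :* y :* z , (c :+ z) :* (a :+ x) :* (b :+ y) }) refl)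
  (*-cong (*-cong whole-6 whole-4) whole-5)

triple-0 : ∀ f g h → f 0 ≡ + 1 → g 0 ≡ + 1 → h 0 ≡ + 1 → (f * g * h) 0 ≡ + 1
triple-0 f g h p q r = trans (coeff-*-zero _ h) (cong₂ ℤ._*_ (trans (coeff-*-zero f g) (cong₂ ℤ._*_ p q)) r)

Â-0 : Â 0 ≡ + 1
Â-0 = triple-0 (θ 1 13) (θ 9 5) (θ 3 11) (coeff-gen (jacobiFibres 1 13) _ 0) (coeff-gen (jacobiFibres 9 5) _ 0) (coeff-gen (jacobiFibres 3 11) _ 0)

B̂-0 : B̂ 0 ≡ + 1
B̂-0 = triple-0 (θ 4 3) (θ 1 6) (θ 5 2) (coeff-gen (jacobiFibres 4 3) _ 0) (coeff-gen (jacobiFibres 1 6) _ 0) (coeff-gen (jacobiFibres 5 2) _ 0)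

≡1⇒≢0 : ∀ {i} → i ≡ + 1 → i ≢ + 0
≡1⇒≢0 refl ()

regular-A : Regular A
regular-A = regular-cong (≈-sym A-shape) (regular-* (regular-X^ 6) (regular-dil 4 Â (≡1⇒≢0 Â-0)))

regular-B : Regular B
regular-B = regular-cong (≈-sym B-shape) (regular-* (regular-X^ 3) (regular-dil 8 B̂ (≡1⇒≢0 B̂-0)))

-- Both products begin with +2t¹⁰, so their sum cannot vanish; this decides the sign in `A-B`.
regular-Ap+BFH : Regular (A * pᵗ + B * (F * H))
regular-Ap+BFH = regular-cong (≈-sym shape) (regular-* (regular-X^ 10) (regular-* (regular-const (+ 2) λ ()) (regular-unit s λ e → case trans (sym value) e of λ ())))
  where
  s : Series
  s = dil 4 Â * dil 4 ψψ₇ + dil 8 B̂ * dil 4 v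
  shape : A * pᵗ + B * (F * H) ≈ X^ 10 * (const (+ 2) * s)
  shape = ≈-trans (+-cong (*-congʳ A-shape) (*-cong B-shape FH)) (≈-trans
    (SR.solve (X^ 6 ∷ X^ 4 ∷ X^ 3 ∷ X^ 7 ∷ dil 4 Â ∷ dil 4 ψψ₇ ∷ dil 8 B̂ ∷ dil 4 v ∷ []) (λ { (x₆ ∷ x₄ ∷ x₃ ∷ x₇ ∷ a ∷ p ∷ b ∷ v ∷ []) →
      x₆ :* a :* (2 · (x₄ :* p)) :+ x₃ :* b :* (2 · (x₇ :* v)) , x₆ :* x₄ :* (2 · (a :* p)) :+ x₃ :* x₇ :* (2 · (b :* v)) }) refl)
    (≈-trans (+-cong (*-congʳ (≈-sym (X^-+ 6 4))) (*-congʳ (≈-sym (X^-+ 3 7))))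
    (SR.solve (X^ 10 ∷ dil 4 Â ∷ dil 4 ψψ₇ ∷ dil 8 B̂ ∷ dil 4 v ∷ []) (λ { (x ∷ a ∷ p ∷ b ∷ v ∷ []) →
      x :* (2 · (a :* p)) :+ x :* (2 · (b :* v)) , x :* (2 · (a :* p :+ b :* v)) }) refl)))
  product-0 : ∀ f g → f 0 ≡ + 1 → g 0 ≡ + 1 → (f * g) 0 ≡ + 1
  product-0 f g p q = trans (coeff-*-zero f g) (cong₂ ℤ._*_ p q)
  value : s 0 ≡ + 2
  value = trans (coeff-+ _ _ 0) (cong₂ ℤ._+_
    (product-0 _ _ (trans (dil-zero 4 Â) Â-0) (trans (dil-zero 4 ψψ₇) (product-0 ψ _ refl (dil-zero 7 ψ))))
    (product-0 _ _ (trans (dil-zero 8 B̂) B̂-0) (trans (dil-zero 4 v) (product-0 _ φ (dil-zero 14 ψ) refl))))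

regular-F : Regular F
regular-F = regular-dil 4 φ (λ ())

regular-T : Regular T′
regular-T = regular-* (regular-const (+ 2) λ ()) (regular-* (regular-X^ 1) (regular-dil 8 ψ (λ ())))

regular-G : Regular G
regular-G = regular-dil 28 φ (λ ())

regular-H : Regular H
regular-H = regular-* (regular-const (+ 2) λ ()) (regular-* (regular-X^ 7) (regular-dil 56 ψ (λ ())))

regular-p : Regular pᵗ
regular-p = regular-* (regular-const (+ 2) λ ()) (regular-* (regular-X^ 4) (regular-dil 4 ψψ₇ (λ e → case trans (sym e) (coeff-*-zero ψ (dil 7 ψ)) of λ q →
  case trans q (cong (+ 1 ℤ.*_) (dil-zero 7 ψ)) of λ ())))

component : ∀ {f : Series} {fs : List Series} → All (_≈ 𝟘) (f ∷ fs) → f ≈ 𝟘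
component (p ∷ _) = p
rest : ∀ {f : Series} {fs : List Series} → All (_≈ 𝟘) (f ∷ fs) → All (_≈ 𝟘) fs
rest (_ ∷ ps) = ps

open Solution F T′ G H pᵗ oᵗ A A′ B′ B (C (+ 2)) (C (- + 1)) (C (+ 1)) (C (+ 0)) curve-p² curve-S curve-o²
  (-≈𝟘⇒≈ (component coreRelations)) (-≈𝟘⇒≈ (component (rest coreRelations))) (-≈𝟘⇒≈ (component (rest (rest coreRelations))))
  (-≈𝟘⇒≈ (component (rest (rest (rest coreRelations))))) (-≈𝟘⇒≈ (component (rest (rest (rest (rest coreRelations))))))
  (-≈𝟘⇒≈ (component (rest (rest (rest (rest (rest (rest coreRelations)))))))) (-≈𝟘⇒≈ (component (rest (rest (rest (rest (rest (rest (rest coreRelations)))))))))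
  curve-LK regular-F regular-T regular-G regular-H regular-p regular-A regular-B regular-Ap+BFH regular-f₂ regular-e regular-σ+2p regular-x+p regular-y+p public

Λ : Series
Λ = λ₀ + λ₁ + λ₂ + λ₃

-- Since A, A′, B′, B and the λᵢ are proportional, A is to the sum of the former as λ₀ is to the sum
-- of the latter.
A*Λ : A * Λ ≈ (A + A′ + B′ + B) * λ₀
A*Λ = -≈𝟘⇒≈ (regular-* (regular-* (regular-const (+ 2) λ ()) (regular-* regular-G regular-H)) (regular-* regular-F regular-H) _ (≈-trans
  (SR.solve (F ∷ T′ ∷ G ∷ H ∷ pᵗ ∷ A ∷ A′ ∷ B′ ∷ B ∷ λ₀ ∷ λ₁ ∷ λ₂ ∷ λ₃ ∷ []) (λ { (F ∷ T ∷ G ∷ H ∷ p ∷ A ∷ A′ ∷ B′ ∷ B ∷ l₀ ∷ l₁ ∷ l₂ ∷ l₃ ∷ []) →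
    2 · (G :* H) :* (F :* H) :* (A :* (l₀ :+ l₁ :+ l₂ :+ l₃) :- (A :+ A′ :+ B′ :+ B) :* l₀) ,
    A :* (F :* H) :* (2 · (G :* H) :* l₁ :- l₀ :* (T :* T :- H :* H)) :+
    (con (+ 0) :- l₀ :* (F :* H)) :* (2 · (G :* H) :* A′ :- A :* (T :* T :- H :* H)) :+
    A :* (F :* H) :* (2 · (G :* H) :* l₂ :- l₃ :* (F :* F :- G :* G)) :+
    (con (+ 0) :- l₀ :* (F :* H)) :* (2 · (G :* H) :* B′ :- B :* (F :* F :- G :* G)) :+
    (con (+ 0) :- A :* (2 · (G :* H) :+ F :* F :- G :* G)) :* (l₀ :* p :- l₃ :* (F :* H)) :+
    l₀ :* (2 · (G :* H) :+ F :* F :- G :* G) :* (A :* p :- B :* (F :* H)) }) refl)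
  ((_ ⊙ λ₁-λ₀) ⊞ (_ ⊙ A′-A) ⊞ (_ ⊙ λ₂-λ₃) ⊞ (_ ⊙ B′-B) ⊞ (_ ⊙ λ₀-λ₃) ⊞ (_ ⊙ A-B))))

-- This is λ₀ with F, G, p replaced by φ(t), φ(t⁷), 2tψ(t)ψ(t⁷), so that the dilation by 4 leads
-- back to λ₀.
D : Series
D = dil 7 φ * dil 7 φ * dil 7 φ - φ * φ * dil 7 φ + const (+ 2) * (const (+ 2) * (X^ 1 * ψψ₇)) * φ

-- Dissecting twice sorts the exponents modulo 4: TG, FH, o and p collect the residues 1, 3, 2 and
-- 0.
ψψ₇-quarters : const (+ 2) * (X^ 1 * ψψ₇) ≈ T′ * G + F * H + oᵗ + pᵗ
ψψ₇-quarters = begin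
  const (+ 2) * (X^ 1 * ψψ₇)
    ≈⟨ *-congˡ (*-congˡ (≈-trans ψψ₇-dissection (+-cong dil-Ω₂ (*-congˡ dil-ψψ₇-dissection)))) ⟩
  const (+ 2) * (X^ 1 * (dil 4 u + X^ 6 * dil 4 v + X^ 1 * (dil 4 Ω + X^ 2 * dil 4 ψψ₇)))
    ≈⟨ SR.solve (X^ 1 ∷ X^ 6 ∷ X^ 2 ∷ dil 4 u ∷ dil 4 v ∷ dil 4 Ω ∷ dil 4 ψψ₇ ∷ []) (λ { (x ∷ y ∷ z ∷ u ∷ v ∷ w ∷ p ∷ []) →
         2 · (x :* (u :+ y :* v :+ x :* (w :+ z :* p))) , 2 · (x :* u) :+ 2 · (x :* y :* v) :+ 2 · (x :* x :* w) :+ 2 · (x :* x :* z :* p) }) refl ⟩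
  const (+ 2) * (X^ 1 * dil 4 u) + const (+ 2) * (X^ 1 * X^ 6 * dil 4 v) + const (+ 2) * (X^ 1 * X^ 1 * dil 4 Ω) + const (+ 2) * (X^ 1 * X^ 1 * X^ 2 * dil 4 ψψ₇)
    ≈⟨ +-cong (+-cong (+-cong (≈-sym T′G) (≈-trans (*-congˡ (*-congʳ (≈-sym (X^-+ 1 6)))) (≈-sym FH))) (*-congˡ (*-congʳ (≈-sym (X^-+ 1 1)))))
         (*-congˡ (*-congʳ (≈-trans (*-congʳ (≈-sym (X^-+ 1 1))) (≈-sym (X^-+ 2 2))))) ⟩
  T′ * G + F * H + oᵗ + pᵗ ∎
  where
  open ≈-Reasoning
  dil-ψψ₇-dissection : dil 2 ψψ₇ ≈ dil 4 Ω + X^ 2 * dil 4 ψψ₇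
  dil-ψψ₇-dissection = ≈-trans (dil-cong 2 ψψ₇-dissection) (≈-trans (dil-+ 2 _ _) (+-cong (dil-dil 2 2 Ω) (≈-trans (dil-* 2 _ _) (*-cong (dil-X^ 2 1) (dil-dil 2 2 ψψ₇)))))

φ₇-dissection : dil 7 φ ≈ G + H
φ₇-dissection = ≈-trans (dil-cong 7 φ-dissection) (≈-trans (dil-+ 7 _ _) (+-cong (dil-dil 7 4 φ)
  (≈-trans (dil-const-* 7 (+ 2) _) (*-congˡ (≈-trans (dil-* 7 _ _) (*-cong (dil-X^ 7 1) (dil-dil 7 8 ψ)))))))

D≈Λ : D ≈ Λ
D≈Λ = ≈-trans (+-cong (+-cong (*-cong (*-cong φ₇-dissection φ₇-dissection) φ₇-dissection) (-‿cong (*-cong (*-cong φ-dissection φ-dissection) φ₇-dissection)))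
    (*-cong (*-congˡ ψψ₇-quarters) φ-dissection))
  (SR.solve (F ∷ T′ ∷ G ∷ H ∷ pᵗ ∷ oᵗ ∷ []) (λ { (F ∷ T ∷ G ∷ H ∷ p ∷ o ∷ []) →
    (G :+ H) :* (G :+ H) :* (G :+ H) :- (F :+ T) :* (F :+ T) :* (G :+ H) :+ 2 · (T :* G :+ F :* H :+ o :+ p) :* (F :+ T) ,
    G :* G :* G :- F :* F :* G :+ 2 · p :* F :+ (3 · (G :* G :* H) :+ F :* F :* H :+ 2 · T :* o) :+
    (3 · (G :* (H :* H)) :+ T :* T :* G :+ 2 · F :* o) :+ (H :* H :* H :- T :* T :* H :+ 2 · p :* T) }) refl)

dil-Λ : dil 4 Λ ≈ λ₀
dil-Λ = ≈-trans (dil-cong 4 (≈-sym D≈Λ)) (≈-trans (dil-+ 4 _ _) (+-cong (≈-trans (dil-+ 4 _ _) (+-cong (≈-trans (dil-* 4 _ _) (*-cong (≈-trans (dil-* 4 _ _) (*-cong φ₂₈ φ₂₈)) φ₂₈))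
    (≈-trans (dil-neg 4 _) (-‿cong (≈-trans (dil-* 4 _ _) (*-cong (dil-* 4 _ _) φ₂₈))))))
  (≈-trans (dil-* 4 _ _) (*-congʳ (≈-trans (dil-const-* 4 (+ 2) _) (*-congˡ (≈-trans (dil-const-* 4 (+ 2) _) (*-congˡ (≈-trans (dil-* 4 _ _) (*-congʳ (dil-X^ 4 1)))))))))))
  where
  φ₂₈ : dil 4 (dil 7 φ) ≈ G
  φ₂₈ = dil-dil 4 7 φ

-- A solution of X⁶ S(q⁴) f(q) = S(q) f(q⁴) is determined by its coefficient of X², its lowest term.
dilation-rigid : ∀ S f → S 0 ≡ + 1 → X^ 6 * (dil 4 S * f) ≈ S * dil 4 f → (∀ k → k ℕ.< 3 → f k ≡ + 0) → f ≈ 𝟘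
dilation-rigid S f S₀ e low = coeffs λ n → trans (strong-induction (λ n → f n ≡ + 0) step n) (sym (coeff-𝟘 n))
  where
  dil-below : ∀ n → (∀ k → k ℕ.< n → f k ≡ + 0) → ∀ k → k ℕ.< n ℕ.* 4 → dil 4 f k ≡ + 0
  dil-below n ih k k<4n = trans (sym (at-degree (at≈dil 4 f) k)) (go (k % 4 ℕ.≡ᵇ 0) (ih (k / 4) (DM.m<n*o⇒m/o<n k<4n)))
    where
    go : ∀ b {i} → i ≡ + 0 → (if b then i else + 0) ≡ + 0
    go true  p = p
    go false _ = refl
  step : ∀ n → (∀ k → k ℕ.< n → f k ≡ + 0) → f n ≡ + 0
  step n ih with n ℕ.<? 3
  ... | yes n<3 = low n n<3
  ... | no n≮3 = begin
    f n                                   ≡⟨ sym (ℤₚ.*-identityˡ (f n)) ⟩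
    + 1 ℤ.* f n                           ≡⟨ cong (ℤ._* f n) (sym (trans (dil-zero 4 S) S₀)) ⟩
    dil 4 S 0 ℤ.* f n                     ≡⟨ sym (coeff-*-lowest 0 n (dil 4 S) f (λ _ ()) ih) ⟩
    (dil 4 S * f) n                       ≡⟨ sym (coeff-X^*-≥ 6 (dil 4 S * f) n) ⟩
    (X^ 6 * (dil 4 S * f)) (6 ℕ.+ n)      ≡⟨ at-degree e (6 ℕ.+ n) ⟩
    (S * dil 4 f) (6 ℕ.+ n)               ≡⟨ coeff-*-lowest 0 (6 ℕ.+ n) S (dil 4 f) (λ _ ()) (λ k k<6+n → dil-below n ih k (ℕₚ.<-trans k<6+n small)) ⟩
    S 0 ℤ.* dil 4 f (6 ℕ.+ n)             ≡⟨ cong (S 0 ℤ.*_) (dil-below n ih (6 ℕ.+ n) small) ⟩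
    S 0 ℤ.* + 0                           ≡⟨ ℤₚ.*-zeroʳ (S 0) ⟩
    + 0                                   ∎
    where
    open ≡-Reasoning
    small : 6 ℕ.+ n ℕ.< n ℕ.* 4
    small = ℕₚ.≤-trans (ℕₚ.≤-reflexive (cong (ℕ._+ n) refl)) (ℕₚ.≤-trans (ℕₚ.+-monoˡ-≤ n {7} {n ℕ.* 3} (ℕₚ.≤-trans (ℕₚ.n≤1+n 7) (ℕₚ.≤-trans (ℕₚ.n≤1+n 8) (ℕₚ.*-monoˡ-≤ 3 (ℕₚ.≮⇒≥ n≮3)))))
      (ℕₚ.≤-reflexive (trans (ℕₚ.+-comm (n ℕ.* 3) n) (sym (ℕₚ.*-suc n 3)))))

-- A monomial with t⁶c(t) = c(t⁴) must have exponent 2; the coefficient 8 is that of t² in `Λ`.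
c : Series
c = const (+ 8) * X^ 2

-- With A = t⁶Â(t⁴) the proportionality `A*Λ` becomes a functional equation for Λ, which cÂ
-- satisfies too. The difference vanishes by `dilation-rigid` because its coefficients up to t² do.
Λ≈cÂ : Λ ≈ c * Â
Λ≈cÂ = -≈𝟘⇒≈ (dilation-rigid Â (Λ - c * Â) Â-0 functional low)
  where
  open ≈-Reasoning
  dil-cÂ : dil 4 (Λ - c * Â) ≈ λ₀ - const (+ 8) * X^ 8 * dil 4 Â
  dil-cÂ = ≈-trans (dil-+ 4 _ _) (+-cong dil-Λ (≈-trans (dil-neg 4 _) (-‿cong (≈-trans (dil-* 4 _ _) (*-congʳ (≈-trans (dil-const-* 4 (+ 8) _) (*-congˡ (dil-X^ 4 2))))))))
  functional : X^ 6 * (dil 4 Â * (Λ - c * Â)) ≈ Â * dil 4 (Λ - c * Â)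
  functional = begin
    X^ 6 * (dil 4 Â * (Λ - const (+ 8) * X^ 2 * Â))
      ≈⟨ SR.solve (X^ 6 ∷ dil 4 Â ∷ Λ ∷ X^ 2 ∷ Â ∷ []) (λ { (x ∷ a ∷ l ∷ y ∷ s ∷ []) → x :* (a :* (l :- 8 · y :* s)) , x :* a :* l :- s :* (8 · (x :* y) :* a) }) refl ⟩
    X^ 6 * dil 4 Â * Λ - Â * (const (+ 8) * (X^ 6 * X^ 2) * dil 4 Â)
      ≈⟨ +-cong (≈-trans (*-congʳ (≈-sym A-shape)) (≈-trans A*Λ (*-congʳ total))) (-‿cong (*-congˡ (*-congʳ (*-congˡ (≈-sym (X^-+ 6 2)))))) ⟩
    Â * λ₀ - Â * (const (+ 8) * X^ 8 * dil 4 Â)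
      ≈⟨ SR.solve (Â ∷ λ₀ ∷ const (+ 8) * X^ 8 * dil 4 Â ∷ []) (λ { (s ∷ l ∷ y ∷ []) → s :* l :- s :* y , s :* (l :- y) }) refl ⟩
    Â * (λ₀ - const (+ 8) * X^ 8 * dil 4 Â)
      ≈⟨ *-congˡ (≈-sym dil-cÂ) ⟩
    Â * dil 4 (Λ - c * Â) ∎
  Λ-start : prefix 3 Λ ≡ + 0 ∷ + 0 ∷ + 8 ∷ []
  Λ-start = Truncation.prefix-expr 3 coefficients (leading 3) (coefficients-known 3) (Λ-expr (Vec.tabulate var))
    where
    Λ-expr : Vars 6 → Expr 6
    Λ-expr = λ { (F ∷ T ∷ G ∷ H ∷ p ∷ o ∷ []) →
      G :* G :* G :- F :* F :* G :+ 2 · p :* F :+ (3 · (G :* G :* H) :+ F :* F :* H :+ 2 · T :* o) :+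
      (3 · (G :* (H :* H)) :+ T :* T :* G :+ 2 · F :* o) :+ (H :* H :* H :- T :* T :* H :+ 2 · p :* T) }
  cÂ-value : ∀ k → (c * Â) k ≡ + 8 ℤ.* (X^ 2 * Â) k
  cÂ-value k = trans (at-degree (*-assoc (const (+ 8)) (X^ 2) Â) k) (coeff-const-* (+ 8) (X^ 2 * Â) k)
  difference : ∀ k {i j} → Λ k ≡ i → (X^ 2 * Â) k ≡ j → (Λ - c * Â) k ≡ i ℤ.- + 8 ℤ.* j
  difference k p q = trans (coeff-- Λ (c * Â) k) (cong₂ ℤ._-_ p (trans (cÂ-value k) (cong (+ 8 ℤ.*_) q)))
  low : ∀ k → k ℕ.< 3 → (Λ - c * Â) k ≡ + 0
  low 0 _ = difference 0 (∷-injectiveˡ Λ-start) (coeff-X^*-< 2 Â 0 (s≤s z≤n))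
  low 1 _ = difference 1 (∷-injectiveˡ (∷-injectiveʳ Λ-start)) (coeff-X^*-< 2 Â 1 (s≤s (s≤s z≤n)))
  low 2 _ = difference 2 (∷-injectiveˡ (∷-injectiveʳ (∷-injectiveʳ Λ-start))) (trans (coeff-X^*-≥ 2 Â 0) Â-0)
  low (suc (suc (suc _))) (s≤s (s≤s (s≤s ())))

-- This is `Λ≈cÂ` at t⁴, where cÂ becomes 8t⁸Â(t⁴) = 8t²A.
cA≈λ₀ : c * A ≈ λ₀
cA≈λ₀ = ≈-trans (≈-trans (*-congˡ A-shape) (≈-trans (SR.solve (X^ 2 ∷ X^ 6 ∷ dil 4 Â ∷ []) (λ { (x ∷ y ∷ a ∷ []) → 8 · x :* (y :* a) , 8 · (x :* y) :* a }) refl)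
  (≈-trans (*-congʳ (*-congˡ (≈-trans (≈-sym (X^-+ 2 6)) (≈-sym (dil-X^ 4 2))))) (≈-trans (*-congʳ (≈-sym (dil-const-* 4 (+ 8) (X^ 2)))) (≈-sym (dil-* 4 c Â))))))
  (≈-trans (dil-cong 4 (≈-sym Λ≈cÂ)) dil-Λ)

cB≈λ₃ : c * B ≈ λ₃
cB≈λ₃ = -≈𝟘⇒≈ (regular-* regular-F regular-H _ (≈-trans
  (SR.solve (F ∷ H ∷ pᵗ ∷ A ∷ B ∷ λ₀ ∷ λ₃ ∷ c ∷ []) (λ { (F ∷ H ∷ p ∷ A ∷ B ∷ l₀ ∷ l₃ ∷ c ∷ []) →
    F :* H :* (c :* B :- l₃) , (con (+ 0) :- c) :* (A :* p :- B :* (F :* H)) :+ p :* (c :* A :- l₀) :+ 1 · (l₀ :* p :- l₃ :* (F :* H)) }) refl)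
  ((_ ⊙ A-B) ⊞ (_ ⊙ cA≈λ₀) ⊞ (_ ⊙ λ₀-λ₃))))

open Scaled c cA≈λ₀ cB≈λ₃ public

-- The formulas for C₁ and C₀

dil-expr : ∀ d .{{_ : NonZero d}} {n} (ρ ρ′ : Vec Series n) → Pointwise (λ f g → dil d f ≈ g) ρ ρ′ → ∀ e → dil d (SR.⟦ e ⟧ ρ) ≈ SR.⟦ e ⟧ ρ′
dil-expr d ρ ρ′ p (var i)  = Pointwise.lookup p i
dil-expr d ρ ρ′ p (con c)  = dil-const d c
dil-expr d ρ ρ′ p (a :+ b) = ≈-trans (dil-+ d _ _) (+-cong (dil-expr d ρ ρ′ p a) (dil-expr d ρ ρ′ p b))
dil-expr d ρ ρ′ p (a :* b) = ≈-trans (dil-* d _ _) (*-cong (dil-expr d ρ ρ′ p a) (dil-expr d ρ ρ′ p b))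
dil-expr d ρ ρ′ p (a :- b) = ≈-trans (dil-+ d _ _) (+-cong (dil-expr d ρ ρ′ p a) (≈-trans (dil-neg d _) (-‿cong (dil-expr d ρ ρ′ p b))))
dil-expr d ρ ρ′ p (:neg a) = ≈-trans (dil-neg d _) (-‿cong (dil-expr d ρ ρ′ p a))
dil-expr d ρ ρ′ p (a :^ k) = go k
  where
  go : ∀ k → dil d (SR.⟦ a ⟧ ρ ↑ k) ≈ SR.⟦ a ⟧ ρ′ ↑ k
  go zero    = dil-𝟙 d
  go (suc k) = ≈-trans (dil-* d _ _) (*-cong (dil-expr d ρ ρ′ p a) (go k))

X^≈↑ : ∀ n → X^ n ≈ X^ 1 ↑ n
X^≈↑ zero    = X^-zero
X^≈↑ (suc n) = ≈-trans (X^-+ 1 n) (*-congˡ (X^≈↑ n))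

powS≈↑ : ∀ {f g} k → f ≈ g → powS f k ≈ g ↑ k
powS≈↑ zero    p = ≈-sym 𝟙≈oneS
powS≈↑ (suc k) p = ≈-trans (≈-sym (*≈⊗ _ _)) (*-cong p (powS≈↑ k p))

⊗≈ : ∀ {f f′ g g′} → f ≈ f′ → g ≈ g′ → f ⊗ g ≈ f′ * g′
⊗≈ p q = ≈-trans (≈-sym (*≈⊗ _ _)) (*-cong p q)

⊕≈ : ∀ {f f′ g g′} → f ≈ f′ → g ≈ g′ → f ⊕ g ≈ f′ + g′
⊕≈ p q = ≈-trans (≈-sym (+≈⊕ _ _)) (+-cong p q)

qpow≈↑ : ∀ m {f g} → f ≈ g → qpow m f ≈ X^ 1 ↑ m * g
qpow≈↑ m p = ≈-trans (qpow≈ m _) (*-cong (X^≈↑ m) p)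

scale≈ : ∀ c {f g} → f ≈ g → scale c f ≈ const c * g
scale≈ c p = ≈-trans (scale≈const c _) (*-congˡ p)

at≈ : ∀ d .{{_ : NonZero d}} {f g} → f ≈ g → at d f ≈ dil d g
at≈ d p = ≈-trans (at≈dil d _) (dil-cong d p)

x y h e f w q σ₄ : Series
x = X^ 1
y = dil 8 ψ
h = dil 56 ψ
e = dil 4 ψ
f = dil 28 ψ
w = dil 4 Ω
q = dil 2 Q
σ₄ = F * G + T′ * H

p-xef : pᵗ ≈ const (+ 2) * (x ↑ 4 * (e * f))
p-xef = *-congˡ (*-cong (X^≈↑ 4) (≈-trans (dil-* 4 _ _) (*-congˡ (dil-dil 4 7 ψ))))

o-xw : oᵗ ≈ const (+ 2) * (x ↑ 2 * w)
o-xw = *-congˡ (*-congʳ (X^≈↑ 2))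

H-xh : H ≈ const (+ 2) * (x ↑ 7 * h)
H-xh = *-congˡ (*-congʳ (X^≈↑ 7))

GH-xf : G * H ≈ const (+ 2) * (x ↑ 7 * (f * f))
GH-xf = ≈-trans GH (*-congˡ (*-congʳ (X^≈↑ 7)))

L-xqef : C (- + 1) ≈ x ↑ 6 * q * (e * f)
L-xqef = ≈-trans C₋₁-Q (*-congʳ (*-congʳ (X^≈↑ 6)))

scaling : const (+ 8) * X^ 2 ≈ const (+ 8) * x ↑ 2
scaling = *-congˡ (X^≈↑ 2)

c² : ∀ {f g} → const (+ 8) * X^ 2 * (const (+ 8) * X^ 2) * f ≈ g → const (+ 64) * x ↑ 4 * f ≈ g
c² {f} p = ≈-trans (SR.solve (x ∷ f ∷ []) (λ { (x ∷ f ∷ []) → 64 · x :^ 4 :* f , 8 · x :^ 2 :* (8 · x :^ 2) :* f }) refl)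
  (≈-trans (*-congʳ (*-cong (≈-sym scaling) (≈-sym scaling))) p)

regular-x : ∀ k → Regular (x ↑ k)
regular-x k = regular-cong (X^≈↑ k) (regular-X^ k)

-- Two values of C₋₁ are compared, the algebraic one in `L-form` and the infinite product in
-- `C₋₁-Q`. The result lets `Q` replace po + (GH)² in the formulas for C₁ and C₀.
po+U : pᵗ * oᵗ + G * H * (G * H) ≈ const (+ 4) * (x ↑ 6 * q)
po+U = -≈𝟘⇒≈ (regular-* (regular-const (+ 8) λ ()) regular-p _ (≈-trans
  (SR.solve (x ∷ pᵗ ∷ pᵗ * oᵗ + G * H * (G * H) ∷ q ∷ e ∷ f ∷ C (- + 1) ∷ []) (λ { (x ∷ p ∷ u ∷ q ∷ e ∷ f ∷ L ∷ []) →
    8 · p :* (u :- 4 · (x :^ 6 :* q)) ,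
    con (- + 1) :* (64 · x :^ 4 :* L :- 8 · p :* u) :+ 64 · x :^ 4 :* (L :- x :^ 6 :* q :* (e :* f)) :+
      con (- + 32) :* x :^ 6 :* q :* (p :- 2 · (x :^ 4 :* (e :* f))) }) refl)
  ((_ ⊙ c² L-form) ⊞ (_ ⊙ L-xqef) ⊞ (_ ⊙ p-xef))))

M-xq : const (+ 2) * C (+ 1) ≈ x ↑ 2 * q * (const (+ 2) * σ₄ - pᵗ)
M-xq = -≈𝟘⇒≈ (regular-* (regular-const (+ 32) λ ()) (regular-x 4) _ (≈-trans
  (SR.solve (x ∷ C (+ 1) ∷ pᵗ * oᵗ + G * H * (G * H) ∷ q ∷ const (+ 2) * σ₄ - pᵗ ∷ []) (λ { (x ∷ M ∷ u ∷ q ∷ s ∷ []) →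
    32 · x :^ 4 :* (2 · M :- x :^ 2 :* q :* s) ,
    1 · (64 · x :^ 4 :* M :- 8 · u :* s) :+ 8 · s :* (u :- 4 · (x :^ 6 :* q)) }) refl)
  ((_ ⊙ c² M-form) ⊞ (_ ⊙ po+U))))

-- σ(q⁴) is σ₇(t⁸), one dilation away from the series σ₇(t⁴) = FG + TH of the algebra; `σ₇-dilated`
-- gives σ₇(t⁸) = FG + TH - p.
RHS1-dilated : const (+ 2) * dil 2 RHS1 ≈ x ↑ 2 * q * (const (+ 2) * σ₄ - pᵗ)
RHS1-dilated = begin
  const (+ 2) * dil 2 RHS1
    ≈⟨ *-congˡ (dil-cong 2 (qpow≈↑ 1 (⊗≈ ≈-refl (⊕≈ (at≈ 4 σ≈σ₇) (qpow≈↑ 2 (⊗≈ (at≈dil 2 ψ) (at≈dil 14 ψ))))))) ⟩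
  const (+ 2) * dil 2 (x ↑ 1 * (Q * (dil 4 σ₇ + x ↑ 2 * (dil 2 ψ * dil 14 ψ))))
    ≈⟨ *-congˡ (dil-expr 2 (x ∷ Q ∷ dil 4 σ₇ ∷ dil 2 ψ ∷ dil 14 ψ ∷ []) (x ↑ 2 ∷ q ∷ σ₄ - pᵗ ∷ e ∷ f ∷ [])
         (≈-trans (dil-X^ 2 1) (X^≈↑ 2) ∷ ≈-refl ∷ σ-dilated ∷ dil-dil 2 2 ψ ∷ dil-dil 2 14 ψ ∷ []) (R₁-expr (Vec.tabulate var))) ⟩
  const (+ 2) * ((x ↑ 2) ↑ 1 * (q * (σ₄ - pᵗ + (x ↑ 2) ↑ 2 * (e * f))))
    ≈⟨ -≈𝟘⇒≈ (≈-trans (SR.solve (x ∷ q ∷ σ₄ ∷ pᵗ ∷ e ∷ f ∷ []) (λ { (x ∷ q ∷ s ∷ p ∷ e ∷ f ∷ []) →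
         2 · ((x :^ 2) :^ 1 :* (q :* (s :- p :+ (x :^ 2) :^ 2 :* (e :* f)))) :- x :^ 2 :* q :* (2 · s :- p) ,
         con (- + 1) :* (x :^ 2 :* q) :* (p :- 2 · (x :^ 4 :* (e :* f))) }) refl) (_ ⊙ p-xef)) ⟩
  x ↑ 2 * q * (const (+ 2) * σ₄ - pᵗ) ∎
  where
  open ≈-Reasoning
  σ-dilated : dil 2 (dil 4 σ₇) ≈ σ₄ - pᵗ
  σ-dilated = ≈-trans (dil-dil 2 4 σ₇) (≈-trans (≈-sym (dil-dil 4 2 σ₇)) (≈-trans (dil-cong 4 σ₇-dilated) (≈-trans (dil-4σ (+ 2)) (+-congʳ (≈-sym curve-σ)))))
  R₁-expr : Vars 5 → Expr 5
  R₁-expr (x ∷ q ∷ s ∷ e ∷ f ∷ []) = x :^ 1 :* (q :* (s :+ x :^ 2 :* (e :* f)))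

rank-one : C7 (+ 1) ≈ RHS1
rank-one = dil-injective 2 (cancel (regular-const (+ 2) λ ()) (≈-trans M-xq (≈-sym RHS1-dilated)))

Z-value : const (+ 8) * x ↑ 4 * C (+ 0) ≈ const (+ 4) * pᵗ * ((σ₄ - pᵗ) * (σ₄ - pᵗ)) + const (+ 4) * oᵗ * (G * H * (G * H)) + (pᵗ * oᵗ + G * H * (G * H)) * oᵗ
Z-value = cancel (regular-const (+ 8) λ ()) (≈-trans (SR.solve (x ∷ C (+ 0) ∷ []) (λ { (x ∷ z ∷ []) → 8 · (8 · x :^ 4 :* z) , 64 · x :^ 4 :* z }) refl) (c² Z-form))

R₀ : Series
R₀ = w * (y ↑ 2 * G ↑ 2 + (x ↑ 2) ↑ 6 * (h ↑ 2 * F ↑ 2) + (x ↑ 2) ↑ 2 * q) + (x ↑ 2) ↑ 2 * (y * f ↑ 2 * G ↑ 3) +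
  const (+ 2) * ((x ↑ 2) ↑ 4 * (e ↑ 3 * f ↑ 3)) + const (+ 4) * ((x ↑ 2) ↑ 12 * (f ↑ 2 * h ↑ 3 * F))

-- The factor 8t⁴ supplies the powers of 2 and t that turn the ψ-factors and Ω into T, H, p, o and
-- GH. The terms TG³GH and FH³GH are then rewritten by `J-form`, the others by `curve-S` and
-- `curve-o²`.
R₀-value : const (+ 8) * x ↑ 4 * R₀ ≈ const (+ 4) * pᵗ * ((σ₄ - pᵗ) * (σ₄ - pᵗ)) + const (+ 4) * oᵗ * (G * H * (G * H)) + (pᵗ * oᵗ + G * H * (G * H)) * oᵗ
R₀-value = begin
  const (+ 8) * x ↑ 4 * R₀
    ≈⟨ SR.solve (x ∷ y ∷ h ∷ e ∷ f ∷ w ∷ q ∷ F ∷ G ∷ []) (λ { (x ∷ y ∷ h ∷ e ∷ f ∷ w ∷ q ∷ F ∷ G ∷ []) →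
         8 · x :^ 4 :* (w :* (y :^ 2 :* G :^ 2 :+ (x :^ 2) :^ 6 :* (h :^ 2 :* F :^ 2) :+ (x :^ 2) :^ 2 :* q) :+ (x :^ 2) :^ 2 :* (y :* f :^ 2 :* G :^ 3) :+
           2 · ((x :^ 2) :^ 4 :* (e :^ 3 :* f :^ 3)) :+ 4 · ((x :^ 2) :^ 12 :* (f :^ 2 :* h :^ 3 :* F))) ,
         2 · (x :^ 2 :* w) :* ((2 · (x :* y) :* G) :^ 2 :+ (F :* (2 · (x :^ 7 :* h))) :^ 2 :+ 4 · (x :^ 6 :* q)) :+
           2 · (2 · (x :* y) :* G :^ 3 :* (2 · (x :^ 7 :* (f :* f)))) :+
           2 · (2 · (x :^ 4 :* (e :* f))) :^ 3 :+
           2 · (F :* (2 · (x :^ 7 :* h)) :^ 3 :* (2 · (x :^ 7 :* (f :* f)))) }) refl ⟩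
  const (+ 2) * (x ↑ 2 * w) * ((T′ * G) ↑ 2 + (F * (const (+ 2) * (x ↑ 7 * h))) ↑ 2 + const (+ 4) * (x ↑ 6 * q)) +
    const (+ 2) * (T′ * G ↑ 3 * (const (+ 2) * (x ↑ 7 * (f * f)))) + const (+ 2) * (const (+ 2) * (x ↑ 4 * (e * f))) ↑ 3 +
    const (+ 2) * (F * (const (+ 2) * (x ↑ 7 * h)) ↑ 3 * (const (+ 2) * (x ↑ 7 * (f * f))))
    ≈⟨ +-cong (+-cong (+-cong (*-cong (≈-sym o-xw) (+-cong (+-congˡ (↑-cong 2 (*-congˡ (≈-sym H-xh)))) (≈-sym po+U)))
         (*-congˡ (*-congˡ (≈-sym GH-xf)))) (*-congˡ (↑-cong 3 (≈-sym p-xef)))) (*-congˡ (*-cong (*-congˡ (↑-cong 3 (≈-sym H-xh))) (≈-sym GH-xf))) ⟩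
  oᵗ * ((T′ * G) ↑ 2 + (F * H) ↑ 2 + (pᵗ * oᵗ + G * H * (G * H))) + const (+ 2) * (T′ * G ↑ 3 * (G * H)) + const (+ 2) * pᵗ ↑ 3 + const (+ 2) * (F * H ↑ 3 * (G * H))
    ≈⟨ -≈𝟘⇒≈ (≈-trans (SR.solve (F ∷ T′ ∷ G ∷ H ∷ pᵗ ∷ oᵗ ∷ []) (λ { (F ∷ T ∷ G ∷ H ∷ p ∷ o ∷ []) →
         o :* ((T :* G) :^ 2 :+ (F :* H) :^ 2 :+ (p :* o :+ G :* H :* (G :* H))) :+ 2 · (T :* G :^ 3 :* (G :* H)) :+ 2 · p :^ 3 :+ 2 · (F :* H :^ 3 :* (G :* H)) :-
           (4 · p :* ((F :* G :+ T :* H :- p) :* (F :* G :+ T :* H :- p)) :+ 4 · o :* (G :* H :* (G :* H)) :+ (p :* o :+ G :* H :* (G :* H)) :* o) ,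
         o :* (F :* H :* (F :* H) :+ T :* G :* (T :* G) :- 2 · o :* (F :* G :+ T :* H :- p)) :+
           2 · (T :* H :* (G :* G :* (G :* G)) :+ F :* G :* (H :* H :* (H :* H)) :- (2 · o :* (G :* H :* (G :* H)) :+ p :* p :* (F :* G :+ T :* H) :- 2 · (p :* p :* p))) :+
           2 · (F :* G :+ T :* H :- p) :* (o :* o :- p :* (2 · (F :* G :+ T :* H) :- 3 · p)) }) refl)
         ((_ ⊙ curve-S) ⊞ (_ ⊙ J-form) ⊞ (_ ⊙ curve-o²))) ⟩
  const (+ 4) * pᵗ * ((σ₄ - pᵗ) * (σ₄ - pᵗ)) + const (+ 4) * oᵗ * (G * H * (G * H)) + (pᵗ * oᵗ + G * H * (G * H)) * oᵗ ∎
  where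
  open ≈-Reasoning
  ↑-cong : ∀ k {f g} → f ≈ g → f ↑ k ≈ g ↑ k
  ↑-cong zero    p = ≈-refl
  ↑-cong (suc k) p = *-cong p (↑-cong k p)

undilated : Vec Series 9
undilated = x ∷ dil 4 ψ ∷ dil 28 ψ ∷ dil 2 ψ ∷ dil 14 ψ ∷ dil 2 Ω ∷ Q ∷ dil 2 φ ∷ dil 14 φ ∷ []
dilated : Vec Series 9
dilated = x ↑ 2 ∷ y ∷ h ∷ e ∷ f ∷ w ∷ q ∷ F ∷ G ∷ []

images : Pointwise (λ f g → dil 2 f ≈ g) undilated dilated
images = ≈-trans (dil-X^ 2 1) (X^≈↑ 2) ∷ dil-dil 2 4 ψ ∷ dil-dil 2 28 ψ ∷ dil-dil 2 2 ψ ∷ dil-dil 2 14 ψ ∷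
  dil-dil 2 2 Ω ∷ ≈-refl ∷ dil-dil 2 2 φ ∷ dil-dil 2 14 φ ∷ []

R₀-expr : Vars 9 → Expr 9
R₀-expr (x ∷ y ∷ h ∷ e ∷ f ∷ w ∷ q ∷ F ∷ G ∷ []) = w :* (y :^ 2 :* G :^ 2 :+ x :^ 6 :* (h :^ 2 :* F :^ 2) :+ x :^ 2 :* q) :+ x :^ 2 :* (y :* f :^ 2 :* G :^ 3) :+
  2 · (x :^ 4 :* (e :^ 3 :* f :^ 3)) :+ 4 · (x :^ 12 :* (f :^ 2 :* h :^ 3 :* F))

RHS0≈ : RHS0 ≈ SR.⟦ R₀-expr (Vec.tabulate var) ⟧ undilated
RHS0≈ = ⊕≈ (⊕≈ (⊕≈ (⊗≈ (at≈ 2 ω≈Ω) (⊕≈ (⊕≈ (⊗≈ (powS≈↑ 2 (at≈dil 4 ψ)) (powS≈↑ 2 (at≈dil 14 φ)))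
      (qpow≈↑ 6 (⊗≈ (powS≈↑ 2 (at≈dil 28 ψ)) (powS≈↑ 2 (at≈dil 2 φ))))) (qpow≈↑ 2 ≈-refl)))
    (qpow≈↑ 2 (⊗≈ (⊗≈ (at≈dil 4 ψ) (powS≈↑ 2 (at≈dil 14 ψ))) (powS≈↑ 3 (at≈dil 14 φ)))))
    (scale≈ (+ 2) (qpow≈↑ 4 (⊗≈ (powS≈↑ 3 (at≈dil 2 ψ)) (powS≈↑ 3 (at≈dil 14 ψ))))))
    (scale≈ (+ 4) (qpow≈↑ 12 (⊗≈ (⊗≈ (powS≈↑ 2 (at≈dil 14 ψ)) (powS≈↑ 3 (at≈dil 28 ψ))) (at≈dil 2 φ))))

rank-zero : C7 (+ 0) ≈ RHS0
rank-zero = dil-injective 2 (cancel (regular-* (regular-const (+ 8) λ ()) (regular-x 4)) (≈-trans Z-value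
  (≈-sym (≈-trans (*-congˡ (≈-trans (dil-cong 2 RHS0≈) (dil-expr 2 undilated dilated images (R₀-expr (Vec.tabulate var))))) R₀-value))))

theorem1p2 : ((n : ℕ) → C7 (+ 1) n ≡ RHS1 n) × ((n : ℕ) → C7 (+ 0) n ≡ RHS0 n)
theorem1p2 = at-degree rank-one , at-degree rank-zero
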